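{- Let $G$ be a graph with $\alpha(G)=2$ and $\theta_f(G)\le 124/33$. Then every inflation $G'$ of $G$ with $\alpha(G')=2$ satisfies $\mathrm{had}(G')\ge\chi(G')$.
   Context: All graphs are finite and simple. $\theta_f(G)$, the fractional clique covering number of $G$, is the fractional chromatic number $\chi_f(\overline{G})=\inf_b \chi_b(\overline{G})/b$ of the complement, where $\chi_b$ is the least number of colours in an assignment of $b$-element colour sets to vertices with adjacent vertices receiving disjoint sets. An inflation of a graph $H$ is obtained by choosing integers $c_x\ge 0$ for $x\in V(H)$, replacing each $x$ by a clique $C_x$ of order $c_x$, with every vertex of $C_x$ adjacent to every vertex of $C_y$ ($x\neq y$) if $xy\in E(H)$ and no edges between them otherwise. $\mathrm{had}(G)$ is the largest $t$ such that $K_t$ is a minor of $G$. -}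

module Defs where

open import Data.Nat using (ℕ; zero; suc; _+_; _*_; _≤_; _<_)
open import Data.Fin using (Fin)
open import Data.Fin.Subset using (Subset; _∈_; ∣_∣)
open import Data.Maybe using (Maybe; just)
open import Data.Product using (Σ; ∃; _×_; _,_)
open import Data.Sum using (_⊎_)
open import Data.Empty using (⊥)
open import Relation.Nullary using (¬_)
open import Relation.Binary.PropositionalEquality using (_≡_; _≢_)
open import Relation.Binary.Construct.Closure.ReflexiveTransitive using (Star)
open import Function.Definitions using (Injective)

record Graph (V : Set) : Set₁ where
  field
    E     : V → V → Set
    sym   : ∀ {u v} → E u v → E v u
    irrefl : ∀ {v} → ¬ E v v
open Graph public

FinGraph : ℕ → Set₁
FinGraph n = Graph (Fin n)

complement : ∀ {V} → Graph V → Graph V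
complement G = record
  { E = λ u v → u ≢ v × ¬ E G u v
  ; sym = λ { (u≢v , ¬e) → (λ eq → u≢v (symm eq)) , (λ e → ¬e (Graph.sym G e)) }
  ; irrefl = λ { (v≢v , _) → v≢v _≡_.refl }
  }
  where
  symm : ∀ {A : Set} {x y : A} → x ≡ y → y ≡ x
  symm _≡_.refl = _≡_.refl

HasIndependentSet : ∀ {V} → Graph V → ℕ → Set
HasIndependentSet {V} G k =
  Σ (Fin k → V) λ f → Injective _≡_ _≡_ f × (∀ i j → ¬ E G (f i) (f j))

IndependenceNumber : ∀ {V} → Graph V → ℕ → Set
IndependenceNumber G k =
  HasIndependentSet G k × (∀ j → HasIndependentSet G j → j ≤ k)

Colourable : ∀ {V} → Graph V → ℕ → Set
Colourable {V} G k = Σ (V → Fin k) λ f → ∀ u v → E G u v → f u ≢ f v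

ChromaticNumber : ∀ {V} → Graph V → ℕ → Set
ChromaticNumber G k = Colourable G k × (∀ j → Colourable G j → k ≤ j)

BFoldColouring : ∀ {V} → Graph V → ℕ → ℕ → Set
BFoldColouring {V} G b k =
  Σ (V → Subset k) λ f →
    (∀ v → ∣ f v ∣ ≡ b) ×
    (∀ u v → E G u v → ∀ c → c ∈ f u → c ∈ f v → ⊥)

-- χ_f(G) = inf_{b ≥ 1} χ_b(G)/b ≤ p/q   (q ≥ 1), unfolded as:
-- for every m ≥ 1 there is b ≥ 1 and a b-fold colouring with k colours
-- such that k/b ≤ p/q + 1/m, i.e. q*m*k ≤ p*m*b + q*b.
FracChromaticAtMost : ∀ {V} → Graph V → ℕ → ℕ → Set
FracChromaticAtMost G p q =
  ∀ m → 1 ≤ m → ∃ λ b → ∃ λ k →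
    1 ≤ b × BFoldColouring G b k × q * m * k ≤ p * m * b + q * b

FracCliqueCoverAtMost : ∀ {V} → Graph V → ℕ → ℕ → Set
FracCliqueCoverAtMost G p q = FracChromaticAtMost (complement G) p q

InflV : ∀ {n} → (Fin n → ℕ) → Set
InflV {n} c = Σ (Fin n) λ x → Fin (c x)

inflation : ∀ {n} → FinGraph n → (c : Fin n → ℕ) → Graph (InflV c)
inflation {n} G c = record
  { E = Ei
  ; sym = s
  ; irrefl = ir
  }
  where
  Ei : InflV c → InflV c → Set
  Ei (x , i) (y , j) = (x ≡ y × (x , i) ≢ (y , j)) ⊎ E G x y
  s : ∀ {u v} → Ei u v → Ei v u
  s (Data.Sum.inj₁ (_≡_.refl , ne)) = Data.Sum.inj₁ (_≡_.refl , λ eq → ne (sy eq))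
    where
    sy : ∀ {A : Set} {a b : A} → a ≡ b → b ≡ a
    sy _≡_.refl = _≡_.refl
  s (Data.Sum.inj₂ e) = Data.Sum.inj₂ (Graph.sym G e)
  ir : ∀ {v} → ¬ Ei v v
  ir (Data.Sum.inj₁ (_ , ne)) = ne _≡_.refl
  ir (Data.Sum.inj₂ e) = Graph.irrefl G e

InBranch : ∀ {V : Set} {t : ℕ} → (V → Maybe (Fin t)) → Fin t → V → Set
InBranch β i v = β v ≡ just i

HasCliqueMinor : ∀ {V} → Graph V → ℕ → Set
HasCliqueMinor {V} G t =
  Σ (V → Maybe (Fin t)) λ β →
    (∀ i → Σ V λ v → InBranch β i v) ×
    (∀ i u v → InBranch β i u → InBranch β i v →
       Star (λ x y → InBranch β i x × InBranch β i y × E G x y) u v) ×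
    (∀ i j → i ≢ j → Σ V λ u → Σ V λ v → InBranch β i u × InBranch β j v × E G u v)

HadwigerNumber : ∀ {V} → Graph V → ℕ → Set
HadwigerNumber G t = HasCliqueMinor G t × (∀ s → HasCliqueMinor G s → s ≤ t)

-- Write 𝓗 for the complement of the inflation; it is triangle-free since α = 2. Three vertices
-- spanning exactly one edge of 𝓗 (an odd triple, or "seagull") form a connected set of the
-- inflation that touches every other vertex, so k disjoint odd triples outside a clique of order ω
-- give a clique minor of order ω + k. Gallai's lemma on maximum matchings of 𝓗 reduces the theorem
-- to finding, in every vertex set of size 2m + 1, a clique minor of order m + 1. A fractional cover
-- of weight 124/33 provides a clique of order ω ≥ 33 (2m + 1) / 124; together with the bound
-- R(3, r) ≤ r (r + 1) / 2 for small ω this gives 2 ω ≥ m + 2. Then the other vertices contain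
-- k = m + 1 − ω disjoint odd triples, by the packing theorem of Chudnovsky and Seymour for
-- seagulls, unless they span a large biclique of 𝓗 or form a five-cycle plus an isolated vertex;
-- König's theorem and a direct construction settle these two cases.
module Submission where

-- Vertex sets are lists and `↭` does the set algebra; a repeated entry behaves like a nonadjacent
-- twin, so distinctness matters only when branch sets finally become a function. Edges of `G` need
-- not be decidable. Maximum matchings, bicliques and cliques are therefore produced in the form
-- `(... → ⊥) → ⊥`, which is enough because `χ ≤ h` is stable.
--
-- The orders fit as follows. A clique of order ω among 2m + 1 vertices leaves m + k others, so 2ω ≥
-- m + 2 says exactly 3k ≤ m + k: there is room for k triples.
--
-- The packing theorem goes by induction on k. An edge of 𝓗 is removed so that the hypotheses
-- survive, k - 1 triples are packed in the rest, and the packing is supposed maximal. A leftover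
-- with an edge but without odd triple is complete bipartite. Packing triples are classified by how
-- their vertices see its two sides; then either an alternating path gives one more triple, or the
-- failed search exhibits a biclique that is too large. A leftover side with a single vertex leaves
-- too few edges for exchanges and causes most of the case work.

open import Defs
open import Data.Nat using (ℕ; zero; suc; _+_; _*_; _∸_; _≤_; _<_; _≡ᵇ_; z≤n; s≤s)
open import Data.Nat.Properties hiding (_≟_)
open import Data.Nat.Tactic.RingSolver using (solve-∀)
open import Data.Fin using (Fin; zero; suc)
open import Data.Bool using (Bool; true; false; _∧_; _∨_; not; _xor_; if_then_else_; T)
open import Data.Bool.Properties using (not-injective)
open import Data.List using (List; []; _∷_; _++_; map; concat; [_]; length; tabulate)
open import Data.List.Properties using (++-assoc; length-++; length-map; length-tabulate; map-++; concat-++)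
open import Data.List.Relation.Binary.Permutation.Propositional
open import Data.List.Relation.Binary.Permutation.Propositional.Properties
  using (∈-resp-↭; All-resp-↭; ↭-length; ++⁺; ++⁺ˡ; ++⁺ʳ; ++-comm; drop-∷; shift; shifts)
  renaming (map⁺ to ↭-map; ++-identityʳ to ↭-identityʳ)
open import Data.List.Relation.Unary.All using (All; []; _∷_)
import Data.List.Relation.Unary.All as All
import Data.List.Relation.Unary.All.Properties as AllP
open import Data.List.Relation.Unary.AllPairs using (AllPairs; []; _∷_)
import Data.List.Relation.Unary.AllPairs.Properties as AllPairsP
open import Data.List.Relation.Unary.Any using (here; there)
open import Data.List.Membership.Propositional using () renaming (_∈_ to _∈ₗ_)
open import Data.List.Membership.Propositional.Properties using (∈-++⁺ˡ; ∈-++⁺ʳ; ∈-++⁻; ∈-tabulate⁺; ∈-concat⁺′)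
open import Data.Product using (Σ; ∃; _×_; _,_; proj₁; proj₂)
open import Data.Sum using (_⊎_; inj₁; inj₂; [_,_]′)
open import Data.Empty using (⊥; ⊥-elim)
open import Relation.Nullary using (¬_; Dec; yes; no)
open import Relation.Nullary.Decidable using (¬¬-excluded-middle)
open import Relation.Binary.PropositionalEquality
  using (_≡_; _≢_; refl; cong; cong₂; subst; subst₂; module ≡-Reasoning) renaming (sym to ≡-sym; trans to ≡-trans)
open import Function using (_∘_; id; case_of_)

-- Permutations between two arrangements of the same blocks, decided on the indices of the blocks.
module Rearrangement where

  infix  6 #_
  infixr 5 _⊕_
  data Expr : Set where
    #_  : ℕ → Expr
    ∅   : Expr
    _⊕_ : Expr → Expr → Expr

  flatten : Expr → List ℕ → List ℕ
  flatten (# n)     ns = n ∷ ns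
  flatten ∅         ns = ns
  flatten (e₁ ⊕ e₂) ns = flatten e₁ (flatten e₂ ns)

  remove : ℕ → List ℕ → List ℕ × Bool
  remove n [] = [] , false
  remove n (m ∷ ms) with n ≡ᵇ m
  ... | true  = ms , true
  ... | false = m ∷ proj₁ (remove n ms) , proj₂ (remove n ms)

  same : List ℕ → List ℕ → Bool
  same []       []      = true
  same []       (_ ∷ _) = false
  same (n ∷ ns) ms      = proj₂ (remove n ms) ∧ same ns (proj₁ (remove n ms))

  module _ {A : Set} where

    block : List (List A) → ℕ → List A
    block []      _       = []
    block (x ∷ ρ) zero    = x
    block (x ∷ ρ) (suc n) = block ρ n

    ⟦_⟧ : Expr → List (List A) → List A
    ⟦ # n ⟧     ρ = block ρ n
    ⟦ ∅ ⟧       ρ = []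
    ⟦ e₁ ⊕ e₂ ⟧ ρ = ⟦ e₁ ⟧ ρ ++ ⟦ e₂ ⟧ ρ

    module _ (ρ : List (List A)) where

      ⟦_⟧* : List ℕ → List A
      ⟦ [] ⟧*     = []
      ⟦ n ∷ ns ⟧* = block ρ n ++ ⟦ ns ⟧*

      flatten-sound : ∀ e ns → ⟦ e ⟧ ρ ++ ⟦ ns ⟧* ↭ ⟦ flatten e ns ⟧*
      flatten-sound (# n)     ns = refl
      flatten-sound ∅         ns = refl
      flatten-sound (e₁ ⊕ e₂) ns =
        trans (↭-reflexive (++-assoc (⟦ e₁ ⟧ ρ) (⟦ e₂ ⟧ ρ) ⟦ ns ⟧*))
          (trans (++⁺ˡ (⟦ e₁ ⟧ ρ) (flatten-sound e₂ ns)) (flatten-sound e₁ (flatten e₂ ns)))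

      remove-sound : ∀ n ms → T (proj₂ (remove n ms)) → ⟦ ms ⟧* ↭ block ρ n ++ ⟦ proj₁ (remove n ms) ⟧*
      remove-sound n (m ∷ ms) t with n ≡ᵇ m in eq
      ... | true  = ↭-reflexive (cong (λ k → block ρ k ++ ⟦ ms ⟧*) (≡-sym (≡ᵇ⇒≡ n m (subst T (≡-sym eq) _))))
      ... | false = trans (++⁺ˡ (block ρ m) (remove-sound n ms t)) (shifts (block ρ m) (block ρ n))

      same-sound : ∀ ns ms → T (same ns ms) → ⟦ ns ⟧* ↭ ⟦ ms ⟧*
      same-sound []       []      t = refl
      same-sound (n ∷ ns) ms      t with proj₂ (remove n ms) in eq
      ... | true = trans (++⁺ˡ (block ρ n) (same-sound ns (proj₁ (remove n ms)) t))
                         (↭-sym (remove-sound n ms (subst T (≡-sym eq) _)))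

      -- The implicit argument evaluates to the unit type and is filled in automatically, so a use
      -- states only the blocks and the two shapes.
      permute : ∀ e₁ e₂ {_ : T (same (flatten e₁ []) (flatten e₂ []))} → ⟦ e₁ ⟧ ρ ↭ ⟦ e₂ ⟧ ρ
      permute e₁ e₂ {t} = trans (flat e₁) (trans (same-sound (flatten e₁ []) (flatten e₂ []) t) (↭-sym (flat e₂)))
        where
        flat : ∀ e → ⟦ e ⟧ ρ ↭ ⟦ flatten e [] ⟧*
        flat e = trans (↭-sym (↭-identityʳ (⟦ e ⟧ ρ))) (flatten-sound e [])

open Rearrangement using (permute; #_; _⊕_; ∅)

-- Cancellation, selection and refinement of lists up to permutation.

module _ {A : Set} where

  ++-cancelʳ : ∀ (zs : List A) {xs ys} → xs ++ zs ↭ ys ++ zs → xs ↭ ys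
  ++-cancelʳ []       p = trans (↭-sym (↭-identityʳ _)) (trans p (↭-identityʳ _))
  ++-cancelʳ (z ∷ zs) {xs} {ys} p =
    ++-cancelʳ zs (drop-∷ (trans (↭-sym (shift z xs zs)) (trans p (shift z ys zs))))

  module _ {x y z : A} where

    ↭₂₁₃ : x ∷ y ∷ z ∷ [] ↭ y ∷ x ∷ z ∷ []
    ↭₂₁₃ = swap x y refl

    ↭₁₃₂ : x ∷ y ∷ z ∷ [] ↭ x ∷ z ∷ y ∷ []
    ↭₁₃₂ = prep x (swap y z refl)

    ↭₂₃₁ : x ∷ y ∷ z ∷ [] ↭ y ∷ z ∷ x ∷ []
    ↭₂₃₁ = ++-comm (x ∷ []) (y ∷ z ∷ [])

    ↭₃₁₂ : x ∷ y ∷ z ∷ [] ↭ z ∷ x ∷ y ∷ []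
    ↭₃₁₂ = ++-comm (x ∷ y ∷ []) (z ∷ [])

    ↭₃₂₁ : x ∷ y ∷ z ∷ [] ↭ z ∷ y ∷ x ∷ []
    ↭₃₂₁ = trans (swap x y refl) (++-comm (y ∷ x ∷ []) (z ∷ []))

  -- Linear reasoning: subtracting the hypothesis as ↭ bs from the goal leaves a rearrangement.
  lin : ∀ {as bs xs ys : List A} → as ↭ bs → xs ++ bs ↭ ys ++ as → xs ↭ ys
  lin {as} {bs} {xs} {ys} p q = ++-cancelʳ as (trans (++⁺ˡ xs p) q)

  ∈⇒↭ : ∀ {x : A} {xs} → x ∈ₗ xs → ∃ λ ys → xs ↭ x ∷ ys
  ∈⇒↭ {xs = y ∷ xs} (here refl) = xs , refl
  ∈⇒↭ {x} {y ∷ xs} (there i) with ∈⇒↭ i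
  ... | ys , p = y ∷ ys , trans (prep y p) (swap y x refl)

  find? : (p : A → Bool) (xs : List A) →
          (∃ λ x → ∃ λ ys → xs ↭ x ∷ ys × p x ≡ true) ⊎ (∀ {x} → x ∈ₗ xs → p x ≡ false)
  find? p [] = inj₂ λ ()
  find? p (x ∷ xs) with p x in eq
  ... | true = inj₁ (x , xs , refl , eq)
  ... | false with find? p xs
  ...   | inj₁ (y , ys , q , e) = inj₁ (y , x ∷ ys , trans (prep x q) (swap x y refl) , e)
  ...   | inj₂ none = inj₂ λ { (here refl) → eq ; (there i) → none i }

  -- The Riesz refinement property of the free commutative monoid: two splittings of one multiset
  -- have a common refinement into four cells.
  riesz : ∀ (xs : List A) {ys zs ws} → xs ++ ys ↭ zs ++ ws →
          ∃ λ a → ∃ λ b → ∃ λ c → ∃ λ d →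
            xs ↭ a ++ b × ys ↭ c ++ d × zs ↭ a ++ c × ws ↭ b ++ d
  riesz [] {ys} {zs} {ws} p = [] , [] , zs , ws , refl , p , refl , refl
  riesz (x ∷ xs) {ys} {zs} {ws} p with ∈-++⁻ zs (∈-resp-↭ p (here refl))
  ... | inj₁ i with ∈⇒↭ i
  ...   | zs′ , q with riesz xs {ys} {zs′} {ws} (drop-∷ {x = x} (lin p (lin q
      (permute ([ _ ] ∷ xs ∷ ys ∷ zs ∷ ws ∷ zs′ ∷ [])
        (# 0 ⊕ ((# 1 ⊕ # 2) ⊕ # 3 ⊕ # 4) ⊕ # 0 ⊕ # 5)
        (# 0 ⊕ ((# 5 ⊕ # 4) ⊕ # 0 ⊕ # 1 ⊕ # 2) ⊕ # 3)))))
  ...     | a , b , c , d , e₁ , e₂ , e₃ , e₄ =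
            x ∷ a , b , c , d , lin e₁
                (permute ([ _ ] ∷ xs ∷ a ∷ b ∷ []) (# 0 ⊕ # 1 ⊕ # 2 ⊕ # 3) (# 0 ⊕ (# 2 ⊕ # 3) ⊕ # 1)) , e₂ , lin q (lin e₃
                    (permute (zs ∷ [ _ ] ∷ zs′ ∷ a ∷ c ∷ [])
                      ((# 0 ⊕ # 1 ⊕ # 2) ⊕ # 3 ⊕ # 4)
                      (# 1 ⊕ ((# 3 ⊕ # 4) ⊕ # 0) ⊕ # 2))) , e₄
  riesz (x ∷ xs) {ys} {zs} {ws} p | inj₂ i with ∈⇒↭ i
  ...   | ws′ , q with riesz xs {ys} {zs} {ws′} (drop-∷ {x = x} (lin p (lin q
      (permute ([ _ ] ∷ xs ∷ ys ∷ zs ∷ ws ∷ ws′ ∷ [])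
        (# 0 ⊕ ((# 1 ⊕ # 2) ⊕ # 3 ⊕ # 4) ⊕ # 0 ⊕ # 5)
        (# 0 ⊕ ((# 3 ⊕ # 5) ⊕ # 0 ⊕ # 1 ⊕ # 2) ⊕ # 4)))))
  ...     | a , b , c , d , e₁ , e₂ , e₃ , e₄ =
            a , x ∷ b , c , d , lin e₁
                (permute ([ _ ] ∷ xs ∷ a ∷ b ∷ []) (# 0 ⊕ # 1 ⊕ # 2 ⊕ # 3) ((# 2 ⊕ # 0 ⊕ # 3) ⊕ # 1)) , e₂ , e₃ , lin q (lin e₄
                    (permute (ws ∷ [ _ ] ∷ ws′ ∷ b ∷ d ∷ [])
                      ((# 0 ⊕ # 1 ⊕ # 2) ⊕ # 3 ⊕ # 4)
                      (# 1 ⊕ ((# 3 ⊕ # 4) ⊕ # 0) ⊕ # 2)))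

-- Triangle-free graphs and odd triples.

record TriangleFree : Set₁ where
  field
    V    : Set
    h    : V → V → Bool
    hsym : ∀ x y → h x y ≡ h y x
    htf  : ∀ {x y z} → h x y ≡ true → h x z ≡ true → h y z ≡ true → ⊥

module Triples (𝓗 : TriangleFree) where

  open TriangleFree 𝓗 public

  infix 4 _~_ _≁_
  _~_ _≁_ : V → V → Set
  x ~ y = h x y ≡ true
  x ≁ y = h x y ≡ false

  ~-sym : ∀ {x y} → x ~ y → y ~ x
  ~-sym {x} {y} e = ≡-trans (hsym y x) e

  ≁-sym : ∀ {x y} → x ≁ y → y ≁ x
  ≁-sym {x} {y} e = ≡-trans (hsym y x) e

  ~⇒¬≁ : ∀ {x y} → x ~ y → x ≁ y → ⊥
  ~⇒¬≁ p q with () ← ≡-trans (≡-sym p) q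

  ~∨≁ : ∀ x y → x ~ y ⊎ x ≁ y
  ~∨≁ x y with h x y
  ... | true  = inj₁ refl
  ... | false = inj₂ refl

  ¬~⇒≁ : ∀ {x y} → (x ~ y → ⊥) → x ≁ y
  ¬~⇒≁ {x} {y} n with ~∨≁ x y
  ... | inj₁ p = ⊥-elim (n p)
  ... | inj₂ p = p

  ¬≁⇒~ : ∀ {x y} → (x ≁ y → ⊥) → x ~ y
  ¬≁⇒~ {x} {y} n with ~∨≁ x y
  ... | inj₁ p = p
  ... | inj₂ p = ⊥-elim (n p)

  common⇒≁ : ∀ {x y z} → x ~ y → x ~ z → y ≁ z
  common⇒≁ p q = ¬~⇒≁ (htf p q)

  ≁-refl : ∀ {x} → x ≁ x
  ≁-refl = ¬~⇒≁ λ p → htf p p p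

  Independent : List V → Set
  Independent C = ∀ {x y} → x ∈ₗ C → y ∈ₗ C → x ≁ y

  Complete : List V → List V → Set
  Complete A B = ∀ {a b} → a ∈ₗ A → b ∈ₗ B → a ~ b

  Complete-sym : ∀ {A B} → Complete A B → Complete B A
  Complete-sym c b a = ~-sym (c a b)

  Triple : Set
  Triple = V × V × V

  tri : Triple → List V
  tri (x , y , z) = x ∷ y ∷ z ∷ []

  -- In a triangle-free graph the odd triples are those spanning exactly one edge; in the
  -- complement they are the induced paths on three vertices.
  odd : V → V → V → Bool
  odd x y z = h x y xor (h x z xor h y z)

  Odd : Triple → Set
  Odd (x , y , z) = odd x y z ≡ true

  edge-apex : ∀ {x y z} → x ~ y → x ≁ z → y ≁ z → Odd (x , y , z)
  edge-apex p q r rewrite p | q | r = refl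

  odd-swap : ∀ x y z → odd y x z ≡ odd x y z
  odd-swap x y z rewrite hsym y x with h x y | h x z | h y z
  ... | true  | true  | true  = refl
  ... | true  | true  | false = refl
  ... | true  | false | true  = refl
  ... | true  | false | false = refl
  ... | false | true  | true  = refl
  ... | false | true  | false = refl
  ... | false | false | true  = refl
  ... | false | false | false = refl

  odd-flip : ∀ x y z → odd x z y ≡ odd x y z
  odd-flip x y z rewrite hsym z y with h x y | h x z | h y z
  ... | true  | true  | true  = refl
  ... | true  | true  | false = refl
  ... | true  | false | true  = refl
  ... | true  | false | false = refl
  ... | false | true  | true  = refl
  ... | false | true  | false = refl
  ... | false | false | true  = refl
  ... | false | false | false = refl

  Odd-swap : ∀ {x y z} → Odd (x , y , z) → Odd (y , x , z)
  Odd-swap {x} {y} {z} e = ≡-trans (odd-swap x y z) e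

  Odd-rotate : ∀ {x y z} → Odd (x , y , z) → Odd (y , z , x)
  Odd-rotate {x} {y} {z} e = ≡-trans (odd-flip y x z) (Odd-swap e)

  edge-across : ∀ {x y z} → x ~ z → x ≁ y → z ≁ y → Odd (x , y , z)
  edge-across {x} {y} {z} p q r = ≡-trans (≡-sym (odd-flip x y z)) (edge-apex p q r)

  Odd-view : ∀ {x y z} → Odd (x , y , z) →
             (x ~ y × x ≁ z × y ≁ z) ⊎ (x ~ z × x ≁ y × y ≁ z) ⊎ (y ~ z × x ≁ y × x ≁ z)
  Odd-view {x} {y} {z} o with h x y in p | h x z in q | h y z in r
  ... | true  | true  | true  = ⊥-elim (htf p q r)
  ... | true  | false | false = inj₁ (refl , refl , refl)
  ... | false | true  | false = inj₂ (inj₁ (refl , refl , refl))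
  ... | false | false | true  = inj₂ (inj₂ (refl , refl , refl))

  Odd-third : ∀ {x y z} → Odd (x , y , z) → x ≁ y → (x ~ z × y ≁ z) ⊎ (y ~ z × x ≁ z)
  Odd-third o n with Odd-view o
  ... | inj₁ (p , _)            = ⊥-elim (~⇒¬≁ p n)
  ... | inj₂ (inj₁ (p , _ , q)) = inj₁ (p , q)
  ... | inj₂ (inj₂ (p , _ , q)) = inj₂ (p , q)

  flat : List Triple → List V
  flat []       = []
  flat (t ∷ ts) = tri t ++ flat ts

  flat-++ : ∀ ts us → flat (ts ++ us) ↭ flat ts ++ flat us
  flat-++ []       us = refl
  flat-++ (t ∷ ts) us = ++⁺ˡ (tri t) (flat-++ ts us)

  flat-↭ : ∀ {ts us} → ts ↭ us → flat ts ↭ flat us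
  flat-↭ refl         = refl
  flat-↭ (prep t p)   = ++⁺ˡ (tri t) (flat-↭ p)
  flat-↭ (swap t u p) = trans (++⁺ˡ (tri t) (++⁺ˡ (tri u) (flat-↭ p))) (shifts (tri t) (tri u))
  flat-↭ (trans p q)  = trans (flat-↭ p) (flat-↭ q)

  length-flat : ∀ ts → length (flat ts) ≡ 3 * length ts
  length-flat []       = refl
  length-flat (t ∷ ts) = ≡-trans (cong (3 +_) (length-flat ts)) (≡-sym (*-suc 3 (length ts)))

  Packing : ℕ → List V → Set
  Packing k R = ∃ λ ts → ∃ λ rest → length ts ≡ k × All Odd ts × flat ts ++ rest ↭ R

  -- `C` is a clique of the inflation. Removing an edge from `R` and lowering `k` by one takes two
  -- from each side, so the bound passes through the induction.
  IndependentBound : ℕ → List V → Set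
  IndependentBound k R = ∀ C X → C ++ X ↭ R → Independent C → length C + 2 * k ≤ suc (length R)

  -- This is `k`-connectivity seen from the inflation: there `X` separates the two sides, and the
  -- inequality says that `X` has at least `k` vertices.
  BicliqueBound : ℕ → List V → Set
  BicliqueBound k R = ∀ a A b B X → (a ∷ A) ++ (b ∷ B) ++ X ↭ R → Complete (a ∷ A) (b ∷ B) →
                      length (a ∷ A) + length (b ∷ B) + k ≤ length R

  -- In the inflation this is the wheel with hub `w`. It has no two disjoint odd triples: the one
  -- through `w` must contain a rim edge, and the other three rim vertices then form a path with two
  -- edges.
  record Wheel (R : List V) : Set where
    constructor wheel
    field
      v₀ v₁ v₂ v₃ v₄ w : V
      rim   : R ↭ v₀ ∷ v₁ ∷ v₂ ∷ v₃ ∷ v₄ ∷ w ∷ []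
      e₀₁   : v₀ ~ v₁
      e₁₂   : v₁ ~ v₂
      e₂₃   : v₂ ~ v₃
      e₃₄   : v₃ ~ v₄
      e₄₀   : v₄ ~ v₀
      apex  : w ≁ v₀ × w ≁ v₁ × w ≁ v₂ × w ≁ v₃ × w ≁ v₄

-- A maximal packing whose leftover is a biclique.

module Leftover (𝓗 : TriangleFree) where

  open Triples 𝓗

  -- A packing of odd triples whose leftover a₀ ∷ a₁ ∷ A′ , g ∷ B′ contains no further one.
  module Maximal
    (a₀ a₁ : V) (A′ : List V) (g : V) (B′ : List V) (ts : List Triple)
    (odds  : All Odd ts)
    (bip   : Complete (a₀ ∷ a₁ ∷ A′) (g ∷ B′))
    (stuck : ∀ W rest → length W ≡ suc (length ts) → All Odd W →
             flat W ++ rest ↭ flat ts ++ (a₀ ∷ a₁ ∷ A′) ++ (g ∷ B′) → ⊥)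
    where

    A B : List V
    A = a₀ ∷ a₁ ∷ A′
    B = g ∷ B′

    odds-↭ : ∀ {us} → ts ↭ us → All Odd us
    odds-↭ p = All-resp-↭ p odds

    -- Maximality in local form: the triples `us` together with the leftover never contain one odd
    -- triple more than `us` has.
    augment : ∀ us {ts′} W rest → ts ↭ us ++ ts′ → All Odd W → length W ≡ suc (length us) →
              flat us ++ A ++ B ↭ flat W ++ rest → ⊥
    augment us {ts′} W rest p oW len q =
      stuck (W ++ ts′) rest
        (≡-trans (length-++ W)
          (≡-trans (cong (_+ length ts′) len)
            (cong suc (≡-sym (≡-trans (↭-length p) (length-++ us))))))
        (AllP.++⁺ oW (AllP.++⁻ʳ us (odds-↭ p)))
        (lin (↭-sym (flat-↭ p)) (lin (↭-sym (flat-++ us ts′)) (lin (flat-++ W ts′) (lin (↭-sym q)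
            (permute ((flat (W ++ ts′)) ∷ rest ∷ (flat ts) ∷ (flat (us ++ ts′)) ∷ (flat W) ∷
              (flat ts′) ∷ (flat us) ∷ [ _ ] ∷ [ _ ] ∷ A′ ∷ [ _ ] ∷ B′ ∷ [])
              (((((# 0 ⊕ # 1) ⊕ # 2) ⊕ # 3) ⊕ # 4 ⊕ # 5) ⊕ # 6 ⊕ # 7 ⊕ # 8 ⊕ # 9 ⊕ # 10 ⊕ # 11)
              (((((# 2 ⊕ # 7 ⊕ # 8 ⊕ # 9 ⊕ # 10 ⊕ # 11) ⊕ # 3) ⊕ # 6 ⊕ # 5) ⊕ # 0) ⊕ # 4 ⊕ # 1))))))

    Nonfull : V → Set
    Nonfull x = (∃ λ a → ∃ λ A₁ → A ↭ a ∷ A₁ × x ≁ a) × (∃ λ b → ∃ λ B₁ → B ↭ b ∷ B₁ × x ≁ b)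

    data Side : Set where
      α β : Side

    -- A vertex complete to `B` behaves like a further vertex of `A`, whence its side is called `α`;
    -- dually for `β`.
    Full : Side → V → Set
    Full α x = ∀ {b} → b ∈ₗ B → x ~ b
    Full β x = ∀ {a} → a ∈ₗ A → x ~ a

    α≁A : ∀ {x} → Full α x → ∀ {a} → a ∈ₗ A → x ≁ a
    α≁A f i = common⇒≁ (~-sym (f (here refl))) (~-sym (bip i (here refl)))

    β≁B : ∀ {x} → Full β x → ∀ {b} → b ∈ₗ B → x ≁ b
    β≁B f i = common⇒≁ (~-sym (f (here refl))) (bip (here refl) i)

    same-side : ∀ s {x y} → Full s x → Full s y → x ≁ y
    same-side α f f′ = common⇒≁ (~-sym (f (here refl))) (~-sym (f′ (here refl)))
    same-side β f f′ = common⇒≁ (~-sym (f (here refl))) (~-sym (f′ (here refl)))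

    nonnbr : ∀ x xs → (∃ λ y → ∃ λ ys → xs ↭ y ∷ ys × x ≁ y) ⊎ (∀ {y} → y ∈ₗ xs → x ~ y)
    nonnbr x xs with find? (not ∘ h x) xs
    ... | inj₁ (y , ys , p , e) = inj₁ (y , ys , p , not-injective e)
    ... | inj₂ all = inj₂ (not-injective ∘ all)

    full? : ∀ x → (∃ λ s → Full s x) ⊎ Nonfull x
    full? x with nonnbr x B | nonnbr x A
    ... | inj₂ f | _      = inj₁ (α , f)
    ... | inj₁ _ | inj₂ f = inj₁ (β , f)
    ... | inj₁ b | inj₁ a = inj₂ (a , b)

    -- Each of `x` and `y` is the isolated vertex over its own leftover edge, so one triple becomes
    -- two and `z` joins the leftover.
    two : ∀ {t ts′ x y z f g′ f′ g″} rest → ts ↭ t ∷ ts′ → tri t ↭ x ∷ y ∷ z ∷ [] →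
          A ++ B ↭ f ∷ g′ ∷ f′ ∷ g″ ∷ rest → f ~ g′ → x ≁ f → x ≁ g′ → f′ ~ g″ → y ≁ f′ → y ≁ g″ → ⊥
    two {t} {z = z} {f} {g′} {f′} {g″} rest p q r e x₁ x₂ e′ y₁ y₂ =
      augment (t ∷ []) (_ ∷ _ ∷ []) (z ∷ rest) p
        (edge-apex e (≁-sym x₁) (≁-sym x₂) ∷ edge-apex e′ (≁-sym y₁) (≁-sym y₂) ∷ []) refl
        (lin q (lin r
            (permute ([ _ ] ∷ [ _ ] ∷ [ _ ] ∷ [ _ ] ∷ [ _ ] ∷ A′ ∷ [ _ ] ∷ B′ ∷ [ _ ] ∷ [ _ ] ∷
              [ _ ] ∷ [ _ ] ∷ [ _ ] ∷ [ _ ] ∷ [ _ ] ∷ rest ∷ [])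
              (# 0 ⊕ # 1 ⊕ # 2 ⊕ # 3 ⊕ # 4 ⊕ ((# 5 ⊕ # 6 ⊕ # 7) ⊕ # 8 ⊕ # 9 ⊕ # 10) ⊕ # 11 ⊕ # 12 ⊕
              # 13 ⊕ # 14 ⊕ # 15)
              (# 11 ⊕ # 12 ⊕ # 8 ⊕ # 13 ⊕ # 14 ⊕ # 9 ⊕ # 10 ⊕ (# 15 ⊕ # 0 ⊕ # 1 ⊕ # 2) ⊕ # 3 ⊕ # 4 ⊕
              # 5 ⊕ # 6 ⊕ # 7))))

    -- P and Q are A and B in either order.
    balanced-half : ∀ {t ts′ x y z} → ts ↭ t ∷ ts′ → tri t ↭ x ∷ y ∷ z ∷ [] → Odd (x , y , z) →
      ∀ {P Q f f₂ P₂ g₁ g₂ Q₂} → P ++ Q ↭ A ++ B → Complete P Q →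
      P ↭ f ∷ f₂ ∷ P₂ → Q ↭ g₁ ∷ g₂ ∷ Q₂ → x ≁ f → x ≁ g₁ → y ≁ f →
      (∀ {p} → p ∈ₗ f₂ ∷ P₂ → y ~ p) → ⊥
    balanced-half {t} {ts′} {x} {y} {z} pt qt o {P} {Q} {f} {f₂} {P₂} {g₁} {g₂} {Q₂} pq c pP pQ xf xg yf yP
      with nonnbr x (f₂ ∷ P₂)
    ... | inj₁ (f₃ , P₃ , r , xf₃) =
      -- `x` takes the edge `f₃ g₁`. That leaves `f g₂` for `y`, which is nonadjacent to `g₂`
      -- because both see `f₂`.
      two (P₃ ++ Q₂) pt qt (lin (↭-sym pq) (lin pP (lin pQ (lin r
          (permute ([ _ ] ∷ [ _ ] ∷ A′ ∷ [ _ ] ∷ B′ ∷ P ∷ Q ∷ [ _ ] ∷ [ _ ] ∷ P₂ ∷ [ _ ] ∷ [ _ ] ∷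
            Q₂ ∷ [ _ ] ∷ P₃ ∷ [])
            (# 0 ⊕ # 1 ⊕ ((((# 2 ⊕ # 3 ⊕ # 4) ⊕ # 5 ⊕ # 6) ⊕ # 7 ⊕ # 8 ⊕ # 9) ⊕ # 10 ⊕ # 11 ⊕
            # 12) ⊕ # 13 ⊕ # 14)
            (# 13 ⊕ # 10 ⊕ # 7 ⊕ # 11 ⊕ ((((# 14 ⊕ # 12) ⊕ # 0 ⊕ # 1 ⊕ # 2 ⊕ # 3 ⊕ # 4) ⊕ # 5) ⊕
            # 6) ⊕ # 8 ⊕ # 9))))))
        (c (∈-resp-↭ (↭-sym pP) (there (∈-resp-↭ (↭-sym r) (here refl)))) g₁∈)
        xf₃ xg (c f∈ g₂∈) yf (common⇒≁ (~-sym (yP (here refl))) (c f₂∈ g₂∈))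
      where
      f∈ = ∈-resp-↭ (↭-sym pP) (here refl)
      f₂∈ = ∈-resp-↭ (↭-sym pP) (there (here refl))
      g₁∈ = ∈-resp-↭ (↭-sym pQ) (here refl)
      g₂∈ = ∈-resp-↭ (↭-sym pQ) (there (here refl))
    -- Now `x` and `y` share the neighbour `f₂`, hence are nonadjacent, and oddness joins `z` to
    -- exactly one of them.
    ... | inj₂ xP = third (Odd-third o (common⇒≁ (~-sym (xP (here refl))) (~-sym (yP (here refl)))))
      where
      f∈ = ∈-resp-↭ (↭-sym pP) (here refl)
      f₂∈ = ∈-resp-↭ (↭-sym pP) (there (here refl))
      g₁∈ = ∈-resp-↭ (↭-sym pQ) (here refl)
      y≁g₁ = common⇒≁ (~-sym (yP (here refl))) (c f₂∈ g₁∈)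
      third : (x ~ z × y ≁ z) ⊎ (y ~ z × x ≁ z) → ⊥
      third (inj₁ (xz , yz)) =
        augment (t ∷ []) ((f , g₁ , x) ∷ (y , f₂ , z) ∷ []) (g₂ ∷ P₂ ++ Q₂) pt
          (edge-apex (c f∈ g₁∈) (≁-sym xf) (≁-sym xg) ∷
           edge-apex (yP (here refl)) yz (≁-sym (common⇒≁ xz (xP (here refl)))) ∷ []) refl
          (lin qt (lin (↭-sym pq) (lin pP (lin pQ
              (permute ([ _ ] ∷ [ _ ] ∷ [ _ ] ∷ [ _ ] ∷ [ _ ] ∷ A′ ∷ [ _ ] ∷ B′ ∷ [ _ ] ∷ [ _ ] ∷
                [ _ ] ∷ P ∷ Q ∷ [ _ ] ∷ [ _ ] ∷ P₂ ∷ [ _ ] ∷ [ _ ] ∷ Q₂ ∷ [])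
                (# 0 ⊕ # 1 ⊕ # 2 ⊕ # 3 ⊕ # 4 ⊕ ((((# 5 ⊕ # 6 ⊕ # 7) ⊕ # 8 ⊕ # 9 ⊕ # 10) ⊕ # 11 ⊕
                # 12) ⊕ # 13 ⊕ # 14 ⊕ # 15) ⊕ # 16 ⊕ # 17 ⊕ # 18)
                (# 13 ⊕ # 16 ⊕ # 8 ⊕ # 9 ⊕ # 14 ⊕ # 10 ⊕ # 17 ⊕ ((((# 15 ⊕ # 18) ⊕ # 0 ⊕ # 1 ⊕
                # 2) ⊕ # 3 ⊕ # 4 ⊕ # 5 ⊕ # 6 ⊕ # 7) ⊕ # 11) ⊕ # 12))))))
      third (inj₂ (yz , xz)) =
        augment (t ∷ []) ((f , g₁ , y) ∷ (x , f₂ , z) ∷ []) (g₂ ∷ P₂ ++ Q₂) pt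
          (edge-apex (c f∈ g₁∈) (≁-sym yf) (≁-sym y≁g₁) ∷
           edge-apex (xP (here refl)) xz (≁-sym (common⇒≁ yz (yP (here refl)))) ∷ []) refl
          (lin qt (lin (↭-sym pq) (lin pP (lin pQ
              (permute ([ _ ] ∷ [ _ ] ∷ [ _ ] ∷ [ _ ] ∷ [ _ ] ∷ A′ ∷ [ _ ] ∷ B′ ∷ [ _ ] ∷ [ _ ] ∷
                [ _ ] ∷ P ∷ Q ∷ [ _ ] ∷ [ _ ] ∷ P₂ ∷ [ _ ] ∷ [ _ ] ∷ Q₂ ∷ [])
                (# 0 ⊕ # 1 ⊕ # 2 ⊕ # 3 ⊕ # 4 ⊕ ((((# 5 ⊕ # 6 ⊕ # 7) ⊕ # 8 ⊕ # 9 ⊕ # 10) ⊕ # 11 ⊕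
                # 12) ⊕ # 13 ⊕ # 14 ⊕ # 15) ⊕ # 16 ⊕ # 17 ⊕ # 18)
                (# 13 ⊕ # 16 ⊕ # 9 ⊕ # 8 ⊕ # 14 ⊕ # 10 ⊕ # 17 ⊕ ((((# 15 ⊕ # 18) ⊕ # 0 ⊕ # 1 ⊕
                # 2) ⊕ # 3 ⊕ # 4 ⊕ # 5 ⊕ # 6 ⊕ # 7) ⊕ # 11) ⊕ # 12))))))

    ¬∀~ : ∀ {y P f P₁} → P ↭ f ∷ P₁ → (∃ λ a → ∃ λ A₁ → P ↭ a ∷ A₁ × y ≁ a) →
          (∀ {p} → p ∈ₗ P₁ → y ~ p) → y ≁ f
    ¬∀~ pP (a , _ , q , ya) yP with ∈-resp-↭ (trans (↭-sym q) pP) (here refl)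
    ... | here refl = ya
    ... | there i   = ⊥-elim (~⇒¬≁ (yP i) ya)

    -- With two vertices on each leftover side, two nonfull vertices of one triple can be served by
    -- disjoint leftover edges. The only obstruction is that on one side `y` misses nothing but the
    -- vertex chosen for `x`, and `balanced-half` removes it.
    balanced : ∀ {t ts′ x y z b₁ B″} → B′ ≡ b₁ ∷ B″ → ts ↭ t ∷ ts′ → tri t ↭ x ∷ y ∷ z ∷ [] →
               Odd (x , y , z) → Nonfull x → Nonfull y → ⊥
    balanced refl pt qt o ((f , [] , pA , xf) , _) _ with () ← ↭-length pA
    balanced refl pt qt o (_ , (g₁ , [] , pB , xg)) _ with () ← ↭-length pB
    balanced {y = y} refl pt qt o ((f , f₂ ∷ A₂ , pA , xf) , (g₁ , g₂ ∷ B₂ , pB , xg)) (nA , nB)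
      with nonnbr y (f₂ ∷ A₂) | nonnbr y (g₂ ∷ B₂)
    ...   | inj₂ yA | _ = balanced-half pt qt o {A} {B} refl bip pA pB xf xg (¬∀~ pA nA yA) yA
    ...   | inj₁ _ | inj₂ yB =
            balanced-half pt qt o {B} {A} (++-comm B A) (Complete-sym bip) pB pA xg xf (¬∀~ pB nB yB) yB
    ...   | inj₁ (f′ , A₃ , pA₃ , yf′) | inj₁ (g′ , B₃ , pB₃ , yg′) =
            two (A₃ ++ B₃) pt qt (lin pA (lin pB (lin pA₃ (lin pB₃
                (permute ([ _ ] ∷ [ _ ] ∷ A′ ∷ [ _ ] ∷ [ _ ] ∷ _ ∷ [ _ ] ∷ [ _ ] ∷ A₂ ∷ [ _ ] ∷
                  [ _ ] ∷ B₂ ∷ [ _ ] ∷ A₃ ∷ [ _ ] ∷ B₃ ∷ [])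
                  (# 0 ⊕ # 1 ⊕ ((((# 2 ⊕ # 3 ⊕ # 4 ⊕ # 5) ⊕ # 6 ⊕ # 7 ⊕ # 8) ⊕ # 9 ⊕ # 10 ⊕ # 11) ⊕
                  # 12 ⊕ # 13) ⊕ # 14 ⊕ # 15)
                  (# 6 ⊕ # 9 ⊕ # 12 ⊕ # 14 ⊕ ((((# 13 ⊕ # 15) ⊕ # 0 ⊕ # 1 ⊕ # 2) ⊕ # 3 ⊕ # 4 ⊕
                  # 5) ⊕ # 7 ⊕ # 8) ⊕ # 10 ⊕ # 11))))))
              (bip (∈-resp-↭ (↭-sym pA) (here refl)) (∈-resp-↭ (↭-sym pB) (here refl))) xf xg
              (bip (∈-resp-↭ (↭-sym pA) (there (∈-resp-↭ (↭-sym pA₃) (here refl))))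
                   (∈-resp-↭ (↭-sym pB) (there (∈-resp-↭ (↭-sym pB₃) (here refl))))) yf′ yg′

-- The possible kinds of packing triples.

module Classification (𝓗 : TriangleFree) where

  open Triples 𝓗
  open Leftover 𝓗

  module Classes
    (a₀ a₁ : V) (A′ : List V) (g : V) (B′ : List V) (ts : List Triple)
    (odds  : All Odd ts)
    (bip   : Complete (a₀ ∷ a₁ ∷ A′) (g ∷ B′))
    (stuck : ∀ W rest → length W ≡ suc (length ts) → All Odd W →
             flat W ++ rest ↭ flat ts ++ (a₀ ∷ a₁ ∷ A′) ++ (g ∷ B′) → ⊥)
    where

    open Maximal a₀ a₁ A′ g B′ ts odds bip stuck public

    -- Together with the star centre these vertices form the five-cycle `g f₁ c d f₂` and an
    -- isolated vertex `w`: the seed of the exceptional wheel.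
    record Pentagon (t : Triple) : Set where
      constructor pentagon
      field
        f₁ f₂ c d w : V
        A↭    : A ↭ f₁ ∷ f₂ ∷ []
        tri↭  : tri t ↭ c ∷ d ∷ w ∷ []
        c~d   : c ~ d
        c~f₁  : c ~ f₁
        d~f₂  : d ~ f₂
        w≁    : w ≁ g × w ≁ f₁ × w ≁ c × w ≁ d × w ≁ f₂

    record IsolatedEdge (t : Triple) : Set where
      constructor isolatedEdge
      field
        c d w : V
        tri↭  : tri t ↭ c ∷ d ∷ w ∷ []
        c~d   : c ~ d
        c≁w   : c ≁ w
        d≁w   : d ≁ w
        c≁A   : ∀ {a} → a ∈ₗ A → c ≁ a
        d≁A   : ∀ {a} → a ∈ₗ A → d ≁ a
        c≁g   : c ≁ g
        d≁g   : d ≁ g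
        w~g   : w ~ g

    record Mixed (t : Triple) : Set where
      constructor mixed
      field
        m y y′ : V
        s s′   : Side
        tri↭   : tri t ↭ m ∷ y ∷ y′ ∷ []
        isOdd  : Odd (m , y , y′)
        m-nf   : Nonfull m
        y-full : Full s y
        y′-full : Full s′ y′

    -- `p` and `q` are nonadjacent and lie on opposite sides, so every leftover vertex completes
    -- them to an odd triple. Thus `o` can be given away.
    record Pure (t : Triple) : Set where
      constructor pure
      field
        p q o  : V
        s      : Side
        tri↭   : tri t ↭ p ∷ q ∷ o ∷ []
        isOdd  : Odd (p , q , o)
        p-full : Full β p
        q-full : Full α q
        p≁q    : p ≁ q
        o-full : Full s o

    data Class (t : Triple) : Set where
      isMixed        : Mixed t → Class t
      isPure         : Pure t → Class t
      isIsolatedEdge : B′ ≡ [] → IsolatedEdge t → Class t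
      isPentagon     : B′ ≡ [] → Pentagon t → Class t

    ∈-singleton : ∀ {x y : V} → x ∈ₗ y ∷ [] → x ≡ y
    ∈-singleton (here refl) = refl

    module Star (star : B′ ≡ []) {t : Triple} {ts′ : List Triple} (pt : ts ↭ t ∷ ts′) where

      twice : ∀ {c d w} → tri t ↭ c ∷ d ∷ w ∷ [] → ∀ {x y z x′ y′ z′} rest →
              Odd (x , y , z) → Odd (x′ , y′ , z′) →
              c ∷ d ∷ w ∷ A ++ g ∷ [] ↭ x ∷ y ∷ z ∷ x′ ∷ y′ ∷ z′ ∷ rest → ⊥
      twice {c} {d} {w} qt {x} {y} {z} {x′} {y′} {z′} rest o o′ r =
        augment (t ∷ []) (_ ∷ _ ∷ []) rest pt (o ∷ o′ ∷ []) refl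
          (lin qt (lin (subst (λ B″ → c ∷ d ∷ w ∷ A ++ g ∷ B″ ↭ x ∷ y ∷ z ∷ x′ ∷ y′ ∷ z′ ∷ rest) (≡-sym star) r)
              (permute ([ _ ] ∷ [ _ ] ∷ [ _ ] ∷ [ _ ] ∷ [ _ ] ∷ A′ ∷ [ _ ] ∷ B′ ∷ [ _ ] ∷ [ _ ] ∷
                [ _ ] ∷ [ _ ] ∷ [ _ ] ∷ [ _ ] ∷ [ _ ] ∷ [ _ ] ∷ [ _ ] ∷ rest ∷ [])
                (# 0 ⊕ # 1 ⊕ # 2 ⊕ # 3 ⊕ # 4 ⊕ ((# 5 ⊕ # 6 ⊕ # 7) ⊕ # 8 ⊕ # 9 ⊕ # 10) ⊕ # 11 ⊕
                # 12 ⊕ # 13 ⊕ # 14 ⊕ # 15 ⊕ # 16 ⊕ # 17)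
                (# 11 ⊕ # 12 ⊕ # 13 ⊕ # 14 ⊕ # 15 ⊕ # 16 ⊕ (# 17 ⊕ # 0 ⊕ # 1 ⊕ # 2) ⊕ # 8 ⊕ # 9 ⊕
                # 10 ⊕ # 3 ⊕ # 4 ⊕ # 5 ⊕ # 6 ⊕ # 7))))

      ~g : ∀ {a} → a ∈ₗ A → a ~ g
      ~g i = bip i (here refl)

      A-ind : ∀ {a b} → a ∈ₗ A → b ∈ₗ A → a ≁ b
      A-ind i j = common⇒≁ (~-sym (~g i)) (~-sym (~g j))

      nf-g : ∀ {x} → Nonfull x → x ≁ g
      nf-g {x} (_ , (b , B₁ , p , n)) =
        subst (x ≁_) (∈-singleton (∈-resp-↭ (trans (↭-sym p) (↭-reflexive (cong (g ∷_) star))) (here refl))) n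

      -- If `d` belongs to the side of `A`, it misses `A`, and `c d` takes as third vertex something
      -- in `A` that `c` misses, while `w` goes to a star edge that it misses. If these choices
      -- collide, `c` and `w` see the same vertices of `A` and exchange roles. If `d` is complete to
      -- `A`, then `c` misses `A`, so `c` takes a star edge and `d w` a vertex of `A`.
      skew : ∀ {c d w} → tri t ↭ c ∷ d ∷ w ∷ [] → c ~ d → c ≁ w → d ≁ w →
             Nonfull c → (∃ λ s → Full s d) → Nonfull w → ⊥
      skew qt cd cw dw nc fd ((_ , [] , p , _) , _) with () ← ↭-length p
      skew {c} {d} {w} qt cd cw dw nc (α , dα) nw@((f , f′ ∷ A₂ , p , wf) , _)
        with nonnbr c (f′ ∷ A₂) | nonnbr w (f′ ∷ A₂)
      ... | inj₁ (f″ , A₃ , r , cf″) | _ =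
        twice qt A₃ (edge-apex (~g f∈) (≁-sym wf) (≁-sym (nf-g nw)))
          (edge-apex cd cf″ (α≁A dα (∈-resp-↭ (↭-sym p) (there (∈-resp-↭ (↭-sym r) (here refl))))))
          (lin p (lin r
              (permute ([ _ ] ∷ [ _ ] ∷ [ _ ] ∷ [ _ ] ∷ [ _ ] ∷ A′ ∷ [ _ ] ∷ [ _ ] ∷ [ _ ] ∷ A₂ ∷
                [ _ ] ∷ A₃ ∷ [])
                (# 0 ⊕ # 1 ⊕ # 2 ⊕ # 3 ⊕ # 4 ⊕ ((# 5 ⊕ # 6) ⊕ # 7 ⊕ # 8 ⊕ # 9) ⊕ # 10 ⊕ # 11)
                (# 7 ⊕ # 6 ⊕ # 2 ⊕ # 0 ⊕ # 1 ⊕ # 10 ⊕ (# 11 ⊕ # 3 ⊕ # 4 ⊕ # 5) ⊕ # 8 ⊕ # 9))))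
        where f∈ = ∈-resp-↭ (↭-sym p) (here refl)
      ... | inj₂ cA | inj₁ (f″ , A₃ , r , wf″) =
        twice qt A₃ (edge-apex (~g (∈-resp-↭ (↭-sym p) (there (∈-resp-↭ (↭-sym r) (here refl)))))
                      (≁-sym wf″) (≁-sym (nf-g nw)))
          (edge-apex cd (¬∀~ p (proj₁ nc) cA) (α≁A dα (∈-resp-↭ (↭-sym p) (here refl))))
          (lin p (lin r
              (permute ([ _ ] ∷ [ _ ] ∷ [ _ ] ∷ [ _ ] ∷ [ _ ] ∷ A′ ∷ [ _ ] ∷ [ _ ] ∷ [ _ ] ∷ A₂ ∷
                [ _ ] ∷ A₃ ∷ [])
                (# 0 ⊕ # 1 ⊕ # 2 ⊕ # 3 ⊕ # 4 ⊕ ((# 5 ⊕ # 6) ⊕ # 7 ⊕ # 8 ⊕ # 9) ⊕ # 10 ⊕ # 11)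
                (# 10 ⊕ # 6 ⊕ # 2 ⊕ # 0 ⊕ # 1 ⊕ # 7 ⊕ (# 11 ⊕ # 3 ⊕ # 4 ⊕ # 5) ⊕ # 8 ⊕ # 9))))
      ... | inj₂ cA | inj₂ wA =
        twice qt A₂ (edge-apex (~g (∈-resp-↭ (↭-sym p) (here refl))) (≁-sym (¬∀~ p (proj₁ nc) cA)) (≁-sym (nf-g nc)))
          (edge-apex (wA (here refl)) (≁-sym dw)
            (≁-sym (α≁A dα (∈-resp-↭ (↭-sym p) (there (here refl))))))
          (lin p
              (permute ([ _ ] ∷ [ _ ] ∷ [ _ ] ∷ [ _ ] ∷ [ _ ] ∷ A′ ∷ [ _ ] ∷ [ _ ] ∷ [ _ ] ∷ A₂ ∷
                [])
                (# 0 ⊕ # 1 ⊕ # 2 ⊕ # 3 ⊕ # 4 ⊕ (# 5 ⊕ # 6) ⊕ # 7 ⊕ # 8 ⊕ # 9)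
                (# 7 ⊕ # 6 ⊕ # 0 ⊕ # 2 ⊕ # 8 ⊕ # 1 ⊕ # 9 ⊕ # 3 ⊕ # 4 ⊕ # 5)))
      skew {c} {d} {w} qt cd cw dw nc (β , dβ) nw@((f , f′ ∷ A₂ , p , wf) , _) =
        twice qt A₂ (edge-apex (~g f′∈) (≁-sym (common⇒≁ (~-sym cd) (dβ f′∈))) (≁-sym (nf-g nc)))
          (edge-apex (dβ (∈-resp-↭ (↭-sym p) (here refl))) dw (≁-sym wf))
          (lin p
              (permute ([ _ ] ∷ [ _ ] ∷ [ _ ] ∷ [ _ ] ∷ [ _ ] ∷ A′ ∷ [ _ ] ∷ [ _ ] ∷ [ _ ] ∷ A₂ ∷
                [])
                (# 0 ⊕ # 1 ⊕ # 2 ⊕ # 3 ⊕ # 4 ⊕ (# 5 ⊕ # 6) ⊕ # 7 ⊕ # 8 ⊕ # 9)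
                (# 8 ⊕ # 6 ⊕ # 0 ⊕ # 1 ⊕ # 7 ⊕ # 2 ⊕ # 9 ⊕ # 3 ⊕ # 4 ⊕ # 5)))
        where f′∈ = ∈-resp-↭ (↭-sym p) (there (here refl))

      -- Since `c` is nonfull it misses some vertex of `A` besides seeing `f₀`. Any further freedom
      -- (a second vertex missed by `d`, a third vertex of `A`, a neighbour of `w`) splits triple
      -- and star into two odd triples; without it the five-cycle remains.
      toPentagon : ∀ {c d w} → tri t ↭ c ∷ d ∷ w ∷ [] → c ~ d → c ≁ w → d ≁ w →
                   Nonfull c → Nonfull d → ∀ {f₀ A₁} → A ↭ f₀ ∷ A₁ → c ~ f₀ → Pentagon t
      toPentagon qt cd cw dw nc nd {A₁ = []} p e with () ← ↭-length p
      toPentagon {c} {d} {w} qt cd cw dw nc nd {f₀} {f₁ ∷ A₂} p cf₀ with proj₁ nc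
      ... | _ , _ , r , cf with ∈-resp-↭ (trans (↭-sym r) p) (here refl)
      ...   | here refl = ⊥-elim (~⇒¬≁ cf₀ cf)
      ...   | there f∈ with ∈⇒↭ f∈ | nonnbr d (f₁ ∷ A₂)
      ...     | A₃ , r′ | inj₁ (f , A₄ , r″ , df) =
        ⊥-elim (twice qt A₄
          (edge-apex (~g (∈-resp-↭ (↭-sym p) (there (∈-resp-↭ (↭-sym r″) (here refl))))) (≁-sym df) (≁-sym (nf-g nd)))
          (edge-apex cf₀ cw (≁-sym w≁f₀)) (lin p (lin r″
              (permute ([ _ ] ∷ [ _ ] ∷ [ _ ] ∷ [ _ ] ∷ [ _ ] ∷ A′ ∷ [ _ ] ∷ [ _ ] ∷ [ _ ] ∷ A₂ ∷
                [ _ ] ∷ A₄ ∷ [])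
                (# 0 ⊕ # 1 ⊕ # 2 ⊕ # 3 ⊕ # 4 ⊕ ((# 5 ⊕ # 6) ⊕ # 7 ⊕ # 8 ⊕ # 9) ⊕ # 10 ⊕ # 11)
                (# 10 ⊕ # 6 ⊕ # 1 ⊕ # 0 ⊕ # 7 ⊕ # 2 ⊕ (# 11 ⊕ # 3 ⊕ # 4 ⊕ # 5) ⊕ # 8 ⊕ # 9)))))
        where
        w≁f₀ : w ≁ f₀
        w≁f₀ = ¬~⇒≁ λ wf₀ → twice qt A₃
          (edge-apex (~g (∈-resp-↭ (↭-sym p) (there f∈))) (≁-sym cf) (≁-sym (nf-g nc)))
          (edge-apex wf₀ (≁-sym dw) (common⇒≁ cf₀ cd))
          (lin p (lin r′
              (permute ([ _ ] ∷ [ _ ] ∷ [ _ ] ∷ [ _ ] ∷ [ _ ] ∷ A′ ∷ [ _ ] ∷ [ _ ] ∷ [ _ ] ∷ A₂ ∷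
                [ _ ] ∷ A₃ ∷ [])
                (# 0 ⊕ # 1 ⊕ # 2 ⊕ # 3 ⊕ # 4 ⊕ ((# 5 ⊕ # 6) ⊕ # 7 ⊕ # 8 ⊕ # 9) ⊕ # 10 ⊕ # 11)
                (# 10 ⊕ # 6 ⊕ # 0 ⊕ # 2 ⊕ # 7 ⊕ # 1 ⊕ (# 11 ⊕ # 3 ⊕ # 4 ⊕ # 5) ⊕ # 8 ⊕ # 9))))
      ...     | A₃ , r′ | inj₂ dA = rest A₂ refl
        where
        f₀∈ = ∈-resp-↭ (↭-sym p) (here refl)
        f₁∈ = ∈-resp-↭ (↭-sym p) (there (here refl))
        d≁f₀ = common⇒≁ cd cf₀
        w≁f₀ : w ≁ f₀
        w≁f₀ = ¬~⇒≁ λ wf₀ → twice qt A₃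
          (edge-apex (~g (∈-resp-↭ (↭-sym p) (there f∈))) (≁-sym cf) (≁-sym (nf-g nc)))
          (edge-apex wf₀ (≁-sym dw) (common⇒≁ cf₀ cd))
          (lin p (lin r′
              (permute ([ _ ] ∷ [ _ ] ∷ [ _ ] ∷ [ _ ] ∷ [ _ ] ∷ A′ ∷ [ _ ] ∷ [ _ ] ∷ [ _ ] ∷ A₂ ∷
                [ _ ] ∷ A₃ ∷ [])
                (# 0 ⊕ # 1 ⊕ # 2 ⊕ # 3 ⊕ # 4 ⊕ ((# 5 ⊕ # 6) ⊕ # 7 ⊕ # 8 ⊕ # 9) ⊕ # 10 ⊕ # 11)
                (# 10 ⊕ # 6 ⊕ # 0 ⊕ # 2 ⊕ # 7 ⊕ # 1 ⊕ (# 11 ⊕ # 3 ⊕ # 4 ⊕ # 5) ⊕ # 8 ⊕ # 9))))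
        c≁f₁ : c ≁ f₁
        c≁f₁ = common⇒≁ (~-sym cd) (dA (here refl))
        w≁f₁ : w ≁ f₁
        w≁f₁ = ¬~⇒≁ λ wf₁ → twice qt A₂
          (edge-apex (~g f₀∈) (≁-sym d≁f₀) (≁-sym (nf-g nd)))
          (edge-apex wf₁ (≁-sym cw) (≁-sym c≁f₁))
          (lin p
              (permute ([ _ ] ∷ [ _ ] ∷ [ _ ] ∷ [ _ ] ∷ [ _ ] ∷ A′ ∷ [ _ ] ∷ [ _ ] ∷ [ _ ] ∷ A₂ ∷
                [])
                (# 0 ⊕ # 1 ⊕ # 2 ⊕ # 3 ⊕ # 4 ⊕ (# 5 ⊕ # 6) ⊕ # 7 ⊕ # 8 ⊕ # 9)
                (# 7 ⊕ # 6 ⊕ # 1 ⊕ # 2 ⊕ # 8 ⊕ # 0 ⊕ # 9 ⊕ # 3 ⊕ # 4 ⊕ # 5)))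
        -- A third vertex of `A` carries the star edge for `c`, which frees `d f₁` for `w`; hence
        -- `A` has just two vertices.
        rest : ∀ A₂′ → A₂′ ≡ A₂ → Pentagon t
        rest (f₂ ∷ A₃) refl = ⊥-elim (twice qt (f₀ ∷ A₃)
          (edge-apex (~g (∈-resp-↭ (↭-sym p) (there (there (here refl)))))
            (≁-sym (common⇒≁ (~-sym cd) (dA (there (here refl))))) (≁-sym (nf-g nc)))
          (edge-apex (dA (here refl)) dw (≁-sym w≁f₁))
          (lin p
              (permute ([ _ ] ∷ [ _ ] ∷ [ _ ] ∷ [ _ ] ∷ [ _ ] ∷ A′ ∷ [ _ ] ∷ [ _ ] ∷ [ _ ] ∷
                [ _ ] ∷ A₃ ∷ [])
                (# 0 ⊕ # 1 ⊕ # 2 ⊕ # 3 ⊕ # 4 ⊕ (# 5 ⊕ # 6) ⊕ # 7 ⊕ # 8 ⊕ # 9 ⊕ # 10)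
                (# 9 ⊕ # 6 ⊕ # 0 ⊕ # 1 ⊕ # 8 ⊕ # 2 ⊕ # 7 ⊕ # 10 ⊕ # 3 ⊕ # 4 ⊕ # 5))))
        rest [] refl = pentagon f₀ f₁ c d w p qt cd cf₀ (dA (here refl)) (w≁g , w≁f₀ , ≁-sym cw , ≁-sym dw , w≁f₁)
          where
          w≁g : w ≁ g
          w≁g = ¬~⇒≁ λ wg → twice qt []
            (edge-apex wg (≁-sym cw) (≁-sym (nf-g nc)))
            (edge-apex (dA (here refl)) d≁f₀ (A-ind f₁∈ f₀∈))
            (lin p
                (permute ([ _ ] ∷ [ _ ] ∷ [ _ ] ∷ [ _ ] ∷ [ _ ] ∷ A′ ∷ [ _ ] ∷ [ _ ] ∷ [ _ ] ∷ [])
                  (# 0 ⊕ # 1 ⊕ # 2 ⊕ # 3 ⊕ # 4 ⊕ (# 5 ⊕ # 6) ⊕ # 7 ⊕ # 8)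
                  (# 2 ⊕ # 6 ⊕ # 0 ⊕ # 1 ⊕ # 8 ⊕ # 7 ⊕ # 3 ⊕ # 4 ⊕ # 5)))

      -- A neighbour of `c` or `d` in `A` leads to the pentagon. Otherwise `c d` is isolated from
      -- the star, and `w` must see its centre and nothing else, or two odd triples appear.
      edge-nonfull : ∀ {c d w} → tri t ↭ c ∷ d ∷ w ∷ [] → c ~ d → c ≁ w → d ≁ w →
                     Nonfull c → Nonfull d → Class t
      edge-nonfull {c} {d} {w} qt cd cw dw nc nd with find? (h c) A | find? (h d) A
      ... | inj₁ (f₀ , A₁ , p , e) | _ = isPentagon star (toPentagon qt cd cw dw nc nd p e)
      ... | inj₂ _ | inj₁ (f₀ , A₁ , p , e) =
        isPentagon star (toPentagon (trans qt ↭₂₁₃) (~-sym cd) dw cw nd nc p e)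
      ... | inj₂ cA | inj₂ dA with find? (h w) A | ~∨≁ w g
      ...   | inj₁ (f₀ , [] , p , e) | _ with () ← ↭-length p
      edge-nonfull {c} {d} {w} qt cd cw dw nc nd | inj₂ cA | inj₂ dA | inj₁ (f₀ , f₁ ∷ A₂ , p , e) | _ =
        ⊥-elim (twice qt A₂ (edge-apex (~g f₁∈) (≁-sym (cA f₁∈)) (≁-sym (nf-g nc)))
          (edge-apex e (≁-sym dw) (≁-sym (dA f₀∈))) (lin p
              (permute ([ _ ] ∷ [ _ ] ∷ [ _ ] ∷ [ _ ] ∷ [ _ ] ∷ A′ ∷ [ _ ] ∷ [ _ ] ∷ [ _ ] ∷ A₂ ∷
                [])
                (# 0 ⊕ # 1 ⊕ # 2 ⊕ # 3 ⊕ # 4 ⊕ (# 5 ⊕ # 6) ⊕ # 7 ⊕ # 8 ⊕ # 9)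
                (# 8 ⊕ # 6 ⊕ # 0 ⊕ # 2 ⊕ # 7 ⊕ # 1 ⊕ # 9 ⊕ # 3 ⊕ # 4 ⊕ # 5))))
        where
        f₀∈ = ∈-resp-↭ (↭-sym p) (here refl)
        f₁∈ = ∈-resp-↭ (↭-sym p) (there (here refl))
      edge-nonfull {c} {d} {w} qt cd cw dw nc nd | inj₂ cA | inj₂ dA | inj₂ wA | inj₁ wg =
        isIsolatedEdge star (isolatedEdge c d w qt cd cw dw cA dA (nf-g nc) (nf-g nd) wg)
      edge-nonfull {c} {d} {w} qt cd cw dw nc nd | inj₂ cA | inj₂ dA | inj₂ wA | inj₂ wg =
        ⊥-elim (twice qt A′ (edge-apex cd (cA (here refl)) (dA (here refl)))
          (edge-apex (~g (there (here refl))) (≁-sym (wA (there (here refl)))) (≁-sym wg))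
              (permute ([ _ ] ∷ [ _ ] ∷ [ _ ] ∷ [ _ ] ∷ [ _ ] ∷ A′ ∷ [ _ ] ∷ [])
                (# 0 ⊕ # 1 ⊕ # 2 ⊕ # 3 ⊕ # 4 ⊕ # 5 ⊕ # 6)
                (# 0 ⊕ # 1 ⊕ # 3 ⊕ # 4 ⊕ # 6 ⊕ # 2 ⊕ # 5)))

    -- Full vertices of one side are nonadjacent, so the edge `c d` joins opposite sides. `w` and
    -- the end opposite to it are the nonadjacent pair `p`, `q`, and the other end is `o`.
    pure-edge : ∀ {t c d w s s′ s″} → tri t ↭ c ∷ d ∷ w ∷ [] → c ~ d → c ≁ w → d ≁ w →
                Full s c → Full s′ d → Full s″ w → Pure t
    pure-edge {s = α} {α} qt cd cw dw fc fd fw = ⊥-elim (~⇒¬≁ cd (same-side α fc fd))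
    pure-edge {s = β} {β} qt cd cw dw fc fd fw = ⊥-elim (~⇒¬≁ cd (same-side β fc fd))
    pure-edge {s = α} {β} {α} qt cd cw dw fc fd fw =
      pure _ _ _ α (trans qt ↭₂₃₁) (Odd-rotate (edge-apex cd cw dw)) fd fw dw fc
    pure-edge {s = α} {β} {β} qt cd cw dw fc fd fw =
      pure _ _ _ β (trans qt ↭₃₁₂) (Odd-rotate (Odd-rotate (edge-apex cd cw dw))) fw fc (≁-sym cw) fd
    pure-edge {s = β} {α} {α} qt cd cw dw fc fd fw =
      pure _ _ _ α (trans qt ↭₁₃₂) (Odd-rotate (edge-apex (~-sym cd) dw cw)) fc fw cw fd
    pure-edge {s = β} {α} {β} qt cd cw dw fc fd fw =
      pure _ _ _ β (trans qt ↭₃₂₁) (Odd-rotate (Odd-rotate (edge-apex (~-sym cd) dw cw))) fw fd (≁-sym dw) fc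

    classify-edge : ∀ {t ts′ c d w} → ts ↭ t ∷ ts′ → tri t ↭ c ∷ d ∷ w ∷ [] →
                    c ~ d → c ≁ w → d ≁ w → Class t
    classify-edge {c = c} {d} {w} pt qt cd cw dw with full? c | full? d | full? w
    ... | inj₁ (_ , fc) | inj₁ (_ , fd) | inj₁ (_ , fw) = isPure (pure-edge qt cd cw dw fc fd fw)
    ... | inj₂ nc | inj₁ (s , fd) | inj₁ (s′ , fw) =
      isMixed (mixed c d w s s′ qt (edge-apex cd cw dw) nc fd fw)
    ... | inj₁ (s , fc) | inj₂ nd | inj₁ (s′ , fw) =
      isMixed (mixed d c w s s′ (trans qt ↭₂₁₃) (edge-apex (~-sym cd) dw cw) nd fc fw)
    ... | inj₁ (s , fc) | inj₁ (s′ , fd) | inj₂ nw =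
      isMixed (mixed w c d s s′ (trans qt ↭₃₁₂) (Odd-rotate (Odd-rotate (edge-apex cd cw dw))) nw fc fd)
    ... | fc | inj₂ nd | inj₂ nw = go B′ refl fc
      where
      go : ∀ B″ → B′ ≡ B″ → (∃ λ s → Full s c) ⊎ Nonfull c → Class _
      go (b ∷ B″) e _ = ⊥-elim (balanced e pt (trans qt ↭₂₃₁) (Odd-rotate (edge-apex cd cw dw)) nd nw)
      go [] e (inj₁ fc) = ⊥-elim (Star.skew e pt (trans qt ↭₂₁₃) (~-sym cd) dw cw nd fc nw)
      go [] e (inj₂ nc) = Star.edge-nonfull e pt qt cd cw dw nc nd
    ... | inj₂ nc | fd | inj₂ nw = go B′ refl fd
      where
      go : ∀ B″ → B′ ≡ B″ → (∃ λ s → Full s d) ⊎ Nonfull d → Class _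
      go (b ∷ B″) e _ = ⊥-elim (balanced e pt (trans qt ↭₁₃₂) (Odd-rotate (edge-apex (~-sym cd) dw cw)) nc nw)
      go [] e (inj₁ fd) = ⊥-elim (Star.skew e pt qt cd cw dw nc fd nw)
      go [] e (inj₂ nd) = Star.edge-nonfull e pt qt cd cw dw nc nd
    ... | inj₂ nc | inj₂ nd | _ = go B′ refl
      where
      go : ∀ B″ → B′ ≡ B″ → Class _
      go (b ∷ B″) e = ⊥-elim (balanced e pt qt (edge-apex cd cw dw) nc nd)
      go [] e = Star.edge-nonfull e pt qt cd cw dw nc nd

    classify : ∀ {t ts′} → ts ↭ t ∷ ts′ → Odd t → Class t
    classify pt o with Odd-view o
    ... | inj₁ (cd , cw , dw)        = classify-edge pt refl cd cw dw
    ... | inj₂ (inj₁ (cd , cw , dw)) = classify-edge pt ↭₁₃₂ cd cw (≁-sym dw)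
    ... | inj₂ (inj₂ (cd , cw , dw)) = classify-edge pt ↭₂₃₁ cd (≁-sym cw) (≁-sym dw)

-- Updates of finite families and the alternating search.

module _ {A : Set} where

  setAt : ∀ {n} → (Fin n → A) → Fin n → A → Fin n → A
  setAt f zero    x zero    = x
  setAt f zero    x (suc j) = f (suc j)
  setAt f (suc i) x zero    = f zero
  setAt f (suc i) x (suc j) = setAt (f ∘ suc) i x j

  setAt-all : ∀ {n} (P : Fin n → A → Set) (f : Fin n → A) i {x} →
              (∀ j → P j (f j)) → P i x → ∀ j → P j (setAt f i x j)
  setAt-all P f zero    a b zero    = b
  setAt-all P f zero    a b (suc j) = a (suc j)
  setAt-all P f (suc i) a b zero    = a zero
  setAt-all P f (suc i) a b (suc j) = setAt-all (P ∘ suc) (f ∘ suc) i (a ∘ suc) b j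

  setAt-other : ∀ {n} (f : Fin n → A) i {x} j → j ≢ i → setAt f i x j ≡ f j
  setAt-other f zero    zero    n = ⊥-elim (n refl)
  setAt-other f zero    (suc j) n = refl
  setAt-other f (suc i) zero    n = refl
  setAt-other f (suc i) (suc j) n = setAt-other (f ∘ suc) i j (n ∘ cong suc)

  setAt-same : ∀ {n} (f : Fin n → A) i {x} → setAt f i x i ≡ x
  setAt-same f zero    = refl
  setAt-same f (suc i) = setAt-same (f ∘ suc) i

  -- The old entry is added on the left instead of being removed on the right, which suits
  -- cancellation by `lin`.
  tabulate-setAt : ∀ {n} (f : Fin n → A) i x → f i ∷ tabulate (setAt f i x) ↭ x ∷ tabulate f
  tabulate-setAt f zero    x = swap _ _ refl
  tabulate-setAt f (suc i) x =
    trans (swap _ _ refl) (trans (prep _ (tabulate-setAt (f ∘ suc) i x)) (swap _ _ refl))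

  ∈-tabulate : ∀ {n} (P : A → Set) (f : Fin n → A) → (∀ i → P (f i)) → ∀ {x} → x ∈ₗ tabulate f → P x
  ∈-tabulate {suc n} P f a (here refl) = a zero
  ∈-tabulate {suc n} P f a (there i)   = ∈-tabulate P (f ∘ suc) (a ∘ suc) i

falses : List Bool → ℕ
falses []           = 0
falses (true  ∷ bs) = falses bs
falses (false ∷ bs) = suc (falses bs)

falses-↭ : ∀ {bs cs} → bs ↭ cs → falses bs ≡ falses cs
falses-↭ refl                 = refl
falses-↭ (prep true p)        = falses-↭ p
falses-↭ (prep false p)       = cong suc (falses-↭ p)
falses-↭ (swap true true p)   = falses-↭ p
falses-↭ (swap true false p)  = cong suc (falses-↭ p)
falses-↭ (swap false true p)  = cong suc (falses-↭ p)
falses-↭ (swap false false p) = cong (2 +_) (falses-↭ p)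
falses-↭ (trans p q)          = ≡-trans (falses-↭ p) (falses-↭ q)

falses-setAt : ∀ {n} (ρ : Fin n → Bool) i → ρ i ≡ false →
               suc (falses (tabulate (setAt ρ i true))) ≡ falses (tabulate ρ)
falses-setAt ρ i e =
  falses-↭ (trans (↭-reflexive (cong (_∷ tabulate (setAt ρ i true)) (≡-sym e))) (tabulate-setAt ρ i true))

-- Alternating search: the pairs q i ≁ p i are a matching in the nonadjacency relation, and a
-- vertex a is attained from a source z when the matching can be moved, along an alternating
-- path starting at z, so that a becomes the unmatched vertex.
module Alternating (𝓗 : TriangleFree) where

  open Triples 𝓗

  -- `Valid i x` means that `x` may stand in for `q i`. `Good` is whatever the absence of an
  -- augmenting path grants to attained vertices; it must in turn make them valid further along the
  -- path.
  module Search {l : ℕ} (p q : Fin l → V) (Source : V → Set)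
    (Valid : Fin l → V → Set) (Good : V → Set)
    (valid : ∀ i → Valid i (q i))
    (step  : ∀ {a} i → Good a → a ≁ p i → Valid i a)
    (good  : ∀ {z a} (q′ : Fin l → V) → Source z → a ∷ tabulate q′ ↭ z ∷ tabulate q →
             (∀ i → Valid i (q′ i)) → Good a)
    where

    -- `ρ` marks the visited indices. All others keep their original partner, so a path can be
    -- prolonged through them without meeting itself.
    Attained : V → (Fin l → Bool) → Set
    Attained a ρ = ∃ λ z → ∃ λ q′ → Source z × a ∷ tabulate q′ ↭ z ∷ tabulate q ×
                   (∀ i → Valid i (q′ i)) × (∀ i → ρ i ≡ false → q′ i ≡ q i)

    attained-good : ∀ {a ρ} → Attained a ρ → Good a
    attained-good (z , q′ , s , π , v , _) = good q′ s π v

    -- The certificate of a failed search, as in König's theorem: sources and reached `q` are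
    -- adjacent to all unreached `p`.
    record Closed : Set where
      field
        ρ : Fin l → Bool
        reached-good    : ∀ i → ρ i ≡ true → Good (q i)
        source-adjacent : ∀ {z} i → Source z → ρ i ≡ false → z ~ p i
        reached-adjacent : ∀ i j → ρ i ≡ true → ρ j ≡ false → q i ~ p j

    advance : ∀ {a ρ} j → Attained a ρ → ρ j ≡ false → a ≁ p j → Attained (q j) (setAt ρ j true)
    advance {a} {ρ} j att@(z , q′ , s , π , v , intact) e n =
      z , setAt q′ j a , s ,
      lin π (lin (subst (λ x → x ∷ tabulate (setAt q′ j a) ↭ a ∷ tabulate q′) (intact j e)
                   (tabulate-setAt q′ j a))
                       (permute ([ _ ] ∷ (tabulate (setAt q′ j a)) ∷ [ _ ] ∷ (tabulate q) ∷ [ _ ] ∷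
                         (tabulate q′) ∷ [])
                         (# 0 ⊕ (# 1 ⊕ # 2 ⊕ # 3) ⊕ # 4 ⊕ # 5)
                         (# 2 ⊕ (# 3 ⊕ # 4 ⊕ # 5) ⊕ # 0 ⊕ # 1))) ,
      setAt-all Valid q′ j v (step j (attained-good att) n) ,
      λ i e′ → ≡-trans (setAt-other q′ j i (i≢j i e′)) (intact i (≡-trans (≡-sym (setAt-other ρ j i (i≢j i e′))) e′))
      where
      i≢j : ∀ i → setAt ρ j true i ≡ false → i ≢ j
      i≢j i e′ refl with () ← ≡-trans (≡-sym (setAt-same ρ j)) e′

    weaken : ∀ {a ρ} j → Attained a ρ → Attained a (setAt ρ j true)
    weaken {ρ = ρ} j (z , q′ , s , π , v , intact) =
      z , q′ , s , π , v , setAt-all (λ i b → b ≡ false → q′ i ≡ q i) ρ j intact λ ()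

    -- The present state is offered to the continuation as closed. Any missing adjacency it asks for
    -- is a step by which the search continues, and the number of unvisited indices drops.
    search : ∀ n ρ → falses (tabulate ρ) ≤ n → (∀ i → ρ i ≡ true → Attained (q i) ρ) →
             (Closed → ⊥) → ⊥
    search n ρ b inv k = k record
      { ρ = ρ
      ; reached-good = λ i e → attained-good (inv i e)
      ; source-adjacent = λ {z} i s e →
          ¬≁⇒~ (continue n b i e (z , q , s , refl , valid , λ _ _ → refl))
      ; reached-adjacent = λ i j e e′ → ¬≁⇒~ (continue n b j e′ (inv i e))
      }
      where
      continue : ∀ n → falses (tabulate ρ) ≤ n → ∀ {a} j → ρ j ≡ false → Attained a ρ → a ≁ p j → ⊥
      continue n b j e att a≁p with n | subst (_≤ n) (≡-sym (falses-setAt ρ j e)) b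
      ... | suc n′ | s≤s b′ = search n′ (setAt ρ j true) b′
        (setAt-all (λ i b → b ≡ true → Attained (q i) (setAt ρ j true)) ρ j
          (λ i e′ → weaken j (inv i e′)) (λ _ → advance j att e a≁p)) k

    closure : (Closed → ⊥) → ⊥
    closure = search _ (λ _ → false) ≤-refl (λ _ ())

-- The packing triples are now of two kinds, each contributing vertices that are complete to one
-- side of the leftover biclique. Either an alternating path yields one more odd triple, or one
-- vertex can be dropped from each triple so that the rest is a biclique.
module Conclusion (𝓗 : TriangleFree) where

  open Triples 𝓗
  open Leftover 𝓗
  open Alternating 𝓗

  module Kinds
    (a₀ a₁ : V) (A′ : List V) (g : V) (B′ : List V) (ts : List Triple)
    (odds  : All Odd ts)
    (bip   : Complete (a₀ ∷ a₁ ∷ A′) (g ∷ B′))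
    (stuck : ∀ W rest → length W ≡ suc (length ts) → All Odd W →
             flat W ++ rest ↭ flat ts ++ (a₀ ∷ a₁ ∷ A′) ++ (g ∷ B′) → ⊥)
    where

    open Maximal a₀ a₁ A′ g B′ ts odds bip stuck public

    record Mix : Set where
      constructor mix
      field
        m y y′  : V
        s s′    : Side
        isOdd   : Odd (m , y , y′)
        m-nf    : Nonfull m
        y-full  : Full s y
        y′-full : Full s′ y′
    open Mix public

    mtri : Mix → Triple
    mtri N = m N , y N , y′ N

    flip : Mix → Mix
    flip (mix m y y′ s s′ o n f f′) = mix m y′ y s′ s (Odd-rotate (Odd-swap o)) n f′ f

    record Pur : Set where
      constructor pur
      field
        p q o  : V
        s      : Side
        isOdd  : Odd (p , q , o)
        p-full : Full β p
        q-full : Full α q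
        p≁q    : p ≁ q
        o-full : Full s o

    Fr : List V
    Fr = A ++ B

    ∈Fr : ∀ {x} → x ∈ₗ Fr → x ∈ₗ A ⊎ x ∈ₗ B
    ∈Fr = ∈-++⁻ A

    A⊆Fr : ∀ {x} → x ∈ₗ A → x ∈ₗ Fr
    A⊆Fr = ∈-++⁺ˡ

    B⊆Fr : ∀ {x} → x ∈ₗ B → x ∈ₗ Fr
    B⊆Fr = ∈-++⁺ʳ A

    -- A leftover vertex lies in `A` or `B`, so it sees exactly one of two vertices that are full on
    -- opposite sides.
    odd-opposite : ∀ {a b f} → Full α a → Full β b → a ≁ b → f ∈ₗ Fr → Odd (a , b , f)
    odd-opposite fa fb n i with ∈Fr i
    ... | inj₁ i′ = Odd-rotate (Odd-rotate (edge-apex (fb i′) (≁-sym n) (≁-sym (α≁A fa i′))))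
    ... | inj₂ i′ = Odd-swap (Odd-rotate (Odd-rotate (edge-apex (fa i′) n (≁-sym (β≁B fb i′)))))

    parity : ∀ {x y z o a b} → odd x y z ≡ o → h x y ≡ a → h x z ≡ b → h y z ≡ o xor (a xor b)
    parity {x} {y} {z} refl refl refl = cancel (h x y) (h x z) (h y z)
      where
      cancel : ∀ a b c → c ≡ (a xor (b xor c)) xor (a xor b)
      cancel true  true  true  = refl
      cancel true  true  false = refl
      cancel true  false true  = refl
      cancel true  false false = refl
      cancel false true  true  = refl
      cancel false true  false = refl
      cancel false false true  = refl
      cancel false false false = refl

    -- The middle vertex of a mixed triple tells the two ends of a leftover edge apart, so the
    -- triple survives the loss of either full vertex.
    repair : ∀ N → ∃ λ f → ∃ λ F → Fr ↭ f ∷ F × Odd (m N , y′ N , f)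
    repair (mix m y y′ s s′ o ((a , A₁ , pA , ma) , (b , B₁ , pB , mb)) f f′) = go s′ f′ (~∨≁ m y′)
      where
      a∈ = ∈-resp-↭ (↭-sym pA) (here refl)
      b∈ = ∈-resp-↭ (↭-sym pB) (here refl)
      go : ∀ s′ → Full s′ y′ → (m ~ y′) ⊎ (m ≁ y′) → ∃ λ f → ∃ λ F → Fr ↭ f ∷ F × Odd (m , y′ , f)
      go α f (inj₁ e) = a , A₁ ++ B , lin pA
          (permute ([ _ ] ∷ [ _ ] ∷ A′ ∷ [ _ ] ∷ B′ ∷ [ _ ] ∷ A₁ ∷ [])
            (# 0 ⊕ # 1 ⊕ (# 2 ⊕ # 3 ⊕ # 4) ⊕ # 5 ⊕ # 6)
            (# 5 ⊕ (# 6 ⊕ # 3 ⊕ # 4) ⊕ # 0 ⊕ # 1 ⊕ # 2)) , edge-apex e ma (α≁A f a∈)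
      go β f (inj₁ e) = b , A ++ B₁ , lin pB
          (permute ([ _ ] ∷ [ _ ] ∷ A′ ∷ [ _ ] ∷ B′ ∷ [ _ ] ∷ B₁ ∷ [])
            (# 0 ⊕ # 1 ⊕ (# 2 ⊕ # 3 ⊕ # 4) ⊕ # 5 ⊕ # 6)
            (# 5 ⊕ # 0 ⊕ # 1 ⊕ (# 2 ⊕ # 6) ⊕ # 3 ⊕ # 4)) , edge-apex e mb (β≁B f b∈)
      go α f (inj₂ n) = b , A ++ B₁ , lin pB
          (permute ([ _ ] ∷ [ _ ] ∷ A′ ∷ [ _ ] ∷ B′ ∷ [ _ ] ∷ B₁ ∷ [])
            (# 0 ⊕ # 1 ⊕ (# 2 ⊕ # 3 ⊕ # 4) ⊕ # 5 ⊕ # 6)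
            (# 5 ⊕ # 0 ⊕ # 1 ⊕ (# 2 ⊕ # 6) ⊕ # 3 ⊕ # 4)) , Odd-rotate (Odd-rotate (edge-apex (f b∈) (≁-sym n) (≁-sym mb)))
      go β f (inj₂ n) = a , A₁ ++ B , lin pA
          (permute ([ _ ] ∷ [ _ ] ∷ A′ ∷ [ _ ] ∷ B′ ∷ [ _ ] ∷ A₁ ∷ [])
            (# 0 ⊕ # 1 ⊕ (# 2 ⊕ # 3 ⊕ # 4) ⊕ # 5 ⊕ # 6)
            (# 5 ⊕ (# 6 ⊕ # 3 ⊕ # 4) ⊕ # 0 ⊕ # 1 ⊕ # 2)) , Odd-rotate (Odd-rotate (edge-apex (f a∈) (≁-sym n) (≁-sym ma)))

    module Final
      (Ns : List Mix) {l : ℕ} (Ps : Fin l → Pur)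
      (decomp : flat ts ↭ flat (map mtri Ns) ++
                          tabulate (Pur.p ∘ Ps) ++ tabulate (Pur.q ∘ Ps) ++ tabulate (Pur.o ∘ Ps))
      (count  : length ts ≡ length Ns + l)
      where

      p q o : Fin l → V
      p = Pur.p ∘ Ps
      q = Pur.q ∘ Ps
      o = Pur.o ∘ Ps

      side : Fin l → Side
      side = Pur.s ∘ Ps

      triples : (Fin l → V) → (Fin l → V) → List Triple
      triples q′ o′ = tabulate (λ i → p i , q′ i , o′ i)

      flat-triples : ∀ {n} (p q o : Fin n → V) →
        flat (tabulate (λ i → p i , q i , o i)) ↭ tabulate p ++ tabulate q ++ tabulate o
      flat-triples {zero}  p q o = refl
      flat-triples {suc n} p q o =
        trans (++⁺ˡ (p zero ∷ q zero ∷ o zero ∷ []) (flat-triples (p ∘ suc) (q ∘ suc) (o ∘ suc)))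
          (rearrange _ _ _)
        where
        rearrange : ∀ ps qs os → p zero ∷ q zero ∷ o zero ∷ ps ++ qs ++ os ↭
                    (p zero ∷ ps) ++ (q zero ∷ qs) ++ (o zero ∷ os)
        rearrange ps qs os =
            permute ([ _ ] ∷ [ _ ] ∷ [ _ ] ∷ ps ∷ qs ∷ os ∷ [])
              (# 0 ⊕ # 1 ⊕ # 2 ⊕ # 3 ⊕ # 4 ⊕ # 5)
              (# 0 ⊕ # 3 ⊕ # 1 ⊕ # 4 ⊕ # 2 ⊕ # 5)

      -- Replaces the mixed triples us and all pure triples at once.
      rebuild : ∀ {us Ns′ q′ o′} W rest → Ns ↭ us ++ Ns′ → length W ≡ suc (length us) → All Odd W →
        (∀ i → Odd (p i , q′ i , o′ i)) →
        flat W ++ tabulate q′ ++ tabulate o′ ++ rest ↭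
          flat (map mtri us) ++ tabulate q ++ tabulate o ++ Fr → ⊥
      rebuild {us} {Ns′} {q′} {o′} W rest π len oW oP r =
        stuck (W ++ map mtri Ns′ ++ triples q′ o′) rest lengths
          (AllP.++⁺ oW (AllP.++⁺ (AllP.map⁺ (All.universal isOdd Ns′)) (AllP.tabulate⁺ oP)))
          (lin (flat-++ W (map mtri Ns′ ++ triples q′ o′)) (lin (flat-++ (map mtri Ns′) (triples q′ o′))
            (lin (flat-triples p q′ o′) (lin r (lin (↭-sym decomp)
              (lin (↭-sym (flat-↭ (↭-map mtri π)))
                (lin (↭-sym (trans (↭-reflexive (cong flat (map-++ mtri us Ns′))) (flat-++ (map mtri us) (map mtri Ns′))))
                    (permute ((flat (W ++ map mtri Ns′ ++ triples q′ o′)) ∷ rest ∷ (flat W) ∷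
                      (flat (map mtri Ns′ ++ triples q′ o′)) ∷ (flat (map mtri Ns′)) ∷
                      (flat (triples q′ o′)) ∷ (tabulate p) ∷ (tabulate q′) ∷ (tabulate o′) ∷
                      (flat (map mtri us)) ∷ (tabulate q) ∷ (tabulate o) ∷ [ _ ] ∷ [ _ ] ∷ A′ ∷
                      [ _ ] ∷ B′ ∷ (flat ts) ∷ (flat (map mtri Ns)) ∷
                      (flat (map mtri (us ++ Ns′))) ∷ [])
                      ((((((((# 0 ⊕ # 1) ⊕ # 2 ⊕ # 3) ⊕ # 4 ⊕ # 5) ⊕ # 6 ⊕ # 7 ⊕ # 8) ⊕ # 9 ⊕ # 10 ⊕
                      # 11 ⊕ # 12 ⊕ # 13 ⊕ # 14 ⊕ # 15 ⊕ # 16) ⊕ # 17) ⊕ # 18) ⊕ # 19)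
                      ((((((((# 17 ⊕ # 12 ⊕ # 13 ⊕ # 14 ⊕ # 15 ⊕ # 16) ⊕ # 0) ⊕ # 3) ⊕ # 5) ⊕ # 2 ⊕
                      # 7 ⊕ # 8 ⊕ # 1) ⊕ # 18 ⊕ # 6 ⊕ # 10 ⊕ # 11) ⊕ # 19) ⊕ # 9 ⊕ # 4)))))))))
        where
        open ≡-Reasoning
        lengths : length (W ++ map mtri Ns′ ++ triples q′ o′) ≡ suc (length ts)
        lengths = begin
          length (W ++ map mtri Ns′ ++ triples q′ o′)
            ≡⟨ length-++ W ⟩
          length W + length (map mtri Ns′ ++ triples q′ o′)
            ≡⟨ cong₂ _+_ len (≡-trans (length-++ (map mtri Ns′)) (cong₂ _+_ (length-map mtri Ns′) (length-tabulate _))) ⟩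
          suc (length us + (length Ns′ + l))
            ≡⟨ cong suc (≡-sym (+-assoc (length us) (length Ns′) l)) ⟩
          suc (length us + length Ns′ + l)
            ≡⟨ cong (λ n → suc (n + l)) (≡-sym (≡-trans (↭-length π) (length-++ us))) ⟩
          suc (length Ns + l)
            ≡⟨ cong suc (≡-sym count) ⟩
          suc (length ts) ∎

      pure-odd : ∀ i → Odd (p i , q i , o i)
      pure-odd i = Pur.isOdd (Ps i)

      -- N′ lists the vertices of N in another order.
      record Orient (N N′ : Mix) : Set where
        constructor oriented
        field
          vertices : m N ∷ y N ∷ y′ N ∷ [] ↭ m N′ ∷ y N′ ∷ y′ N′ ∷ []
      open Orient using (vertices)

      -- Otherwise the two full vertices form an odd triple with any leftover vertex, and `m` forms
      -- another with a leftover edge that it misses.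
      opposite-adjacent : ∀ {N N′ Ns′} → Ns ↭ N ∷ Ns′ → Orient N N′ → s N′ ≡ α → s′ N′ ≡ β → y N′ ~ y′ N′
      opposite-adjacent {N′ = mix m y y′ _ _ o ((a , [] , pA , ma) , _) f f′} π or refl refl with () ← ↭-length pA
      opposite-adjacent {N} {mix m y y′ _ _ o ((a , f₀ ∷ A₁ , pA , ma) , (b , B₁ , pB , mb)) f f′} π or refl refl =
        ¬≁⇒~ λ n → rebuild {us = N ∷ []} ((y , y′ , f₀) ∷ (a , b , m) ∷ []) (A₁ ++ B₁) π refl
          (odd-opposite f f′ n (A⊆Fr (∈-resp-↭ (↭-sym pA) (there (here refl)))) ∷
           edge-apex (bip (∈-resp-↭ (↭-sym pA) (here refl)) (∈-resp-↭ (↭-sym pB) (here refl))) (≁-sym ma) (≁-sym mb) ∷ [])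
          pure-odd
          (lin (↭-sym (vertices or)) (lin (↭-sym pA) (lin (↭-sym pB)
              (permute ([ _ ] ∷ [ _ ] ∷ [ _ ] ∷ [ _ ] ∷ [ _ ] ∷ [ _ ] ∷ (tabulate q) ∷
                (tabulate (Pur.o ∘ Ps)) ∷ A₁ ∷ B₁ ∷ [ _ ] ∷ [ _ ] ∷ [ _ ] ∷ [ _ ] ∷ [ _ ] ∷ A′ ∷
                [ _ ] ∷ B′ ∷ [])
                (# 0 ⊕ # 1 ⊕ # 2 ⊕ # 3 ⊕ # 4 ⊕ # 5 ⊕ (((# 6 ⊕ # 7 ⊕ # 8 ⊕ # 9) ⊕ # 10 ⊕ # 11 ⊕
                # 12) ⊕ # 13 ⊕ # 14 ⊕ # 15) ⊕ # 16 ⊕ # 17)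
                (# 10 ⊕ # 11 ⊕ # 12 ⊕ (((# 6 ⊕ # 7 ⊕ # 13 ⊕ # 14 ⊕ # 15 ⊕ # 16 ⊕ # 17) ⊕ # 5 ⊕ # 0 ⊕
                # 1) ⊕ # 3 ⊕ # 2 ⊕ # 8) ⊕ # 4 ⊕ # 9)))))

      isα : Side → Bool
      isα α = true
      isα β = false

      ~A : ∀ {σ x a} → Full σ x → a ∈ₗ A → h x a ≡ not (isα σ)
      ~A {α} f i = α≁A f i
      ~A {β} f i = f i

      ~B : ∀ {σ x b} → Full σ x → b ∈ₗ B → h x b ≡ isα σ
      ~B {α} f i = f i
      ~B {β} f i = β≁B f i

      orient-adj : ∀ {N} N′ → N ∈ₗ Ns → Orient N N′ → h (y N′) (y′ N′) ≡ isα (s N′) xor isα (s′ N′)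
      orient-adj N i or with s N in e | s′ N in e′
      ... | α | α = same-side α (subst (λ σ → Full σ (y N)) e (y-full N)) (subst (λ σ → Full σ (y′ N)) e′ (y′-full N))
      ... | β | β = same-side β (subst (λ σ → Full σ (y N)) e (y-full N)) (subst (λ σ → Full σ (y′ N)) e′ (y′-full N))
      ... | α | β = opposite-adjacent (proj₂ (∈⇒↭ i)) or e e′
      ... | β | α = ~-sym (opposite-adjacent {N′ = flip N} (proj₂ (∈⇒↭ i)) (oriented (trans (vertices or) ↭₁₃₂)) e′ e)

      -- `y` and `y′` are adjacent exactly when their sides differ, that is, when exactly one of
      -- them sees `f`. Adding this to the parity of the triple shows that exactly one of `y`, `y′`
      -- is odd with `m` and `f`.
      complementary : ∀ {N N′ f} → N ∈ₗ Ns → Orient N N′ → f ∈ₗ Fr →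
                      odd (m N′) (y N′) f ≡ not (odd (m N′) (y′ N′) f)
      complementary {N′ = N} {f} i or f∈ = algebra (h (m N) (y N)) (h (m N) (y′ N)) (h (y N) (y′ N))
        (h (m N) f) (h (y N) f) (h (y′ N) f) (isOdd N) (trans-adj (∈Fr f∈))
        where
        algebra : ∀ a b c d e k → a xor (b xor c) ≡ true → c ≡ e xor k → a xor (d xor e) ≡ not (b xor (d xor k))
        algebra true  true  true  true  true  false p refl = refl
        algebra true  true  true  true  false true  p refl = refl
        algebra true  true  true  false true  false p refl = refl
        algebra true  true  true  false false true  p refl = refl
        algebra true  false false true  true  true  p refl = refl
        algebra true  false false true  false false p refl = refl
        algebra true  false false false true  true  p refl = refl
        algebra true  false false false false false p refl = refl
        algebra false true  false true  true  true  p refl = refl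
        algebra false true  false true  false false p refl = refl
        algebra false true  false false true  true  p refl = refl
        algebra false true  false false false false p refl = refl
        algebra false false true  true  true  false p refl = refl
        algebra false false true  true  false true  p refl = refl
        algebra false false true  false true  false p refl = refl
        algebra false false true  false false true  p refl = refl
        sides : ∀ σ τ → isα σ xor isα τ ≡ not (isα σ) xor not (isα τ)
        sides α α = refl
        sides α β = refl
        sides β α = refl
        sides β β = refl
        trans-adj : f ∈ₗ A ⊎ f ∈ₗ B → h (y N) (y′ N) ≡ h (y N) f xor h (y′ N) f
        trans-adj (inj₁ j) = ≡-trans (orient-adj N i or)
          (≡-trans (sides (s N) (s′ N)) (≡-sym (cong₂ _xor_ (~A (y-full N) j) (~A (y′-full N) j))))
        trans-adj (inj₂ j) = ≡-trans (orient-adj N i or)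
          (≡-sym (cong₂ _xor_ (~B (y-full N) j) (~B (y′-full N) j)))

      -- Full vertices that a triple can give up: a leftover vertex completes its other two vertices
      -- again. They are the ends of augmenting paths.
      data Exposed (σ : Side) : V → Set where
        ofMix  : ∀ {N} N′ → N ∈ₗ Ns → N′ ≡ N ⊎ N′ ≡ flip N → s N′ ≡ σ → Exposed σ (y N′)
        ofPure : ∀ i → side i ≡ σ → Exposed σ (o i)

      exposed-full : ∀ {σ v} → Exposed σ v → Full σ v
      exposed-full (ofMix N′ _ _ refl) = y-full N′
      exposed-full (ofPure i refl)     = Pur.o-full (Ps i)

      -- The conditions under which `x` can replace `q i` and keep the triple odd. If `o i` is on
      -- side `β`, the edge of the triple runs from `q i` to `o i`, so `x` must see `o i` too.
      Valid : Fin l → V → Set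
      Valid i x = Full α x × x ≁ p i × (side i ≡ β → x ~ o i)

      apex-on : ∀ i → (side i ≡ α × p i ~ o i) ⊎ (side i ≡ β × q i ~ o i × p i ≁ o i)
      apex-on i with Ps i
      ... | pur p q o α od fp fq n fo with Odd-third od n
      ...   | inj₁ (e , _) = inj₁ (refl , e)
      ...   | inj₂ (e , _) = ⊥-elim (~⇒¬≁ e (same-side α fq fo))
      apex-on i | pur p q o β od fp fq n fo with Odd-third od n
      ...   | inj₁ (e , _) = ⊥-elim (~⇒¬≁ e (same-side β fp fo))
      ...   | inj₂ (e , n′) = inj₂ (refl , e , n′)

      valid-odd : ∀ i {x} → Valid i x → Odd (p i , x , o i)
      valid-odd i (fx , n , k) with apex-on i
      ... | inj₁ (e , po) =
        Odd-swap (Odd-rotate (Odd-rotate (edge-apex po (≁-sym n)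
          (same-side α (subst (λ σ → Full σ (o i)) e (Pur.o-full (Ps i))) fx))))
      ... | inj₂ (e , _ , po) = Odd-rotate (Odd-rotate (edge-apex (k e) n (≁-sym po)))

      valid₀ : ∀ i → Valid i (q i)
      valid₀ i with apex-on i
      ... | inj₁ (e , _)     = Pur.q-full (Ps i) , ≁-sym (Pur.p≁q (Ps i)) , λ e′ → case ≡-trans (≡-sym e) e′ of λ ()
      ... | inj₂ (_ , e , _) = Pur.q-full (Ps i) , ≁-sym (Pur.p≁q (Ps i)) , λ _ → e

      other-two : ∀ {f F} → Fr ↭ f ∷ F → ∃ λ f₁ → ∃ λ f₂ → ∃ λ F′ → F ≡ f₁ ∷ f₂ ∷ F′
      other-two {F = f₁ ∷ f₂ ∷ F′} _ = f₁ , f₂ , F′ , refl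
      other-two {F = f₁ ∷ []} π with () ← ≡-trans (≡-sym (↭-length π)) (≡-trans (cong (2 +_) (length-++ A′)) (cong (2 +_) (+-suc (length A′) (length B′))))
      other-two {F = []} π with () ← ↭-length π

      opposite-at : ∀ {a b f F} → Fr ↭ F → f ∈ₗ F → Full α a → Full β b → a ≁ b → Odd (a , b , f)
      opposite-at π i fa fb n = odd-opposite fa fb n (∈-resp-↭ (↭-sym π) i)

      record Tied (N : Mix) (f : V) (F : List V) : Set where
        constructor tied
        field
          at-f  : Odd (m N , y′ N , f)
          off-f : ∀ {x} → x ∈ₗ F → odd (m N) (y′ N) x ≡ false

      flipped-at : ∀ {N N′ f F} → N ∈ₗ Ns → Orient N N′ → Fr ↭ f ∷ F → Tied N′ f F → odd (m N′) (y N′) f ≡ false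
      flipped-at i or π (tied e _) = ≡-trans (complementary i or (∈-resp-↭ (↭-sym π) (here refl))) (cong not e)

      flipped-off : ∀ {N N′ f F x} → N ∈ₗ Ns → Orient N N′ → Fr ↭ f ∷ F → Tied N′ f F → x ∈ₗ F → Odd (m N′ , y N′ , x)
      flipped-off i or π (tied _ n) j = ≡-trans (complementary i or (∈-resp-↭ (↭-sym π) (there j))) (cong not (n j))

      -- If the repair of a mixed triple depends on the single leftover vertex f, then no other
      -- leftover vertex lies on the side of f whenever y is complete to that side.
      lonely : ∀ {N N′ f F p q₀} → N ∈ₗ Ns → Orient N N′ → Fr ↭ f ∷ F → Tied N′ f F →
               y N′ ~ f → y N′ ~ p → y N′ ≁ q₀ → p ∈ₗ F → q₀ ∈ₗ F → f ~ q₀ → ⊥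
      lonely {N′ = N} {f} {p = p} {q₀} i or π t yf yp yq p∈ q∈ fq with ~∨≁ (m N) (y N)
      ... | inj₁ my = htf my
        (parity {y N} {m N} {p} (≡-trans (odd-swap (m N) (y N) p) (flipped-off i or π t p∈)) (~-sym my) yp)
        yp
      ... | inj₂ my = htf
        (parity {y N} {m N} {q₀} (≡-trans (odd-swap (m N) (y N) q₀) (flipped-off i or π t q∈)) (≁-sym my) yq)
        (parity {y N} {m N} {f} (≡-trans (odd-swap (m N) (y N) f) (flipped-at i or π t)) (≁-sym my) yf)
        (~-sym fq)

      All~g⇒Independent : ∀ {C} → All (_~ g) C → Independent C
      All~g⇒Independent a i j = common⇒≁ (~-sym (All.lookup a i)) (~-sym (All.lookup a j))

      g∈B : g ∈ₗ B
      g∈B = here refl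

      -- One neighbour of `g` is taken from each triple; they will extend `A` to an independent set.
      αs : ∀ ns → (∀ {N} → N ∈ₗ ns → (isα (s N) ∨ isα (s′ N)) ≡ true) →
           ∃ λ as → ∃ λ rs → flat (map mtri ns) ↭ as ++ rs × length as ≡ length ns × All (_~ g) as
      αs [] n = [] , [] , refl , refl , []
      αs (N ∷ ns) n with αs ns (n ∘ there) | s N in e | s′ N in e′ | n (here refl)
      ... | as , rs , π , len , al | α | _ | _ =
        y N ∷ as , m N ∷ y′ N ∷ rs , lin π
            (permute ([ _ ] ∷ [ _ ] ∷ [ _ ] ∷ (flat (map mtri ns)) ∷ as ∷ rs ∷ [])
              (# 0 ⊕ # 1 ⊕ # 2 ⊕ # 3 ⊕ # 4 ⊕ # 5)
              (# 1 ⊕ (# 4 ⊕ # 0 ⊕ # 2 ⊕ # 5) ⊕ # 3)) , cong suc len , subst (λ σ → Full σ (y N)) e (y-full N) g∈B ∷ al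
      ... | as , rs , π , len , al | β | α | _ =
        y′ N ∷ as , m N ∷ y N ∷ rs , lin π
            (permute ([ _ ] ∷ [ _ ] ∷ [ _ ] ∷ (flat (map mtri ns)) ∷ as ∷ rs ∷ [])
              (# 0 ⊕ # 1 ⊕ # 2 ⊕ # 3 ⊕ # 4 ⊕ # 5)
              (# 2 ⊕ (# 4 ⊕ # 0 ⊕ # 1 ⊕ # 5) ⊕ # 3)) , cong suc len , subst (λ σ → Full σ (y′ N)) e′ (y′-full N) g∈B ∷ al

      record SplitPair (N : Mix) : Set where
        constructor splitPair
        field
          N′   : Mix
          or   : Orient N N′
          sβ   : s N′ ≡ β
          sβ′  : s′ N′ ≡ β
          m~y  : m N′ ~ y N′
          m≁y′ : m N′ ≁ y′ N′

      splitβ : ∀ N → s N ≡ β → s′ N ≡ β → SplitPair N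
      splitβ N@(mix m y y′ β β o n f f′) refl refl with Odd-third (Odd-rotate o) (same-side β f f′)
      ... | inj₁ (e , n′) = splitPair N (oriented refl) refl refl (~-sym e) (≁-sym n′)
      ... | inj₂ (e , n′) = splitPair (flip N) (oriented ↭₁₃₂) refl refl (~-sym e) (≁-sym n′)

      -- The configuration forced on a triple with an `α` vertex `y` that, over a star, can be
      -- repaired only by the centre: both full vertices are on side `α`, and `m` sees `y` and
      -- nothing of the leftover.
      record Anchor (N : Mix) : Set where
        constructor anchor
        field
          m~y   : m N ~ y N
          m≁y′  : m N ≁ y′ N
          m≁A   : ∀ {a} → a ∈ₗ A → m N ≁ a
          m≁g   : m N ≁ g
          y≁A   : ∀ {a} → a ∈ₗ A → y N ≁ a
          y~g   : y N ~ g
          y′≁A  : ∀ {a} → a ∈ₗ A → y′ N ≁ a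
          y′~g  : y′ N ~ g

      anchored : ∀ {N N′ F} → N ∈ₗ Ns → Orient N N′ → s N′ ≡ α → Fr ↭ g ∷ F → (∀ {a} → a ∈ₗ A → a ∈ₗ F) →
                 Tied N′ g F → Anchor N′
      anchored {N} {N′} {F} i or eα π A⊆F t = go (s′ N′) refl
        where
        yα : Full α (y N′)
        yα = subst (λ σ → Full σ (y N′)) eα (y-full N′)
        flip-m : ∀ x → odd (y N′) (m N′) x ≡ odd (m N′) (y N′) x
        flip-m x = odd-swap (m N′) (y N′) x
        m~y : m N′ ~ y N′
        m~y = ¬≁⇒~ λ n → htf
          (parity {y N′} {m N′} {g} (≡-trans (flip-m g) (flipped-at i or π t)) (≁-sym n) (yα g∈B))
          (parity {y N′} {m N′} {a₀} (≡-trans (flip-m a₀) (flipped-off i or π t (A⊆F (here refl)))) (≁-sym n) (α≁A yα (here refl)))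
          (~-sym (bip (here refl) g∈B))
        m≁A : ∀ {a} → a ∈ₗ A → m N′ ≁ a
        m≁A {a} j = parity {y N′} {m N′} {a} (≡-trans (flip-m a) (flipped-off i or π t (A⊆F j))) (~-sym m~y) (α≁A yα j)
        go : ∀ σ → s′ N′ ≡ σ → Anchor N′
        go β e′ = ⊥-elim (htf m~y
          (parity {y N′} {m N′} {y′ N′} (≡-trans (flip-m (y′ N′)) (isOdd N′)) (~-sym m~y) yy′) yy′)
          where
          yy′ : y N′ ~ y′ N′
          yy′ = ≡-trans (orient-adj N′ i or) (cong₂ (λ σ τ → isα σ xor isα τ) eα e′)
        go α e′ = anchor m~y
          (parity {y N′} {m N′} {y′ N′} (≡-trans (flip-m (y′ N′)) (isOdd N′)) (~-sym m~y) (same-side α yα y′α))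
          m≁A (common⇒≁ (~-sym m~y) (yα g∈B)) (α≁A yα) (yα g∈B) (α≁A y′α) (y′α g∈B)
          where
          y′α : Full α (y′ N′)
          y′α = subst (λ σ → Full σ (y′ N′)) e′ (y′-full N′)

      βA : ∀ {x σ} → σ ≡ β → Full σ x → ∀ {a} → a ∈ₗ A → x ~ a
      βA refl f = f

      βg : ∀ {x σ} → σ ≡ β → Full σ x → x ≁ g
      βg refl f = β≁B f g∈B

      m≁g-star : ∀ N → B′ ≡ [] → m N ≁ g
      m≁g-star N star with proj₂ (m-nf N)
      ... | b , _ , p , n with ∈-resp-↭ (trans (↭-sym p) (↭-reflexive (cong (g ∷_) star))) (here refl)
      ...   | here refl = n

      -- The vertex d of a split pair can repair an anchored triple.
      anchor-repair : ∀ {N₁ N₁′ N Ns″} → B′ ≡ [] → Ns ↭ N₁ ∷ N ∷ Ns″ → Orient N₁ N₁′ → Anchor N₁′ →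
                      ∀ N′ → Orient N N′ → s N′ ≡ β → s′ N′ ≡ β → m N′ ~ y N′ → m N′ ≁ y′ N′ →
                      Odd (m N₁′ , y′ N₁′ , y N′)
      anchor-repair {N₁} {N₁′} {N} refl π or₁ (anchor m~y m≁y′ m≁A m≁g y≁A y~g y′≁A y′~g) N′ or eβ eβ′ m~d m≁w =
        Odd-rotate (Odd-rotate (edge-apex y′~d (≁-sym m≁y′) (≁-sym m≁d)))
        where
        d~A = βA eβ (y-full N′)
        w~A = βA eβ′ (y′-full N′)
        d≁g = βg eβ (y-full N′)
        m′≁A : ∀ {a} → a ∈ₗ A → m N′ ≁ a
        m′≁A j = common⇒≁ (~-sym m~d) (d~A j)
        wOdd : Odd (y′ N′ , a₁ , m N′)
        wOdd = edge-apex (w~A (there (here refl))) (≁-sym m≁w) (≁-sym (m′≁A (there (here refl))))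
        y′~d : y′ N₁′ ~ y N′
        y′~d = ¬≁⇒~ λ n → rebuild {us = N₁ ∷ N ∷ []}
          ((y′ N₁′ , g , y N′) ∷ (m N₁′ , y N₁′ , a₀) ∷ (y′ N′ , a₁ , m N′) ∷ []) A′ π refl
          (edge-apex y′~g n (≁-sym d≁g) ∷ edge-apex m~y (m≁A (here refl)) (y≁A (here refl)) ∷ wOdd ∷ [])
          pure-odd (lin (↭-sym (vertices or₁)) (lin (↭-sym (vertices or))
              (permute ([ _ ] ∷ [ _ ] ∷ [ _ ] ∷ [ _ ] ∷ [ _ ] ∷ [ _ ] ∷ [ _ ] ∷ [ _ ] ∷ [ _ ] ∷
                (tabulate q) ∷ (tabulate o) ∷ A′ ∷ [ _ ] ∷ [ _ ] ∷ [ _ ] ∷ [ _ ] ∷ [ _ ] ∷ [ _ ] ∷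
                [])
                (# 0 ⊕ # 1 ⊕ # 2 ⊕ # 3 ⊕ # 4 ⊕ # 5 ⊕ # 6 ⊕ # 7 ⊕ # 8 ⊕ ((# 9 ⊕ # 10 ⊕ # 11) ⊕ # 12 ⊕
                # 13 ⊕ # 14) ⊕ # 15 ⊕ # 16 ⊕ # 17)
                (# 12 ⊕ # 13 ⊕ # 14 ⊕ # 15 ⊕ # 16 ⊕ # 17 ⊕ ((# 9 ⊕ # 10 ⊕ # 5 ⊕ # 7 ⊕ # 11 ⊕ # 1) ⊕
                # 3 ⊕ # 4 ⊕ # 0) ⊕ # 8 ⊕ # 2 ⊕ # 6))))
        m≁d : m N₁′ ≁ y N′
        m≁d = ¬~⇒≁ λ e → rebuild {us = N₁ ∷ N ∷ []}
          ((y N′ , a₀ , y N₁′) ∷ (y′ N₁′ , g , m N₁′) ∷ (y′ N′ , a₁ , m N′) ∷ []) A′ π refl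
          (edge-apex (d~A (here refl)) (common⇒≁ e m~y) (≁-sym (y≁A (here refl))) ∷
           edge-apex y′~g (≁-sym m≁y′) (≁-sym m≁g) ∷ wOdd ∷ [])
          pure-odd (lin (↭-sym (vertices or₁)) (lin (↭-sym (vertices or))
              (permute ([ _ ] ∷ [ _ ] ∷ [ _ ] ∷ [ _ ] ∷ [ _ ] ∷ [ _ ] ∷ [ _ ] ∷ [ _ ] ∷ [ _ ] ∷
                (tabulate q) ∷ (tabulate o) ∷ A′ ∷ [ _ ] ∷ [ _ ] ∷ [ _ ] ∷ [ _ ] ∷ [ _ ] ∷ [ _ ] ∷
                [])
                (# 0 ⊕ # 1 ⊕ # 2 ⊕ # 3 ⊕ # 4 ⊕ # 5 ⊕ # 6 ⊕ # 7 ⊕ # 8 ⊕ ((# 9 ⊕ # 10 ⊕ # 11) ⊕ # 12 ⊕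
                # 13 ⊕ # 14) ⊕ # 15 ⊕ # 16 ⊕ # 17)
                (# 12 ⊕ # 13 ⊕ # 14 ⊕ # 15 ⊕ # 16 ⊕ # 17 ⊕ ((# 9 ⊕ # 10 ⊕ # 1 ⊕ # 7 ⊕ # 11 ⊕ # 4) ⊕
                # 5 ⊕ # 2 ⊕ # 3) ⊕ # 8 ⊕ # 0 ⊕ # 6))))

      findMix : ∀ ns → (∃ λ N → ∃ λ ns′ → ns ↭ N ∷ ns′ × s N ≡ β × s′ N ≡ β) ⊎
                       (∀ {N} → N ∈ₗ ns → (isα (s N) ∨ isα (s′ N)) ≡ true)
      findMix ns with find? (λ N → not (isα (s N) ∨ isα (s′ N))) ns
      ... | inj₂ none = inj₂ (λ i → not-injective (none i))
      ... | inj₁ (N , ns′ , π , e) = go (s N) (s′ N) refl refl e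
        where
        go : ∀ σ τ → s N ≡ σ → s′ N ≡ τ → not (isα σ ∨ isα τ) ≡ true → _
        go β β e₁ e₂ _ = inj₁ (N , ns′ , π , e₁ , e₂)

      -- There are `2 + n + l` triples, and they supply one vertex more than that to the independent
      -- set around `A`.
      odd-arith : ∀ a n l → a + (3 + n + l) + 2 * suc (2 + n + l) ≤ suc (3 * (2 + n + l) + (a + 1)) → ⊥
      odd-arith a n l b = m+1+n≰m (suc (3 * (2 + n + l) + (a + 1))) {0} (≤-trans (≤-reflexive eq) b)
        where
        eq : suc (3 * (2 + n + l) + (a + 1)) + 1 ≡ a + (3 + n + l) + 2 * suc (2 + n + l)
        eq = identity a n l
          where
          identity : ∀ a n l → suc (3 * (2 + n + l) + (a + 1)) + 1 ≡ a + (3 + n + l) + 2 * suc (2 + n + l)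
          identity = solve-∀

      module Clash (αbound : IndependentBound (suc (length ts)) (flat ts ++ Fr)) {z a : V} (q′ : Fin l → V)
        (path : a ∷ tabulate q′ ↭ z ∷ tabulate q) (v : ∀ i → Valid i (q′ i)) (aα : Full α a) where

        -- Both triples compete for `g`. A mixed triple with two `β` vertices, either `N₂` or a
        -- further one, can lend a vertex to the anchored triple and live on a star vertex. If there
        -- is none, every triple contains a neighbour of `g` and `N₁` contains two, and with `A`
        -- these violate the independence bound.
        stuck-star : ∀ {N₁ N₂ N₁′ N₂′ Ns″} → B′ ≡ [] → Ns ↭ N₁ ∷ N₂ ∷ Ns″ → Orient N₁ N₁′ → Orient N₂ N₂′ →
                     z ≡ y N₁′ → s N₂′ ≡ β → Anchor N₁′ → Odd (m N₂′ , y′ N₂′ , g) → a ≁ y N₂′ → ⊥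
        stuck-star {N₁} {N₂} {N₁′} {N₂′} {Ns″} refl π or₁ or₂ refl eb an o₂ n with s′ N₂′ in eb′
        ... | β with Odd-third (Odd-rotate o₂) (βg eb′ (y′-full N₂′))
        ...   | inj₂ (gm , _) = ~⇒¬≁ (~-sym gm) (m≁g-star N₂′ refl)
        ...   | inj₁ (ym , _) with Odd-third (Odd-rotate (isOdd N₂′)) (same-side β (βfull eb (y-full N₂′)) (βfull eb′ (y′-full N₂′)))
          where
          βfull : ∀ {x σ} → σ ≡ β → Full σ x → Full β x
          βfull refl f = f
        ...     | inj₁ (_ , n′) = ~⇒¬≁ ym n′
        ...     | inj₂ (_ , n′) =
          rebuild {us = N₁ ∷ N₂ ∷ []}
            ((a , y N₂′ , a₁) ∷ (m N₁′ , y′ N₁′ , y′ N₂′) ∷ (g , a₀ , m N₂′) ∷ []) A′ π refl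
            (odd-opposite aα (βA eb (y-full N₂′)) n (A⊆Fr (there (here refl))) ∷
             anchor-repair refl π or₁ an (flip N₂′) (oriented (trans (vertices or₂) ↭₁₃₂)) eb′ eb (~-sym ym) (≁-sym n′) ∷
             edge-apex (~-sym (bip (here refl) (here refl))) (≁-sym (m≁g-star N₂′ refl))
               (common⇒≁ (βA eb′ (y′-full N₂′) (here refl)) ym) ∷ [])
            (λ i → valid-odd i (v i))
            (lin (↭-sym (vertices or₁)) (lin (↭-sym (vertices or₂)) (lin path
                (permute ([ _ ] ∷ [ _ ] ∷ [ _ ] ∷ [ _ ] ∷ [ _ ] ∷ [ _ ] ∷ [ _ ] ∷ [ _ ] ∷ [ _ ] ∷
                  (tabulate q′) ∷ (tabulate o) ∷ A′ ∷ [ _ ] ∷ [ _ ] ∷ [ _ ] ∷ [ _ ] ∷ [ _ ] ∷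
                  [ _ ] ∷ [ _ ] ∷ (tabulate q) ∷ [])
                  (# 0 ⊕ # 1 ⊕ # 2 ⊕ # 3 ⊕ # 4 ⊕ # 5 ⊕ # 6 ⊕ # 7 ⊕ # 8 ⊕ (((# 9 ⊕ # 10 ⊕ # 11) ⊕
                  # 12 ⊕ # 13 ⊕ # 14) ⊕ # 15 ⊕ # 16 ⊕ # 17) ⊕ # 18 ⊕ # 19)
                  (# 12 ⊕ # 13 ⊕ # 14 ⊕ # 15 ⊕ # 16 ⊕ # 17 ⊕ (((# 19 ⊕ # 10 ⊕ # 7 ⊕ # 2 ⊕ # 11 ⊕
                  # 6) ⊕ # 3 ⊕ # 18 ⊕ # 4) ⊕ # 8 ⊕ # 1 ⊕ # 5) ⊕ # 0 ⊕ # 9)))))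
        stuck-star {N₁} {N₂} {N₁′} {N₂′} {Ns″} refl π or₁ or₂ refl eb an o₂ n | α with findMix Ns″
        ... | inj₁ (N , Ns‴ , π′ , e , e′) with splitβ N e e′
        ...   | splitPair N′ or sβ sβ′ m~d m≁w =
          rebuild {us = N₁ ∷ N₂ ∷ N ∷ []} {Ns‴}
            ((a , y N₂′ , a₁) ∷ (m N₁′ , y′ N₁′ , y N′) ∷ (y′ N′ , a₀ , m N′) ∷ (m N₂′ , y′ N₂′ , g) ∷ []) A′
            (lin π (lin π′
                (permute (Ns ∷ [ _ ] ∷ [ _ ] ∷ Ns″ ∷ [ _ ] ∷ Ns‴ ∷ [])
                  ((# 0 ⊕ # 1 ⊕ # 2 ⊕ # 3) ⊕ # 4 ⊕ # 5)
                  (# 1 ⊕ # 2 ⊕ # 4 ⊕ (# 5 ⊕ # 0) ⊕ # 3)))) refl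
            (odd-opposite aα (βA eb (y-full N₂′)) n (A⊆Fr (there (here refl))) ∷
             anchor-repair {Ns″ = N₂ ∷ Ns‴} refl (lin π (lin π′
                 (permute (Ns ∷ [ _ ] ∷ [ _ ] ∷ Ns″ ∷ [ _ ] ∷ Ns‴ ∷ [])
                   ((# 0 ⊕ # 1 ⊕ # 2 ⊕ # 3) ⊕ # 4 ⊕ # 5)
                   (# 1 ⊕ # 4 ⊕ # 2 ⊕ (# 5 ⊕ # 0) ⊕ # 3)))) or₁ an N′ or sβ sβ′ m~d m≁w ∷
             edge-apex (βA sβ′ (y′-full N′) (here refl)) (≁-sym m≁w)
               (common⇒≁ (βA sβ (y-full N′) (here refl)) (~-sym m~d)) ∷ o₂ ∷ [])
            (λ i → valid-odd i (v i))
            (lin (↭-sym (vertices or₁)) (lin (↭-sym (vertices or₂)) (lin (↭-sym (vertices or)) (lin path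
                (permute ([ _ ] ∷ [ _ ] ∷ [ _ ] ∷ [ _ ] ∷ [ _ ] ∷ [ _ ] ∷ [ _ ] ∷ [ _ ] ∷ [ _ ] ∷
                  [ _ ] ∷ [ _ ] ∷ [ _ ] ∷ (tabulate q′) ∷ (tabulate o) ∷ A′ ∷ [ _ ] ∷ [ _ ] ∷
                  [ _ ] ∷ [ _ ] ∷ [ _ ] ∷ [ _ ] ∷ [ _ ] ∷ [ _ ] ∷ [ _ ] ∷ [ _ ] ∷ (tabulate q) ∷ [])
                  (# 0 ⊕ # 1 ⊕ # 2 ⊕ # 3 ⊕ # 4 ⊕ # 5 ⊕ # 6 ⊕ # 7 ⊕ # 8 ⊕ # 9 ⊕ # 10 ⊕ # 11 ⊕
                  ((((# 12 ⊕ # 13 ⊕ # 14) ⊕ # 15 ⊕ # 16 ⊕ # 17) ⊕ # 18 ⊕ # 19 ⊕ # 20) ⊕ # 21 ⊕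
                  # 22 ⊕ # 23) ⊕ # 24 ⊕ # 25)
                  (# 15 ⊕ # 16 ⊕ # 17 ⊕ # 18 ⊕ # 19 ⊕ # 20 ⊕ # 21 ⊕ # 22 ⊕ # 23 ⊕ ((((# 25 ⊕ # 13 ⊕
                  # 7 ⊕ # 2 ⊕ # 14 ⊕ # 11) ⊕ # 3 ⊕ # 24 ⊕ # 4) ⊕ # 9 ⊕ # 1 ⊕ # 10) ⊕ # 8 ⊕ # 5 ⊕
                  # 6) ⊕ # 0 ⊕ # 12))))))
        stuck-star {N₁} {N₂} {N₁′} {N₂′} {Ns″} refl π or₁ or₂ refl eb an o₂ n | α | inj₂ hasα with αs Ns″ hasα
        ... | as , rs , ρ , len , as~g =
          odd-arith (length A) (length Ns″) l
            (subst (λ t → length A + (3 + length Ns″ + l) + 2 * suc t ≤ suc (3 * t + (length A + 1))) lenTs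
              (subst₂ (λ x y → x + 2 * suc (length ts) ≤ suc y) lenC lenR′
                (αbound C X perm (All~g⇒Independent all~g))))
          where
          C X : List V
          C = A ++ (y N₁′ ∷ y′ N₁′ ∷ y′ N₂′ ∷ as) ++ tabulate q
          X = m N₁′ ∷ m N₂′ ∷ y N₂′ ∷ rs ++ tabulate p ++ tabulate o ++ g ∷ []
          all~g : All (_~ g) C
          all~g = AllP.++⁺ (All.tabulate (λ i → bip i (here refl)))
            (AllP.++⁺ (Anchor.y~g an ∷ Anchor.y′~g an ∷
              subst (λ σ → Full σ (y′ N₂′)) eb′ (y′-full N₂′) (here refl) ∷ as~g)
              (AllP.tabulate⁺ (λ i → Pur.q-full (Ps i) (here refl))))
          perm : C ++ X ↭ flat ts ++ Fr
          perm = lin (↭-sym decomp) (lin (↭-sym (flat-↭ (↭-map mtri π))) (lin (↭-sym (vertices or₁)) (lin (↭-sym (vertices or₂)) (lin (↭-sym ρ)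
              (permute ([ _ ] ∷ [ _ ] ∷ A′ ∷ [ _ ] ∷ [ _ ] ∷ [ _ ] ∷ as ∷ (tabulate q) ∷ [ _ ] ∷
                [ _ ] ∷ [ _ ] ∷ rs ∷ (tabulate p) ∷ (tabulate o) ∷ [ _ ] ∷ (flat ts) ∷
                (flat (map mtri Ns)) ∷ [ _ ] ∷ [ _ ] ∷ [ _ ] ∷ [ _ ] ∷ [ _ ] ∷ [ _ ] ∷
                (flat (map mtri Ns″)) ∷ [])
                (# 0 ⊕ # 1 ⊕ ((((((# 2 ⊕ # 3 ⊕ # 4 ⊕ # 5 ⊕ # 6 ⊕ # 7) ⊕ # 8 ⊕ # 9 ⊕ # 10 ⊕ # 11 ⊕
                # 12 ⊕ # 13 ⊕ # 14) ⊕ # 15) ⊕ # 16) ⊕ # 17 ⊕ # 18 ⊕ # 19) ⊕ # 20 ⊕ # 21 ⊕ # 22) ⊕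
                # 23)
                ((((((# 15 ⊕ # 0 ⊕ # 1 ⊕ # 2 ⊕ # 14) ⊕ # 16 ⊕ # 12 ⊕ # 7 ⊕ # 13) ⊕ # 17 ⊕ # 18 ⊕
                # 19 ⊕ # 20 ⊕ # 21 ⊕ # 22 ⊕ # 23) ⊕ # 8 ⊕ # 3 ⊕ # 4) ⊕ # 9 ⊕ # 10 ⊕ # 5) ⊕ # 6 ⊕
                # 11))))))
          lenTs : length ts ≡ 2 + length Ns″ + l
          lenTs = ≡-trans count (cong (_+ l) (↭-length π))
          lenC : length C ≡ length A + (3 + length Ns″ + l)
          lenC = ≡-trans (length-++ A) (cong (length A +_)
            (≡-trans (cong (3 +_) (length-++ as)) (cong (3 +_) (cong₂ _+_ len (length-tabulate q)))))
          lenR′ : length (flat ts ++ Fr) ≡ 3 * length ts + (length A + 1)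
          lenR′ = ≡-trans (length-++ (flat ts)) (cong₂ _+_ (length-flat ts) (length-++ A))

        lone : ∀ {b} → b ∈ₗ B → b ∷ [] ↭ B → B′ ≡ [] × g ≡ b
        lone i π with ↭-length π | π
        ... | _ | π′ with ↭-singleton-inv (↭-sym π′)
          where open import Data.List.Relation.Binary.Permutation.Propositional.Properties using (↭-singleton-inv)
        ...   | refl = refl , refl

        -- Any leftover vertex completes `a` and the vertex released by `N₂` to a new triple. Two
        -- more leftover vertices have to repair `N₁` and `N₂`, which fails only if both accept the
        -- same single vertex.
        two-mixed : ∀ {N₁ N₂ N₁′ N₂′ Ns″} → Ns ↭ N₁ ∷ N₂ ∷ Ns″ → Orient N₁ N₁′ → Orient N₂ N₂′ →
                    z ≡ y N₁′ → s N₁′ ≡ α → s N₂′ ≡ β → a ≁ y N₂′ → ⊥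
        two-mixed {N₁} {N₂} {N₁′} {N₂′} {Ns″} π or₁ or₂ refl ea eb n = go (repair N₁′)
          where
          yα : Full α (y N₁′)
          yα = subst (λ σ → Full σ (y N₁′)) ea (y-full N₁′)
          yβ : Full β (y N₂′)
          yβ = subst (λ σ → Full σ (y N₂′)) eb (y-full N₂′)
          N₁∈ : N₁ ∈ₗ Ns
          N₁∈ = ∈-resp-↭ (↭-sym π) (here refl)
          N₂∈ : N₂ ∈ₗ Ns
          N₂∈ = ∈-resp-↭ (↭-sym π) (there (here refl))

          finish : ∀ {f₁ f₂ F} → Fr ↭ f₁ ∷ f₂ ∷ F → Odd (m N₁′ , y′ N₁′ , f₁) → Odd (m N₂′ , y′ N₂′ , f₂) → ⊥
          finish {f₁} {f₂} {F} ρ o₁ o₂ with other-two ρ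
          ... | _ , f₀ , F′ , refl =
            rebuild {us = N₁ ∷ N₂ ∷ []} ((a , y N₂′ , f₀) ∷ (m N₁′ , y′ N₁′ , f₁) ∷ (m N₂′ , y′ N₂′ , f₂) ∷ []) F′ π refl
              (opposite-at ρ (there (there (here refl))) aα yβ n ∷ o₁ ∷ o₂ ∷ [])
              (λ i → valid-odd i (v i))
              (lin (↭-sym (vertices or₁)) (lin (↭-sym (vertices or₂)) (lin (↭-sym ρ) (lin path
                  (permute ([ _ ] ∷ [ _ ] ∷ [ _ ] ∷ [ _ ] ∷ [ _ ] ∷ [ _ ] ∷ [ _ ] ∷ [ _ ] ∷ [ _ ] ∷
                    (tabulate q′) ∷ (tabulate o) ∷ F′ ∷ [ _ ] ∷ [ _ ] ∷ [ _ ] ∷ [ _ ] ∷ [ _ ] ∷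
                    [ _ ] ∷ [ _ ] ∷ [ _ ] ∷ A′ ∷ [ _ ] ∷ B′ ∷ [ _ ] ∷ (tabulate q) ∷ [])
                    (# 0 ⊕ # 1 ⊕ # 2 ⊕ # 3 ⊕ # 4 ⊕ # 5 ⊕ # 6 ⊕ # 7 ⊕ # 8 ⊕ ((((# 9 ⊕ # 10 ⊕ # 11) ⊕
                    # 12 ⊕ # 13 ⊕ # 14) ⊕ # 15 ⊕ # 16 ⊕ # 17) ⊕ # 18 ⊕ # 19 ⊕ # 20 ⊕ # 21 ⊕ # 22) ⊕
                    # 23 ⊕ # 24)
                    (# 12 ⊕ # 13 ⊕ # 14 ⊕ # 15 ⊕ # 16 ⊕ # 17 ⊕ ((((# 24 ⊕ # 10 ⊕ # 18 ⊕ # 19 ⊕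
                    # 20 ⊕ # 21 ⊕ # 22) ⊕ # 3 ⊕ # 23 ⊕ # 4) ⊕ # 6 ⊕ # 1 ⊕ # 7) ⊕ # 5 ⊕ # 8 ⊕ # 2 ⊕
                    # 11) ⊕ # 0 ⊕ # 9))))))

          -- For `f` in `A` the full vertex of `N₂` sees the whole side of `f`, for `f` in `B` that
          -- of `N₁` does, and `lonely` needs one more vertex on that side. Only `B` can lack it.
          conflict : ∀ {f F} → Fr ↭ f ∷ F → Tied N₁′ f F → Tied N₂′ f F → ⊥
          conflict {f} {F} ρ t₁ t₂ with ∈Fr (∈-resp-↭ (↭-sym ρ) (here refl))
          ... | inj₁ f∈A with ∈⇒↭ f∈A
          ...   | [] , ρ′ with () ← ↭-length ρ′
          conflict {f} {F} ρ t₁ t₂ | inj₁ f∈A | p ∷ A₂ , ρ′ =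
            lonely N₂∈ or₂ ρ t₂ (yβ f∈A) (yβ (∈-resp-↭ (↭-sym ρ′) (there (here refl)))) (β≁B yβ (here refl))
              (∈-resp-↭ F↭ (here refl)) (∈-resp-↭ F↭ (there (∈-++⁺ʳ A₂ (here refl)))) (bip f∈A (here refl))
            where
            F↭ : p ∷ A₂ ++ B ↭ F
            F↭ = drop-∷ {x = f} (lin ρ (lin (↭-sym ρ′)
                (permute ([ _ ] ∷ [ _ ] ∷ A₂ ∷ [ _ ] ∷ B′ ∷ F ∷ [ _ ] ∷ [ _ ] ∷ A′ ∷ [])
                  (# 0 ⊕ # 1 ⊕ ((# 2 ⊕ # 3 ⊕ # 4) ⊕ # 0 ⊕ # 5) ⊕ # 6 ⊕ # 7 ⊕ # 8)
                  (# 0 ⊕ (# 5 ⊕ # 6 ⊕ # 7 ⊕ # 8 ⊕ # 3 ⊕ # 4) ⊕ # 0 ⊕ # 1 ⊕ # 2))))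
          conflict {f} {F} ρ t₁ t₂ | inj₂ f∈B with ∈⇒↭ f∈B
          ...   | b ∷ B₂ , ρ′ =
            lonely N₁∈ or₁ ρ t₁ (yα f∈B) (yα (∈-resp-↭ (↭-sym ρ′) (there (here refl)))) (α≁A yα (here refl))
              (∈-resp-↭ F↭ (here refl)) (∈-resp-↭ F↭ (there (∈-++⁺ʳ B₂ (here refl)))) (~-sym (bip (here refl) f∈B))
            where
            F↭ : b ∷ B₂ ++ A ↭ F
            F↭ = drop-∷ {x = f} (lin ρ (lin (↭-sym ρ′)
                (permute ([ _ ] ∷ [ _ ] ∷ B₂ ∷ [ _ ] ∷ [ _ ] ∷ A′ ∷ F ∷ [ _ ] ∷ B′ ∷ [])
                  (# 0 ⊕ # 1 ⊕ ((# 2 ⊕ # 3 ⊕ # 4 ⊕ # 5) ⊕ # 0 ⊕ # 6) ⊕ # 7 ⊕ # 8)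
                  (# 0 ⊕ (# 6 ⊕ # 3 ⊕ # 4 ⊕ # 5 ⊕ # 7 ⊕ # 8) ⊕ # 0 ⊕ # 1 ⊕ # 2))))
          ...   | [] , ρ′ with lone f∈B (↭-sym ρ′)
          ...     | star , refl = stuck-star star π or₁ or₂ refl eb (anchored N₁∈ or₁ ea ρ A⊆F t₁) (Tied.at-f t₂) n
            where
            A⊆F : ∀ {x} → x ∈ₗ A → x ∈ₗ F
            A⊆F = ∈-resp-↭ (drop-∷ {x = g} (lin ρ (lin (↭-sym ρ′)
                (permute ([ _ ] ∷ [ _ ] ∷ [ _ ] ∷ A′ ∷ F ∷ B′ ∷ [])
                  (# 0 ⊕ # 1 ⊕ # 2 ⊕ (# 3 ⊕ # 0 ⊕ # 4) ⊕ # 0 ⊕ # 5)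
                  (# 0 ⊕ (# 4 ⊕ # 1 ⊕ # 2 ⊕ # 3 ⊕ # 0 ⊕ # 5) ⊕ # 0)))))

          go : (∃ λ f → ∃ λ F → Fr ↭ f ∷ F × Odd (m N₁′ , y′ N₁′ , f)) → ⊥
          go (f , F , ρ , o₁) with find? (odd (m N₂′) (y′ N₂′)) F
          ... | inj₁ (f₂ , F′ , ρ′ , o₂) = finish {F = F′} (lin ρ (lin ρ′
              (permute ([ _ ] ∷ [ _ ] ∷ A′ ∷ [ _ ] ∷ B′ ∷ [ _ ] ∷ F ∷ [ _ ] ∷ F′ ∷ [])
                (# 0 ⊕ # 1 ⊕ ((# 2 ⊕ # 3 ⊕ # 4) ⊕ # 5 ⊕ # 6) ⊕ # 7 ⊕ # 8)
                (# 5 ⊕ # 7 ⊕ (# 8 ⊕ # 0 ⊕ # 1 ⊕ # 2 ⊕ # 3 ⊕ # 4) ⊕ # 6)))) o₁ o₂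
          ... | inj₂ none₂ with repair N₂′
          ...   | f₂ , F₂ , ρ₂ , o₂ with ∈-resp-↭ (trans (↭-sym ρ₂) ρ) (here refl)
          ...     | there i = case ≡-trans (≡-sym o₂) (none₂ i) of λ ()
          ...     | here refl with find? (odd (m N₁′) (y′ N₁′)) F
          ...       | inj₁ (f₁ , F′ , ρ′ , o₁′) = finish {F = F′} (lin ρ (lin ρ′
              (permute ([ _ ] ∷ [ _ ] ∷ A′ ∷ [ _ ] ∷ B′ ∷ [ _ ] ∷ F ∷ [ _ ] ∷ F′ ∷ [])
                (# 0 ⊕ # 1 ⊕ ((# 2 ⊕ # 3 ⊕ # 4) ⊕ # 5 ⊕ # 6) ⊕ # 7 ⊕ # 8)
                (# 7 ⊕ # 5 ⊕ (# 8 ⊕ # 0 ⊕ # 1 ⊕ # 2 ⊕ # 3 ⊕ # 4) ⊕ # 6)))) o₁′ o₂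
          ...       | inj₂ none₁ = conflict ρ (tied o₁ none₁) (tied o₂ none₂)

        odd-at : ∀ i {x f F} → Fr ↭ F → f ∈ₗ F → Valid i x → Odd (p i , x , f)
        odd-at i ρ f∈ (xα , n , _) = Odd-swap (opposite-at ρ f∈ xα (Pur.p-full (Ps i)) n)

        -- Here the path leaves from and returns to the same triple, which loses both full vertices;
        -- its `m` moves to a leftover edge that it misses.
        survive : ∀ {N N′ Ns′ b} → Ns ↭ N ∷ Ns′ → Orient N N′ → z ≡ y N′ → b ≡ y′ N′ → s′ N′ ≡ β → a ≁ b → ⊥
        survive {N′ = N′} π or refl refl e n with m-nf N′
        ... | (_ , [] , pA , _) , _ with () ← ↭-length pA
        survive {N} {N′} π or refl refl e n | (f , f₀ ∷ A₁ , pA , mf) , (f′ , B₁ , pB , mf′) =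
          rebuild {us = N ∷ []} ((a , y′ N′ , f₀) ∷ (f , f′ , m N′) ∷ []) (A₁ ++ B₁) π refl
            (odd-opposite aα (subst (λ σ → Full σ (y′ N′)) e (y′-full N′)) n
               (A⊆Fr (∈-resp-↭ (↭-sym pA) (there (here refl)))) ∷
             edge-apex (bip (∈-resp-↭ (↭-sym pA) (here refl)) (∈-resp-↭ (↭-sym pB) (here refl))) (≁-sym mf) (≁-sym mf′) ∷ [])
            (λ i → valid-odd i (v i))
            (lin (↭-sym (vertices or)) (lin (↭-sym pA) (lin (↭-sym pB) (lin path
                (permute ([ _ ] ∷ [ _ ] ∷ [ _ ] ∷ [ _ ] ∷ [ _ ] ∷ [ _ ] ∷ (tabulate q′) ∷
                  (tabulate o) ∷ A₁ ∷ B₁ ∷ [ _ ] ∷ [ _ ] ∷ [ _ ] ∷ [ _ ] ∷ [ _ ] ∷ A′ ∷ [ _ ] ∷ B′ ∷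
                  [ _ ] ∷ (tabulate q) ∷ [])
                  (# 0 ⊕ # 1 ⊕ # 2 ⊕ # 3 ⊕ # 4 ⊕ # 5 ⊕ ((((# 6 ⊕ # 7 ⊕ # 8 ⊕ # 9) ⊕ # 10 ⊕ # 11 ⊕
                  # 12) ⊕ # 13 ⊕ # 14 ⊕ # 15) ⊕ # 16 ⊕ # 17) ⊕ # 18 ⊕ # 19)
                  (# 10 ⊕ # 11 ⊕ # 12 ⊕ ((((# 19 ⊕ # 7 ⊕ # 13 ⊕ # 14 ⊕ # 15 ⊕ # 16 ⊕ # 17) ⊕ # 5 ⊕
                  # 18 ⊕ # 1) ⊕ # 3 ⊕ # 2 ⊕ # 8) ⊕ # 4 ⊕ # 9) ⊕ # 0 ⊕ # 6))))))

        reorient : ∀ {N N′} → N′ ≡ N ⊎ N′ ≡ flip N → Orient N N′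
        reorient (inj₁ refl) = oriented refl
        reorient (inj₂ refl) = oriented ↭₁₃₂

        -- An augmenting path from side `α` to side `β`: `a` and `b` found a new triple, and the
        -- triples at the two ends of the path are mended with other leftover vertices.
        clash : ∀ {b} → Exposed α z → Exposed β b → a ≁ b → ⊥
        clash (ofMix {N₁} N₁′ i₁ r₁ e₁) (ofMix {N₂} N₂′ i₂ r₂ e₂) n with ∈⇒↭ i₁
        ... | Ns′ , π with ∈-resp-↭ π i₂
        ...   | there i₂′ =
          two-mixed {Ns″ = proj₁ (∈⇒↭ i₂′)} (lin π (lin (proj₂ (∈⇒↭ i₂′))
              (permute (Ns ∷ [ _ ] ∷ Ns′ ∷ [ _ ] ∷ (proj₁ (∈⇒↭ i₂′)) ∷ [])
                ((# 0 ⊕ # 1 ⊕ # 2) ⊕ # 3 ⊕ # 4)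
                (# 1 ⊕ # 3 ⊕ (# 4 ⊕ # 0) ⊕ # 2)))) (reorient r₁) (reorient r₂) refl e₁ e₂ n
        ...   | here refl with r₁ | r₂
        ...     | inj₁ refl | inj₁ refl = case ≡-trans (≡-sym e₁) e₂ of λ ()
        ...     | inj₂ refl | inj₂ refl = case ≡-trans (≡-sym e₁) e₂ of λ ()
        ...     | inj₁ refl | inj₂ refl = survive {N′ = N₁} π (oriented refl) refl refl e₂ n
        ...     | inj₂ refl | inj₁ refl = survive {N′ = flip N₁} π (oriented ↭₁₃₂) refl refl e₂ n
        clash (ofMix {N₁} N₁′ i₁ r₁ e₁) (ofPure j e₂) n with repair N₁′
        ... | f₁ , F , ρ , o₁ with other-two ρ
        ...   | f₂ , f₀ , F′ , refl =
          rebuild {us = N₁ ∷ []} {o′ = setAt o j f₂} ((a , o j , f₀) ∷ (m N₁′ , y′ N₁′ , f₁) ∷ []) F′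
            (proj₂ (∈⇒↭ i₁)) refl
            (opposite-at ρ (there (there (here refl))) aα (exposed-full (ofPure j e₂)) n ∷ o₁ ∷ [])
            (setAt-all (λ i w → Odd (p i , q′ i , w)) o j (λ i → valid-odd i (v i)) (odd-at j ρ (there (here refl)) (v j)))
            (lin (↭-sym (vertices (reorient r₁))) (lin (↭-sym ρ) (lin path (lin (tabulate-setAt o j f₂)
                (permute ([ _ ] ∷ [ _ ] ∷ [ _ ] ∷ [ _ ] ∷ [ _ ] ∷ [ _ ] ∷ (tabulate q′) ∷
                  (tabulate (setAt o j f₂)) ∷ F′ ∷ [ _ ] ∷ [ _ ] ∷ [ _ ] ∷ [ _ ] ∷ [ _ ] ∷ A′ ∷
                  [ _ ] ∷ B′ ∷ [ _ ] ∷ (tabulate q) ∷ [ _ ] ∷ (tabulate o) ∷ [])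
                  (# 0 ⊕ # 1 ⊕ # 2 ⊕ # 3 ⊕ # 4 ⊕ # 5 ⊕ ((((# 6 ⊕ # 7 ⊕ # 8) ⊕ # 9 ⊕ # 10 ⊕ # 11) ⊕
                  # 12 ⊕ # 13 ⊕ # 14 ⊕ # 15 ⊕ # 16) ⊕ # 17 ⊕ # 18) ⊕ # 19 ⊕ # 20)
                  (# 9 ⊕ # 10 ⊕ # 11 ⊕ ((((# 18 ⊕ # 20 ⊕ # 12 ⊕ # 13 ⊕ # 14 ⊕ # 15 ⊕ # 16) ⊕ # 3 ⊕
                  # 17 ⊕ # 4) ⊕ # 5 ⊕ # 19 ⊕ # 2 ⊕ # 8) ⊕ # 0 ⊕ # 6) ⊕ # 1 ⊕ # 7))))))
        clash (ofPure i e₁) (ofMix {N₂} N₂′ i₂ r₂ e₂) n with repair N₂′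
        ... | f₂ , F , ρ , o₂ with other-two ρ
        ...   | f₁ , f₀ , F′ , refl =
          rebuild {us = N₂ ∷ []} {o′ = setAt o i f₁} ((a , y N₂′ , f₀) ∷ (m N₂′ , y′ N₂′ , f₂) ∷ []) F′
            (proj₂ (∈⇒↭ i₂)) refl
            (opposite-at ρ (there (there (here refl))) aα (exposed-full (ofMix N₂′ i₂ r₂ e₂)) n ∷ o₂ ∷ [])
            (setAt-all (λ i w → Odd (p i , q′ i , w)) o i (λ i → valid-odd i (v i)) (odd-at i ρ (there (here refl)) (v i)))
            (lin (↭-sym (vertices (reorient r₂))) (lin (↭-sym ρ) (lin path (lin (tabulate-setAt o i f₁)
                (permute ([ _ ] ∷ [ _ ] ∷ [ _ ] ∷ [ _ ] ∷ [ _ ] ∷ [ _ ] ∷ (tabulate q′) ∷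
                  (tabulate (setAt o i f₁)) ∷ F′ ∷ [ _ ] ∷ [ _ ] ∷ [ _ ] ∷ [ _ ] ∷ [ _ ] ∷ A′ ∷
                  [ _ ] ∷ B′ ∷ [ _ ] ∷ (tabulate q) ∷ [ _ ] ∷ (tabulate o) ∷ [])
                  (# 0 ⊕ # 1 ⊕ # 2 ⊕ # 3 ⊕ # 4 ⊕ # 5 ⊕ ((((# 6 ⊕ # 7 ⊕ # 8) ⊕ # 9 ⊕ # 10 ⊕ # 11) ⊕
                  # 12 ⊕ # 13 ⊕ # 14 ⊕ # 15 ⊕ # 16) ⊕ # 17 ⊕ # 18) ⊕ # 19 ⊕ # 20)
                  (# 9 ⊕ # 10 ⊕ # 11 ⊕ ((((# 18 ⊕ # 20 ⊕ # 12 ⊕ # 13 ⊕ # 14 ⊕ # 15 ⊕ # 16) ⊕ # 3 ⊕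
                  # 1 ⊕ # 4) ⊕ # 5 ⊕ # 19 ⊕ # 2 ⊕ # 8) ⊕ # 0 ⊕ # 6) ⊕ # 17 ⊕ # 7))))))
        clash (ofPure i e₁) (ofPure j e₂) n =
          rebuild {us = []} {o′ = setAt (setAt o i a₁) j g} ((a , o j , a₀) ∷ []) (A′ ++ B′) refl refl
            (odd-opposite aα (exposed-full (ofPure j e₂)) n (A⊆Fr (here refl)) ∷ [])
            (setAt-all (λ i w → Odd (p i , q′ i , w)) (setAt o i a₁) j
              (setAt-all (λ i w → Odd (p i , q′ i , w)) o i (λ i → valid-odd i (v i))
                (odd-at i refl (there (here refl)) (v i)))
              (odd-at j refl (B⊆Fr (here refl)) (v j)))
            (lin path (lin (tabulate-setAt o i a₁)
              (lin (subst (λ w → w ∷ tabulate (setAt (setAt o i a₁) j g) ↭ g ∷ tabulate (setAt o i a₁))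
                     (setAt-other o i j j≢i) (tabulate-setAt (setAt o i a₁) j g))
                         (permute ([ _ ] ∷ [ _ ] ∷ [ _ ] ∷ (tabulate q′) ∷
                           (tabulate (setAt (setAt o i a₁) j g)) ∷ A′ ∷ B′ ∷ [ _ ] ∷ (tabulate q) ∷
                           [ _ ] ∷ (tabulate o) ∷ [ _ ] ∷ (tabulate (setAt o i a₁)) ∷ [])
                           (# 0 ⊕ # 1 ⊕ # 2 ⊕ (((# 3 ⊕ # 4 ⊕ # 5 ⊕ # 6) ⊕ # 7 ⊕ # 8) ⊕ # 9 ⊕ # 10) ⊕
                           # 11 ⊕ # 12)
                           ((((# 8 ⊕ # 10 ⊕ # 2 ⊕ # 9 ⊕ # 5 ⊕ # 11 ⊕ # 6) ⊕ # 0 ⊕ # 3) ⊕ # 7 ⊕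
                           # 12) ⊕ # 1 ⊕ # 4)))))
          where
          j≢i : j ≢ i
          j≢i refl = case ≡-trans (≡-sym e₁) e₂ of λ ()

      pair-up : ∀ {n} (ρ : Fin n → Bool) (p q : Fin n → V) →
                tabulate p ++ tabulate q ↭
                tabulate (λ i → if ρ i then q i else p i) ++ tabulate (λ i → if ρ i then p i else q i)
      pair-up {zero}  ρ p q = refl
      pair-up {suc n} ρ p q = go (ρ zero) _ _ _ _ (pair-up (ρ ∘ suc) (p ∘ suc) (q ∘ suc))
        where
        go : ∀ b ps qs ks ds → ps ++ qs ↭ ks ++ ds → (p zero ∷ ps) ++ (q zero ∷ qs) ↭
             ((if b then q zero else p zero) ∷ ks) ++ ((if b then p zero else q zero) ∷ ds)
        go true  ps qs ks ds π = lin π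
            (permute ([ _ ] ∷ ps ∷ [ _ ] ∷ qs ∷ ks ∷ ds ∷ [])
              (# 0 ⊕ (# 1 ⊕ # 2 ⊕ # 3) ⊕ # 4 ⊕ # 5)
              (# 2 ⊕ (# 4 ⊕ # 0 ⊕ # 5) ⊕ # 1 ⊕ # 3))
        go false ps qs ks ds π = lin π
            (permute ([ _ ] ∷ ps ∷ [ _ ] ∷ qs ∷ ks ∷ ds ∷ [])
              (# 0 ⊕ (# 1 ⊕ # 2 ⊕ # 3) ⊕ # 4 ⊕ # 5)
              (# 0 ⊕ (# 4 ⊕ # 2 ⊕ # 5) ⊕ # 1 ⊕ # 3))

      fulls : List Mix → List V
      fulls []       = []
      fulls (N ∷ ns) = y N ∷ y′ N ∷ fulls ns

      flat-fulls : ∀ ns → flat (map mtri ns) ↭ map m ns ++ fulls ns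
      flat-fulls []       = refl
      flat-fulls (N ∷ ns) = lin (flat-fulls ns)
          (permute ([ _ ] ∷ [ _ ] ∷ [ _ ] ∷ (flat (map mtri ns)) ∷ (map m ns) ∷ (fulls ns) ∷ [])
            (# 0 ⊕ # 1 ⊕ # 2 ⊕ # 3 ⊕ # 4 ⊕ # 5)
            (# 0 ⊕ (# 4 ⊕ # 1 ⊕ # 2 ⊕ # 5) ⊕ # 3))

      length-fulls : ∀ ns → length (fulls ns) ≡ 2 * length ns
      length-fulls []       = refl
      length-fulls (N ∷ ns) = ≡-trans (cong (2 +_) (length-fulls ns)) (≡-sym (*-suc 2 (length ns)))

      module _ (αbound : IndependentBound (suc (length ts)) (flat ts ++ Fr))
               (βbound : BicliqueBound (suc (length ts)) (flat ts ++ Fr)) where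

        Good : V → Set
        Good a = Full α a × (∀ {b} → Exposed β b → a ~ b)

        good : ∀ {z a} (q′ : Fin l → V) → Exposed α z → a ∷ tabulate q′ ↭ z ∷ tabulate q →
               (∀ i → Valid i (q′ i)) → Good a
        good {z} {a} q′ src path v = aα , λ snk → ¬≁⇒~ (Clash.clash αbound q′ path v aα src snk)
          where
          aα : Full α a
          aα with ∈-resp-↭ path (here refl)
          ... | here refl = exposed-full src
          ... | there i   = ∈-tabulate (Full α) q (λ i → Pur.q-full (Ps i)) i

        -- A good vertex sees every exposed `β` vertex, in particular `o i` when that is on side
        -- `β`; this is the last clause of validity.
        open Search p q (Exposed α) Valid Good valid₀
          (λ i k n → proj₁ k , n , λ e → proj₂ k (ofPure i e)) good

        module Biclique (closed : Closed) where

          open Closed closed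

          -- The failed search keeps two vertices of each triple: both full ones of a mixed triple,
          -- and `o` with either `q` or `p` of a pure one, according to whether the search reached
          -- it.
          data Kept : Side → V → Set where
            exposed : ∀ {σ v} → Exposed σ v → Kept σ v
            reached : ∀ i → ρ i ≡ true → Kept α (q i)
            missed  : ∀ i → ρ i ≡ false → Kept β (p i)

          kept-full : ∀ {σ v} → Kept σ v → Full σ v
          kept-full (exposed x)   = exposed-full x
          kept-full (reached i _) = Pur.q-full (Ps i)
          kept-full (missed i _)  = Pur.p-full (Ps i)

          kept-complete : ∀ {v w} → Kept α v → Kept β w → v ~ w
          kept-complete (exposed x)   (exposed y)   = proj₂ (good q x refl valid₀) y
          kept-complete (exposed x)   (missed i e)  = source-adjacent i x e
          kept-complete (reached i e) (exposed y)   = proj₂ (reached-good i e) y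
          kept-complete (reached i e) (missed j e′) = reached-adjacent i j e e′

          record Sorted (L : List V) : Set where
            constructor sorted
            field
              as bs : List V
              sides : L ↭ as ++ bs
              inα   : All (Kept α) as
              inβ   : All (Kept β) bs

          insert : ∀ {σ v L} → Kept σ v → Sorted L → Sorted (v ∷ L)
          insert {α} {v} k (sorted as bs π a b) = sorted (v ∷ as) bs (lin π
              (permute ([ _ ] ∷ _ ∷ as ∷ bs ∷ []) (# 0 ⊕ # 1 ⊕ # 2 ⊕ # 3) (# 0 ⊕ (# 2 ⊕ # 3) ⊕ # 1))) (k ∷ a) b
          insert {β} {v} k (sorted as bs π a b) = sorted as (v ∷ bs) (lin π
              (permute ([ _ ] ∷ _ ∷ as ∷ bs ∷ []) (# 0 ⊕ # 1 ⊕ # 2 ⊕ # 3) ((# 2 ⊕ # 0 ⊕ # 3) ⊕ # 1))) a (k ∷ b)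

          insert-all : ∀ {n} (f : Fin n → V) → (∀ i → ∃ λ σ → Kept σ (f i)) → ∀ {L} → Sorted L → Sorted (tabulate f ++ L)
          insert-all {zero}  f k S = S
          insert-all {suc n} f k S = insert (proj₂ (k zero)) (insert-all (f ∘ suc) (k ∘ suc) S)

          sort-fulls : ∀ ns → (∀ {N} → N ∈ₗ ns → N ∈ₗ Ns) → Sorted (fulls ns)
          sort-fulls [] i = sorted [] [] refl [] []
          sort-fulls (N ∷ ns) i =
            insert (exposed (ofMix N (i (here refl)) (inj₁ refl) refl))
              (insert (exposed (ofMix (flip N) (i (here refl)) (inj₂ refl) refl)) (sort-fulls ns (i ∘ there)))

          chosen dropped : Fin l → V
          chosen  i = if ρ i then q i else p i
          dropped i = if ρ i then p i else q i

          chosen-kept : ∀ i → ∃ λ σ → Kept σ (chosen i)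
          chosen-kept i with ρ i in e
          ... | true  = α , reached i e
          ... | false = β , missed i e

          contradiction : Sorted (tabulate chosen ++ tabulate o ++ fulls Ns) → ⊥
          -- Only one vertex per triple lies outside the biclique, and the bound demands one more
          -- than the number of triples.
          contradiction (sorted as bs π inα inβ) =
            m+1+n≰m (length (flat ts ++ Fr)) {0} (≤-trans (≤-reflexive sizes) (βbound a₀ (a₁ ∷ A′ ++ as) g (B′ ++ bs) X perm complete))
            where
            X : List V
            X = map m Ns ++ tabulate dropped
            perm : (A ++ as) ++ (B ++ bs) ++ X ↭ flat ts ++ Fr
            perm = lin (↭-sym decomp) (lin (↭-sym (flat-fulls Ns)) (lin (↭-sym (pair-up ρ p q)) (lin (↭-sym π)
                (permute ([ _ ] ∷ [ _ ] ∷ A′ ∷ as ∷ [ _ ] ∷ B′ ∷ bs ∷ (map m Ns) ∷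
                  (tabulate dropped) ∷ (flat ts) ∷ (flat (map mtri Ns)) ∷ (tabulate p) ∷
                  (tabulate q) ∷ (tabulate chosen) ∷ (tabulate o) ∷ (fulls Ns) ∷ [])
                  (# 0 ⊕ # 1 ⊕ (((((# 2 ⊕ # 3) ⊕ # 4 ⊕ (# 5 ⊕ # 6) ⊕ # 7 ⊕ # 8) ⊕ # 9) ⊕ # 10) ⊕
                  # 11 ⊕ # 12) ⊕ # 13 ⊕ # 14 ⊕ # 15)
                  (((((# 9 ⊕ # 0 ⊕ # 1 ⊕ # 2 ⊕ # 4 ⊕ # 5) ⊕ # 10 ⊕ # 11 ⊕ # 12 ⊕ # 14) ⊕ # 7 ⊕
                  # 15) ⊕ # 13 ⊕ # 8) ⊕ # 3 ⊕ # 6)))))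
            complete : Complete (A ++ as) (B ++ bs)
            complete i j with ∈-++⁻ A i | ∈-++⁻ B j
            ... | inj₁ i′ | inj₁ j′ = bip i′ j′
            ... | inj₁ i′ | inj₂ j′ = ~-sym (kept-full (All.lookup inβ j′) i′)
            ... | inj₂ i′ | inj₁ j′ = kept-full (All.lookup inα i′) j′
            ... | inj₂ i′ | inj₂ j′ = kept-complete (All.lookup inα i′) (All.lookup inβ j′)
            kept-count : length as + length bs ≡ l + (l + 2 * length Ns)
            kept-count = ≡-trans (≡-sym (length-++ as)) (≡-trans (≡-sym (↭-length π))
              (≡-trans (length-++ (tabulate chosen)) (cong₂ _+_ (length-tabulate chosen)
                (≡-trans (length-++ (tabulate o)) (cong₂ _+_ (length-tabulate o) (length-fulls Ns))))))
            identity : ∀ a b n l → 3 * (n + l) + (a + b) + 1 ≡ a + b + (l + (l + 2 * n)) + suc (n + l)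
            identity = solve-∀
            regroup : ∀ a b x y k → (a + x) + (b + y) + k ≡ a + b + (x + y) + k
            regroup = solve-∀
            sizes : length (flat ts ++ Fr) + 1 ≡ length (A ++ as) + length (B ++ bs) + suc (length ts)
            sizes = begin
              length (flat ts ++ Fr) + 1
                ≡⟨ cong (_+ 1) (≡-trans (length-++ (flat ts)) (cong₂ _+_ (≡-trans (length-flat ts) (cong (3 *_) count)) (length-++ A))) ⟩
              3 * (length Ns + l) + (length A + length B) + 1
                ≡⟨ identity (length A) (length B) (length Ns) l ⟩
              length A + length B + (l + (l + 2 * length Ns)) + suc (length Ns + l)
                ≡⟨ cong₂ (λ n k → length A + length B + n + suc k) (≡-sym kept-count) (≡-sym count) ⟩
              length A + length B + (length as + length bs) + suc (length ts)
                ≡⟨ regroup (length A) (length B) (length as) (length bs) (suc (length ts)) ⟨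
              (length A + length as) + (length B + length bs) + suc (length ts)
                ≡⟨ cong₂ (λ n k → n + k + suc (length ts)) (≡-sym (length-++ A)) (≡-sym (length-++ B)) ⟩
              length (A ++ as) + length (B ++ bs) + suc (length ts) ∎
              where open ≡-Reasoning

        impossible : ⊥
        impossible = closure λ closed → let open Biclique closed in
          contradiction (insert-all chosen chosen-kept
            (insert-all o (λ i → side i , exposed (ofPure i refl)) (sort-fulls Ns id)))

-- Star leftovers with a triple that contains an isolated edge.

module IsolatedEdges (𝓗 : TriangleFree) where

  open Triples 𝓗
  open Leftover 𝓗
  open Classification 𝓗

  module Fan
    (a₀ a₁ : V) (A′ : List V) (g : V) (ts : List Triple)
    (odds  : All Odd ts)
    (bip   : Complete (a₀ ∷ a₁ ∷ A′) (g ∷ []))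
    (stuck : ∀ W rest → length W ≡ suc (length ts) → All Odd W →
             flat W ++ rest ↭ flat ts ++ (a₀ ∷ a₁ ∷ A′) ++ (g ∷ []) → ⊥)
    (αbound : IndependentBound (suc (length ts)) (flat ts ++ (a₀ ∷ a₁ ∷ A′) ++ (g ∷ [])))
    where

    open Classes a₀ a₁ A′ g [] ts odds bip stuck

    -- The neighbour `a` of the centre can be traded away, since every vertex of `A` repairs the
    -- triple.
    record Loose (t : Triple) : Set where
      constructor loose
      field
        a x y : V
        tri↭  : tri t ↭ a ∷ x ∷ y ∷ []
        a~g   : a ~ g
        oddA  : ∀ {f} → f ∈ₗ A → Odd (x , y , f)

    record Double (t : Triple) : Set where
      constructor double
      field
        a a′ x : V
        tri↭   : tri t ↭ a ∷ a′ ∷ x ∷ []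
        a~g    : a ~ g
        a′~g   : a′ ~ g

    module _ {t₀ : Triple} {ts′ : List Triple} (π : ts ↭ t₀ ∷ ts′) (E : IsolatedEdge t₀) where

      open IsolatedEdge E

      g∈ : g ∈ₗ g ∷ []
      g∈ = here refl

      t₀-loose : Loose t₀
      t₀-loose = loose w c d (trans tri↭ ↭₃₁₂) w~g λ i → edge-apex c~d (c≁A i) (d≁A i)

      -- Removing from t a vertex complete to A must not leave an odd triple behind.
      β-free : ∀ {t ts″ v x y f f′ A₁} → ts′ ↭ t ∷ ts″ → tri t ↭ v ∷ x ∷ y ∷ [] → Full β v →
               A ↭ f ∷ f′ ∷ A₁ → Odd (x , y , f) → ⊥
      β-free {t} {ts″} {v} {x} {y} {f} {f′} {A₁} π′ qt vβ ρ o with ~∨≁ c v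
      ... | inj₂ cv =
        augment (t₀ ∷ t ∷ []) {ts″} ((v , f′ , c) ∷ (w , g , d) ∷ (x , y , f) ∷ []) A₁ (lin π (lin π′
            (permute (ts ∷ [ _ ] ∷ ts′ ∷ [ _ ] ∷ ts″ ∷ [])
              ((# 0 ⊕ # 1 ⊕ # 2) ⊕ # 3 ⊕ # 4)
              (# 1 ⊕ # 3 ⊕ (# 4 ⊕ # 0) ⊕ # 2))))
          (edge-apex (vβ f′∈) (≁-sym cv) (≁-sym (c≁A f′∈)) ∷ edge-apex w~g (≁-sym d≁w) (≁-sym d≁g) ∷ o ∷ []) refl
          (lin tri↭ (lin qt (lin ρ
              (permute ([ _ ] ∷ [ _ ] ∷ [ _ ] ∷ [ _ ] ∷ [ _ ] ∷ [ _ ] ∷ [ _ ] ∷ [ _ ] ∷ A′ ∷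
                [ _ ] ∷ [ _ ] ∷ [ _ ] ∷ [ _ ] ∷ [ _ ] ∷ [ _ ] ∷ [ _ ] ∷ [ _ ] ∷ [ _ ] ∷ A₁ ∷ [])
                (# 0 ⊕ # 1 ⊕ # 2 ⊕ # 3 ⊕ # 4 ⊕ # 5 ⊕ # 6 ⊕ # 7 ⊕ (((# 8 ⊕ # 9) ⊕ # 10 ⊕ # 11 ⊕
                # 12) ⊕ # 13 ⊕ # 14 ⊕ # 15) ⊕ # 16 ⊕ # 17 ⊕ # 18)
                (# 13 ⊕ # 17 ⊕ # 10 ⊕ # 12 ⊕ # 9 ⊕ # 11 ⊕ # 14 ⊕ # 15 ⊕ # 16 ⊕ ((# 18 ⊕ # 0 ⊕ # 1 ⊕
                # 2) ⊕ # 3 ⊕ # 4 ⊕ # 5) ⊕ # 6 ⊕ # 7 ⊕ # 8)))))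
        where f′∈ = ∈-resp-↭ (↭-sym ρ) (there (here refl))
      ... | inj₁ cv =
        augment (t₀ ∷ t ∷ []) {ts″} ((v , f′ , d) ∷ (w , g , c) ∷ (x , y , f) ∷ []) A₁ (lin π (lin π′
            (permute (ts ∷ [ _ ] ∷ ts′ ∷ [ _ ] ∷ ts″ ∷ [])
              ((# 0 ⊕ # 1 ⊕ # 2) ⊕ # 3 ⊕ # 4)
              (# 1 ⊕ # 3 ⊕ (# 4 ⊕ # 0) ⊕ # 2))))
          (edge-apex (vβ f′∈) (common⇒≁ cv c~d) (≁-sym (d≁A f′∈)) ∷ edge-apex w~g (≁-sym c≁w) (≁-sym c≁g) ∷ o ∷ []) refl
          (lin tri↭ (lin qt (lin ρ
              (permute ([ _ ] ∷ [ _ ] ∷ [ _ ] ∷ [ _ ] ∷ [ _ ] ∷ [ _ ] ∷ [ _ ] ∷ [ _ ] ∷ A′ ∷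
                [ _ ] ∷ [ _ ] ∷ [ _ ] ∷ [ _ ] ∷ [ _ ] ∷ [ _ ] ∷ [ _ ] ∷ [ _ ] ∷ [ _ ] ∷ A₁ ∷ [])
                (# 0 ⊕ # 1 ⊕ # 2 ⊕ # 3 ⊕ # 4 ⊕ # 5 ⊕ # 6 ⊕ # 7 ⊕ (((# 8 ⊕ # 9) ⊕ # 10 ⊕ # 11 ⊕
                # 12) ⊕ # 13 ⊕ # 14 ⊕ # 15) ⊕ # 16 ⊕ # 17 ⊕ # 18)
                (# 13 ⊕ # 17 ⊕ # 11 ⊕ # 12 ⊕ # 9 ⊕ # 10 ⊕ # 14 ⊕ # 15 ⊕ # 16 ⊕ ((# 18 ⊕ # 0 ⊕ # 1 ⊕
                # 2) ⊕ # 3 ⊕ # 4 ⊕ # 5) ⊕ # 6 ⊕ # 7 ⊕ # 8)))))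
        where f′∈ = ∈-resp-↭ (↭-sym ρ) (there (here refl))

      -- `β-free` forbids `m y f` to be odd for `f` in `A`. Since `y ~ y′`, parity then makes
      -- `m y′ f` odd for all these `f`, so `y` is the vertex to trade.
      mixed-αβ : ∀ {t ts″ m y y′} → ts′ ↭ t ∷ ts″ → tri t ↭ m ∷ y ∷ y′ ∷ [] → Odd (m , y , y′) → Nonfull m →
                 Full α y → Full β y′ → Loose t
      mixed-αβ {t} {ts″} {m} {y} {y′} π′ qt o ((_ , [] , ρ , mf) , _) yα y′β with () ← ↭-length ρ
      mixed-αβ {t} {ts″} {m} {y} {y′} π′ qt o nf@((f , f₂ ∷ A₁ , ρ , mf) , _) yα y′β with find? (odd m y) A
      ... | inj₁ (f′ , f″ ∷ A₂ , ρ′ , o′) = ⊥-elim (β-free π′ (trans qt ↭₃₁₂) y′β ρ′ o′)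
      ... | inj₁ (f′ , [] , ρ′ , _) with () ← ↭-length ρ′
      mixed-αβ {t} {ts″} {m} {y} {y′} π′ qt o nf@((f , f₂ ∷ A₁ , ρ , mf) , _) yα y′β | inj₂ even =
        loose y m y′ (trans qt ↭₂₁₃) (yα g∈) λ {f} i →
          algebra (h m y) (h m y′) (h m f) (h y y′) (h y f) (h y′ f) o y~y′ (α≁A yα i) (y′β i) (even i)
        where
        open Star refl {t} {t₀ ∷ ts″} (lin π (lin π′
            (permute (ts ∷ [ _ ] ∷ ts′ ∷ [ _ ] ∷ ts″ ∷ [])
              ((# 0 ⊕ # 1 ⊕ # 2) ⊕ # 3 ⊕ # 4)
              (# 3 ⊕ # 1 ⊕ (# 4 ⊕ # 0) ⊕ # 2))))
        y~y′ : y ~ y′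
        y~y′ = ¬≁⇒~ λ n → twice qt A₁
          (edge-apex (y′β (∈-resp-↭ (↭-sym ρ) (there (here refl)))) (≁-sym n)
            (≁-sym (α≁A yα (∈-resp-↭ (↭-sym ρ) (there (here refl))))))
          (edge-apex (~g (∈-resp-↭ (↭-sym ρ) (here refl))) (≁-sym mf) (≁-sym (nf-g nf)))
          (lin ρ
              (permute ([ _ ] ∷ [ _ ] ∷ [ _ ] ∷ [ _ ] ∷ [ _ ] ∷ A′ ∷ [ _ ] ∷ [ _ ] ∷ [ _ ] ∷ A₁ ∷
                [])
                (# 0 ⊕ # 1 ⊕ # 2 ⊕ # 3 ⊕ # 4 ⊕ (# 5 ⊕ # 6) ⊕ # 7 ⊕ # 8 ⊕ # 9)
                (# 2 ⊕ # 8 ⊕ # 1 ⊕ # 7 ⊕ # 6 ⊕ # 0 ⊕ # 9 ⊕ # 3 ⊕ # 4 ⊕ # 5)))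
        algebra : ∀ a b k u v w → a xor (b xor u) ≡ true → u ≡ true → v ≡ false → w ≡ true →
                  a xor (k xor v) ≡ false → b xor (k xor w) ≡ true
        algebra true  true  true  _ _ _ _ refl refl refl _ = refl
        algebra false false false _ _ _ _ refl refl refl _ = refl
        algebra true  true  false _ _ _ _ refl refl refl ()
        algebra false false true  _ _ _ _ refl refl refl ()
        algebra true  false _ _ _ _ () refl refl refl _
        algebra false true  _ _ _ _ () refl refl refl _

      -- Kinds in which a vertex complete to `A` could be spared contradict `β-free`; each of the
      -- others has a neighbour of `g` to offer, either a tradable one or two of them.
      analyse : ∀ {t} → t ∈ₗ ts′ → (Pentagon t → ⊥) → Loose t ⊎ Double t
      analyse {t} t∈ np with ∈⇒↭ t∈
      ... | ts″ , π′ = go (classify {ts′ = t₀ ∷ ts″} (lin π (lin π′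
          (permute (ts ∷ [ _ ] ∷ ts′ ∷ [ _ ] ∷ ts″ ∷ [])
            ((# 0 ⊕ # 1 ⊕ # 2) ⊕ # 3 ⊕ # 4)
            (# 3 ⊕ # 1 ⊕ (# 4 ⊕ # 0) ⊕ # 2)))) (All.lookup odds (∈-resp-↭ (↭-sym π) (there t∈))))
        where
        go : Class t → Loose t ⊎ Double t
        go (isPentagon _ x) = ⊥-elim (np x)
        go (isIsolatedEdge _ (isolatedEdge c d w qt cd _ _ cA dA _ _ wg)) =
          inj₁ (loose w c d (trans qt ↭₃₁₂) wg λ i → edge-apex cd (cA i) (dA i))
        go (isPure (pure p q o α qt od fp fq n fo)) = inj₂ (double q o p (trans qt ↭₂₃₁) (fq g∈) (fo g∈))
        go (isPure (pure p q o β qt od fp fq n fo)) =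
          ⊥-elim (β-free π′ (trans qt ↭₃₁₂) fo refl
            (edge-across (fp (here refl)) n (≁-sym (α≁A fq (here refl)))))
        go (isMixed (mixed m y y′ α α qt o nf f f′)) = inj₂ (double y y′ m (trans qt ↭₂₃₁) (f g∈) (f′ g∈))
        go (isMixed (mixed m y y′ α β qt o nf f f′)) = inj₁ (mixed-αβ π′ qt o nf f f′)
        go (isMixed (mixed m y y′ β α qt o nf f f′)) =
          inj₁ (mixed-αβ π′ (trans qt ↭₁₃₂) (Odd-rotate (Odd-swap o)) nf f′ f)
        go (isMixed (mixed m y y′ β β qt o nf f f′)) with Odd-third (Odd-rotate o) (same-side β f f′)
        ... | inj₁ (ym , n) = ⊥-elim (β-free π′ (trans qt ↭₂₃₁) f refl
              (edge-across (f′ (here refl)) n (common⇒≁ (f (here refl)) ym)))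
        ... | inj₂ (ym , n) = ⊥-elim (β-free π′ (trans qt ↭₃₂₁) f′ refl
              (edge-across (f (here refl)) n (common⇒≁ (f′ (here refl)) ym)))

      Alpha : Triple → Set
      Alpha t = ∃ λ a → ∃ λ x → ∃ λ y → tri t ↭ a ∷ x ∷ y ∷ [] × a ~ g

      loose-α : ∀ {t} → Loose t → Alpha t
      loose-α (loose a x y p e _) = a , x , y , p , e

      alphas : ∀ us → (∀ {t} → t ∈ₗ us → Alpha t) → ∃ λ as → ∃ λ rs →
               flat us ↭ as ++ rs × length as ≡ length us × All (_~ g) as
      alphas [] f = [] , [] , refl , refl , []
      alphas (t ∷ us) f with f (here refl) | alphas us (f ∘ there)
      ... | a , x , y , p , e | as , rs , q , len , al =
        a ∷ as , x ∷ y ∷ rs , lin p (lin q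
            (permute ([ _ ] ∷ [ _ ] ∷ [ _ ] ∷ (flat us) ∷ [ _ ] ∷ [ _ ] ∷ [ _ ] ∷ as ∷ rs ∷ [])
              (# 0 ⊕ # 1 ⊕ # 2 ⊕ (# 3 ⊕ # 4 ⊕ # 5 ⊕ # 6) ⊕ # 7 ⊕ # 8)
              (# 4 ⊕ ((# 7 ⊕ # 5 ⊕ # 6 ⊕ # 8) ⊕ # 0 ⊕ # 1 ⊕ # 2) ⊕ # 3))) , cong suc len , e ∷ al

      -- `A` and one vertex more than there are triples exceed the independence bound by one.
      too-many : ∀ {C X} → A ++ C ++ X ↭ flat ts ++ A ++ (g ∷ []) → length C ≡ suc (length ts) →
                 Independent (A ++ C) → ⊥
      too-many {C} {X} p len ind =
        m+1+n≰m (suc (length (flat ts ++ A ++ (g ∷ [])))) {0} (≤-trans (≤-reflexive sizes)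
          (αbound (A ++ C) X (trans
              (permute ([ _ ] ∷ [ _ ] ∷ A′ ∷ C ∷ X ∷ [])
                (# 0 ⊕ # 1 ⊕ (# 2 ⊕ # 3) ⊕ # 4)
                (# 0 ⊕ # 1 ⊕ # 2 ⊕ # 3 ⊕ # 4)) p) ind))
        where
        identity : ∀ a n → suc (3 * n + (a + 1)) + 1 ≡ a + suc n + 2 * suc n
        identity = solve-∀
        sizes : suc (length (flat ts ++ A ++ (g ∷ []))) + 1 ≡ length (A ++ C) + 2 * suc (length ts)
        sizes = begin
          suc (length (flat ts ++ A ++ (g ∷ []))) + 1
            ≡⟨ cong (λ n → suc n + 1) (≡-trans (length-++ (flat ts)) (cong₂ _+_ (length-flat ts) (length-++ A))) ⟩
          suc (3 * length ts + (length A + 1)) + 1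
            ≡⟨ identity (length A) (length ts) ⟩
          length A + suc (length ts) + 2 * suc (length ts)
            ≡⟨ cong (_+ 2 * suc (length ts)) (≡-trans (cong (length A +_) (≡-sym len)) (≡-sym (length-++ A))) ⟩
          length (A ++ C) + 2 * suc (length ts) ∎
          where open ≡-Reasoning

      fan-independent : ∀ {C} → All (_~ g) C → Independent C
      fan-independent a i j = common⇒≁ (~-sym (All.lookup a i)) (~-sym (All.lookup a j))

      A~g : All (_~ g) A
      A~g = All.tabulate λ i → bip i g∈

      no-double : ∀ {t us} → ts ↭ t ∷ us → (∀ {t} → t ∈ₗ us → Alpha t) → Double t → ⊥
      no-double {t} {us} p f (double a a′ x q e e′) with alphas us f
      ... | as , rs , r , len , al =
        too-many {a ∷ a′ ∷ as} {x ∷ rs ++ g ∷ []} (lin (↭-sym (flat-↭ p)) (lin (↭-sym q) (lin (↭-sym r)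
            (permute ([ _ ] ∷ [ _ ] ∷ A′ ∷ [ _ ] ∷ [ _ ] ∷ as ∷ [ _ ] ∷ rs ∷ [ _ ] ∷ (flat ts) ∷
              [ _ ] ∷ [ _ ] ∷ [ _ ] ∷ (flat us) ∷ [])
              (# 0 ⊕ # 1 ⊕ (((# 2 ⊕ # 3 ⊕ # 4 ⊕ # 5 ⊕ # 6 ⊕ # 7 ⊕ # 8) ⊕ # 9) ⊕ # 10 ⊕ # 11 ⊕
              # 12) ⊕ # 13)
              ((((# 9 ⊕ # 0 ⊕ # 1 ⊕ # 2 ⊕ # 8) ⊕ # 10 ⊕ # 11 ⊕ # 12 ⊕ # 13) ⊕ # 3 ⊕ # 4 ⊕ # 6) ⊕
              # 5 ⊕ # 7)))))
          (cong suc (≡-trans (cong suc len) (≡-sym (↭-length p))))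
          (fan-independent (AllP.++⁺ A~g (e ∷ e′ ∷ al)))

      scan : ∀ us → (∀ {t} → t ∈ₗ us → Loose t) →
             (∃ λ t → ∃ λ us′ → us ↭ t ∷ us′ × Σ (Loose t) λ L → c ~ Loose.a L) ⊎
             (∃ λ as → ∃ λ rs → flat us ↭ as ++ rs × length as ≡ length us × All (_~ g) as × All (c ≁_) as)
      scan [] f = inj₂ ([] , [] , refl , refl , [] , [])
      scan (t ∷ us) f with ~∨≁ c (Loose.a (f (here refl)))
      ... | inj₁ e = inj₁ (t , us , refl , f (here refl) , e)
      ... | inj₂ n with scan us (f ∘ there)
      ...   | inj₁ (t′ , us′ , p , L , e) = inj₁ (t′ , t ∷ us′ , lin p
          (permute ([ _ ] ∷ us ∷ [ _ ] ∷ us′ ∷ []) (# 0 ⊕ # 1 ⊕ # 2 ⊕ # 3) (# 2 ⊕ # 0 ⊕ # 3 ⊕ # 1)) , L , e)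
      ...   | inj₂ (as , rs , p , len , al , nl) =
        inj₂ (Loose.a (f (here refl)) ∷ as , Loose.x (f (here refl)) ∷ Loose.y (f (here refl)) ∷ rs ,
              lin p (lin (Loose.tri↭ (f (here refl)))
                  (permute ([ _ ] ∷ [ _ ] ∷ [ _ ] ∷ (flat us) ∷ as ∷ rs ∷ [ _ ] ∷ [ _ ] ∷ [ _ ] ∷
                    [])
                    (# 0 ⊕ # 1 ⊕ # 2 ⊕ (# 3 ⊕ # 4 ⊕ # 5) ⊕ # 6 ⊕ # 7 ⊕ # 8)
                    (# 6 ⊕ ((# 4 ⊕ # 7 ⊕ # 8 ⊕ # 5) ⊕ # 3) ⊕ # 0 ⊕ # 1 ⊕ # 2))) , cong suc len , Loose.a~g (f (here refl)) ∷ al , n ∷ nl)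

      -- Either `c` can join the chosen neighbours of `g` and makes the independent set too large,
      -- or `c` sees the tradable vertex `a` of some triple. Then `c a` and `w g` are edges of two
      -- new triples and `a₁` repairs the rest of the old one.
      all-loose : (∀ {t} → t ∈ₗ ts′ → Loose t) → ⊥
      all-loose f with scan ts′ f
      ... | inj₁ (t , us , p , loose a x y q e o , ca) =
        augment (t₀ ∷ t ∷ []) {us} ((c , a , a₀) ∷ (w , g , d) ∷ (x , y , a₁) ∷ []) A′ (lin π (lin p
            (permute (ts ∷ [ _ ] ∷ ts′ ∷ [ _ ] ∷ us ∷ [])
              ((# 0 ⊕ # 1 ⊕ # 2) ⊕ # 3 ⊕ # 4)
              (# 1 ⊕ # 3 ⊕ (# 4 ⊕ # 0) ⊕ # 2))))
          (edge-apex ca (c≁A (here refl)) (fan-independent (e ∷ A~g) (here refl) (there (here refl))) ∷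
           edge-apex w~g (≁-sym d≁w) (≁-sym d≁g) ∷ o (there (here refl)) ∷ []) refl
          (lin tri↭ (lin q
              (permute ([ _ ] ∷ [ _ ] ∷ [ _ ] ∷ [ _ ] ∷ [ _ ] ∷ [ _ ] ∷ [ _ ] ∷ [ _ ] ∷ A′ ∷
                [ _ ] ∷ [ _ ] ∷ [ _ ] ∷ [ _ ] ∷ [ _ ] ∷ [ _ ] ∷ [ _ ] ∷ [])
                (# 0 ⊕ # 1 ⊕ # 2 ⊕ # 3 ⊕ # 4 ⊕ # 5 ⊕ # 6 ⊕ # 7 ⊕ ((# 8 ⊕ # 9) ⊕ # 10 ⊕ # 11 ⊕
                # 12) ⊕ # 13 ⊕ # 14 ⊕ # 15)
                (# 10 ⊕ # 13 ⊕ # 6 ⊕ # 12 ⊕ # 9 ⊕ # 11 ⊕ # 14 ⊕ # 15 ⊕ # 7 ⊕ (# 8 ⊕ # 0 ⊕ # 1 ⊕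
                # 2) ⊕ # 3 ⊕ # 4 ⊕ # 5))))
      ... | inj₂ (as , rs , p , len , al , nl) =
        too-many {c ∷ w ∷ as} {d ∷ rs ++ g ∷ []}
          (lin (↭-sym (flat-↭ π)) (lin (↭-sym tri↭) (lin (↭-sym p)
              (permute ([ _ ] ∷ [ _ ] ∷ A′ ∷ [ _ ] ∷ [ _ ] ∷ as ∷ [ _ ] ∷ rs ∷ [ _ ] ∷ (flat ts) ∷
                [ _ ] ∷ [ _ ] ∷ [ _ ] ∷ (flat ts′) ∷ [])
                (# 0 ⊕ # 1 ⊕ (((# 2 ⊕ # 3 ⊕ # 4 ⊕ # 5 ⊕ # 6 ⊕ # 7 ⊕ # 8) ⊕ # 9) ⊕ # 10 ⊕ # 11 ⊕
                # 12) ⊕ # 13)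
                ((((# 9 ⊕ # 0 ⊕ # 1 ⊕ # 2 ⊕ # 8) ⊕ # 10 ⊕ # 11 ⊕ # 12 ⊕ # 13) ⊕ # 3 ⊕ # 6 ⊕ # 4) ⊕
                # 5 ⊕ # 7)))))
          (cong suc (≡-trans (cong suc len) (≡-sym (↭-length π)))) ind
        where
        fan : All (_~ g) (A ++ w ∷ as)
        fan = AllP.++⁺ A~g (w~g ∷ al)
        c≁ : All (c ≁_) (A ++ w ∷ as)
        c≁ = AllP.++⁺ (All.tabulate c≁A) (c≁w ∷ nl)
        place : ∀ {x} → x ∈ₗ A ++ c ∷ w ∷ as → x ≡ c ⊎ x ∈ₗ A ++ w ∷ as
        place i with ∈-resp-↭ (shift c A (w ∷ as)) i
        ... | here e  = inj₁ e
        ... | there j = inj₂ j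
        ind : Independent (A ++ c ∷ w ∷ as)
        ind i j with place i | place j
        ... | inj₁ refl | inj₁ refl = ≁-refl
        ... | inj₁ refl | inj₂ j′ = All.lookup c≁ j′
        ... | inj₂ i′ | inj₁ refl = ≁-sym (All.lookup c≁ i′)
        ... | inj₂ i′ | inj₂ j′ = fan-independent fan i′ j′

      sift : ∀ us → (∀ {t} → t ∈ₗ us → Loose t ⊎ Double t) →
             (∃ λ t → ∃ λ us′ → us ↭ t ∷ us′ × Double t × (∀ {t} → t ∈ₗ us′ → Alpha t)) ⊎
             (∀ {t} → t ∈ₗ us → Loose t)
      sift [] f = inj₂ λ ()
      sift (t ∷ us) f with f (here refl) | sift us (f ∘ there)
      ... | inj₂ D | _ = inj₁ (t , us , refl , D , λ i → case f (there i) of λ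
              { (inj₁ L) → loose-α L ; (inj₂ (double a a′ x p e _)) → a , a′ , x , p , e })
      ... | inj₁ L | inj₂ all = inj₂ λ { (here refl) → L ; (there i) → all i }
      ... | inj₁ L | inj₁ (t′ , us′ , p , D , g) =
            inj₁ (t′ , t ∷ us′ , lin p
                (permute ([ _ ] ∷ us ∷ [ _ ] ∷ us′ ∷ [])
                  (# 0 ⊕ # 1 ⊕ # 2 ⊕ # 3)
                  (# 2 ⊕ # 0 ⊕ # 3 ⊕ # 1)) , D , λ { (here refl) → loose-α L ; (there i) → g i })

      isolated-edge-impossible : (∀ {t} → t ∈ₗ ts → Pentagon t → ⊥) → ⊥
      isolated-edge-impossible np with sift ts′ (λ i → analyse i (np (∈-resp-↭ (↭-sym π) (there i))))
      ... | inj₂ all = all-loose all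
      ... | inj₁ (t , us , p , D , f) = no-double {t} {t₀ ∷ us} (lin π (lin p
          (permute (ts ∷ [ _ ] ∷ ts′ ∷ [ _ ] ∷ us ∷ [])
            ((# 0 ⊕ # 1 ⊕ # 2) ⊕ # 3 ⊕ # 4)
            (# 3 ⊕ # 1 ⊕ (# 4 ⊕ # 0) ⊕ # 2))))
        (λ { (here refl) → loose-α t₀-loose ; (there i) → f i }) D

-- A five-cycle together with an isolated vertex w and one further packing triple: for some
-- centre vᵢ the triple and vᵢ₋₁, vᵢ, vᵢ₊₁ split into two odd triples, which the opposite edge
-- completes with w. That such a centre always exists is checked over all adjacencies.
module CycleSearch where

  odd₃ : Bool → Bool → Bool → Bool
  odd₃ a b c = a xor (b xor c)

  -- The argument order is that of the pairs of c, d, w, l, v, r in lexicographic order.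
  splits : (cd cw cl cv cr dw dl dv dr wl wv wr lv lr vr : Bool) → Bool
  splits cd cw cl cv cr dw dl dv dr wl wv wr lv lr vr =
    (odd₃ cd cl dl ∧ odd₃ wv wr vr) ∨ (odd₃ cd cv dv ∧ odd₃ wl wr lr) ∨
    (odd₃ cd cr dr ∧ odd₃ wl wv lv) ∨ (odd₃ cw cl wl ∧ odd₃ dv dr vr) ∨
    (odd₃ cw cv wv ∧ odd₃ dl dr lr) ∨ (odd₃ cw cr wr ∧ odd₃ dl dv lv) ∨
    (odd₃ cl cv lv ∧ odd₃ dw dr wr) ∨ (odd₃ cl cr lr ∧ odd₃ dw dv wv) ∨
    (odd₃ cv cr vr ∧ odd₃ dw dl wl)

  -- The constants are the known pairs: `c d` is an edge that misses `w`, and `l v r` is an induced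
  -- path.
  centred : (cl cv cr dl dv dr wl wv wr : Bool) → Bool
  centred cl cv cr dl dv dr wl wv wr = splits true false cl cv cr false dl dv dr wl wv wr true false true

  some-centre : (c₀ c₁ c₂ c₃ c₄ d₀ d₁ d₂ d₃ d₄ w₀ w₁ w₂ w₃ w₄ : Bool) → Bool
  some-centre c₀ c₁ c₂ c₃ c₄ d₀ d₁ d₂ d₃ d₄ w₀ w₁ w₂ w₃ w₄ =
    centred c₄ c₀ c₁ d₄ d₀ d₁ w₄ w₀ w₁ ∨ centred c₀ c₁ c₂ d₀ d₁ d₂ w₀ w₁ w₂ ∨
    centred c₁ c₂ c₃ d₁ d₂ d₃ w₁ w₂ w₃ ∨ centred c₂ c₃ c₄ d₂ d₃ d₄ w₂ w₃ w₄ ∨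
    centred c₃ c₄ c₀ d₃ d₄ d₀ w₃ w₄ w₀

  -- Triangle-freeness for one vertex: no two consecutive cycle vertices are neighbours of it.
  on-cycle : (x₀ x₁ x₂ x₃ x₄ : Bool) → Bool
  on-cycle x₀ x₁ x₂ x₃ x₄ = not ((x₀ ∧ x₁) ∨ (x₁ ∧ x₂) ∨ (x₂ ∧ x₃) ∨ (x₃ ∧ x₄) ∨ (x₄ ∧ x₀))

  apart : (x₀ x₁ x₂ x₃ x₄ y₀ y₁ y₂ y₃ y₄ : Bool) → Bool
  apart x₀ x₁ x₂ x₃ x₄ y₀ y₁ y₂ y₃ y₄ =
    not ((x₀ ∧ y₀) ∨ (x₁ ∧ y₁) ∨ (x₂ ∧ y₂) ∨ (x₃ ∧ y₃) ∨ (x₄ ∧ y₄))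

  infixr 4 _⇒_
  _⇒_ : Bool → Bool → Bool
  true  ⇒ b = b
  false ⇒ b = true

  ⇒-elim : ∀ {a b} → (a ⇒ b) ≡ true → a ≡ true → b ≡ true
  ⇒-elim p refl = p

  ∧-elim : ∀ {a b} → a ∧ b ≡ true → a ≡ true × b ≡ true
  ∧-elim {true} p = refl , p

  ∨-elim : ∀ {a b} → a ∨ b ≡ true → a ≡ true ⊎ b ≡ true
  ∨-elim {true}  p = inj₁ refl
  ∨-elim {false} p = inj₂ p

  Bool⁵ : Set
  Bool⁵ = Bool → Bool → Bool → Bool → Bool → Bool

  both : (Bool → Bool) → Bool
  both g = g true ∧ g false

  both-elim : ∀ g x → both g ≡ true → g x ≡ true
  both-elim g true  p = proj₁ (∧-elim p)
  both-elim g false p = proj₂ (∧-elim {g true} p)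

  every : Bool⁵ → Bool
  every f = both λ a → both λ b → both λ c → both λ d → both λ e → f a b c d e

  every-elim : ∀ f → every f ≡ true → ∀ a b c d e → f a b c d e ≡ true
  every-elim f p a b c d e =
    both-elim (f a b c d) e
      (both-elim (λ d → both (f a b c d)) d
        (both-elim (λ c → both λ d → both (f a b c d)) c
          (both-elim (λ b → both λ c → both λ d → both (f a b c d)) b
            (both-elim (λ a → both λ b → both λ c → both λ d → both (f a b c d)) a p))))

  module _ (c₀ c₁ c₂ c₃ c₄ : Bool) where

    search-w : (d₀ d₁ d₂ d₃ d₄ : Bool) → Bool⁵
    search-w d₀ d₁ d₂ d₃ d₄ w₀ w₁ w₂ w₃ w₄ =
      on-cycle w₀ w₁ w₂ w₃ w₄ ⇒ some-centre c₀ c₁ c₂ c₃ c₄ d₀ d₁ d₂ d₃ d₄ w₀ w₁ w₂ w₃ w₄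

    search-d : Bool⁵
    search-d d₀ d₁ d₂ d₃ d₄ = on-cycle d₀ d₁ d₂ d₃ d₄ ⇒
      apart c₀ c₁ c₂ c₃ c₄ d₀ d₁ d₂ d₃ d₄ ⇒ every (search-w d₀ d₁ d₂ d₃ d₄)

  -- Nesting the three enumerations cuts off inadmissible rows before the next vertex is enumerated,
  -- which keeps the evaluation small.
  search-c : Bool⁵
  search-c c₀ c₁ c₂ c₃ c₄ = on-cycle c₀ c₁ c₂ c₃ c₄ ⇒ every (search-d c₀ c₁ c₂ c₃ c₄)

  search-succeeds : every search-c ≡ true
  search-succeeds = refl

  centre-exists : ∀ c₀ c₁ c₂ c₃ c₄ d₀ d₁ d₂ d₃ d₄ w₀ w₁ w₂ w₃ w₄ →
    on-cycle c₀ c₁ c₂ c₃ c₄ ≡ true → on-cycle d₀ d₁ d₂ d₃ d₄ ≡ true →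
    apart c₀ c₁ c₂ c₃ c₄ d₀ d₁ d₂ d₃ d₄ ≡ true → on-cycle w₀ w₁ w₂ w₃ w₄ ≡ true →
    some-centre c₀ c₁ c₂ c₃ c₄ d₀ d₁ d₂ d₃ d₄ w₀ w₁ w₂ w₃ w₄ ≡ true
  centre-exists c₀ c₁ c₂ c₃ c₄ d₀ d₁ d₂ d₃ d₄ w₀ w₁ w₂ w₃ w₄ p q r s =
    ⇒-elim (every-elim (search-w c₀ c₁ c₂ c₃ c₄ d₀ d₁ d₂ d₃ d₄) (⇒-elim (⇒-elim
      (every-elim (search-d c₀ c₁ c₂ c₃ c₄)
        (⇒-elim (every-elim search-c search-succeeds c₀ c₁ c₂ c₃ c₄) p) d₀ d₁ d₂ d₃ d₄) q) r) w₀ w₁ w₂ w₃ w₄) s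

module Pentagons (𝓗 : TriangleFree) where

  open Triples 𝓗
  open CycleSearch

  split₆ : ∀ {c d w l v r} → c ~ d → c ≁ w → d ≁ w → l ~ v → l ≁ r → v ~ r →
           centred (h c l) (h c v) (h c r) (h d l) (h d v) (h d r) (h w l) (h w v) (h w r) ≡ true →
           ∃ λ s → ∃ λ t → Odd s × Odd t × c ∷ d ∷ w ∷ l ∷ v ∷ r ∷ [] ↭ tri s ++ tri t
  split₆ {c} {d} {w} {l} {v} {r} cd cw dw lv lr vr p = extract (restore p)
    where
    restore : centred (h c l) (h c v) (h c r) (h d l) (h d v) (h d r) (h w l) (h w v) (h w r) ≡ true →
      splits (h c d) (h c w) (h c l) (h c v) (h c r) (h d w) (h d l) (h d v) (h d r)
             (h w l) (h w v) (h w r) (h l v) (h l r) (h v r) ≡ true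
    restore p rewrite cd | cw | dw | lv | lr | vr = p
    extract : splits (h c d) (h c w) (h c l) (h c v) (h c r) (h d w) (h d l) (h d v) (h d r)
             (h w l) (h w v) (h w r) (h l v) (h l r) (h v r) ≡ true → _
    extract p with ∨-elim p
    ... | inj₁ e = (c , d , l) , (w , v , r) , proj₁ (∧-elim e) , proj₂ (∧-elim {odd c d l} e) ,
        (permute ([ _ ] ∷ [ _ ] ∷ [ _ ] ∷ [ _ ] ∷ [ _ ] ∷ [ _ ] ∷ [])
          (# 0 ⊕ # 1 ⊕ # 2 ⊕ # 3 ⊕ # 4 ⊕ # 5)
          (# 0 ⊕ # 1 ⊕ # 3 ⊕ # 2 ⊕ # 4 ⊕ # 5))
    ... | inj₂ p with ∨-elim p
    ... | inj₁ e = (c , d , v) , (w , l , r) , proj₁ (∧-elim e) , proj₂ (∧-elim {odd c d v} e) ,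
        (permute ([ _ ] ∷ [ _ ] ∷ [ _ ] ∷ [ _ ] ∷ [ _ ] ∷ [ _ ] ∷ [])
          (# 0 ⊕ # 1 ⊕ # 2 ⊕ # 3 ⊕ # 4 ⊕ # 5)
          (# 0 ⊕ # 1 ⊕ # 4 ⊕ # 2 ⊕ # 3 ⊕ # 5))
    ... | inj₂ p with ∨-elim p
    ... | inj₁ e = (c , d , r) , (w , l , v) , proj₁ (∧-elim e) , proj₂ (∧-elim {odd c d r} e) ,
        (permute ([ _ ] ∷ [ _ ] ∷ [ _ ] ∷ [ _ ] ∷ [ _ ] ∷ [ _ ] ∷ [])
          (# 0 ⊕ # 1 ⊕ # 2 ⊕ # 3 ⊕ # 4 ⊕ # 5)
          (# 0 ⊕ # 1 ⊕ # 5 ⊕ # 2 ⊕ # 3 ⊕ # 4))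
    ... | inj₂ p with ∨-elim p
    ... | inj₁ e = (c , w , l) , (d , v , r) , proj₁ (∧-elim e) , proj₂ (∧-elim {odd c w l} e) ,
        (permute ([ _ ] ∷ [ _ ] ∷ [ _ ] ∷ [ _ ] ∷ [ _ ] ∷ [ _ ] ∷ [])
          (# 0 ⊕ # 1 ⊕ # 2 ⊕ # 3 ⊕ # 4 ⊕ # 5)
          (# 0 ⊕ # 2 ⊕ # 3 ⊕ # 1 ⊕ # 4 ⊕ # 5))
    ... | inj₂ p with ∨-elim p
    ... | inj₁ e = (c , w , v) , (d , l , r) , proj₁ (∧-elim e) , proj₂ (∧-elim {odd c w v} e) ,
        (permute ([ _ ] ∷ [ _ ] ∷ [ _ ] ∷ [ _ ] ∷ [ _ ] ∷ [ _ ] ∷ [])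
          (# 0 ⊕ # 1 ⊕ # 2 ⊕ # 3 ⊕ # 4 ⊕ # 5)
          (# 0 ⊕ # 2 ⊕ # 4 ⊕ # 1 ⊕ # 3 ⊕ # 5))
    ... | inj₂ p with ∨-elim p
    ... | inj₁ e = (c , w , r) , (d , l , v) , proj₁ (∧-elim e) , proj₂ (∧-elim {odd c w r} e) ,
        (permute ([ _ ] ∷ [ _ ] ∷ [ _ ] ∷ [ _ ] ∷ [ _ ] ∷ [ _ ] ∷ [])
          (# 0 ⊕ # 1 ⊕ # 2 ⊕ # 3 ⊕ # 4 ⊕ # 5)
          (# 0 ⊕ # 2 ⊕ # 5 ⊕ # 1 ⊕ # 3 ⊕ # 4))
    ... | inj₂ p with ∨-elim p
    ... | inj₁ e = (c , l , v) , (d , w , r) , proj₁ (∧-elim e) , proj₂ (∧-elim {odd c l v} e) ,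
        (permute ([ _ ] ∷ [ _ ] ∷ [ _ ] ∷ [ _ ] ∷ [ _ ] ∷ [ _ ] ∷ [])
          (# 0 ⊕ # 1 ⊕ # 2 ⊕ # 3 ⊕ # 4 ⊕ # 5)
          (# 0 ⊕ # 3 ⊕ # 4 ⊕ # 1 ⊕ # 2 ⊕ # 5))
    ... | inj₂ p with ∨-elim p
    ... | inj₁ e = (c , l , r) , (d , w , v) , proj₁ (∧-elim e) , proj₂ (∧-elim {odd c l r} e) ,
        (permute ([ _ ] ∷ [ _ ] ∷ [ _ ] ∷ [ _ ] ∷ [ _ ] ∷ [ _ ] ∷ [])
          (# 0 ⊕ # 1 ⊕ # 2 ⊕ # 3 ⊕ # 4 ⊕ # 5)
          (# 0 ⊕ # 3 ⊕ # 5 ⊕ # 1 ⊕ # 2 ⊕ # 4))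
    ... | inj₂ e = (c , v , r) , (d , w , l) , proj₁ (∧-elim e) , proj₂ (∧-elim {odd c v r} e) ,
        (permute ([ _ ] ∷ [ _ ] ∷ [ _ ] ∷ [ _ ] ∷ [ _ ] ∷ [ _ ] ∷ [])
          (# 0 ⊕ # 1 ⊕ # 2 ⊕ # 3 ⊕ # 4 ⊕ # 5)
          (# 0 ⊕ # 4 ⊕ # 5 ⊕ # 1 ⊕ # 2 ⊕ # 3))

  not-both : ∀ {x y z} → y ~ z → h x y ∧ h x z ≡ false
  not-both {x} {y} {z} e with ~∨≁ x y
  ... | inj₁ p rewrite p = common⇒≁ (~-sym p) e
  ... | inj₂ p rewrite p = refl

  none-of : ∀ {a b c d e} → a ≡ false → b ≡ false → c ≡ false → d ≡ false → e ≡ false →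
            not (a ∨ b ∨ c ∨ d ∨ e) ≡ true
  none-of refl refl refl refl refl = refl

  module _ {v₀ v₁ v₂ v₃ v₄ w c d o : V}
    (e₀₁ : v₀ ~ v₁) (e₁₂ : v₁ ~ v₂) (e₂₃ : v₂ ~ v₃) (e₃₄ : v₃ ~ v₄) (e₄₀ : v₄ ~ v₀)
    (w₀ : w ≁ v₀) (w₁ : w ≁ v₁) (w₂ : w ≁ v₂) (w₃ : w ≁ v₃) (w₄ : w ≁ v₄)
    (cd : c ~ d) (co : c ≁ o) (do′ : d ≁ o) where

    Result : Set
    Result = ∃ λ r → ∃ λ s → ∃ λ t → Odd r × Odd s × Odd t ×
             v₀ ∷ v₁ ∷ v₂ ∷ v₃ ∷ v₄ ∷ w ∷ c ∷ d ∷ o ∷ [] ↭ tri r ++ tri s ++ tri t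

    avoids : ∀ x → on-cycle (h x v₀) (h x v₁) (h x v₂) (h x v₃) (h x v₄) ≡ true
    avoids x = none-of (not-both e₀₁) (not-both e₁₂) (not-both e₂₃) (not-both e₃₄) (not-both e₄₀)

    separate : ∀ {x} → h c x ∧ h d x ≡ false
    separate {x} with ~∨≁ c x
    ... | inj₁ p rewrite p = common⇒≁ cd p
    ... | inj₂ p rewrite p = refl

    at-centre : ∀ {l v r x y} → l ~ v → v ~ r → l ≁ r → x ~ y → w ≁ x → w ≁ y →
      v₀ ∷ v₁ ∷ v₂ ∷ v₃ ∷ v₄ ∷ [] ↭ l ∷ v ∷ r ∷ x ∷ y ∷ [] →
      centred (h c l) (h c v) (h c r) (h d l) (h d v) (h d r) (h o l) (h o v) (h o r) ≡ true → Result
    at-centre {x = x} {y} lv vr lr xy wx wy π p with split₆ cd co do′ lv lr vr p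
    ... | s , t , os , ot , ρ =
      (x , y , w) , s , t , edge-apex xy (≁-sym wx) (≁-sym wy) , os , ot , lin π (lin ρ
          (permute ([ _ ] ∷ [ _ ] ∷ [ _ ] ∷ [ _ ] ∷ [ _ ] ∷ [ _ ] ∷ [ _ ] ∷ [ _ ] ∷ [ _ ] ∷ [ _ ] ∷
            [ _ ] ∷ [ _ ] ∷ [ _ ] ∷ [ _ ] ∷ [ _ ] ∷ [ _ ] ∷ [ _ ] ∷ [ _ ] ∷ [ _ ] ∷ [ _ ] ∷ [])
            (# 0 ⊕ # 1 ⊕ # 2 ⊕ # 3 ⊕ # 4 ⊕ # 5 ⊕ # 6 ⊕ # 7 ⊕ # 8 ⊕ # 9 ⊕ # 10 ⊕ # 11 ⊕ # 12 ⊕ # 13 ⊕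
            # 14 ⊕ # 15 ⊕ # 16 ⊕ # 17 ⊕ # 18 ⊕ # 19)
            (# 12 ⊕ # 13 ⊕ # 5 ⊕ # 14 ⊕ # 15 ⊕ # 16 ⊕ # 17 ⊕ # 18 ⊕ # 19 ⊕ # 0 ⊕ # 1 ⊕ # 2 ⊕ # 3 ⊕
            # 4 ⊕ # 6 ⊕ # 7 ⊕ # 8 ⊕ # 9 ⊕ # 10 ⊕ # 11)))

    three-odd : Result
    three-odd with ∨-elim (centre-exists
        (h c v₀) (h c v₁) (h c v₂) (h c v₃) (h c v₄) (h d v₀) (h d v₁) (h d v₂) (h d v₃) (h d v₄)
        (h o v₀) (h o v₁) (h o v₂) (h o v₃) (h o v₄) (avoids c) (avoids d)
        (none-of separate separate separate separate separate) (avoids o))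
    ... | inj₁ p = at-centre e₄₀ e₀₁ (common⇒≁ (~-sym e₄₀) e₀₁) e₂₃ w₂ w₃
        (permute ([ _ ] ∷ [ _ ] ∷ [ _ ] ∷ [ _ ] ∷ [ _ ] ∷ [])
          (# 0 ⊕ # 1 ⊕ # 2 ⊕ # 3 ⊕ # 4)
          (# 4 ⊕ # 0 ⊕ # 1 ⊕ # 2 ⊕ # 3)) p
    ... | inj₂ p with ∨-elim p
    ... | inj₁ p = at-centre e₀₁ e₁₂ (common⇒≁ (~-sym e₀₁) e₁₂) e₃₄ w₃ w₄
        (permute ([ _ ] ∷ [ _ ] ∷ [ _ ] ∷ [ _ ] ∷ [ _ ] ∷ [])
          (# 0 ⊕ # 1 ⊕ # 2 ⊕ # 3 ⊕ # 4)
          (# 0 ⊕ # 1 ⊕ # 2 ⊕ # 3 ⊕ # 4)) p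
    ... | inj₂ p with ∨-elim p
    ... | inj₁ p = at-centre e₁₂ e₂₃ (common⇒≁ (~-sym e₁₂) e₂₃) e₄₀ w₄ w₀
        (permute ([ _ ] ∷ [ _ ] ∷ [ _ ] ∷ [ _ ] ∷ [ _ ] ∷ [])
          (# 0 ⊕ # 1 ⊕ # 2 ⊕ # 3 ⊕ # 4)
          (# 1 ⊕ # 2 ⊕ # 3 ⊕ # 4 ⊕ # 0)) p
    ... | inj₂ p with ∨-elim p
    ... | inj₁ p = at-centre e₂₃ e₃₄ (common⇒≁ (~-sym e₂₃) e₃₄) e₀₁ w₀ w₁
        (permute ([ _ ] ∷ [ _ ] ∷ [ _ ] ∷ [ _ ] ∷ [ _ ] ∷ [])
          (# 0 ⊕ # 1 ⊕ # 2 ⊕ # 3 ⊕ # 4)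
          (# 2 ⊕ # 3 ⊕ # 4 ⊕ # 0 ⊕ # 1)) p
    ... | inj₂ p = at-centre e₃₄ e₄₀ (common⇒≁ (~-sym e₃₄) e₄₀) e₁₂ w₁ w₂
        (permute ([ _ ] ∷ [ _ ] ∷ [ _ ] ∷ [ _ ] ∷ [ _ ] ∷ [])
          (# 0 ⊕ # 1 ⊕ # 2 ⊕ # 3 ⊕ # 4)
          (# 3 ⊕ # 4 ⊕ # 0 ⊕ # 1 ⊕ # 2)) p

-- A leftover biclique is impossible.

module LeftoverImpossible (𝓗 : TriangleFree) where

  open Triples 𝓗
  open Leftover 𝓗
  open Classification 𝓗
  open Conclusion 𝓗
  open IsolatedEdges 𝓗
  open Pentagons 𝓗

  record Situation (a₀ a₁ : V) (A′ : List V) (g : V) (B′ : List V) (ts : List Triple) : Set where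
    field
      odds   : All Odd ts
      bip    : Complete (a₀ ∷ a₁ ∷ A′) (g ∷ B′)
      stuck  : ∀ W rest → length W ≡ suc (length ts) → All Odd W →
               flat W ++ rest ↭ flat ts ++ (a₀ ∷ a₁ ∷ A′) ++ (g ∷ B′) → ⊥
      αbound : IndependentBound (suc (length ts)) (flat ts ++ (a₀ ∷ a₁ ∷ A′) ++ (g ∷ B′))
      βbound : BicliqueBound (suc (length ts)) (flat ts ++ (a₀ ∷ a₁ ∷ A′) ++ (g ∷ B′))
      ¬wheel : length ts ≡ 1 → Wheel (flat ts ++ (a₀ ∷ a₁ ∷ A′) ++ (g ∷ B′)) → ⊥

  module Analysis {a₀ a₁ A′ g B′ ts} (S : Situation a₀ a₁ A′ g B′ ts) where

    open Situation S
    open Classes a₀ a₁ A′ g B′ ts odds bip stuck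
    module K = Kinds a₀ a₁ A′ g B′ ts odds bip stuck

    -- If there is no other triple, the whole set is the excluded wheel. Otherwise the six vertices
    -- and another triple split into three odd triples, one more than before.
    pentagon-impossible : B′ ≡ [] → ∀ {t ts′} → ts ↭ t ∷ ts′ → Pentagon t → ⊥
    pentagon-impossible refl {t} {ts′} π (pentagon f₁ f₂ c d w A↭ tri↭ c~d c~f₁ d~f₂ (w≁g , w≁f₁ , w≁c , w≁d , w≁f₂)) =
      go ts′ π
      where
      f₁~g = bip (∈-resp-↭ (↭-sym A↭) (here refl)) (here refl)
      f₂~g = bip (∈-resp-↭ (↭-sym A↭) (there (here refl))) (here refl)
      go : ∀ ts″ → ts ↭ t ∷ ts″ → ⊥
      go [] π′ = ¬wheel (↭-length π′)
        (wheel g f₁ c d f₂ w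
          (lin (flat-↭ π′) (lin tri↭ (lin A↭
              (permute ((flat ts) ∷ [ _ ] ∷ [ _ ] ∷ A′ ∷ [ _ ] ∷ [ _ ] ∷ [ _ ] ∷ [ _ ] ∷ [ _ ] ∷
                [ _ ] ∷ [ _ ] ∷ [ _ ] ∷ [ _ ] ∷ [])
                ((((# 0 ⊕ # 1 ⊕ # 2 ⊕ # 3 ⊕ # 4) ⊕ # 5 ⊕ # 6 ⊕ # 7) ⊕ # 8 ⊕ # 9 ⊕ # 10) ⊕ # 11 ⊕
                # 12)
                (# 4 ⊕ # 11 ⊕ # 8 ⊕ # 9 ⊕ # 12 ⊕ # 10 ⊕ (# 0 ⊕ # 5 ⊕ # 6 ⊕ # 7) ⊕ # 1 ⊕ # 2 ⊕ # 3)))))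
          (~-sym f₁~g) (~-sym c~f₁) c~d d~f₂ f₂~g (w≁g , w≁f₁ , w≁c , w≁d , w≁f₂))
      go (t′ ∷ ts″) π′ with Odd-view (All.lookup odds (∈-resp-↭ (↭-sym π′) (there (here refl))))
      ... | v = finish (three v)
        where
        three : _ → ∃ λ r → ∃ λ s → ∃ λ u → Odd r × Odd s × Odd u ×
                g ∷ f₁ ∷ c ∷ d ∷ f₂ ∷ w ∷ tri t′ ↭ tri r ++ tri s ++ tri u
        three (inj₁ (e , n , n′)) =
          three-odd (~-sym f₁~g) (~-sym c~f₁) c~d d~f₂ f₂~g w≁g w≁f₁ w≁c w≁d w≁f₂ e n n′
        three (inj₂ (inj₁ (e , n , n′)))
          with three-odd (~-sym f₁~g) (~-sym c~f₁) c~d d~f₂ f₂~g w≁g w≁f₁ w≁c w≁d w≁f₂ e n (≁-sym n′)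
        ... | r , s , u , or , os , ou , ρ = r , s , u , or , os , ou , lin ρ
            (permute ([ _ ] ∷ [ _ ] ∷ [ _ ] ∷ [ _ ] ∷ [ _ ] ∷ [ _ ] ∷ [ _ ] ∷ [ _ ] ∷ [ _ ] ∷
              [ _ ] ∷ [ _ ] ∷ [ _ ] ∷ [ _ ] ∷ [ _ ] ∷ [ _ ] ∷ [ _ ] ∷ [ _ ] ∷ [ _ ] ∷ [])
              (# 0 ⊕ # 1 ⊕ # 2 ⊕ # 3 ⊕ # 4 ⊕ # 5 ⊕ # 6 ⊕ # 7 ⊕ # 8 ⊕ # 9 ⊕ # 10 ⊕ # 11 ⊕ # 12 ⊕
              # 13 ⊕ # 14 ⊕ # 15 ⊕ # 16 ⊕ # 17)
              (# 9 ⊕ # 10 ⊕ # 11 ⊕ # 12 ⊕ # 13 ⊕ # 14 ⊕ # 15 ⊕ # 16 ⊕ # 17 ⊕ # 0 ⊕ # 1 ⊕ # 2 ⊕ # 3 ⊕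
              # 4 ⊕ # 5 ⊕ # 6 ⊕ # 8 ⊕ # 7))
        three (inj₂ (inj₂ (e , n , n′)))
          with three-odd (~-sym f₁~g) (~-sym c~f₁) c~d d~f₂ f₂~g w≁g w≁f₁ w≁c w≁d w≁f₂ e (≁-sym n) (≁-sym n′)
        ... | r , s , u , or , os , ou , ρ = r , s , u , or , os , ou , lin ρ
            (permute ([ _ ] ∷ [ _ ] ∷ [ _ ] ∷ [ _ ] ∷ [ _ ] ∷ [ _ ] ∷ [ _ ] ∷ [ _ ] ∷ [ _ ] ∷
              [ _ ] ∷ [ _ ] ∷ [ _ ] ∷ [ _ ] ∷ [ _ ] ∷ [ _ ] ∷ [ _ ] ∷ [ _ ] ∷ [ _ ] ∷ [])
              (# 0 ⊕ # 1 ⊕ # 2 ⊕ # 3 ⊕ # 4 ⊕ # 5 ⊕ # 6 ⊕ # 7 ⊕ # 8 ⊕ # 9 ⊕ # 10 ⊕ # 11 ⊕ # 12 ⊕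
              # 13 ⊕ # 14 ⊕ # 15 ⊕ # 16 ⊕ # 17)
              (# 9 ⊕ # 10 ⊕ # 11 ⊕ # 12 ⊕ # 13 ⊕ # 14 ⊕ # 15 ⊕ # 16 ⊕ # 17 ⊕ # 0 ⊕ # 1 ⊕ # 2 ⊕ # 3 ⊕
              # 4 ⊕ # 5 ⊕ # 7 ⊕ # 8 ⊕ # 6))
        finish : _ → ⊥
        finish (r , s , u , or , os , ou , ρ) =
          augment (t ∷ t′ ∷ []) {ts″} (r ∷ s ∷ u ∷ []) [] π′ (or ∷ os ∷ ou ∷ []) refl
            (lin tri↭ (lin A↭ (lin ρ
                (permute ([ _ ] ∷ [ _ ] ∷ [ _ ] ∷ [ _ ] ∷ [ _ ] ∷ [ _ ] ∷ [ _ ] ∷ [ _ ] ∷ A′ ∷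
                  [ _ ] ∷ [ _ ] ∷ [ _ ] ∷ [ _ ] ∷ [ _ ] ∷ [ _ ] ∷ [ _ ] ∷ [ _ ] ∷ [ _ ] ∷ [ _ ] ∷
                  [ _ ] ∷ [ _ ] ∷ [ _ ] ∷ [ _ ] ∷ [ _ ] ∷ [])
                  (# 0 ⊕ # 1 ⊕ # 2 ⊕ # 3 ⊕ # 4 ⊕ # 5 ⊕ # 6 ⊕ # 7 ⊕ (((# 8 ⊕ # 9) ⊕ # 10 ⊕ # 11 ⊕
                  # 12) ⊕ # 13 ⊕ # 14) ⊕ # 15 ⊕ # 16 ⊕ # 17 ⊕ # 18 ⊕ # 19 ⊕ # 20 ⊕ # 21 ⊕ # 22 ⊕
                  # 23)
                  (# 15 ⊕ # 16 ⊕ # 17 ⊕ # 18 ⊕ # 19 ⊕ # 20 ⊕ # 21 ⊕ # 22 ⊕ # 23 ⊕ # 0 ⊕ # 1 ⊕ # 2 ⊕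
                  # 6 ⊕ # 7 ⊕ # 8 ⊕ # 9 ⊕ # 13 ⊕ # 10 ⊕ # 11 ⊕ # 14 ⊕ # 12 ⊕ # 3 ⊕ # 4 ⊕ # 5)))))

    data Kind (t : Triple) : Set where
      mixedK : Mixed t → Kind t
      pureK  : Pure t → Kind t

    record Assembled (us : List Triple) : Set where
      constructor assembled
      field
        Ns : List K.Mix
        {l} : ℕ
        Ps : Fin l → K.Pur
        decomp : flat us ↭ flat (map K.mtri Ns) ++
                 tabulate (K.Pur.p ∘ Ps) ++ tabulate (K.Pur.q ∘ Ps) ++ tabulate (K.Pur.o ∘ Ps)
        count : length us ≡ length Ns + l

    cons : ∀ {X : Set} {n} → X → (Fin n → X) → Fin (suc n) → X
    cons x f zero    = x
    cons x f (suc i) = f i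

    assemble : ∀ us → (∀ {t} → t ∈ₗ us → Kind t) → Assembled us
    assemble [] f = assembled [] {0} (λ ()) refl refl
    assemble (t ∷ us) f with f (here refl) | assemble us (f ∘ there)
    ... | mixedK (mixed m y y′ s s′ p o nf yf y′f) | assembled Ns Ps dec cnt =
      assembled (K.mix m y y′ s s′ o nf yf y′f ∷ Ns) Ps (lin p (lin dec
          (permute ([ _ ] ∷ [ _ ] ∷ [ _ ] ∷ (flat us) ∷ [ _ ] ∷ [ _ ] ∷ [ _ ] ∷
            (flat (map K.mtri Ns)) ∷ (tabulate (K.Pur.p ∘ Ps)) ∷ (tabulate (K.Pur.q ∘ Ps)) ∷
            (tabulate (K.Pur.o ∘ Ps)) ∷ [])
            (# 0 ⊕ # 1 ⊕ # 2 ⊕ (# 3 ⊕ # 4 ⊕ # 5 ⊕ # 6) ⊕ # 7 ⊕ # 8 ⊕ # 9 ⊕ # 10)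
            (# 4 ⊕ # 5 ⊕ # 6 ⊕ ((# 7 ⊕ # 8 ⊕ # 9 ⊕ # 10) ⊕ # 0 ⊕ # 1 ⊕ # 2) ⊕ # 3)))) (cong suc cnt)
    ... | pureK (pure p q o s π od pf qf n of) | assembled Ns {l} Ps dec cnt =
      assembled Ns (cons (K.pur p q o s od pf qf n of) Ps) (lin π (lin dec
          (permute ([ _ ] ∷ [ _ ] ∷ [ _ ] ∷ (flat us) ∷ [ _ ] ∷ [ _ ] ∷ [ _ ] ∷
            (flat (map K.mtri Ns)) ∷ (tabulate (K.Pur.p ∘ Ps)) ∷ (tabulate (K.Pur.q ∘ Ps)) ∷
            (tabulate (K.Pur.o ∘ Ps)) ∷ [])
            (# 0 ⊕ # 1 ⊕ # 2 ⊕ (# 3 ⊕ # 4 ⊕ # 5 ⊕ # 6) ⊕ # 7 ⊕ # 8 ⊕ # 9 ⊕ # 10)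
            (((# 7 ⊕ # 4 ⊕ # 8 ⊕ # 5 ⊕ # 9 ⊕ # 6 ⊕ # 10) ⊕ # 0 ⊕ # 1 ⊕ # 2) ⊕ # 3))))
        (≡-trans (cong suc cnt) (≡-sym (+-suc (length Ns) l)))

    class : ∀ {t} → t ∈ₗ ts → Class t
    class i = classify (proj₂ (∈⇒↭ i)) (All.lookup odds i)

    no-pentagon : ∀ {t} → t ∈ₗ ts → B′ ≡ [] → Pentagon t → ⊥
    no-pentagon i star x = pentagon-impossible star (proj₂ (∈⇒↭ i)) x

    isolated-edge-impossible : B′ ≡ [] → ∀ {t} → t ∈ₗ ts → IsolatedEdge t → ⊥
    isolated-edge-impossible refl i x =
      Fan.isolated-edge-impossible a₀ a₁ A′ g ts odds bip stuck αbound (proj₂ (∈⇒↭ i)) x λ j → no-pentagon j refl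

    kind : ∀ {t} → t ∈ₗ ts → Kind t
    kind i with class i
    ... | isMixed x             = mixedK x
    ... | isPure x              = pureK x
    ... | isIsolatedEdge star x = ⊥-elim (isolated-edge-impossible star i x)
    ... | isPentagon star x     = ⊥-elim (no-pentagon i star x)

    impossible : ⊥
    impossible = K.Final.impossible Ns Ps decomp count αbound βbound
      where open Assembled (assemble ts kind)

excess : ∀ {a b} n → a ≤ b → a ≡ suc (b + n) → ⊥
excess {a} {b} n le e = m+1+n≰m b (≤-trans (≤-reflexive (≡-trans (+-suc b n) (≡-sym e))) le)

module _ {A : Set} where

  partitionᵇ : (p : A → Bool) (xs : List A) → ∃ λ ys → ∃ λ zs → xs ↭ ys ++ zs ×
               (∀ {x} → x ∈ₗ ys → p x ≡ true) × (∀ {x} → x ∈ₗ zs → p x ≡ false)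
  partitionᵇ p [] = [] , [] , refl , (λ ()) , (λ ())
  partitionᵇ p (x ∷ xs) with p x in e | partitionᵇ p xs
  ... | true  | ys , zs , π , f , g =
    x ∷ ys , zs , lin π
        (permute ([ _ ] ∷ xs ∷ ys ∷ zs ∷ []) (# 0 ⊕ # 1 ⊕ # 2 ⊕ # 3) (# 0 ⊕ (# 2 ⊕ # 3) ⊕ # 1)) , (λ { (here refl) → e ; (there i) → f i }) , g
  ... | false | ys , zs , π , f , g =
    ys , x ∷ zs , lin π
        (permute ([ _ ] ∷ xs ∷ ys ∷ zs ∷ []) (# 0 ⊕ # 1 ⊕ # 2 ⊕ # 3) ((# 2 ⊕ # 0 ⊕ # 3) ⊕ # 1)) , f , (λ { (here refl) → e ; (there i) → g i })

-- `P` is undecidable, so the current witness is handed to the continuation as largest; an objection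
-- to that is a larger witness, from which the climb resumes.
maximum : ∀ {P : ℕ → Set} n b → (∀ m → P m → m ≤ b) → P n →
          ((∃ λ m → P m × (∀ m′ → P m′ → m′ ≤ m)) → ⊥) → ⊥
maximum {P} n b bounded pn k = climb (b ∸ n) n ≤-refl pn
  where
  climb : ∀ d n → b ∸ n ≤ d → P n → ⊥
  climb d n le pn = k (n , pn , λ m pm → ≮⇒≥ λ n<m → higher d le m pm n<m)
    where
    higher : ∀ d → b ∸ n ≤ d → ∀ m → P m → n < m → ⊥
    higher d le m pm n<m with d | ≤-trans (∸-monoʳ-< n<m (bounded m pm)) le
    ... | suc d′ | s≤s le′ = climb d′ m le′ pm

-- The packing theorem for odd triples.

module Packings (𝓗 : TriangleFree) where

  open Triples 𝓗
  open LeftoverImpossible 𝓗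

  IndependentBound-↭ : ∀ {k R S} → R ↭ S → IndependentBound k R → IndependentBound k S
  IndependentBound-↭ {k} π f C X p ind =
    subst (λ n → length C + 2 * k ≤ suc n) (↭-length π) (f C X (trans p (↭-sym π)) ind)

  BicliqueBound-↭ : ∀ {k R S} → R ↭ S → BicliqueBound k R → BicliqueBound k S
  BicliqueBound-↭ {k} π f a A b B X p c =
    subst (length (a ∷ A) + length (b ∷ B) + k ≤_) (↭-length π) (f a A b B X (trans p (↭-sym π)) c)

  Wheel-↭ : ∀ {R S} → R ↭ S → Wheel R → Wheel S
  Wheel-↭ π (wheel v₀ v₁ v₂ v₃ v₄ w rim e₀ e₁ e₂ e₃ e₄ ap) =
    wheel v₀ v₁ v₂ v₃ v₄ w (trans (↭-sym π) rim) e₀ e₁ e₂ e₃ e₄ ap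

  -- No leftover vertex makes an odd triple with `u v`, so each sees exactly one of them; the same
  -- argument with other edges makes the leftover complete bipartite. A third vertex guarantees a
  -- side with two vertices, which becomes `A`.
  leftover-edge : ∀ {R u v x rest} ts → All Odd ts → flat ts ++ u ∷ v ∷ x ∷ rest ↭ R → u ~ v →
    IndependentBound (suc (length ts)) R → BicliqueBound (suc (length ts)) R →
    (length ts ≡ 1 → Wheel R → ⊥) → (Packing (suc (length ts)) R → ⊥) → ⊥
  leftover-edge {R} {u} {v} {x₀} {rest} ts odds π uv αb βb ¬wheel ¬pack with partitionᵇ (h u) (x₀ ∷ rest)
  ... | P , Q , ρ , uP , uQ = conclude P Q ρ uP uQ
    where
    even : ∀ {x y z S} → u ∷ v ∷ x₀ ∷ rest ↭ x ∷ y ∷ z ∷ S → Odd (x , y , z) → ⊥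
    even {x} {y} {z} {S} σ o = ¬pack ((x , y , z) ∷ ts , S , refl , o ∷ odds , lin π (lin (↭-sym σ)
        (permute ([ _ ] ∷ [ _ ] ∷ [ _ ] ∷ (flat ts) ∷ S ∷ R ∷ [ _ ] ∷ [ _ ] ∷ [ _ ] ∷ rest ∷ [])
          (# 0 ⊕ # 1 ⊕ # 2 ⊕ ((# 3 ⊕ # 4) ⊕ # 5) ⊕ # 6 ⊕ # 7 ⊕ # 8 ⊕ # 9)
          ((# 5 ⊕ # 3 ⊕ # 6 ⊕ # 7 ⊕ # 8 ⊕ # 9) ⊕ # 0 ⊕ # 1 ⊕ # 2 ⊕ # 4))))

    situate : ∀ a₀ a₁ A′ g B′ → (a₀ ∷ a₁ ∷ A′) ++ g ∷ B′ ↭ u ∷ v ∷ x₀ ∷ rest →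
              Complete (a₀ ∷ a₁ ∷ A′) (g ∷ B′) → ⊥
    situate a₀ a₁ A′ g B′ σ c = Analysis.impossible {a₀} {a₁} {A′} {g} {B′} {ts} record
      { odds = odds ; bip = c
      ; stuck = λ W S len oW τ → ¬pack (W , S , len , oW , trans τ R↭)
      ; αbound = IndependentBound-↭ {suc (length ts)} (↭-sym R↭) αb
      ; βbound = BicliqueBound-↭ (↭-sym R↭) βb
      ; ¬wheel = λ e w → ¬wheel e (Wheel-↭ R↭ w) }
      where
      R↭ : flat ts ++ (a₀ ∷ a₁ ∷ A′) ++ g ∷ B′ ↭ R
      R↭ = lin σ (lin π
          (permute ((flat ts) ∷ [ _ ] ∷ [ _ ] ∷ A′ ∷ [ _ ] ∷ B′ ∷ [ _ ] ∷ [ _ ] ∷ [ _ ] ∷ rest ∷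
            R ∷ [])
            (((# 0 ⊕ # 1 ⊕ # 2 ⊕ # 3 ⊕ # 4 ⊕ # 5) ⊕ # 6 ⊕ # 7 ⊕ # 8 ⊕ # 9) ⊕ # 10)
            ((# 10 ⊕ # 1 ⊕ # 2 ⊕ # 3 ⊕ # 4 ⊕ # 5) ⊕ # 0 ⊕ # 6 ⊕ # 7 ⊕ # 8 ⊕ # 9)))

    conclude : ∀ P Q → x₀ ∷ rest ↭ P ++ Q → (∀ {x} → x ∈ₗ P → u ~ x) → (∀ {x} → x ∈ₗ Q → u ≁ x) → ⊥
    conclude P Q ρ uP uQ = finish P Q ρ complete
      where
      vQ : ∀ {x} → x ∈ₗ Q → v ~ x
      vQ i with ∈⇒↭ i
      ... | Q₁ , σ = ¬≁⇒~ λ n → even {S = P ++ Q₁} (lin ρ (lin σ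
          (permute ([ _ ] ∷ [ _ ] ∷ [ _ ] ∷ rest ∷ P ∷ Q ∷ [ _ ] ∷ Q₁ ∷ [])
            (# 0 ⊕ # 1 ⊕ # 2 ⊕ (# 3 ⊕ # 4 ⊕ # 5) ⊕ # 6 ⊕ # 7)
            (# 0 ⊕ # 1 ⊕ # 6 ⊕ ((# 4 ⊕ # 7) ⊕ # 2 ⊕ # 3) ⊕ # 5)))) (edge-apex uv (uQ i) n)
      complete : Complete (v ∷ P) (u ∷ Q)
      complete (here refl) (here refl) = ~-sym uv
      complete (here refl) (there j)   = vQ j
      complete (there i)   (here refl) = ~-sym (uP i)
      complete (there i)   (there j) with ∈⇒↭ i | ∈⇒↭ j
      ... | P₁ , σ | Q₁ , τ =
        ¬≁⇒~ λ n → even {S = v ∷ P₁ ++ Q₁} (lin ρ (lin σ (lin τ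
            (permute ([ _ ] ∷ [ _ ] ∷ [ _ ] ∷ rest ∷ P ∷ Q ∷ [ _ ] ∷ P₁ ∷ [ _ ] ∷ Q₁ ∷ [])
              (# 0 ⊕ # 1 ⊕ # 2 ⊕ ((# 3 ⊕ # 4 ⊕ # 5) ⊕ # 6 ⊕ # 7) ⊕ # 8 ⊕ # 9)
              (# 0 ⊕ # 6 ⊕ # 8 ⊕ # 1 ⊕ (((# 7 ⊕ # 9) ⊕ # 2 ⊕ # 3) ⊕ # 4) ⊕ # 5))))) (edge-apex (uP i) (uQ j) n)
      finish : ∀ P Q → x₀ ∷ rest ↭ P ++ Q → Complete (v ∷ P) (u ∷ Q) → ⊥
      finish P (q ∷ Q) ρ c = situate u q Q v P (lin (↭-sym ρ)
          (permute ([ _ ] ∷ [ _ ] ∷ Q ∷ [ _ ] ∷ P ∷ [ _ ] ∷ rest ∷ [])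
            (# 0 ⊕ # 1 ⊕ (# 2 ⊕ # 3 ⊕ # 4) ⊕ # 5 ⊕ # 6)
            (# 0 ⊕ # 3 ⊕ # 5 ⊕ # 6 ⊕ # 4 ⊕ # 1 ⊕ # 2))) (Complete-sym c)
      finish (p ∷ P) [] ρ c = situate v p P u [] (lin (↭-sym ρ)
          (permute ([ _ ] ∷ [ _ ] ∷ P ∷ [ _ ] ∷ [ _ ] ∷ rest ∷ [])
            (# 0 ⊕ # 1 ⊕ (# 2 ⊕ # 3) ⊕ # 4 ⊕ # 5)
            (# 3 ⊕ # 0 ⊕ # 4 ⊕ # 5 ⊕ # 1 ⊕ # 2 ⊕ ∅))) c
      finish [] [] ρ c with () ← ↭-length ρ

  record Edge (R : List V) : Set where
    constructor edge
    field
      u v   : V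
      R′    : List V
      R↭    : R ↭ u ∷ v ∷ R′
      u~v   : u ~ v

  edge-in : ∀ {R x y} → x ∈ₗ R → y ∈ₗ R → x ~ y → Edge R
  edge-in {R} {x} {y} i j e with ∈⇒↭ i
  ... | R₁ , π with ∈-resp-↭ π j
  ...   | here refl = ⊥-elim (~⇒¬≁ e ≁-refl)
  ...   | there j′ with ∈⇒↭ j′
  ...     | R₂ , ρ = edge x y R₂ (lin π (lin ρ
      (permute (R ∷ [ _ ] ∷ R₁ ∷ [ _ ] ∷ R₂ ∷ [])
        ((# 0 ⊕ # 1 ⊕ # 2) ⊕ # 3 ⊕ # 4)
        (# 1 ⊕ # 3 ⊕ (# 4 ⊕ # 0) ⊕ # 2)))) e

  has-edge : ∀ {k R} → IndependentBound (suc k) R → (Edge R → ⊥) → ⊥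
  has-edge {k} {R} αb n = excess (2 * k) (αb R []
      (permute (R ∷ []) (# 0 ⊕ ∅) (# 0)) λ i j → ¬~⇒≁ λ e → n (edge-in i j e)) (identity (length R) k)
    where
    identity : ∀ r k → r + 2 * suc k ≡ suc (suc r + 2 * k)
    identity = solve-∀

  -- Only the biclique bound has to be chosen for: order and independence bound survive the removal
  -- of any edge.
  GoodEdge : ℕ → List V → Set
  GoodEdge k R = Σ (Edge R) λ e → BicliqueBound k (Edge.R′ e)

  module Spanning {R : List V} (large : 6 ≤ length R) (αb : IndependentBound 2 R) (βb : BicliqueBound 2 R)
    (bad : GoodEdge 1 R → ⊥) where

    -- For `k` equal to one the biclique bound says that no biclique spans, so removing a bad edge
    -- leaves a spanning biclique.
    spanning : ∀ {u v R′} → R ↭ u ∷ v ∷ R′ → u ~ v →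
               ((∃ λ a → ∃ λ A → ∃ λ b → ∃ λ B → R′ ↭ (a ∷ A) ++ (b ∷ B) × Complete (a ∷ A) (b ∷ B)) → ⊥) → ⊥
    spanning {u} {v} {R′} π e k = bad (edge u v R′ π e , bound)
      where
      bound : BicliqueBound 1 R′
      bound a A b B [] p c = ⊥-elim (k (a , A , b , B , trans (↭-sym p)
          (permute ([ _ ] ∷ A ∷ [ _ ] ∷ B ∷ []) (# 0 ⊕ # 1 ⊕ # 2 ⊕ # 3 ⊕ ∅) (# 0 ⊕ # 1 ⊕ # 2 ⊕ # 3)) , c))
      bound a A b B (x ∷ X) p c = ≤-reflexive-≤ (↭-length p)
        where
        ≤-reflexive-≤ : length ((a ∷ A) ++ (b ∷ B) ++ x ∷ X) ≡ length R′ → length (a ∷ A) + length (b ∷ B) + 1 ≤ length R′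
        ≤-reflexive-≤ q = subst (length (a ∷ A) + length (b ∷ B) + 1 ≤_) q
          (subst (length (a ∷ A) + length (b ∷ B) + 1 ≤_)
            (≡-sym (≡-trans (length-++ (a ∷ A)) (≡-trans (cong (length (a ∷ A) +_) (length-++ (b ∷ B)))
              (≡-sym (+-assoc (length (a ∷ A)) (length (b ∷ B)) (suc (length X)))))))
            (+-monoʳ-≤ (length (a ∷ A) + length (b ∷ B)) (s≤s z≤n)))

    -- The biclique that spans the rest separates `x` from `y`, so every other remaining vertex sees
    -- one of them.
    dominated : ∀ {u v x y z S} → R ↭ u ∷ v ∷ x ∷ y ∷ z ∷ S → u ~ v → x ~ y → z ≁ x → z ≁ y → ⊥
    dominated {u} {v} {x} {y} {z} {S} π uv xy zx zy = spanning π uv λ { (a , A , b , B , p , c) →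
      place c (∈-++⁻ (a ∷ A) (∈-resp-↭ p (here refl))) (∈-++⁻ (a ∷ A) (∈-resp-↭ p (there (here refl))))
        (∈-++⁻ (a ∷ A) (∈-resp-↭ p (there (there (here refl))))) }
      where
      place : ∀ {a A b B} → Complete (a ∷ A) (b ∷ B) →
              x ∈ₗ a ∷ A ⊎ x ∈ₗ b ∷ B → y ∈ₗ a ∷ A ⊎ y ∈ₗ b ∷ B → z ∈ₗ a ∷ A ⊎ z ∈ₗ b ∷ B → ⊥
      place c (inj₁ i) (inj₁ j) _ = htf (c i (here refl)) xy (~-sym (c j (here refl)))
      place c (inj₂ i) (inj₂ j) _ = htf (~-sym (c (here refl) i)) xy (c (here refl) j)
      place c (inj₁ i) (inj₂ j) (inj₁ k) = ~⇒¬≁ (c k j) zy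
      place c (inj₁ i) (inj₂ j) (inj₂ k) = ~⇒¬≁ (~-sym (c i k)) zx
      place c (inj₂ i) (inj₁ j) (inj₁ k) = ~⇒¬≁ (c k i) zx
      place c (inj₂ i) (inj₁ j) (inj₂ k) = ~⇒¬≁ (~-sym (c j k)) zy

    -- If every other vertex sees u or v then R is a biclique.
    seen-⊥ : ∀ {u v M} → R ↭ u ∷ v ∷ M → u ~ v → 3 ≤ length M →
             (∀ {z M₁} → M ↭ z ∷ M₁ → z ≁ u → z ≁ v → ⊥) → ⊥
    seen-⊥ {u} {v} {M} π uv big seen with partitionᵇ (h u) M
    ... | P , Q , ρ , uP , uQ =
      excess 1 (βb v P u Q [] (lin (↭-sym π) (lin (↭-sym ρ)
          (permute ([ _ ] ∷ P ∷ [ _ ] ∷ Q ∷ R ∷ M ∷ [])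
            (# 0 ⊕ ((# 1 ⊕ # 2 ⊕ # 3 ⊕ ∅) ⊕ # 4) ⊕ # 5)
            ((# 4 ⊕ # 2 ⊕ # 0 ⊕ # 5) ⊕ # 1 ⊕ # 3)))) complete) sizes
      where
      vQ : ∀ {x} → x ∈ₗ Q → v ~ x
      vQ i with ∈⇒↭ i
      ... | Q₁ , σ = ¬≁⇒~ λ n → seen {M₁ = P ++ Q₁} (lin ρ (lin σ
          (permute (M ∷ P ∷ Q ∷ [ _ ] ∷ Q₁ ∷ [])
            ((# 0 ⊕ # 1 ⊕ # 2) ⊕ # 3 ⊕ # 4)
            (# 3 ⊕ ((# 1 ⊕ # 4) ⊕ # 0) ⊕ # 2)))) (≁-sym (uQ i)) (≁-sym n)
      sizes : suc (length P) + suc (length Q) + 2 ≡ suc (length R + 1)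
      sizes = ≡-trans (identity (length P) (length Q))
        (cong (λ n → suc (n + 1)) (≡-trans (cong (2 +_) (≡-sym (≡-trans (↭-length ρ) (length-++ P)))) (≡-sym (↭-length π))))
        where
        identity : ∀ p q → suc p + suc q + 2 ≡ suc (2 + (p + q) + 1)
        identity = solve-∀
      cross : ∀ {x y P₁ Q₁} → P ↭ x ∷ P₁ → Q ↭ y ∷ Q₁ → x ~ y
      cross {x} {y} {z ∷ P₁} {Q₁} σ τ = ¬≁⇒~ λ n →
        dominated {u} {z} {y} {v} {x} {P₁ ++ Q₁} (lin π (lin ρ (lin σ (lin τ
            (permute (R ∷ [ _ ] ∷ [ _ ] ∷ M ∷ P ∷ Q ∷ [ _ ] ∷ [ _ ] ∷ P₁ ∷ [ _ ] ∷ Q₁ ∷ [])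
              ((((# 0 ⊕ # 1 ⊕ # 2 ⊕ # 3) ⊕ # 4 ⊕ # 5) ⊕ # 6 ⊕ # 7 ⊕ # 8) ⊕ # 9 ⊕ # 10)
              (# 1 ⊕ # 7 ⊕ # 9 ⊕ # 2 ⊕ # 6 ⊕ ((((# 8 ⊕ # 10) ⊕ # 0) ⊕ # 3) ⊕ # 4) ⊕ # 5)))))) (uP (∈-resp-↭ (↭-sym σ) (there (here refl))))
          (~-sym (vQ (∈-resp-↭ (↭-sym τ) (here refl)))) n
          (≁-sym (common⇒≁ uv (uP (∈-resp-↭ (↭-sym σ) (here refl)))))
      cross {x} {y} {[]} {z ∷ Q₁} σ τ = ¬≁⇒~ λ n →
        dominated {v} {z} {x} {u} {y} {Q₁} (lin π (lin ρ (lin σ (lin τ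
            (permute (R ∷ [ _ ] ∷ [ _ ] ∷ M ∷ P ∷ Q ∷ [ _ ] ∷ [ _ ] ∷ [ _ ] ∷ Q₁ ∷ [])
              ((((# 0 ⊕ # 1 ⊕ # 2 ⊕ # 3) ⊕ # 4 ⊕ # 5) ⊕ # 6) ⊕ # 7 ⊕ # 8 ⊕ # 9)
              (# 2 ⊕ # 8 ⊕ # 6 ⊕ # 1 ⊕ # 7 ⊕ (((# 9 ⊕ # 0) ⊕ # 3) ⊕ # 4) ⊕ # 5)))))) (vQ (∈-resp-↭ (↭-sym τ) (there (here refl))))
          (~-sym (uP (∈-resp-↭ (↭-sym σ) (here refl)))) (≁-sym n) (≁-sym (uQ (∈-resp-↭ (↭-sym τ) (here refl))))
      cross {x} {y} {[]} {[]} σ τ = ⊥-elim (excess 0 big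
        (cong suc (≡-sym (≡-trans (+-identityʳ (length M)) (≡-trans (↭-length ρ) (↭-length (++⁺ σ τ)))))))
      complete : Complete (v ∷ P) (u ∷ Q)
      complete (here refl) (here refl) = ~-sym uv
      complete (here refl) (there j)   = vQ j
      complete (there i)   (here refl) = ~-sym (uP i)
      complete (there i)   (there j)   = cross (proj₂ (∈⇒↭ i)) (proj₂ (∈⇒↭ j))

    -- Removing an edge from `a` to a far vertex leaves the edge `b u`, so the other far vertices
    -- see `u`. Hence all vertices but `u` and `a` are neighbours of `u`, an independent set that is
    -- too large.
    one-sided : ∀ {u v a b z z′ L} → R ↭ u ∷ v ∷ a ∷ b ∷ z ∷ z′ ∷ L → u ~ v →
                (∀ {x} → x ∈ₗ z ∷ z′ ∷ L → a ~ x × b ≁ x) → b ~ u → ⊥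
    one-sided {u} {v} {a} {b} {z} {z′} {L} π uv far bu =
      excess 0 (αb (b ∷ v ∷ z ∷ z′ ∷ L) (u ∷ a ∷ []) (lin (↭-sym π)
          (permute ([ _ ] ∷ [ _ ] ∷ [ _ ] ∷ [ _ ] ∷ L ∷ [ _ ] ∷ [ _ ] ∷ R ∷ [])
            (# 0 ⊕ # 1 ⊕ # 2 ⊕ # 3 ⊕ (# 4 ⊕ # 5 ⊕ # 6) ⊕ # 7)
            (# 7 ⊕ # 5 ⊕ # 1 ⊕ # 6 ⊕ # 0 ⊕ # 2 ⊕ # 3 ⊕ # 4))) independent) sizes
      where
      near-u : ∀ {x L′} → z ∷ z′ ∷ L ↭ x ∷ L′ → u ~ x
      near-u {x} {y ∷ L′} σ = ¬≁⇒~ λ n →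
        dominated {a} {y} {b} {u} {x} {v ∷ L′} (lin π (lin σ
            (permute (R ∷ [ _ ] ∷ [ _ ] ∷ [ _ ] ∷ [ _ ] ∷ [ _ ] ∷ [ _ ] ∷ L ∷ [ _ ] ∷ [ _ ] ∷ L′ ∷
              [])
              ((# 0 ⊕ # 1 ⊕ # 2 ⊕ # 3 ⊕ # 4 ⊕ # 5 ⊕ # 6 ⊕ # 7) ⊕ # 8 ⊕ # 9 ⊕ # 10)
              (# 3 ⊕ # 9 ⊕ # 4 ⊕ # 1 ⊕ # 8 ⊕ # 2 ⊕ (# 10 ⊕ # 0) ⊕ # 5 ⊕ # 6 ⊕ # 7)))) (proj₁ (far (∈-resp-↭ (↭-sym σ) (there (here refl))))) bu
          (≁-sym (proj₂ (far (∈-resp-↭ (↭-sym σ) (here refl))))) (≁-sym n)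
      near-u {x} {[]} σ with () ← ↭-length σ
      all-near : ∀ {x} → x ∈ₗ b ∷ v ∷ z ∷ z′ ∷ L → u ~ x
      all-near (here refl) = ~-sym bu
      all-near (there (here refl)) = uv
      all-near (there (there i)) = near-u (proj₂ (∈⇒↭ i))
      independent : Independent (b ∷ v ∷ z ∷ z′ ∷ L)
      independent i j = common⇒≁ (all-near i) (all-near j)
      sizes : 4 + length L + 2 * 2 ≡ suc (suc (length R) + 0)
      sizes = ≡-trans (identity (length L)) (cong (λ n → suc (suc n + 0)) (≡-sym (↭-length π)))
        where
        identity : ∀ n → 4 + n + 2 * 2 ≡ suc (suc (6 + n) + 0)
        identity = solve-∀

    -- Removing `u v` shows that `a` sees all far vertices. If `b` sees `u` or `v`, the previous
    -- case applies; otherwise removing `a z` leaves the edge `u v` undominating `b`.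
    lopsided : ∀ {u v a b z z′ L} → R ↭ u ∷ v ∷ a ∷ b ∷ z ∷ z′ ∷ L → u ~ v → a ~ b →
               (∀ {x} → x ∈ₗ z ∷ z′ ∷ L → b ≁ x) → ⊥
    lopsided {u} {v} {a} {b} {z} {z′} {L} π uv ab bL = go (~∨≁ b u) (~∨≁ b v)
      where
      a~ : ∀ {x} → x ∈ₗ z ∷ z′ ∷ L → a ~ x
      a~ i with ∈⇒↭ i
      ... | L₁ , σ = ¬≁⇒~ λ n →
        dominated {u} {v} {a} {b} {_} {L₁} (lin π (lin σ
            (permute (R ∷ [ _ ] ∷ [ _ ] ∷ [ _ ] ∷ [ _ ] ∷ [ _ ] ∷ [ _ ] ∷ L ∷ [ _ ] ∷ L₁ ∷ [])
              ((# 0 ⊕ # 1 ⊕ # 2 ⊕ # 3 ⊕ # 4 ⊕ # 5 ⊕ # 6 ⊕ # 7) ⊕ # 8 ⊕ # 9)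
              (# 1 ⊕ # 2 ⊕ # 3 ⊕ # 4 ⊕ # 8 ⊕ (# 9 ⊕ # 0) ⊕ # 5 ⊕ # 6 ⊕ # 7)))) uv ab (≁-sym n) (≁-sym (bL i))
      go : b ~ u ⊎ b ≁ u → b ~ v ⊎ b ≁ v → ⊥
      go (inj₁ bu) _ = one-sided π uv (λ i → a~ i , bL i) bu
      go _ (inj₁ bv) = one-sided {v} {u} (lin π
          (permute (R ∷ [ _ ] ∷ [ _ ] ∷ [ _ ] ∷ [ _ ] ∷ [ _ ] ∷ [ _ ] ∷ L ∷ [])
            (# 0 ⊕ # 1 ⊕ # 2 ⊕ # 3 ⊕ # 4 ⊕ # 5 ⊕ # 6 ⊕ # 7)
            (# 2 ⊕ # 1 ⊕ # 3 ⊕ # 4 ⊕ # 5 ⊕ # 6 ⊕ # 7 ⊕ # 0))) (~-sym uv) (λ i → a~ i , bL i) bv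
      go (inj₂ bu) (inj₂ bv) = dominated {a} {z} {u} {v} {b} {z′ ∷ L} (lin π
          (permute (R ∷ [ _ ] ∷ [ _ ] ∷ [ _ ] ∷ [ _ ] ∷ [ _ ] ∷ [ _ ] ∷ L ∷ [])
            (# 0 ⊕ # 1 ⊕ # 2 ⊕ # 3 ⊕ # 4 ⊕ # 5 ⊕ # 6 ⊕ # 7)
            (# 3 ⊕ # 5 ⊕ # 1 ⊕ # 2 ⊕ # 4 ⊕ # 6 ⊕ # 7 ⊕ # 0))) (a~ (here refl)) uv bu bv

    -- If `a` and `b` both have far neighbours, every vertex other than `u` and `v` can be kept
    -- while an edge disjoint from `u v` is removed. It therefore sees `u` or `v`, and all of `R` is
    -- a biclique.
    two-edges : ∀ {u v a b z z′ L} → R ↭ u ∷ v ∷ a ∷ b ∷ z ∷ z′ ∷ L → u ~ v → a ~ b → ⊥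
    two-edges {u} {v} {a} {b} {z} {z′} {L} π uv ab with find? (h a) (z ∷ z′ ∷ L) | find? (h b) (z ∷ z′ ∷ L)
    ... | inj₂ aL | _ = lopsided {a = b} {a} (lin π
        (permute (R ∷ [ _ ] ∷ [ _ ] ∷ [ _ ] ∷ [ _ ] ∷ [ _ ] ∷ [ _ ] ∷ L ∷ [])
          (# 0 ⊕ # 1 ⊕ # 2 ⊕ # 3 ⊕ # 4 ⊕ # 5 ⊕ # 6 ⊕ # 7)
          (# 1 ⊕ # 2 ⊕ # 4 ⊕ # 3 ⊕ # 5 ⊕ # 6 ⊕ # 7 ⊕ # 0))) uv (~-sym ab) aL
    ... | inj₁ _ | inj₂ bL = lopsided π uv ab bL
    ... | inj₁ (x , L₁ , σ , ax) | inj₁ (y , L₂ , τ , by) =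
      seen-⊥ π uv (s≤s (s≤s (s≤s z≤n))) λ ρ → see (∈-resp-↭ (↭-sym ρ) (here refl))
      where
      see : ∀ {w} → w ∈ₗ a ∷ b ∷ z ∷ z′ ∷ L → w ≁ u → w ≁ v → ⊥
      see (here refl) = dominated {b} {y} {u} {v} {a} {L₂} (lin π (lin τ
          (permute (R ∷ [ _ ] ∷ [ _ ] ∷ [ _ ] ∷ [ _ ] ∷ [ _ ] ∷ [ _ ] ∷ L ∷ [ _ ] ∷ L₂ ∷ [])
            ((# 0 ⊕ # 1 ⊕ # 2 ⊕ # 3 ⊕ # 4 ⊕ # 5 ⊕ # 6 ⊕ # 7) ⊕ # 8 ⊕ # 9)
            (# 4 ⊕ # 8 ⊕ # 1 ⊕ # 2 ⊕ # 3 ⊕ (# 9 ⊕ # 0) ⊕ # 5 ⊕ # 6 ⊕ # 7)))) by uv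
      see (there (here refl)) = dominated {a} {x} {u} {v} {b} {L₁} (lin π (lin σ
          (permute (R ∷ [ _ ] ∷ [ _ ] ∷ [ _ ] ∷ [ _ ] ∷ [ _ ] ∷ [ _ ] ∷ L ∷ [ _ ] ∷ L₁ ∷ [])
            ((# 0 ⊕ # 1 ⊕ # 2 ⊕ # 3 ⊕ # 4 ⊕ # 5 ⊕ # 6 ⊕ # 7) ⊕ # 8 ⊕ # 9)
            (# 3 ⊕ # 8 ⊕ # 1 ⊕ # 2 ⊕ # 4 ⊕ (# 9 ⊕ # 0) ⊕ # 5 ⊕ # 6 ⊕ # 7)))) ax uv
      see (there (there i)) with ∈⇒↭ i
      ... | L₃ , ρ = dominated {a} {b} {u} {v} {_} {L₃} (lin π (lin ρ
          (permute (R ∷ [ _ ] ∷ [ _ ] ∷ [ _ ] ∷ [ _ ] ∷ [ _ ] ∷ [ _ ] ∷ L ∷ [ _ ] ∷ L₃ ∷ [])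
            ((# 0 ⊕ # 1 ⊕ # 2 ⊕ # 3 ⊕ # 4 ⊕ # 5 ⊕ # 6 ⊕ # 7) ⊕ # 8 ⊕ # 9)
            (# 3 ⊕ # 4 ⊕ # 1 ⊕ # 2 ⊕ # 8 ⊕ (# 9 ⊕ # 0) ⊕ # 5 ⊕ # 6 ⊕ # 7)))) ab uv

    spanning-⊥ : ⊥
    spanning-⊥ = has-edge {1} αb λ { (edge u v R′ π uv) → spanning π uv λ { (a , A , b , B , ρ , c) →
      split A B (lin π (lin ρ
          (permute (R ∷ [ _ ] ∷ [ _ ] ∷ R′ ∷ [ _ ] ∷ A ∷ [ _ ] ∷ B ∷ [])
            ((# 0 ⊕ # 1 ⊕ # 2 ⊕ # 3) ⊕ # 4 ⊕ # 5 ⊕ # 6 ⊕ # 7)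
            (# 1 ⊕ # 2 ⊕ # 4 ⊕ # 6 ⊕ ((# 5 ⊕ # 7) ⊕ # 0) ⊕ # 3)))) uv (c (here refl) (here refl)) } }
      where
      split : ∀ {u v a b} A B → R ↭ u ∷ v ∷ a ∷ b ∷ A ++ B → u ~ v → a ~ b → ⊥
      split (z ∷ z′ ∷ A) B π uv ab = two-edges π uv ab
      split (z ∷ []) (z′ ∷ B) π uv ab = two-edges π uv ab
      split [] (z ∷ z′ ∷ B) π uv ab = two-edges π uv ab
      split (z ∷ []) [] π uv ab = excess 0 large (cong suc (≡-sym (≡-trans (+-identityʳ _) (↭-length π))))
      split [] (z ∷ []) π uv ab = excess 0 large (cong suc (≡-sym (≡-trans (+-identityʳ _) (↭-length π))))
      split [] [] π uv ab = excess 1 large (cong suc (≡-sym (≡-trans (+-comm _ 1) (cong suc (↭-length π)))))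

  -- For k ≥ 3 two bicliques meeting the bound with equality overlap on both sides, and form a
  -- lattice; so an edge inside the one with the largest left side meets all of them.
  module Tight {k : ℕ} {R : List V} (large : 3 * (3 + k) ≤ length R)
    (αb : IndependentBound (3 + k) R) (βb : BicliqueBound (3 + k) R) where

    TightWith : ℕ → Set
    TightWith n = ∃ λ p → ∃ λ P → ∃ λ q → ∃ λ Q → ∃ λ X → (p ∷ P) ++ (q ∷ Q) ++ X ↭ R ×
                  Complete (p ∷ P) (q ∷ Q) × length (p ∷ P) + length (q ∷ Q) + (3 + k) ≡ length R ×
                  length (p ∷ P) ≡ n

    side-bound : ∀ {p P q Q X} → (p ∷ P) ++ (q ∷ Q) ++ X ↭ R → Complete (p ∷ P) (q ∷ Q) →
                 length (p ∷ P) + 2 * (3 + k) ≤ suc (length R)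
    side-bound {p} {P} {q} {Q} {X} π c = αb (p ∷ P) ((q ∷ Q) ++ X) π
      λ i j → common⇒≁ (~-sym (c i (here refl))) (~-sym (c j (here refl)))

    length₃ : ∀ {zs : List V} xs ys {ws} → zs ↭ xs ++ ys ++ ws → length zs ≡ length xs + (length ys + length ws)
    length₃ xs ys π = ≡-trans (↭-length π) (≡-trans (length-++ xs) (cong (length xs +_) (length-++ ys)))

    -- Write K for `3 + k`. The hypotheses give K ≤ n + 2, K ≤ s + 1, s ≤ f + 1 and K = 2 + f + n +
    -- t, so 2K ≤ f + n + 4 ≤ K + 2, which fails for K ≥ 3.
    side-arith : ∀ a f n r s t {N} → suc (a + f) + suc n + (3 + k) ≡ N → a + r + s + (3 + k) ≡ N →
      3 + k ≡ 2 + (f + (n + t)) → a + (suc n + s) + (3 + k) ≤ N → suc (a + f) + 2 * (3 + k) ≤ suc N →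
      a + r + 2 * (3 + k) ≤ suc N → ⊥
    side-arith a f n r s t {N} e₁ e₂ e₃ i₁ i₂ i₃ =
      excess (k + t)
        (+-mono-≤ (subst (_ ≤_) (≡-sym e₁) i₁) (+-mono-≤ (subst (λ N → _ ≤ suc N) (≡-sym e₁) i₂)
          (+-mono-≤ (subst (λ N → _ ≤ suc N) (≡-sym e₂) i₃) (≤-reflexive (≡-sym e₃)))))
        (identity a f n r s t k)
      where
      identity : ∀ a f n r s t k →
        a + (suc n + s) + (3 + k) + (suc (a + f) + 2 * (3 + k) + (a + r + 2 * (3 + k) + (2 + (f + (n + t))))) ≡
        suc (suc (a + f) + suc n + (3 + k) + (suc (suc (a + f) + suc n + (3 + k)) + (suc (a + r + s + (3 + k)) + (3 + k))) + (k + t))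
      identity = solve-∀

    -- The nine intersections of two tripartitions of `R`, each into two sides and an outside. `u`
    -- and `v` are listed separately: they lie in the first biclique and outside the second.
    record Cross (u v p′ q′ : V) (P₀ Q₀ X P′ Q′ X′ a e f i m n r s t : List V) : Set where
      field
        P↭     : P₀ ↭ a ++ e ++ f
        Q↭     : Q₀ ↭ i ++ m ++ n
        X↭     : X ↭ r ++ s ++ t
        P′↭    : p′ ∷ P′ ↭ a ++ i ++ r
        Q′↭    : q′ ∷ Q′ ↭ e ++ m ++ s
        X′↭    : X′ ↭ f ++ n ++ t
        R↭     : (u ∷ P₀) ++ (v ∷ Q₀) ++ X ↭ R
        c      : Complete (u ∷ P₀) (v ∷ Q₀)
        c′     : Complete (p′ ∷ P′) (q′ ∷ Q′)
        tight  : length (u ∷ P₀) + length (v ∷ Q₀) + (3 + k) ≡ length R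
        tight′ : length (p′ ∷ P′) + length (q′ ∷ Q′) + (3 + k) ≡ length R

    -- The same two bicliques with the sides exchanged: in both, or in the second one only.
    mirror : ∀ {u v p′ q′ P₀ Q₀ X P′ Q′ X′ a e f i m n r s t} →
             Cross u v p′ q′ P₀ Q₀ X P′ Q′ X′ a e f i m n r s t → Cross v u q′ p′ Q₀ P₀ X Q′ P′ X′ m i n e a f s r t
    mirror {u} {v} {p′} {q′} {P₀} {Q₀} {X} {P′} {Q′} {X′} {a} {e} {f} {i} {m} {n} {r} {s} {t} C = record
      { P↭ = trans Q↭ (shifts i m) ; Q↭ = trans P↭ (shifts a e) ; X↭ = trans X↭ (shifts r s)
      ; P′↭ = trans Q′↭ (shifts e m) ; Q′↭ = trans P′↭ (shifts a i) ; X′↭ = trans X′↭ (shifts f n)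
      ; R↭ = trans (shifts (v ∷ Q₀) (u ∷ P₀)) R↭
      ; c = Complete-sym c ; c′ = Complete-sym c′
      ; tight = ≡-trans (cong (_+ (3 + k)) (+-comm (length (v ∷ Q₀)) (length (u ∷ P₀)))) tight
      ; tight′ = ≡-trans (cong (_+ (3 + k)) (+-comm (length (q′ ∷ Q′)) (length (p′ ∷ P′)))) tight′ }
      where open Cross C

    twist : ∀ {u v p′ q′ P₀ Q₀ X P′ Q′ X′ a e f i m n r s t} →
            Cross u v p′ q′ P₀ Q₀ X P′ Q′ X′ a e f i m n r s t → Cross u v q′ p′ P₀ Q₀ X Q′ P′ X′ e a f m i n s r t
    twist {u} {v} {p′} {q′} {P₀} {Q₀} {X} {P′} {Q′} {X′} {a} {e} {f} {i} {m} {n} {r} {s} {t} C = record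
      { P↭ = trans P↭ (shifts a e) ; Q↭ = trans Q↭ (shifts i m) ; X↭ = trans X↭ (shifts r s)
      ; P′↭ = Q′↭ ; Q′↭ = P′↭ ; X′↭ = X′↭ ; R↭ = R↭ ; c = c ; c′ = Complete-sym c′ ; tight = tight
      ; tight′ = ≡-trans (cong (_+ (3 + k)) (+-comm (length (q′ ∷ Q′)) (length (p′ ∷ P′)))) tight′ }
      where open Cross C

    module Meet {u v p′ q′ P₀ Q₀ X P′ Q′ X′ a e f i m n r s t}
      (C : Cross u v p′ q′ P₀ Q₀ X P′ Q′ X′ a e f i m n r s t) where

      open Cross C

      R↭′ : (p′ ∷ P′) ++ (q′ ∷ Q′) ++ u ∷ v ∷ X′ ↭ R
      R↭′ = lin R↭ (lin (↭-sym P↭) (lin (↭-sym Q↭) (lin (↭-sym X↭) (lin P′↭ (lin Q′↭ (lin X′↭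
          (permute ([ _ ] ∷ P′ ∷ [ _ ] ∷ Q′ ∷ [ _ ] ∷ [ _ ] ∷ X′ ∷ R ∷ P₀ ∷ Q₀ ∷ X ∷ a ∷ i ∷ r ∷
            e ∷ m ∷ s ∷ f ∷ n ∷ t ∷ [])
            (# 0 ⊕ (((((((# 1 ⊕ # 2 ⊕ # 3 ⊕ # 4 ⊕ # 5 ⊕ # 6) ⊕ # 7) ⊕ # 8) ⊕ # 9) ⊕ # 10) ⊕ # 11 ⊕
            # 12 ⊕ # 13) ⊕ # 14 ⊕ # 15 ⊕ # 16) ⊕ # 17 ⊕ # 18 ⊕ # 19)
            (((((((# 7 ⊕ # 4 ⊕ # 8 ⊕ # 5 ⊕ # 9 ⊕ # 10) ⊕ # 11 ⊕ # 14 ⊕ # 17) ⊕ # 12 ⊕ # 15 ⊕ # 18) ⊕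
            # 13 ⊕ # 16 ⊕ # 19) ⊕ # 0 ⊕ # 1) ⊕ # 2 ⊕ # 3) ⊕ # 6))))))))

      outside : 3 + k ≡ 2 + (length f + (length n + length t))
      outside = ≡-trans (+-cancelˡ-≡ (length (p′ ∷ P′) + length (q′ ∷ Q′)) _ _
        (≡-trans tight′ (≡-trans (≡-sym (↭-length R↭′))
          (≡-trans (length-++ (p′ ∷ P′)) (≡-trans (cong (length (p′ ∷ P′) +_) (length-++ (q′ ∷ Q′)))
            (≡-sym (+-assoc (length (p′ ∷ P′)) (length (q′ ∷ Q′)) _)))))))
        (cong (2 +_) (length₃ f n X′↭))

      inP : ∀ {x} → x ∈ₗ a ++ e ++ f → x ∈ₗ u ∷ P₀
      inP j = there (∈-resp-↭ (↭-sym P↭) j)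
      inQ : ∀ {x} → x ∈ₗ i ++ m ++ n → x ∈ₗ v ∷ Q₀
      inQ j = there (∈-resp-↭ (↭-sym Q↭) j)
      inP′ : ∀ {x} → x ∈ₗ a ++ i ++ r → x ∈ₗ p′ ∷ P′
      inP′ = ∈-resp-↭ (↭-sym P′↭)
      inQ′ : ∀ {x} → x ∈ₗ e ++ m ++ s → x ∈ₗ q′ ∷ Q′
      inQ′ = ∈-resp-↭ (↭-sym Q′↭)

      -- An element on the same side of both bicliques excludes one on opposite sides.
      a-e : ∀ {y x} → y ∈ₗ a → x ∈ₗ e → ⊥
      a-e y∈ x∈ = htf (~-sym (c (inP (∈-++⁺ˡ y∈)) (here refl))) (~-sym (c (inP (∈-++⁺ʳ a (∈-++⁺ˡ x∈))) (here refl)))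
        (c′ (inP′ (∈-++⁺ˡ y∈)) (inQ′ (∈-++⁺ˡ x∈)))
      a-i : ∀ {y x} → y ∈ₗ a → x ∈ₗ i → ⊥
      a-i y∈ x∈ = htf (~-sym (c′ (inP′ (∈-++⁺ˡ y∈)) (here refl))) (~-sym (c′ (inP′ (∈-++⁺ʳ a (∈-++⁺ˡ x∈))) (here refl)))
        (c (inP (∈-++⁺ˡ y∈)) (inQ (∈-++⁺ˡ x∈)))

    -- Only the left sides meet. The intersection of the left sides against the union of the right
    -- sides is again a biclique; its bound and the independence bounds for both left sides
    -- contradict each other.
    left-only : ∀ {u v p′ q′ P₀ Q₀ X P′ Q′ X′ y a f n r s t} →
      Cross u v p′ q′ P₀ Q₀ X P′ Q′ X′ (y ∷ a) [] f [] [] n r s t → ⊥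
    left-only {u} {v} {p′} {q′} {P₀} {Q₀} {P′ = P′} {Q′} {y = y} {a} {f} {n} {r} {s} {t} C =
      side-arith (suc (length a)) (length f) (length n) (length r) (length s) (length t)
        (subst₂ (λ x z → suc x + suc z + (3 + k) ≡ length R) lenP lenQ tight)
        (subst₂ (λ x z → x + z + (3 + k) ≡ length R) lenP′ (↭-length Q′↭) tight′)
        outside
        (subst (λ x → suc (length a) + x + (3 + k) ≤ length R)
          (≡-trans (cong suc (length-++ Q₀)) (cong (λ z → suc z + length s) lenQ))
          (βb y a v (Q₀ ++ s) (u ∷ f ++ r ++ t)
            (lin R↭ (lin (↭-sym P↭) (lin (↭-sym X↭)
                (permute ([ _ ] ∷ a ∷ [ _ ] ∷ Q₀ ∷ s ∷ [ _ ] ∷ f ∷ r ∷ t ∷ R ∷ P₀ ∷ _ ∷ [])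
                  (# 0 ⊕ (((# 1 ⊕ # 2 ⊕ (# 3 ⊕ # 4) ⊕ # 5 ⊕ # 6 ⊕ # 7 ⊕ # 8) ⊕ # 9) ⊕ # 10) ⊕ # 11)
                  (((# 9 ⊕ # 5 ⊕ # 10 ⊕ # 2 ⊕ # 3 ⊕ # 11) ⊕ # 0 ⊕ # 1 ⊕ # 6) ⊕ # 7 ⊕ # 4 ⊕ # 8))))) complete))
        (subst (λ x → suc x + 2 * (3 + k) ≤ suc (length R)) lenP (side-bound R↭ c))
        (subst (λ x → x + 2 * (3 + k) ≤ suc (length R)) lenP′ (side-bound R↭′ c′))
      where
      open Cross C
      open Meet C
      lenP : length P₀ ≡ suc (length a) + length f
      lenP = length₃ (y ∷ a) [] P↭
      lenQ : length Q₀ ≡ length n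
      lenQ = ↭-length Q↭
      lenP′ : length (p′ ∷ P′) ≡ suc (length a) + length r
      lenP′ = length₃ (y ∷ a) [] P′↭
      complete : Complete (y ∷ a) (v ∷ Q₀ ++ s)
      complete j l with ∈-++⁻ (v ∷ Q₀) l
      ... | inj₁ l′ = c (inP (∈-++⁺ˡ j)) l′
      ... | inj₂ l′ = c′ (inP′ (∈-++⁺ˡ j)) (inQ′ l′)

    -- Both sides meet. Intersection against union and union against intersection are bicliques with
    -- the same total order as the given two, so both are tight. The left union is strictly larger
    -- because `v` is missing from the second right side.
    both-sides : ∀ {u v p′ q′ P₀ Q₀ X P′ Q′ X′ y a f z m n r s t} → (∀ n → TightWith n → n ≤ length (u ∷ P₀)) →
      Cross u v p′ q′ P₀ Q₀ X P′ Q′ X′ (y ∷ a) [] f [] (z ∷ m) n r s t → ⊥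
    both-sides {u} {v} {p′} {q′} {P₀} {Q₀} {P′ = P′} {Q′} {y = y} {a} {f} {z} {m} {n} {r} {s} {t} top C =
      excess (length n) (≤-trans (≤-reflexive (≡-sym (length-++ (u ∷ P₀)))) (top _ joined)) r-size
      where
      open Cross C
      open Meet C
      lenP : length P₀ ≡ suc (length a) + length f
      lenP = length₃ (y ∷ a) [] P↭
      lenQ : length Q₀ ≡ suc (length m) + length n
      lenQ = length₃ [] (z ∷ m) Q↭
      lenP′ : length (p′ ∷ P′) ≡ suc (length a) + length r
      lenP′ = length₃ (y ∷ a) [] P′↭
      lenQ′ : length (q′ ∷ Q′) ≡ suc (length m) + length s
      lenQ′ = length₃ [] (z ∷ m) Q′↭
      meet-join : length (y ∷ a) + length (v ∷ Q₀ ++ s) + (3 + k) ≤ length R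
      meet-join = βb y a v (Q₀ ++ s) (u ∷ f ++ r ++ t) (lin R↭ (lin (↭-sym P↭) (lin (↭-sym X↭)
          (permute ([ _ ] ∷ a ∷ [ _ ] ∷ Q₀ ∷ s ∷ [ _ ] ∷ f ∷ r ∷ t ∷ R ∷ P₀ ∷ _ ∷ [])
            (# 0 ⊕ (((# 1 ⊕ # 2 ⊕ (# 3 ⊕ # 4) ⊕ # 5 ⊕ # 6 ⊕ # 7 ⊕ # 8) ⊕ # 9) ⊕ # 10) ⊕ # 11)
            (((# 9 ⊕ # 5 ⊕ # 10 ⊕ # 2 ⊕ # 3 ⊕ # 11) ⊕ # 0 ⊕ # 1 ⊕ # 6) ⊕ # 7 ⊕ # 4 ⊕ # 8))))) complete
        where
        complete : Complete (y ∷ a) (v ∷ Q₀ ++ s)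
        complete j l with ∈-++⁻ (v ∷ Q₀) l
        ... | inj₁ l′ = c (inP (∈-++⁺ˡ j)) l′
        ... | inj₂ l′ = c′ (inP′ (∈-++⁺ˡ j)) (inQ′ (∈-++⁺ʳ (z ∷ m) l′))
      complete : Complete (u ∷ P₀ ++ r) (z ∷ m)
      complete j l with ∈-++⁻ (u ∷ P₀) j
      ... | inj₁ j′ = c j′ (inQ (∈-++⁺ˡ l))
      ... | inj₂ j′ = c′ (inP′ (∈-++⁺ʳ (y ∷ a) j′)) (inQ′ (∈-++⁺ˡ l))
      join-meet-perm : (u ∷ P₀ ++ r) ++ (z ∷ m) ++ v ∷ n ++ s ++ t ↭ R
      join-meet-perm = lin R↭ (lin (↭-sym Q↭) (lin (↭-sym X↭)
          (permute ([ _ ] ∷ P₀ ∷ r ∷ [ _ ] ∷ m ∷ [ _ ] ∷ n ∷ s ∷ t ∷ R ∷ Q₀ ∷ _ ∷ [])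
            (# 0 ⊕ ((((# 1 ⊕ # 2) ⊕ # 3 ⊕ # 4 ⊕ # 5 ⊕ # 6 ⊕ # 7 ⊕ # 8) ⊕ # 9) ⊕ # 10) ⊕ # 11)
            (((# 9 ⊕ # 0 ⊕ # 1 ⊕ # 5 ⊕ # 10 ⊕ # 11) ⊕ # 3 ⊕ # 4 ⊕ # 6) ⊕ # 2 ⊕ # 7 ⊕ # 8))))
      total : length (u ∷ P₀ ++ r) + length (z ∷ m) + (3 + k) + (length (y ∷ a) + length (v ∷ Q₀ ++ s) + (3 + k)) ≡
              length R + length R
      total rewrite length-++ P₀ {r} | length-++ Q₀ {s} =
        ≡-trans (cong₂ (λ x w → suc (x + length r) + suc (length m) + (3 + k) + (suc (length a) + suc (w + length s) + (3 + k))) lenP lenQ)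
          (≡-trans (identity (length a) (length f) (length m) (length n) (length r) (length s) k)
            (cong₂ _+_
              (≡-trans (≡-sym (cong₂ (λ x w → suc x + suc w + (3 + k)) lenP lenQ)) tight)
              (≡-trans (≡-sym (cong₂ (λ x w → x + w + (3 + k)) lenP′ lenQ′)) tight′)))
        where
        identity : ∀ a f m n r s k →
          suc (suc a + f + r) + suc m + (3 + k) + (suc a + suc (suc m + n + s) + (3 + k)) ≡
          suc (suc a + f) + suc (suc m + n) + (3 + k) + (suc a + r + (suc m + s) + (3 + k))
        identity = solve-∀
      exact : length (u ∷ P₀ ++ r) + length (z ∷ m) + (3 + k) ≡ length R
      exact = ≤-antisym (βb u (P₀ ++ r) z m _ join-meet-perm complete)
        (+-cancelʳ-≤ (length R) _ _ (≤-trans (≤-reflexive (≡-sym total))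
          (+-monoʳ-≤ (length (u ∷ P₀ ++ r) + length (z ∷ m) + (3 + k)) meet-join)))
      joined : TightWith (length (u ∷ P₀ ++ r))
      joined = u , P₀ ++ r , z , m , _ , join-meet-perm , complete , exact , refl
      r-size : length (u ∷ P₀) + length r ≡ suc (length (u ∷ P₀) + length n)
      r-size = +-cancelʳ-≡ (suc (length m) + (3 + k)) _ _
        (≡-trans (≡-sym (+-assoc (length (u ∷ P₀) + length r) (suc (length m)) (3 + k)))
          (≡-trans (cong (λ x → x + suc (length m) + (3 + k)) (≡-sym (length-++ (u ∷ P₀))))
            (≡-trans exact (≡-trans (≡-sym tight)
              (≡-trans (cong (λ w → length (u ∷ P₀) + suc w + (3 + k)) lenQ)
                (identity (length (u ∷ P₀)) (length m) (length n) k))))))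
        where
        identity : ∀ p m n k → p + suc (suc m + n) + (3 + k) ≡ suc (p + n) + (suc m + (3 + k))
        identity = solve-∀

    -- The first biclique lies outside the second, where only `3 + k` vertices are, so `R` has at
    -- most twice that many, fewer than `large` requires.
    disjoint : ∀ {u v p′ q′ P₀ Q₀ X P′ Q′ X′ f n r s t} → Cross u v p′ q′ P₀ Q₀ X P′ Q′ X′ [] [] f [] [] n r s t → ⊥
    disjoint {P₀ = P₀} {Q₀} {f = f} {n} {t = t} C =
      excess (2 + k + length t)
        (+-mono-≤ (≤-trans large (≤-reflexive (≡-sym (subst₂ (λ x z → suc x + suc z + (3 + k) ≡ length R) (↭-length P↭) (↭-length Q↭) tight))))
          (≤-reflexive (≡-sym outside)))
        (identity (length f) (length n) (length t) k)
      where
      open Cross C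
      open Meet C
      identity : ∀ f n t k → 3 * (3 + k) + (2 + (f + (n + t))) ≡ suc (suc f + suc n + (3 + k) + (3 + k) + (2 + k + t))
      identity = solve-∀

    -- Two cells in one row or column of the inner square cannot both be inhabited. The remaining
    -- patterns reduce by the two symmetries to three cases.
    cross-⊥ : ∀ {u v p′ q′ P₀ Q₀ X P′ Q′ X′} a e f i m n r s t → (∀ n → TightWith n → n ≤ length (u ∷ P₀)) →
              Cross u v p′ q′ P₀ Q₀ X P′ Q′ X′ a e f i m n r s t → ⊥
    cross-⊥ (y ∷ a) (x ∷ e) f i m n r s t top C = Meet.a-e C (here refl) (here refl)
    cross-⊥ (y ∷ a) e f (x ∷ i) m n r s t top C = Meet.a-i C (here refl) (here refl)
    cross-⊥ a (x ∷ e) f i (y ∷ m) n r s t top C = Meet.a-i (mirror C) (here refl) (here refl)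
    cross-⊥ a e f (x ∷ i) (y ∷ m) n r s t top C = Meet.a-e (mirror C) (here refl) (here refl)
    cross-⊥ (y ∷ a) [] f [] [] n r s t top C = left-only C
    cross-⊥ (y ∷ a) [] f [] (z ∷ m) n r s t top C = both-sides top C
    cross-⊥ [] [] f [] (z ∷ m) n r s t top C = left-only (mirror C)
    cross-⊥ [] (x ∷ e) f [] [] n r s t top C = left-only (twist C)
    cross-⊥ [] (x ∷ e) f (z ∷ i) [] n r s t top C = both-sides top (twist C)
    cross-⊥ [] [] f (z ∷ i) [] n r s t top C = left-only (mirror (twist C))
    cross-⊥ [] [] f [] [] n r s t top C = disjoint C

    -- The nine cells arise by repeated binary refinement.
    refine : ∀ {u v p′ q′ P₀ Q₀ X P′ Q′ X′} → (u ∷ P₀) ++ (v ∷ Q₀) ++ X ↭ R → Complete (u ∷ P₀) (v ∷ Q₀) →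
      (p′ ∷ P′) ++ (q′ ∷ Q′) ++ u ∷ v ∷ X′ ↭ R → Complete (p′ ∷ P′) (q′ ∷ Q′) →
      length (u ∷ P₀) + length (v ∷ Q₀) + (3 + k) ≡ length R →
      length (p′ ∷ P′) + length (q′ ∷ Q′) + (3 + k) ≡ length R →
      (∀ n → TightWith n → n ≤ length (u ∷ P₀)) → ⊥
    refine {u} {v} {p′} {q′} {P₀} {Q₀} {X} {P′} {Q′} {X′} π c π′ c′ tight tight′ top
      with riesz P₀ {Q₀ ++ X} {p′ ∷ P′} {(q′ ∷ Q′) ++ X′} (drop-∷ {x = u} (drop-∷ {x = v} {u ∷ P₀ ++ Q₀ ++ X} {u ∷ (p′ ∷ P′) ++ (q′ ∷ Q′) ++ X′} (lin π (lin (↭-sym π′)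
          (permute ([ _ ] ∷ [ _ ] ∷ P₀ ∷ Q₀ ∷ X ∷ R ∷ [ _ ] ∷ P′ ∷ [ _ ] ∷ Q′ ∷ X′ ∷ [])
            (# 0 ⊕ # 1 ⊕ ((# 2 ⊕ # 3 ⊕ # 4) ⊕ # 5) ⊕ # 6 ⊕ # 7 ⊕ # 8 ⊕ # 9 ⊕ # 1 ⊕ # 0 ⊕ # 10)
            (# 0 ⊕ # 1 ⊕ # 6 ⊕ ((# 7 ⊕ # 8 ⊕ # 9 ⊕ # 10) ⊕ # 1 ⊕ # 2 ⊕ # 0 ⊕ # 3 ⊕ # 4) ⊕ # 5))))))
    ... | a , b , c₁ , d , r₁ , r₂ , r₃ , r₄ with riesz b {d} {q′ ∷ Q′} {X′} (↭-sym r₄) | riesz Q₀ {X} {c₁} {d} r₂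
    ...   | e , f , g , g′ , s₁ , s₂ , s₃ , s₄ | i , j , r , l , t₁ , t₂ , t₃ , t₄
      with riesz j {l} {g} {g′} (trans (↭-sym t₄) s₂)
    ...     | m , n , s , t , w₁ , w₂ , w₃ , w₄ =
      cross-⊥ {X′ = X′} a e f i m n r s t top record
        { P↭ = lin r₁ (lin s₁
            (permute (P₀ ∷ a ∷ b ∷ e ∷ f ∷ [])
              ((# 0 ⊕ # 1 ⊕ # 2) ⊕ # 3 ⊕ # 4)
              (((# 1 ⊕ # 3 ⊕ # 4) ⊕ # 0) ⊕ # 2))) ; Q↭ = lin t₁ (lin w₁
                (permute (Q₀ ∷ i ∷ j ∷ m ∷ n ∷ [])
                  ((# 0 ⊕ # 1 ⊕ # 2) ⊕ # 3 ⊕ # 4)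
                  (((# 1 ⊕ # 3 ⊕ # 4) ⊕ # 0) ⊕ # 2))) ; X↭ = lin t₂ (lin w₂
                      (permute (X ∷ r ∷ l ∷ s ∷ t ∷ [])
                        ((# 0 ⊕ # 1 ⊕ # 2) ⊕ # 3 ⊕ # 4)
                        (((# 1 ⊕ # 3 ⊕ # 4) ⊕ # 0) ⊕ # 2)))
        ; P′↭ = lin r₃ (lin t₃
            (permute ([ _ ] ∷ P′ ∷ a ∷ c₁ ∷ i ∷ r ∷ [])
              (# 0 ⊕ (# 1 ⊕ # 2 ⊕ # 3) ⊕ # 4 ⊕ # 5)
              (((# 2 ⊕ # 4 ⊕ # 5) ⊕ # 0 ⊕ # 1) ⊕ # 3))) ; Q′↭ = lin s₃ (lin w₃
                  (permute ([ _ ] ∷ Q′ ∷ e ∷ g ∷ m ∷ s ∷ [])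
                    (# 0 ⊕ (# 1 ⊕ # 2 ⊕ # 3) ⊕ # 4 ⊕ # 5)
                    (((# 2 ⊕ # 4 ⊕ # 5) ⊕ # 0 ⊕ # 1) ⊕ # 3))) ; X′↭ = lin s₄ (lin w₄
                        (permute (X′ ∷ f ∷ g′ ∷ n ∷ t ∷ [])
                          ((# 0 ⊕ # 1 ⊕ # 2) ⊕ # 3 ⊕ # 4)
                          (((# 1 ⊕ # 3 ⊕ # 4) ⊕ # 0) ⊕ # 2)))
        ; R↭ = π ; c = c ; c′ = c′ ; tight = tight ; tight′ = tight′ }

    bound-or-tight : ∀ {u v R′ a A b B X} → R ↭ u ∷ v ∷ R′ → (a ∷ A) ++ (b ∷ B) ++ X ↭ R′ → Complete (a ∷ A) (b ∷ B) →
      (length (a ∷ A) + length (b ∷ B) + (3 + k) ≡ length R → ⊥) →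
      length (a ∷ A) + length (b ∷ B) + (2 + k) ≤ length R′
    bound-or-tight {u} {v} {R′} {a} {A} {b} {B} {X} π ρ c n =
      ≤-pred (≤-pred (subst₂ _≤_ (cong suc (+-suc (length (a ∷ A) + length (b ∷ B)) (2 + k))) (↭-length π)
        (≤∧≢⇒< (βb a A b B (u ∷ v ∷ X) (lin ρ (lin (↭-sym π)
            (permute ([ _ ] ∷ A ∷ [ _ ] ∷ B ∷ [ _ ] ∷ [ _ ] ∷ X ∷ R′ ∷ R ∷ [])
              (# 0 ⊕ ((# 1 ⊕ # 2 ⊕ # 3 ⊕ # 4 ⊕ # 5 ⊕ # 6) ⊕ # 7) ⊕ # 8)
              ((# 8 ⊕ # 0 ⊕ # 1 ⊕ # 2 ⊕ # 3 ⊕ # 6) ⊕ # 4 ⊕ # 5 ⊕ # 7)))) c) n)))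

    -- An edge fails only because of a tight biclique that avoids both its ends. Without tight
    -- bicliques any edge is good; otherwise an edge across one with largest left side is.
    good-edge : (GoodEdge (2 + k) R → ⊥) → ⊥
    good-edge bad = has-edge {2 + k} αb λ { (edge u v R′ π uv) → bad (edge u v R′ π uv ,
      λ a A b B X ρ c → bound-or-tight {X = X} π ρ c λ tight →
        untight (_ , a , A , b , B , u ∷ v ∷ X , lin ρ (lin (↭-sym π)
            (permute ([ _ ] ∷ A ∷ [ _ ] ∷ B ∷ [ _ ] ∷ [ _ ] ∷ X ∷ R′ ∷ R ∷ [])
              (# 0 ⊕ ((# 1 ⊕ # 2 ⊕ # 3 ⊕ # 4 ⊕ # 5 ⊕ # 6) ⊕ # 7) ⊕ # 8)
              ((# 8 ⊕ # 0 ⊕ # 1 ⊕ # 2 ⊕ # 3 ⊕ # 6) ⊕ # 4 ⊕ # 5 ⊕ # 7))) , c , tight , refl)) }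
      where
      untight : ∃ TightWith → ⊥
      untight (n , T) = maximum {TightWith} n (length R) bounded T λ {
        (_ , (p , P , q , Q , X , π , c , tight , refl) , top) →
          bad (edge p q (P ++ Q ++ X) (lin (↭-sym π)
              (permute (R ∷ [ _ ] ∷ P ∷ [ _ ] ∷ Q ∷ X ∷ [])
                (# 0 ⊕ # 1 ⊕ # 2 ⊕ # 3 ⊕ # 4 ⊕ # 5)
                (# 1 ⊕ # 3 ⊕ (# 2 ⊕ # 4 ⊕ # 5) ⊕ # 0))) (c (here refl) (here refl)) ,
            λ a A b B X′ ρ c′ → bound-or-tight {p} {q} {P ++ Q ++ X} {X = X′} (lin (↭-sym π)
                (permute (R ∷ [ _ ] ∷ P ∷ [ _ ] ∷ Q ∷ X ∷ [])
                  (# 0 ⊕ # 1 ⊕ # 2 ⊕ # 3 ⊕ # 4 ⊕ # 5)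
                  (# 1 ⊕ # 3 ⊕ (# 2 ⊕ # 4 ⊕ # 5) ⊕ # 0))) ρ c′ λ tight′ →
              refine {X′ = X′} π c (lin π (lin ρ
                  (permute ([ _ ] ∷ A ∷ [ _ ] ∷ B ∷ [ _ ] ∷ [ _ ] ∷ X′ ∷ R ∷ P ∷ Q ∷ X ∷ [])
                    (# 0 ⊕ ((# 1 ⊕ # 2 ⊕ # 3 ⊕ # 4 ⊕ # 5 ⊕ # 6) ⊕ # 7) ⊕ # 8 ⊕ # 9 ⊕ # 10)
                    ((# 7 ⊕ # 4 ⊕ # 8 ⊕ # 5 ⊕ # 9 ⊕ # 10) ⊕ # 0 ⊕ # 1 ⊕ # 2 ⊕ # 3 ⊕ # 6)))) c′ tight tight′ top) }
        where
        bounded : ∀ m → TightWith m → m ≤ length R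
        bounded _ (p , P , q , Q , X , π , c , tight , refl) =
          subst (length (p ∷ P) ≤_) tight (≤-trans (m≤m+n _ (length (q ∷ Q))) (m≤m+n _ (3 + k)))

  -- The lattice argument needs a bound of at least three. For one every edge works, and for two the
  -- tight bicliques are the spanning ones of the rest.
  good-edge : ∀ k R → 3 * suc k ≤ length R → IndependentBound (suc k) R → BicliqueBound (suc k) R →
              (GoodEdge k R → ⊥) → ⊥
  good-edge 0 R large αb βb bad = has-edge {0} αb λ { e@(edge u v R′ π uv) → bad (e , λ a A b B X ρ c →
    ≤-trans (≤-reflexive (+-identityʳ _)) (≤-trans (m≤m+n _ (length X))
      (≤-reflexive (≡-trans (+-assoc (length (a ∷ A)) (length (b ∷ B)) (length X))
        (≡-trans (cong (length (a ∷ A) +_) (≡-sym (length-++ (b ∷ B))))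
          (≡-trans (≡-sym (length-++ (a ∷ A))) (↭-length ρ))))))) }
  good-edge 1 R large αb βb bad = Spanning.spanning-⊥ large αb βb bad
  good-edge (suc (suc k)) R large αb βb bad = Tight.good-edge large αb βb bad

  -- The order of `R` ensures that a packing of `k` triples beside the removed edge leaves at least
  -- one further vertex, which is what `leftover-edge` asks for.
  packing-exists : ∀ k R → 3 * k ≤ length R → IndependentBound k R → BicliqueBound k R →
                   (k ≡ 2 → length R ≡ 6 → Wheel R → ⊥) → (Packing k R → ⊥) → ⊥
  packing-exists zero R _ _ _ _ k = k ([] , R , refl , [] , refl)
  packing-exists (suc k) R large αb βb ¬wheel ¬pack = good-edge k R large αb βb λ { (edge u v R′ π uv , βb′) →
    packing-exists k R′ (large′ π) (αb′ π) βb′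
      -- A wheel has six vertices, so `R` would have eight, but three triples need nine.
      (λ { refl _ w → excess 0 large (cong suc (≡-sym (≡-trans (+-identityʳ _) (≡-trans (↭-length π) (cong (2 +_) (↭-length (Wheel.rim w))))))) })
      (λ { (ts , [] , refl , odds , ρ) → excess 0 large (few {u} {v} ts (lin π (lin (↭-sym ρ)
          (permute (R ∷ [ _ ] ∷ [ _ ] ∷ R′ ∷ (flat ts) ∷ [])
            ((# 0 ⊕ # 1 ⊕ # 2 ⊕ # 3) ⊕ # 4 ⊕ ∅)
            (# 1 ⊕ # 2 ⊕ (# 4 ⊕ # 0) ⊕ # 3)))))
         ; (ts , x ∷ rest , refl , odds , ρ) →
             leftover-edge {x = x} {rest} ts odds (lin (↭-sym π) (lin ρ
                 (permute ((flat ts) ∷ [ _ ] ∷ [ _ ] ∷ [ _ ] ∷ rest ∷ R ∷ R′ ∷ [])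
                   (((# 0 ⊕ # 1 ⊕ # 2 ⊕ # 3 ⊕ # 4) ⊕ # 5) ⊕ # 6)
                   ((# 5 ⊕ # 1 ⊕ # 2 ⊕ # 6) ⊕ # 0 ⊕ # 3 ⊕ # 4)))) uv αb βb
               (λ { e w → ¬wheel (cong suc e) (↭-length (Wheel.rim w)) w }) ¬pack }) }
    where
    large′ : ∀ {u v R′} → R ↭ u ∷ v ∷ R′ → 3 * k ≤ length R′
    large′ π = ≤-pred (≤-pred (subst (2 + 3 * k ≤_) (↭-length π)
      (≤-trans (n≤1+n _) (≤-trans (≤-reflexive (≡-sym (*-suc 3 k))) large))))
    few : ∀ {u v} ts → R ↭ u ∷ v ∷ flat ts → 3 * suc (length ts) ≡ suc (length R + 0)
    few ts π = ≡-trans (3*-suc (length ts))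
      (cong (λ n → suc (n + 0)) (≡-sym (≡-trans (↭-length π) (cong (2 +_) (length-flat ts)))))
      where
      3*-suc : ∀ n → 3 * suc n ≡ suc (2 + 3 * n + 0)
      3*-suc = solve-∀
    αb′ : ∀ {u v R′} → R ↭ u ∷ v ∷ R′ → IndependentBound k R′
    αb′ {u} {v} {R′} π C X ρ ind = ≤-pred (≤-pred (subst₂ _≤_ (shift-two (length C) k) (cong suc (↭-length π))
      (αb C (u ∷ v ∷ X) (lin ρ (lin (↭-sym π)
          (permute (C ∷ [ _ ] ∷ [ _ ] ∷ X ∷ R′ ∷ R ∷ [])
            (((# 0 ⊕ # 1 ⊕ # 2 ⊕ # 3) ⊕ # 4) ⊕ # 5)
            ((# 5 ⊕ # 0 ⊕ # 3) ⊕ # 1 ⊕ # 2 ⊕ # 4)))) ind)))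
      where
      shift-two : ∀ c k → c + 2 * suc k ≡ 2 + (c + 2 * k)
      shift-two = solve-∀

-- Clique minors of the complement of 𝓗, as lists of branch sets: two vertices are joined in the
-- complement when they are nonadjacent in 𝓗.
module Minors (𝓗 : TriangleFree) where

  open Triples 𝓗
  open import Relation.Binary.Construct.Closure.ReflexiveTransitive using (Star; ε; _◅_)

  Connected : List V → Set
  Connected C = ∀ {x y} → x ∈ₗ C → y ∈ₗ C → Star (λ x y → x ∈ₗ C × y ∈ₗ C × x ≁ y) x y

  NonEmpty : List V → Set
  NonEmpty C = ∃ λ x → x ∈ₗ C

  Touch : List V → List V → Set
  Touch C D = ∃ λ x → ∃ λ y → x ∈ₗ C × y ∈ₗ D × x ≁ y

  Dominates : List V → V → Set
  Dominates C y = ∃ λ x → x ∈ₗ C × x ≁ y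

  BranchSets : List (List V) → Set
  BranchSets Cs = All (λ C → NonEmpty C × Connected C) Cs × AllPairs Touch Cs

  Minor : List V → ℕ → Set
  Minor X t = ∃ λ Cs → ∃ λ rest → concat Cs ++ rest ↭ X × length Cs ≡ t × BranchSets Cs

  minor-mono : ∀ {X Y Z t} → X ↭ Y ++ Z → Minor Y t → Minor X t
  minor-mono {Z = Z} π (Cs , rest , ρ , len , bs) = Cs , rest ++ Z , lin (↭-sym π) (lin ρ
      (permute ((concat Cs) ∷ rest ∷ Z ∷ _ ∷ _ ∷ [])
        (((# 0 ⊕ # 1 ⊕ # 2) ⊕ # 3) ⊕ # 4)
        ((# 3 ⊕ # 4 ⊕ # 2) ⊕ # 0 ⊕ # 1))) , len , bs

  minor-pred : ∀ {X t} → Minor X (suc t) → Minor X t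
  minor-pred (C ∷ Cs , rest , ρ , len , (_ ∷ ok) , (_ ∷ pairs)) =
    Cs , C ++ rest , lin ρ
        (permute ((concat Cs) ∷ C ∷ rest ∷ _ ∷ []) ((# 0 ⊕ # 1 ⊕ # 2) ⊕ # 3) (# 3 ⊕ (# 1 ⊕ # 0) ⊕ # 2)) , suc-injective len , ok , pairs

  minor-≤ : ∀ {X s t} → s ≤ t → Minor X t → Minor X s
  minor-≤ {s = s} {t} le M with ≤⇒≤′ le
  ... | le′ = go le′ M
    where
    open import Data.Nat using (_≤′_; ≤′-refl; ≤′-step)
    go : ∀ {X s t} → s ≤′ t → Minor X t → Minor X s
    go ≤′-refl M = M
    go (≤′-step le) M = go le (minor-pred M)

  -- A branch set that dominates all of `Y` touches every branch set inside `Y`, whatever these are.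
  dominate : ∀ {X Y Cs t} → BranchSets Cs → concat Cs ++ Y ↭ X →
             (∀ {y} → y ∈ₗ Y → All (λ C → Dominates C y) Cs) → Minor Y t → Minor X (length Cs + t)
  dominate {Cs = Cs} (ok , pairs) π dom (Ds , rest , ρ , refl , ok′ , pairs′) =
    Cs ++ Ds , rest ,
    trans (++⁺ʳ rest (↭-reflexive (≡-sym (concat-++ Cs Ds)))) (lin ρ (lin π
        (permute ((concat Cs) ∷ (concat Ds) ∷ rest ∷ _ ∷ _ ∷ [])
          ((((# 0 ⊕ # 1) ⊕ # 2) ⊕ # 3) ⊕ # 4)
          ((# 4 ⊕ # 1 ⊕ # 2) ⊕ # 0 ⊕ # 3)))) ,
    length-++ Cs , AllP.++⁺ ok ok′ , AllPairsP.++⁺ pairs pairs′ (cross Cs Ds (λ i → dom (∈-resp-↭ ρ (∈-++⁺ˡ i))) ok′)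
    where
    touch : ∀ Cs {D} → (∃ λ y → y ∈ₗ D × All (λ C → Dominates C y) Cs) → All (λ C → Touch C D) Cs
    touch Cs (y , y∈ , a) = All.map (λ { (x , x∈ , n) → x , y , x∈ , y∈ , n }) a
    cross : ∀ Cs Ds → (∀ {y} → y ∈ₗ concat Ds → All (λ C → Dominates C y) Cs) →
            All (λ C → NonEmpty C × Connected C) Ds → All (λ C → All (Touch C) Ds) Cs
    cross Cs [] d _ = All.universal (λ _ → []) Cs
    cross Cs (D ∷ Ds) d (((y , y∈) , _) ∷ ok) =
      All.zipWith (λ { (p , q) → p ∷ q }) (touch Cs (y , y∈ , d (∈-++⁺ˡ y∈)) , cross Cs Ds (d ∘ ∈-++⁺ʳ D) ok)

  minor-empty : ∀ {X} → Minor X 0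
  minor-empty {X} = [] , X , refl , refl , [] , []

  minor-join : ∀ {X Y Z s t} → X ↭ Y ++ Z → (∀ {y z} → y ∈ₗ Y → z ∈ₗ Z → y ≁ z) →
               Minor Y s → Minor Z t → Minor X (s + t)
  minor-join {X} {Y} {Z} π sep (Cs , rest , ρ , refl , bs) M =
    minor-mono {Z = rest} (lin π (lin (↭-sym ρ)
        (permute (X ∷ Y ∷ Z ∷ (concat Cs) ∷ rest ∷ [])
          ((# 0 ⊕ # 1 ⊕ # 2) ⊕ # 3 ⊕ # 4)
          ((((# 3 ⊕ # 2) ⊕ # 4) ⊕ # 0) ⊕ # 1))))
      (dominate {concat Cs ++ Z} bs refl (λ z∈ → from Cs (proj₁ bs) (λ i → sep (∈-resp-↭ ρ (∈-++⁺ˡ i)) z∈)) M)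
    where
    from : ∀ Cs {z} → All (λ C → NonEmpty C × Connected C) Cs → (∀ {y} → y ∈ₗ concat Cs → y ≁ z) → All (λ C → Dominates C z) Cs
    from [] _ _ = []
    from (C ∷ Cs) (((y , y∈) , _) ∷ ok) f = (y , y∈ , f (∈-++⁺ˡ y∈)) ∷ from Cs ok (f ∘ ∈-++⁺ʳ C)

  singleton-connected : ∀ x → NonEmpty (x ∷ []) × Connected (x ∷ [])
  singleton-connected x = (x , here refl) , λ { (here refl) (here refl) → ε }

  pair-connected : ∀ {x y} → x ≁ y → NonEmpty (x ∷ y ∷ []) × Connected (x ∷ y ∷ [])
  pair-connected {x} {y} n = (x , here refl) , λ
    { (here refl) (here refl) → ε
    ; (here refl) (there (here refl)) → (here refl , there (here refl) , n) ◅ ε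
    ; (there (here refl)) (here refl) → (there (here refl) , here refl , ≁-sym n) ◅ ε
    ; (there (here refl)) (there (here refl)) → ε }

  triple-connected : ∀ t → Odd t → NonEmpty (tri t) × Connected (tri t)
  triple-connected (x , y , z) o = (x , here refl) , λ i j → walk (place i) (place j)
    where
    ix : x ∈ₗ tri (x , y , z)
    ix = here refl
    iy : y ∈ₗ tri (x , y , z)
    iy = there (here refl)
    iz : z ∈ₗ tri (x , y , z)
    iz = there (there (here refl))
    Walk : V → V → Set
    Walk = Star (λ u v → u ∈ₗ tri (x , y , z) × v ∈ₗ tri (x , y , z) × u ≁ v)
    place : ∀ {u} → u ∈ₗ tri (x , y , z) → u ≡ x ⊎ u ≡ y ⊎ u ≡ z
    place (here e) = inj₁ e
    place (there (here e)) = inj₂ (inj₁ e)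
    place (there (there (here e))) = inj₂ (inj₂ e)
    via : ∀ {a b c} → a ∈ₗ tri (x , y , z) → b ∈ₗ tri (x , y , z) → c ∈ₗ tri (x , y , z) → a ≁ c → c ≁ b → Walk a b
    via i j k m n = (i , k , m) ◅ (k , j , n) ◅ ε
    xy : Walk x y
    xy with Odd-view o
    ... | inj₁ (_ , n , n′) = via ix iy iz n (≁-sym n′)
    ... | inj₂ (inj₁ (_ , n , _)) = (ix , iy , n) ◅ ε
    ... | inj₂ (inj₂ (_ , n , _)) = (ix , iy , n) ◅ ε
    xz : Walk x z
    xz with Odd-view o
    ... | inj₁ (_ , n , n′) = (ix , iz , n) ◅ ε
    ... | inj₂ (inj₁ (_ , n , n′)) = via ix iz iy n n′
    ... | inj₂ (inj₂ (_ , _ , n)) = (ix , iz , n) ◅ ε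
    open import Relation.Binary.Construct.Closure.ReflexiveTransitive using (reverse; _◅◅_)
    back : ∀ {a b} → Walk a b → Walk b a
    back = reverse λ { (i , j , n) → j , i , ≁-sym n }
    walk : ∀ {u v} → u ≡ x ⊎ u ≡ y ⊎ u ≡ z → v ≡ x ⊎ v ≡ y ⊎ v ≡ z → Walk u v
    walk (inj₁ refl) (inj₁ refl) = ε
    walk (inj₁ refl) (inj₂ (inj₁ refl)) = xy
    walk (inj₁ refl) (inj₂ (inj₂ refl)) = xz
    walk (inj₂ (inj₁ refl)) (inj₁ refl) = back xy
    walk (inj₂ (inj₁ refl)) (inj₂ (inj₁ refl)) = ε
    walk (inj₂ (inj₁ refl)) (inj₂ (inj₂ refl)) = back xy ◅◅ xz
    walk (inj₂ (inj₂ refl)) (inj₁ refl) = back xz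
    walk (inj₂ (inj₂ refl)) (inj₂ (inj₁ refl)) = back xz ◅◅ xy
    walk (inj₂ (inj₂ refl)) (inj₂ (inj₂ refl)) = ε

  edge-dominates : ∀ {C x y} → x ∈ₗ C → y ∈ₗ C → x ~ y → ∀ v → Dominates C v
  edge-dominates {x = x} {y} i j e v with ~∨≁ x v
  ... | inj₂ n = x , i , n
  ... | inj₁ p = y , j , common⇒≁ e p

  triple-dominates : ∀ t → Odd t → ∀ v → Dominates (tri t) v
  triple-dominates (x , y , z) o with Odd-view o
  ... | inj₁ (e , _)        = edge-dominates (here refl) (there (here refl)) e
  ... | inj₂ (inj₁ (e , _)) = edge-dominates (here refl) (there (there (here refl))) e
  ... | inj₂ (inj₂ (e , _)) = edge-dominates (there (here refl)) (there (there (here refl))) e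

  singletons : ∀ C → Independent C → Minor C (length C)
  singletons [] _ = minor-empty
  singletons (x ∷ C) ind =
    dominate {Cs = (x ∷ []) ∷ []} (singleton-connected x ∷ [] , [] ∷ []) refl
      (λ j → (x , here refl , ind (here refl) (there j)) ∷ []) (singletons C (λ i j → ind (there i) (there j)))

  triples-minor : ∀ {X Y s} ts → All Odd ts → flat ts ++ Y ↭ X → Minor Y s → Minor X (length ts + s)
  triples-minor {Y = Y} [] _ π M = minor-mono {Z = []} (trans (↭-sym π) (↭-sym (↭-identityʳ Y))) M
  triples-minor {X} {Y} (t ∷ ts) (o ∷ os) π M =
    dominate {Cs = tri t ∷ []} (triple-connected t o ∷ [] , [] ∷ []) π
      (λ {y} _ → triple-dominates t o y ∷ []) (triples-minor {flat ts ++ Y} ts os refl M)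

  record Matching (L S : List V) : Set where
    field
      {l}   : ℕ
      p q   : Fin l → V
      L′ S′ : List V
      L↭    : L ↭ tabulate q ++ L′
      S↭    : S ↭ tabulate p ++ S′
      q≁p   : ∀ i → q i ≁ p i

  pairs : ∀ {l} (p q : Fin l → V) → List (List V)
  pairs p q = tabulate λ i → q i ∷ p i ∷ []

  concat-pairs : ∀ {l} (p q : Fin l → V) → concat (pairs p q) ↭ tabulate q ++ tabulate p
  concat-pairs {zero}  p q = refl
  concat-pairs {suc l} p q = trans (++⁺ˡ (q zero ∷ p zero ∷ []) (concat-pairs (p ∘ suc) (q ∘ suc))) (rearrange _ _)
    where
    rearrange : ∀ qs ps → q zero ∷ p zero ∷ qs ++ ps ↭ (q zero ∷ qs) ++ (p zero ∷ ps)
    rearrange qs ps =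
        permute ([ _ ] ∷ [ _ ] ∷ qs ∷ ps ∷ [])
          (# 0 ⊕ # 1 ⊕ # 2 ⊕ # 3)
          (# 0 ⊕ # 2 ⊕ # 1 ⊕ # 3)

  pairs-branch : ∀ {l} (p q : Fin l → V) → (∀ i → q i ≁ p i) → (∀ i j → q i ≁ q j) → BranchSets (pairs p q)
  pairs-branch p q n m =
    AllP.tabulate⁺ (λ i → pair-connected (n i)) ,
    AllPairsP.tabulate⁺ (λ {i} {j} _ → q i , q j , here refl , here refl , m i j)

-- König's theorem for nonadjacency between two lists.

module Koenig (𝓗 : TriangleFree) where

  open Triples 𝓗
  open Alternating 𝓗
  open Minors 𝓗

  data Outcome {L S : List V} (M : Matching L S) : Set where
    saturatesˡ : Matching.L′ M ≡ [] → Outcome M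
    saturatesʳ : Matching.S′ M ≡ [] → Outcome M
    biclique   : ∀ a A b B RL RS → L ↭ (a ∷ A) ++ RL → S ↭ (b ∷ B) ++ RS → Complete (a ∷ A) (b ∷ B) →
                 length L < length (a ∷ A) + length (b ∷ B) → Outcome M

  -- Take a maximum matching. If both sides have unmatched vertices, the closed search yields the
  -- complement of a vertex cover: one vertex of each matched pair and all unmatched ones. These are
  -- as many as `L` and the unmatched part of `S` together.
  koenig : ∀ L S → ((Σ (Matching L S) Outcome) → ⊥) → ⊥
  koenig L S k = maximum {λ n → Σ (Matching L S) λ M → Matching.l M ≡ n} 0 (length L) bounded empty analyse
    where
    bounded : ∀ m → (Σ (Matching L S) λ M → Matching.l M ≡ m) → m ≤ length L
    bounded _ (M , refl) = subst (Matching.l M ≤_)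
      (≡-sym (≡-trans (↭-length (Matching.L↭ M)) (≡-trans (length-++ (tabulate (Matching.q M)))
        (cong (_+ length (Matching.L′ M)) (length-tabulate (Matching.q M)))))) (m≤m+n _ _)
    empty : Σ (Matching L S) λ M → Matching.l M ≡ 0
    empty = record { p = λ () ; q = λ () ; L′ = L ; S′ = S ; L↭ = refl ; S↭ = refl ; q≁p = λ () } , refl

    extend : ∀ {n} → V → (Fin n → V) → Fin (suc n) → V
    extend x f zero    = x
    extend x f (suc i) = f i

    analyse : (∃ λ n → (Σ (Matching L S) λ M → Matching.l M ≡ n) ×
               (∀ m → (Σ (Matching L S) λ M → Matching.l M ≡ m) → m ≤ n)) → ⊥
    analyse (_ , (M , refl) , top) = split L′ S′ refl refl
      where
      open Matching M
      augmenting : ∀ {z a s} (q′ : Fin l → V) → z ∈ₗ L′ → a ∷ tabulate q′ ↭ z ∷ tabulate q →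
                   (∀ i → q′ i ≁ p i) → s ∈ₗ S′ → a ≁ s → ⊥
      augmenting {z} {a} {s} q′ z∈ path v s∈ n with ∈⇒↭ z∈ | ∈⇒↭ s∈
      ... | L″ , σ | S″ , τ = 1+n≰n (top (suc l) (record
        { p = extend s p ; q = extend a q′ ; L′ = L″ ; S′ = S″
        ; L↭ = trans L↭ (trans (++⁺ˡ (tabulate q) σ) (trans (shift z (tabulate q) L″) (++⁺ʳ L″ (↭-sym path))))
        ; S↭ = trans S↭ (trans (++⁺ˡ (tabulate p) τ) (shift s (tabulate p) S″))
        ; q≁p = λ { zero → n ; (suc i) → v i } } , refl))

      Good : V → Set
      Good a = ∀ {s} → s ∈ₗ S′ → a ~ s

      good : ∀ {z a} (q′ : Fin l → V) → z ∈ₗ L′ → a ∷ tabulate q′ ↭ z ∷ tabulate q → (∀ i → q′ i ≁ p i) → Good a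
      good q′ z∈ path v s∈ = ¬≁⇒~ (augmenting q′ z∈ path v s∈)

      open Search p q (_∈ₗ L′) (λ i x → x ≁ p i) Good q≁p (λ i _ n → n) good

      split : ∀ L₀ S₀ → L₀ ≡ L′ → S₀ ≡ S′ → ⊥
      split [] _ e _ = k (M , saturatesˡ (≡-sym e))
      split _ [] _ e = k (M , saturatesʳ (≡-sym e))
      split (a ∷ A) (b ∷ B) refl refl = closure λ closed → cover closed
        where
        module _ (closed : Closed) where
          open Closed closed

          record Cover {n : ℕ} (f : Fin n → Fin l) : Set where
            field
              ks rs us ms : List V
              q↭ : tabulate (q ∘ f) ↭ ks ++ rs
              p↭ : tabulate (p ∘ f) ↭ us ++ ms
              reached   : ∀ {x} → x ∈ₗ ks → ∃ λ i → ρ i ≡ true × x ≡ q i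
              unreached : ∀ {x} → x ∈ₗ us → ∃ λ i → ρ i ≡ false × x ≡ p i
              total : length ks + length us ≡ n

          covering : ∀ n (f : Fin n → Fin l) → Cover f
          covering zero f = record { ks = [] ; rs = [] ; us = [] ; ms = [] ; q↭ = refl ; p↭ = refl
                                   ; reached = λ () ; unreached = λ () ; total = refl }
          covering (suc n) f with ρ (f zero) in e | covering n (f ∘ suc)
          ... | true | C = record
            { ks = q (f zero) ∷ ks ; rs = rs ; us = us ; ms = p (f zero) ∷ ms
            ; q↭ = prep _ q↭ ; p↭ = trans (prep _ p↭)
                (permute ([ _ ] ∷ us ∷ ms ∷ []) (# 0 ⊕ # 1 ⊕ # 2) (# 1 ⊕ # 0 ⊕ # 2))
            ; reached = λ { (here refl) → _ , e , refl ; (there i) → reached i }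
            ; unreached = unreached ; total = cong suc total }
            where open Cover C
          ... | false | C = record
            { ks = ks ; rs = q (f zero) ∷ rs ; us = p (f zero) ∷ us ; ms = ms
            ; q↭ = trans (prep _ q↭)
                (permute ([ _ ] ∷ ks ∷ rs ∷ []) (# 0 ⊕ # 1 ⊕ # 2) (# 1 ⊕ # 0 ⊕ # 2)) ; p↭ = prep _ p↭
            ; reached = reached
            ; unreached = λ { (here refl) → _ , e , refl ; (there i) → unreached i }
            ; total = ≡-trans (+-suc (length ks) (length us)) (cong suc total) }
            where open Cover C

          cover : ⊥
          cover = k (M , biclique a (A ++ ks) b (B ++ us) rs ms
            (trans L↭ (trans (++⁺ʳ (a ∷ A) q↭)
                (permute (ks ∷ rs ∷ [ _ ] ∷ A ∷ []) ((# 0 ⊕ # 1) ⊕ # 2 ⊕ # 3) (# 2 ⊕ (# 3 ⊕ # 0) ⊕ # 1)))) (trans S↭ (trans (++⁺ʳ (b ∷ B) p↭)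
                    (permute (us ∷ ms ∷ [ _ ] ∷ B ∷ [])
                      ((# 0 ⊕ # 1) ⊕ # 2 ⊕ # 3)
                      (# 2 ⊕ (# 3 ⊕ # 0) ⊕ # 1)))) complete sizes)
            where
            open Cover (covering l id)
            complete : Complete (a ∷ A ++ ks) (b ∷ B ++ us)
            complete i j with ∈-++⁻ (a ∷ A) i | ∈-++⁻ (b ∷ B) j
            ... | inj₁ i′ | inj₁ j′ = good q i′ refl q≁p j′
            ... | inj₁ i′ | inj₂ j′ with unreached j′
            ...   | y , e , refl = source-adjacent y i′ e
            complete i j | inj₂ i′ | inj₁ j′ with reached i′
            ...   | x , e , refl = reached-good x e j′
            complete i j | inj₂ i′ | inj₂ j′ with reached i′ | unreached j′
            ...   | x , e , refl | y , e′ , refl = reached-adjacent x y e e′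
            regroup : ∀ x y k u → suc (x + k) + suc (y + u) ≡ suc (k + u + suc x) + y
            regroup = solve-∀
            sizes : length L < length (a ∷ A ++ ks) + length (b ∷ B ++ us)
            sizes = ≤-trans (≤-trans (s≤s (≤-reflexive lenL)) (m≤m+n _ (length B)))
              (≤-reflexive (≡-trans (≡-sym (regroup (length A) (length B) (length ks) (length us)))
                (cong₂ (λ x y → suc x + suc y) (≡-sym (length-++ A)) (≡-sym (length-++ B)))))
              where
              lenL : length L ≡ length ks + length us + suc (length A)
              lenL = ≡-trans (↭-length L↭) (≡-trans (length-++ (tabulate q))
                (cong (_+ suc (length A)) (≡-trans (length-tabulate q) (≡-sym total))))

-- Clique minors of half the order.

module HalfMinor (𝓗 : TriangleFree) where

  open Triples 𝓗
  open Minors 𝓗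
  open Koenig 𝓗
  open Packings 𝓗

  -- A set of 2m + 1 vertices without a clique minor of order m + 1, all of whose proper subsets
  -- are fine.
  module Counterexample {X : List V} {m : ℕ} (size : length X ≡ suc (2 * m))
    (none : Minor X (suc m) → ⊥)
    (smaller : ∀ {y Y Z t} → X ↭ y ∷ Z ++ Y → 2 * t ≤ suc (length Y) → (Minor Y t → ⊥) → ⊥)
    where

    -- These `l + 1` pairs can be put on top of a minor of order `m − l` of the other vertices,
    -- which the minimality of `X` provides.
    no-dominating-pairs : ∀ {l} (p q : Fin (suc l) → V) {Y} → (∀ i → q i ≁ p i) → (∀ i j → q i ≁ q j) →
      concat (pairs p q) ++ Y ↭ X → (∀ {y} → y ∈ₗ Y → ∀ i → q i ≁ y ⊎ p i ≁ y) → ⊥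
    no-dominating-pairs {l} p q {Y} n n′ π dom =
      smaller {Z = p zero ∷ concat (pairs (p ∘ suc) (q ∘ suc))} {m ∸ l} (↭-sym π) enough λ M →
        none (minor-≤ (≤-trans (s≤s (m≤n+m∸n m l)) (≤-reflexive (cong (_+ (m ∸ l)) (≡-sym (length-tabulate (λ i → q i ∷ p i ∷ []))))))
          (dominate (pairs-branch p q n n′) π
            (λ y∈ → AllP.tabulate⁺ λ i → either (dom y∈ i)) M))
      where
      either : ∀ {x x′ y} → x ≁ y ⊎ x′ ≁ y → Dominates (x ∷ x′ ∷ []) y
      either (inj₁ k) = _ , here refl , k
      either (inj₂ k) = _ , there (here refl) , k
      lenX : 2 * suc l + length Y ≡ suc (2 * m)
      lenX = ≡-trans (≡-sym (≡-trans (↭-length (↭-sym π)) (≡-trans (length-++ (concat (pairs p q)))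
        (cong (_+ length Y) (≡-trans (↭-length (concat-pairs p q)) (≡-trans (length-++ (tabulate q))
          (≡-trans (cong₂ _+_ (length-tabulate q) (length-tabulate p)) (double (suc l))))))))) size
        where
        double : ∀ n → n + n ≡ 2 * n
        double = solve-∀
      enough : 2 * (m ∸ l) ≤ suc (length Y)
      enough = ≤-reflexive (≡-trans (*-distribˡ-∸ 2 m l) (≡-trans
        (cong (_∸ 2 * l) (suc-injective (≡-trans (≡-sym lenX) (rearrange l (length Y)))))
        (m+n∸m≡n (2 * l) (suc (length Y)))))
        where
        rearrange : ∀ l y → 2 * suc l + y ≡ suc (2 * l + suc y)
        rearrange = solve-∀

    -- König's theorem is applied between `B` and the vertices that miss `A`. A matching covering
    -- `B` gives pairs which, with the single vertices of `A`, form more than `m` branch sets. A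
    -- matching covering `SA` gives dominating pairs. A large biclique between the two would enlarge
    -- the given one, by moving its part of `SA` to the side of `A`.
    side-empty : ∀ {a A b B s SA SB} → (a ∷ A) ++ (b ∷ B) ++ (s ∷ SA) ++ SB ↭ X → Complete (a ∷ A) (b ∷ B) →
      (∀ {x y} → x ∈ₗ s ∷ SA → y ∈ₗ a ∷ A → x ≁ y) → (∀ {x y} → x ∈ₗ SB → y ∈ₗ b ∷ B → x ≁ y) →
      m < length (a ∷ A) + length (b ∷ B) →
      (∀ a′ A′ b′ B′ S′ → (a′ ∷ A′) ++ (b′ ∷ B′) ++ S′ ↭ X → Complete (a′ ∷ A′) (b′ ∷ B′) →
        length (a′ ∷ A′) + length (b′ ∷ B′) ≤ length (a ∷ A) + length (b ∷ B)) → ⊥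
    side-empty {a} {A} {b} {B} {s} {SA} {SB} π c anti anti′ big top =
      koenig (b ∷ B) (s ∷ SA) λ { (M , out) → outcome M out }
      where
      A-ind : Independent (a ∷ A)
      A-ind i j = common⇒≁ (~-sym (c i (here refl))) (~-sym (c j (here refl)))
      B-ind : Independent (b ∷ B)
      B-ind i j = common⇒≁ (c (here refl) i) (c (here refl) j)
      outcome : (M : Matching (b ∷ B) (s ∷ SA)) → Outcome M → ⊥
      outcome M (biclique a′ A′ b′ B′ RL RS L↭ S↭ c′ lt) =
        <⇒≱ (+-monoʳ-< (length (a ∷ A)) lt)
          (≤-trans (≤-reflexive regroup) (top a (A ++ b′ ∷ B′) a′ A′ (RL ++ RS ++ SB)
            (lin (↭-sym L↭) (lin (↭-sym S↭) (lin π
                (permute ([ _ ] ∷ A ∷ [ _ ] ∷ B′ ∷ [ _ ] ∷ A′ ∷ RL ∷ RS ∷ SB ∷ [ _ ] ∷ B ∷ [ _ ] ∷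
                  SA ∷ X ∷ [])
                  (# 0 ⊕ ((((# 1 ⊕ # 2 ⊕ # 3) ⊕ # 4 ⊕ # 5 ⊕ # 6 ⊕ # 7 ⊕ # 8) ⊕ # 9 ⊕ # 10) ⊕ # 11 ⊕
                  # 12) ⊕ # 13)
                  (((# 13 ⊕ # 4 ⊕ # 5 ⊕ # 6) ⊕ # 2 ⊕ # 3 ⊕ # 7) ⊕ # 0 ⊕ # 1 ⊕ # 9 ⊕ # 10 ⊕ # 11 ⊕
                  # 12 ⊕ # 8))))) complete))
        where
        complete : Complete (a ∷ A ++ b′ ∷ B′) (a′ ∷ A′)
        complete i j with ∈-++⁻ (a ∷ A) i
        ... | inj₁ i′ = c i′ (∈-resp-↭ (↭-sym L↭) (∈-++⁺ˡ j))
        ... | inj₂ i′ = ~-sym (c′ j i′)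
        identity : ∀ x y z → x + (y + z) ≡ x + z + y
        identity = solve-∀
        regroup : length (a ∷ A) + (length (a′ ∷ A′) + length (b′ ∷ B′)) ≡ length (a ∷ A ++ b′ ∷ B′) + length (a′ ∷ A′)
        regroup = ≡-trans (identity (length (a ∷ A)) (length (a′ ∷ A′)) (length (b′ ∷ B′)))
          (cong (_+ length (a′ ∷ A′)) (≡-sym (length-++ (a ∷ A))))
      outcome M (saturatesˡ e) = none (minor-≤ enough (minor-mono {Z = S′ ++ SB} X↭
        (dominate {Y = (a ∷ A)} (pairs-branch p q q≁p (λ i j → B-ind (inB i) (inB j))) refl
          (λ y∈ → AllP.tabulate⁺ λ i → p i , there (here refl) , anti (inS i) y∈)
          (singletons (a ∷ A) A-ind))))
        where
        open Matching M
        inB : ∀ i → q i ∈ₗ b ∷ B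
        inB i = ∈-resp-↭ (↭-sym L↭) (∈-++⁺ˡ (∈-tabulate⁺ {f = q} i))
        inS : ∀ i → p i ∈ₗ s ∷ SA
        inS i = ∈-resp-↭ (↭-sym S↭) (∈-++⁺ˡ (∈-tabulate⁺ {f = p} i))
        X↭ : X ↭ (concat (pairs p q) ++ a ∷ A) ++ S′ ++ SB
        X↭ = lin (↭-sym π) (lin (↭-sym (concat-pairs p q)) (lin (subst (λ L′ → b ∷ B ↭ tabulate q ++ L′) e L↭) (lin S↭
            (permute (X ∷ [ _ ] ∷ A ∷ [ _ ] ∷ B ∷ [ _ ] ∷ SA ∷ SB ∷ (concat (pairs p q)) ∷
              (tabulate q) ∷ (tabulate p) ∷ S′ ∷ [])
              ((((# 0 ⊕ # 1 ⊕ # 2 ⊕ # 3 ⊕ # 4 ⊕ # 5 ⊕ # 6 ⊕ # 7) ⊕ # 8) ⊕ # 9 ⊕ ∅) ⊕ # 10 ⊕ # 11)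
              ((((((# 8 ⊕ # 1 ⊕ # 2) ⊕ # 11 ⊕ # 7) ⊕ # 0) ⊕ # 9 ⊕ # 10) ⊕ # 3 ⊕ # 4) ⊕ # 5 ⊕ # 6)))))
        enough : suc m ≤ length (pairs p q) + length (a ∷ A)
        enough = subst (suc m ≤_) (≡-trans (+-comm (length (a ∷ A)) (length (b ∷ B)))
          (cong (_+ length (a ∷ A)) (≡-trans (↭-length (subst (λ L′ → b ∷ B ↭ tabulate q ++ L′) e L↭))
            (≡-trans (length-++ (tabulate q)) (≡-trans (+-identityʳ _) (≡-trans (length-tabulate q) (≡-sym (length-tabulate _)))))))) big
      outcome M (saturatesʳ e) = go p q q≁p L↭ (subst (λ S′ → s ∷ SA ↭ tabulate p ++ S′) e S↭)
        where
        open Matching M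
        go : ∀ {l} (p q : Fin l → V) → (∀ i → q i ≁ p i) → b ∷ B ↭ tabulate q ++ L′ → s ∷ SA ↭ tabulate p ++ [] → ⊥
        go {zero} p q n L↭ S↭ with () ← ↭-length S↭
        go {suc l} p q n L↭ S↭ =
          no-dominating-pairs p q n (λ i j → B-ind (inB i) (inB j))
            (lin (concat-pairs p q) (lin (↭-sym L↭) (lin (↭-sym S↭) (lin π
                (permute ([ _ ] ∷ [ _ ] ∷ (concat (pairs (p ∘ suc) (q ∘ suc))) ∷ [ _ ] ∷ A ∷ L′ ∷
                  SB ∷ (tabulate (q ∘ suc)) ∷ (tabulate (p ∘ suc)) ∷ [ _ ] ∷ B ∷ [ _ ] ∷ SA ∷ X ∷
                  [])
                  (# 0 ⊕ # 1 ⊕ ((((# 2 ⊕ # 3 ⊕ # 4 ⊕ # 5 ⊕ # 6) ⊕ # 0 ⊕ # 7 ⊕ # 1 ⊕ # 8) ⊕ # 9 ⊕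
                  # 10) ⊕ # 11 ⊕ # 12) ⊕ # 13)
                  ((((# 13 ⊕ # 0 ⊕ # 1 ⊕ # 2) ⊕ # 0 ⊕ # 7 ⊕ # 5) ⊕ # 1 ⊕ # 8 ⊕ ∅) ⊕ # 3 ⊕ # 4 ⊕
                  # 9 ⊕ # 10 ⊕ # 11 ⊕ # 12 ⊕ # 6)))))) dom
          where
          inB : ∀ i → q i ∈ₗ b ∷ B
          inB i = ∈-resp-↭ (↭-sym L↭) (∈-++⁺ˡ (∈-tabulate⁺ {f = q} i))
          inS : ∀ i → p i ∈ₗ s ∷ SA
          inS i = ∈-resp-↭ (↭-sym S↭) (∈-++⁺ˡ (∈-tabulate⁺ {f = p} i))
          dom : ∀ {y} → y ∈ₗ (a ∷ A) ++ L′ ++ SB → ∀ i → q i ≁ y ⊎ p i ≁ y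
          dom y∈ i with ∈-++⁻ (a ∷ A) y∈
          ... | inj₁ y∈A = inj₂ (anti (inS i) y∈A)
          ... | inj₂ y∈′ with ∈-++⁻ L′ y∈′
          ...   | inj₁ y∈L = inj₁ (B-ind (inB i) (∈-resp-↭ (↭-sym L↭) (∈-++⁺ʳ (tabulate q) y∈L)))
          ...   | inj₂ y∈S = inj₁ (≁-sym (anti′ y∈S (inB i)))

    -- An outer vertex that sees `A` misses `B`, so the outer vertices divide by the side they miss.
    -- If there are none, the larger side is a clique of order `m + 1`.
    too-big-⊥ : ∀ {a A b B S} → (a ∷ A) ++ (b ∷ B) ++ S ↭ X → Complete (a ∷ A) (b ∷ B) →
      m < length (a ∷ A) + length (b ∷ B) →
      (∀ a′ A′ b′ B′ S′ → (a′ ∷ A′) ++ (b′ ∷ B′) ++ S′ ↭ X → Complete (a′ ∷ A′) (b′ ∷ B′) →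
        length (a′ ∷ A′) + length (b′ ∷ B′) ≤ length (a ∷ A) + length (b ∷ B)) → ⊥
    too-big-⊥ {a} {A} {b} {B} {S} π c big top with partitionᵇ (λ z → any (h z) (a ∷ A)) S
      where open import Data.Bool.ListAction using (any)
    ... | SB , SA , ρ , sees , blind = go SA SB ρ (λ i → not-seen (blind i)) (λ i j → seen (sees i) j)
      where
      open import Data.Bool.ListAction using (any)
      not-seen : ∀ {z A} → any (h z) A ≡ false → ∀ {y} → y ∈ₗ A → z ≁ y
      not-seen {z} {x ∷ A} e i with h z x in e′
      not-seen {z} {x ∷ A} e (here refl) | false = e′
      not-seen {z} {x ∷ A} e (there i)   | false = not-seen {z} {A} e i
      someone : ∀ {z} A → any (h z) A ≡ true → ∃ λ y → y ∈ₗ A × z ~ y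
      someone {z} (x ∷ A) e with h z x in e′
      ... | true = x , here refl , e′
      ... | false with someone A e
      ...   | y , i , k = y , there i , k
      seen : ∀ {z} → any (h z) (a ∷ A) ≡ true → ∀ {y} → y ∈ₗ b ∷ B → z ≁ y
      seen e j with someone (a ∷ A) e
      ... | y , i , k = common⇒≁ (~-sym k) (c i j)
      go : ∀ SA SB → S ↭ SB ++ SA → (∀ {x y} → x ∈ₗ SA → y ∈ₗ a ∷ A → x ≁ y) →
           (∀ {x y} → x ∈ₗ SB → y ∈ₗ b ∷ B → x ≁ y) → ⊥
      go (s ∷ SA) SB ρ anti anti′ = side-empty (lin (↭-sym ρ) (lin π
          (permute ([ _ ] ∷ A ∷ [ _ ] ∷ B ∷ [ _ ] ∷ SA ∷ SB ∷ S ∷ X ∷ [])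
            (# 0 ⊕ ((# 1 ⊕ # 2 ⊕ # 3 ⊕ # 4 ⊕ # 5 ⊕ # 6) ⊕ # 7) ⊕ # 8)
            ((# 8 ⊕ # 6 ⊕ # 4 ⊕ # 5) ⊕ # 0 ⊕ # 1 ⊕ # 2 ⊕ # 3 ⊕ # 7)))) c anti anti′ big top
      go [] (s ∷ SB) ρ anti anti′ = side-empty {b} {B} {a} {A} {s} {SB} {[]} (lin (↭-sym ρ) (lin π
          (permute ([ _ ] ∷ B ∷ [ _ ] ∷ A ∷ [ _ ] ∷ SB ∷ S ∷ X ∷ [])
            (# 0 ⊕ ((# 1 ⊕ # 2 ⊕ # 3 ⊕ # 4 ⊕ # 5 ⊕ ∅) ⊕ # 6) ⊕ # 7)
            ((# 7 ⊕ # 4 ⊕ # 5 ⊕ ∅) ⊕ # 2 ⊕ # 3 ⊕ # 0 ⊕ # 1 ⊕ # 6))))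
        (Complete-sym c) anti′ anti (subst (m <_) (+-comm (length (a ∷ A)) _) big)
        λ a′ A′ b′ B′ S′ π′ c′ → ≤-trans (top a′ A′ b′ B′ S′ π′ c′) (≤-reflexive (+-comm (length (a ∷ A)) _))
      go [] [] ρ anti anti′ = larger (<-≤-connex m (length (a ∷ A)))
        where
        X↭ : (a ∷ A) ++ (b ∷ B) ↭ X
        X↭ = lin (↭-sym ρ) (lin π
            (permute ([ _ ] ∷ A ∷ [ _ ] ∷ B ∷ S ∷ X ∷ [])
              (# 0 ⊕ ((# 1 ⊕ # 2 ⊕ # 3) ⊕ # 4) ⊕ # 5)
              ((# 5 ⊕ ∅) ⊕ # 0 ⊕ # 1 ⊕ # 2 ⊕ # 3 ⊕ # 4)))
        sum : length (a ∷ A) + length (b ∷ B) ≡ suc (2 * m)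
        sum = ≡-trans (≡-sym (length-++ (a ∷ A))) (≡-trans (↭-length X↭) size)
        larger : m < length (a ∷ A) ⊎ length (a ∷ A) ≤ m → ⊥
        larger (inj₁ lt) = none (minor-≤ lt (minor-mono {Z = b ∷ B} (↭-sym X↭) (singletons (a ∷ A)
          λ i j → common⇒≁ (~-sym (c i (here refl))) (~-sym (c j (here refl))))))
        larger (inj₂ le) = none (minor-≤ lt (minor-mono {Z = a ∷ A} (lin (↭-sym X↭)
            (permute (X ∷ [ _ ] ∷ A ∷ [ _ ] ∷ B ∷ [])
              (# 0 ⊕ # 1 ⊕ # 2 ⊕ # 3 ⊕ # 4)
              (# 3 ⊕ (# 4 ⊕ # 1 ⊕ # 2) ⊕ # 0))) (singletons (b ∷ B)
          λ i j → common⇒≁ (c (here refl) i) (c (here refl) j))))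
          where
          lt : m < length (b ∷ B)
          lt = +-cancelˡ-≤ m _ _ (≤-trans (≤-reflexive (≡-trans (+-suc m m) (≡-trans (cong (λ n → suc (m + n)) (≡-sym (+-identityʳ m))) (≡-sym sum))))
            (+-monoˡ-≤ (length (b ∷ B)) le))

    biclique-small : ∀ {a A b B S} → (a ∷ A) ++ (b ∷ B) ++ S ↭ X → Complete (a ∷ A) (b ∷ B) →
                     length (a ∷ A) + length (b ∷ B) ≤ m
    biclique-small {a} {A} {b} {B} {S} π c = ≮⇒≥ λ big →
      maximum {Size} _ (length X) bounded (a , A , b , B , S , π , c , refl)
        λ { (_ , (a₁ , A₁ , b₁ , B₁ , S₁ , π₁ , c₁ , refl) , top) →
          too-big-⊥ π₁ c₁ (≤-trans big (top _ (a , A , b , B , S , π , c , refl)))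
            λ a′ A′ b′ B′ S′ π′ c′ → top _ (a′ , A′ , b′ , B′ , S′ , π′ , c′ , refl) }
      where
      Size : ℕ → Set
      Size n = ∃ λ a → ∃ λ A → ∃ λ b → ∃ λ B → ∃ λ S → (a ∷ A) ++ (b ∷ B) ++ S ↭ X ×
               Complete (a ∷ A) (b ∷ B) × length (a ∷ A) + length (b ∷ B) ≡ n
      bounded : ∀ n → Size n → n ≤ length X
      bounded _ (a , A , b , B , S , π , c , refl) = ≤-trans (m≤m+n _ (length S))
        (≤-reflexive (≡-trans (+-assoc (length (a ∷ A)) _ _) (≡-trans (cong (length (a ∷ A) +_) (≡-sym (length-++ (b ∷ B))))
          (≡-trans (≡-sym (length-++ (a ∷ A))) (↭-length π)))))

  triangular : ℕ → ℕ
  triangular zero    = 0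
  triangular (suc r) = suc (triangular r + r)

  -- R(3, r) ≤ r (r + 1) / 2
  ramsey : ∀ r X → triangular r ≤ length X → ∃ λ C → ∃ λ W → C ++ W ↭ X × Independent C × length C ≡ r
  ramsey zero X _ = [] , X , refl , (λ ()) , refl
  ramsey (suc r) (x ∷ X) (s≤s le) with partitionᵇ (h x) X
  ... | N , M , ρ , near , far with <-≤-connex r (length N)
  ...   | inj₁ r<N with prefix (suc r) N r<N
    where
    prefix : ∀ n xs → n ≤ length xs → ∃ λ (ys : List V) → ∃ λ zs → ys ++ zs ≡ xs × length ys ≡ n
    prefix zero    xs       _        = [] , xs , refl , refl
    prefix (suc n) (x ∷ xs) (s≤s le) with prefix n xs le
    ... | ys , zs , refl , refl = x ∷ ys , zs , refl , refl
  ...     | C , W , refl , len =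
    C , x ∷ W ++ M , lin (↭-sym ρ)
        (permute (C ∷ [ _ ] ∷ W ∷ M ∷ X ∷ [])
          ((# 0 ⊕ # 1 ⊕ # 2 ⊕ # 3) ⊕ # 4)
          (# 1 ⊕ # 4 ⊕ (# 0 ⊕ # 2) ⊕ # 3)) , (λ i j → common⇒≁ (near (∈-++⁺ˡ i)) (near (∈-++⁺ˡ j))) , len
  ramsey (suc r) (x ∷ X) (s≤s le) | N , M , ρ , near , far | inj₂ N≤r
    with ramsey r M (+-cancelʳ-≤ r _ _ (≤-trans le (≤-trans (≤-reflexive (≡-trans (↭-length ρ) (≡-trans (length-++ N) (+-comm (length N) (length M)))))
           (+-monoʳ-≤ (length M) N≤r))))
  ...   | C , W , σ , ind , len = x ∷ C , N ++ W , lin σ (lin (↭-sym ρ)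
      (permute ([ _ ] ∷ C ∷ N ∷ W ∷ M ∷ X ∷ [])
        (# 0 ⊕ ((# 1 ⊕ # 2 ⊕ # 3) ⊕ # 4) ⊕ # 5)
        (# 0 ⊕ (# 5 ⊕ # 1 ⊕ # 3) ⊕ # 2 ⊕ # 4))) , ind′ , cong suc len
    where
    C⊆M : ∀ {y} → y ∈ₗ C → x ≁ y
    C⊆M i = far (∈-resp-↭ σ (∈-++⁺ˡ i))
    ind′ : Independent (x ∷ C)
    ind′ (here refl) (here refl) = ≁-refl
    ind′ (here refl) (there j)   = C⊆M j
    ind′ (there i)   (here refl) = ≁-sym (C⊆M i)
    ind′ (there i)   (there j)   = ind i j

  Bounded : List V → ℕ → Set
  Bounded Y ω = ∀ C W → C ++ W ↭ Y → Independent C → length C ≤ ω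

  -- What is retained of the fractional cover. The condition ranges over all sublists so that it is
  -- inherited by every subset met in the inductions.
  Coverable : List V → Set
  Coverable X = ∀ Y Z → Y ++ Z ↭ X → ∀ ω → Bounded Y ω → 33 * length Y ≤ 124 * ω

  coverable-⊆ : ∀ {X Y Z} → Coverable X → X ↭ Y ++ Z → Coverable Y
  coverable-⊆ {Z = Z} f π Y′ Z′ ρ = f Y′ (Z′ ++ Z) (lin ρ (lin (↭-sym π)
      (permute (Y′ ∷ Z′ ∷ Z ∷ _ ∷ _ ∷ [])
        (((# 0 ⊕ # 1 ⊕ # 2) ⊕ # 3) ⊕ # 4)
        ((# 4 ⊕ # 0 ⊕ # 1) ⊕ # 3 ⊕ # 2))))

  -- For ω ≤ 4 the count 33 (2m + 1) ≤ 124 ω leaves only cases excluded by the Ramsey bound.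
  ω-large : ∀ {X m ω} → length X ≡ suc (2 * m) → Bounded X ω → 33 * suc (2 * m) ≤ 124 * ω → m + 2 ≤ 2 * ω
  ω-large {X} {m} {ω} size bounded count = ≮⇒≥ λ lt → small ω (≤-pred (≤-trans lt (≤-reflexive (+-comm m 2)))) count bounded
    where
    tri-contra : ∀ r → triangular (suc r) ≤ suc (2 * m) → Bounded X r → ⊥
    tri-contra r le b with ramsey (suc r) X (≤-trans le (≤-reflexive (≡-sym size)))
    ... | C , W , π , ind , len = 1+n≰n (≤-trans (≤-reflexive (≡-sym len)) (b C W π ind))
    grow : ∀ {r} → 2 * r ≤ suc m → 4 * r ≤ suc (suc (2 * m))
    grow {r} le = ≤-trans (≤-reflexive (e₁ r)) (≤-trans (*-monoʳ-≤ 2 le) (≤-reflexive (e₂ m)))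
      where
      e₁ : ∀ r → 4 * r ≡ 2 * (2 * r)
      e₁ = solve-∀
      e₂ : ∀ m → 2 * suc m ≡ suc (suc (2 * m))
      e₂ = solve-∀
    small : ∀ ω → 2 * ω ≤ suc m → 33 * suc (2 * m) ≤ 124 * ω → Bounded X ω → ⊥
    small 0 _ c _ with () ← ≤-trans (*-monoʳ-≤ 33 (s≤s (z≤n {2 * m}))) c
    -- In these four cases 2m + 1 ≥ 4ω - 1, that is 3, 7, 11, 15, against the triangular numbers 3,
    -- 6, 10, 15.
    small 1 le _ b = tri-contra 1 (≤-pred (grow {1} le)) b
    small 2 le _ b = tri-contra 2 (≤-trans (n≤1+n 6) (≤-pred (grow {2} le))) b
    small 3 le _ b = tri-contra 3 (≤-trans (n≤1+n 10) (≤-pred (grow {3} le))) b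
    small 4 le _ b = tri-contra 4 (≤-pred (grow {4} le)) b
    small ω@(suc (suc (suc (suc (suc w))))) le c _ =
      -- From 2ω ≤ m + 1 follows 132ω ≤ 33 (2m + 2), and the count gives 33 (2m + 1) ≤ 124ω. Hence
      -- 8ω ≤ 33, impossible for ω ≥ 5.
      excess (6 + 8 * w) (+-mono-≤ (*-monoʳ-≤ 33 (grow {ω} le)) c) (identity m w)
      where
      identity : ∀ m w → 33 * (4 * (5 + w)) + 33 * suc (2 * m) ≡ suc (33 * suc (suc (2 * m)) + 124 * (5 + w) + (6 + 8 * w))
      identity = solve-∀

  module WheelMinor where

    open CycleSearch

    clear : (a₀ a₂ b₀ b₂ c₀ c₂ : Bool) → Bool
    clear a₀ a₂ b₀ b₂ c₀ c₂ = not ((a₀ ∧ a₂) ∨ (b₀ ∧ b₂) ∨ (c₀ ∧ c₂))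

    some-clear : (a₀ a₁ a₂ a₃ a₄ b₀ b₁ b₂ b₃ b₄ c₀ c₁ c₂ c₃ c₄ : Bool) → Bool
    some-clear a₀ a₁ a₂ a₃ a₄ b₀ b₁ b₂ b₃ b₄ c₀ c₁ c₂ c₃ c₄ =
      clear a₀ a₂ b₀ b₂ c₀ c₂ ∨ clear a₁ a₃ b₁ b₃ c₁ c₃ ∨ clear a₂ a₄ b₂ b₄ c₂ c₄ ∨
      clear a₃ a₀ b₃ b₀ c₃ c₀ ∨ clear a₄ a₁ b₄ b₁ c₄ c₁

    module _ (a₀ a₁ a₂ a₃ a₄ : Bool) where

      clear-c : (b₀ b₁ b₂ b₃ b₄ : Bool) → Bool⁵
      clear-c b₀ b₁ b₂ b₃ b₄ c₀ c₁ c₂ c₃ c₄ =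
        on-cycle c₀ c₁ c₂ c₃ c₄ ⇒ some-clear a₀ a₁ a₂ a₃ a₄ b₀ b₁ b₂ b₃ b₄ c₀ c₁ c₂ c₃ c₄

      clear-b : Bool⁵
      clear-b b₀ b₁ b₂ b₃ b₄ = on-cycle b₀ b₁ b₂ b₃ b₄ ⇒ every (clear-c b₀ b₁ b₂ b₃ b₄)

    clear-a : Bool⁵
    clear-a a₀ a₁ a₂ a₃ a₄ = on-cycle a₀ a₁ a₂ a₃ a₄ ⇒ every (clear-b a₀ a₁ a₂ a₃ a₄)

    clear-succeeds : every clear-a ≡ true
    clear-succeeds = refl

    -- Each of three vertices has at most two neighbours on the cycle and so spoils at most one of
    -- the five pairs at distance two.
    clear-exists : ∀ a₀ a₁ a₂ a₃ a₄ b₀ b₁ b₂ b₃ b₄ c₀ c₁ c₂ c₃ c₄ →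
      on-cycle a₀ a₁ a₂ a₃ a₄ ≡ true → on-cycle b₀ b₁ b₂ b₃ b₄ ≡ true → on-cycle c₀ c₁ c₂ c₃ c₄ ≡ true →
      some-clear a₀ a₁ a₂ a₃ a₄ b₀ b₁ b₂ b₃ b₄ c₀ c₁ c₂ c₃ c₄ ≡ true
    clear-exists a₀ a₁ a₂ a₃ a₄ b₀ b₁ b₂ b₃ b₄ c₀ c₁ c₂ c₃ c₄ p q r =
      ⇒-elim (every-elim (clear-c a₀ a₁ a₂ a₃ a₄ b₀ b₁ b₂ b₃ b₄) (⇒-elim
        (every-elim (clear-b a₀ a₁ a₂ a₃ a₄) (⇒-elim
          (every-elim clear-a clear-succeeds a₀ a₁ a₂ a₃ a₄) p) b₀ b₁ b₂ b₃ b₄) q) c₀ c₁ c₂ c₃ c₄) r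

    open Pentagons 𝓗 using (not-both; none-of)

    missing : ∀ {i x y} → h i x ∧ h i y ≡ false → i ≁ x ⊎ i ≁ y
    missing {i} {x} {y} e with h i x
    ... | true  = inj₂ e
    ... | false = inj₁ refl

    ∨₃-false : ∀ {a b c} → not (a ∨ b ∨ c) ≡ true → a ≡ false × b ≡ false × c ≡ false
    ∨₃-false {false} {false} {false} _ = refl , refl , refl

    -- Five branch sets: a rim edge with the hub, a pair at distance two that touches all of `i₁`,
    -- `i₂`, `i₃`, and these three alone. One rim vertex is dropped.
    wheel-minor : ∀ {X R i₁ i₂ i₃} → Independent (i₁ ∷ i₂ ∷ i₃ ∷ []) → (i₁ ∷ i₂ ∷ i₃ ∷ []) ++ R ↭ X → Wheel R → Minor X 5
    wheel-minor {X} {R} {i₁} {i₂} {i₃} ind π (wheel v₀ v₁ v₂ v₃ v₄ w rim e₀₁ e₁₂ e₂₃ e₃₄ e₄₀ (w₀ , w₁ , w₂ , w₃ , w₄)) =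
      find-pair (clear-exists
        (h i₁ v₀) (h i₁ v₁) (h i₁ v₂) (h i₁ v₃) (h i₁ v₄) (h i₂ v₀) (h i₂ v₁) (h i₂ v₂) (h i₂ v₃) (h i₂ v₄)
        (h i₃ v₀) (h i₃ v₁) (h i₃ v₂) (h i₃ v₃) (h i₃ v₄) (avoids i₁) (avoids i₂) (avoids i₃))
      where
      avoids : ∀ x → on-cycle (h x v₀) (h x v₁) (h x v₂) (h x v₃) (h x v₄) ≡ true
      avoids x = none-of (not-both e₀₁) (not-both e₁₂) (not-both e₂₃) (not-both e₃₄) (not-both e₄₀)
      build : ∀ {x y a b u} → v₀ ∷ v₁ ∷ v₂ ∷ v₃ ∷ v₄ ∷ [] ↭ x ∷ y ∷ a ∷ b ∷ u ∷ [] → x ≁ y → a ~ b → w ≁ a → w ≁ b →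
              clear (h i₁ x) (h i₁ y) (h i₂ x) (h i₂ y) (h i₃ x) (h i₃ y) ≡ true → Minor X 5
      build {x} {y} {a} {b} {u} ρ xy ab wa wb cl with ∨₃-false cl
      ... | k₁ , k₂ , k₃ =
        minor-mono {Y = tri (a , b , w) ++ x ∷ y ∷ i₁ ∷ i₂ ∷ i₃ ∷ []} {Z = u ∷ []} (lin (↭-sym π) (lin rim (lin ρ
            (permute (X ∷ [ _ ] ∷ [ _ ] ∷ [ _ ] ∷ R ∷ [ _ ] ∷ [ _ ] ∷ [ _ ] ∷ [ _ ] ∷ [ _ ] ∷
              [ _ ] ∷ [ _ ] ∷ [ _ ] ∷ [ _ ] ∷ [ _ ] ∷ [ _ ] ∷ [])
              (((# 0 ⊕ # 1 ⊕ # 2 ⊕ # 3 ⊕ # 4) ⊕ # 5 ⊕ # 6 ⊕ # 7 ⊕ # 8 ⊕ # 9 ⊕ # 10) ⊕ # 11 ⊕ # 12 ⊕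
              # 13 ⊕ # 14 ⊕ # 15)
              (# 13 ⊕ # 14 ⊕ # 10 ⊕ # 11 ⊕ # 12 ⊕ # 1 ⊕ # 2 ⊕ # 3 ⊕ # 15 ⊕ (# 0 ⊕ # 4) ⊕ # 5 ⊕ # 6 ⊕
              # 7 ⊕ # 8 ⊕ # 9)))))
          (triples-minor ((a , b , w) ∷ []) (edge-apex ab (≁-sym wa) (≁-sym wb) ∷ []) refl
            (dominate {Cs = (x ∷ y ∷ []) ∷ []} (pair-connected xy ∷ [] , [] ∷ []) refl dom (singletons (i₁ ∷ i₂ ∷ i₃ ∷ []) ind)))
        where
        from : ∀ {i} → i ≁ x ⊎ i ≁ y → All (λ C → Dominates C i) ((x ∷ y ∷ []) ∷ [])
        from (inj₁ n) = (x , here refl , ≁-sym n) ∷ []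
        from (inj₂ n) = (y , there (here refl) , ≁-sym n) ∷ []
        dom : ∀ {i} → i ∈ₗ i₁ ∷ i₂ ∷ i₃ ∷ [] → All (λ C → Dominates C i) ((x ∷ y ∷ []) ∷ [])
        dom (here refl)                 = from (missing k₁)
        dom (there (here refl))         = from (missing k₂)
        dom (there (there (here refl))) = from (missing k₃)
      find-pair : _ → Minor X 5
      find-pair p with ∨-elim p
      ... | inj₁ c = build {u = v₁}
          (permute ([ _ ] ∷ [ _ ] ∷ [ _ ] ∷ [ _ ] ∷ [ _ ] ∷ [])
            (# 0 ⊕ # 1 ⊕ # 2 ⊕ # 3 ⊕ # 4)
            (# 0 ⊕ # 2 ⊕ # 3 ⊕ # 4 ⊕ # 1)) (common⇒≁ (~-sym e₀₁) e₁₂) e₃₄ w₃ w₄ c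
      ... | inj₂ p with ∨-elim p
      ... | inj₁ c = build {u = v₂}
          (permute ([ _ ] ∷ [ _ ] ∷ [ _ ] ∷ [ _ ] ∷ [ _ ] ∷ [])
            (# 0 ⊕ # 1 ⊕ # 2 ⊕ # 3 ⊕ # 4)
            (# 1 ⊕ # 3 ⊕ # 4 ⊕ # 0 ⊕ # 2)) (common⇒≁ (~-sym e₁₂) e₂₃) e₄₀ w₄ w₀ c
      ... | inj₂ p with ∨-elim p
      ... | inj₁ c = build {u = v₃}
          (permute ([ _ ] ∷ [ _ ] ∷ [ _ ] ∷ [ _ ] ∷ [ _ ] ∷ [])
            (# 0 ⊕ # 1 ⊕ # 2 ⊕ # 3 ⊕ # 4)
            (# 2 ⊕ # 4 ⊕ # 0 ⊕ # 1 ⊕ # 3)) (common⇒≁ (~-sym e₂₃) e₃₄) e₀₁ w₀ w₁ c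
      ... | inj₂ p with ∨-elim p
      ... | inj₁ c = build {u = v₄}
          (permute ([ _ ] ∷ [ _ ] ∷ [ _ ] ∷ [ _ ] ∷ [ _ ] ∷ [])
            (# 0 ⊕ # 1 ⊕ # 2 ⊕ # 3 ⊕ # 4)
            (# 3 ⊕ # 0 ⊕ # 1 ⊕ # 2 ⊕ # 4)) (common⇒≁ (~-sym e₃₄) e₄₀) e₁₂ w₁ w₂ c
      ... | inj₂ c = build {u = v₀}
          (permute ([ _ ] ∷ [ _ ] ∷ [ _ ] ∷ [ _ ] ∷ [ _ ] ∷ [])
            (# 0 ⊕ # 1 ⊕ # 2 ⊕ # 3 ⊕ # 4)
            (# 4 ⊕ # 1 ⊕ # 2 ⊕ # 3 ⊕ # 0)) (common⇒≁ (~-sym e₄₀) e₀₁) e₂₃ w₂ w₃ c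

  module _ {X : List V} {m : ℕ} (size : length X ≡ suc (2 * m)) (cov : Coverable X)
    (none : Minor X (suc m) → ⊥)
    (smaller : ∀ {y Y Z t} → X ↭ y ∷ Z ++ Y → 2 * t ≤ suc (length Y) → (Minor Y t → ⊥) → ⊥) where

    open Counterexample size none (λ {y} {Y} {Z} {t} → smaller {y} {Y} {Z} {t})

    -- With a largest clique `I` and `k = m + 1 − |I|`, the independence bound outside `I` is just
    -- the maximality of `I`, and the biclique bound is `biclique-small`, since `m + k` vertices
    -- remain.
    odd-case : ⊥
    odd-case = maximum {Size} 0 (length X) bounded ([] , X , refl , (λ ()) , refl) λ
      { (ω , (I , R , π , ind , refl) , top) → largest I R π ind λ C W ρ i → top _ (C , W , ρ , i , refl) }
      where
      Size : ℕ → Set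
      Size n = ∃ λ C → ∃ λ W → C ++ W ↭ X × Independent C × length C ≡ n
      bounded : ∀ n → Size n → n ≤ length X
      bounded _ (C , W , π , _ , refl) = ≤-trans (m≤m+n _ (length W)) (≤-reflexive (≡-trans (≡-sym (length-++ C)) (↭-length π)))

      largest : ∀ I R → I ++ R ↭ X → Independent I → Bounded X (length I) → ⊥
      largest I R π ind top with <-≤-connex m (length I)
      ... | inj₁ lt = none (minor-≤ lt (minor-mono {Z = R} (↭-sym π) (singletons I ind)))
      ... | inj₂ ω≤m = packing-exists k R large αb βb wheel-⊥ λ { (ts , rest , len , odds , ρ) →
          none (minor-≤ (≤-reflexive (≡-trans (≡-sym k+ω) (cong (_+ length I) (≡-sym len))))
            (minor-mono {Y = flat ts ++ I} {Z = rest} (lin (↭-sym π) (lin (↭-sym ρ)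
                (permute (X ∷ I ∷ R ∷ (flat ts) ∷ rest ∷ [])
                  ((# 0 ⊕ # 1 ⊕ # 2) ⊕ # 3 ⊕ # 4)
                  ((((# 3 ⊕ # 1) ⊕ # 4) ⊕ # 0) ⊕ # 2))))
              (triples-minor ts odds refl (singletons I ind)))) }
        where
        k : ℕ
        k = suc m ∸ length I
        k+ω : k + length I ≡ suc m
        k+ω = m∸n+n≡m (≤-trans ω≤m (n≤1+n m))
        lenR : length R ≡ m + k
        lenR = +-cancelˡ-≡ (length I) _ _ (≡-trans (≡-sym (length-++ I)) (≡-trans (↭-length π) (≡-trans size
          (≡-trans (e₁ m) (≡-trans (cong (m +_) (≡-sym k+ω)) (e₂ m k (length I)))))))
          where
          e₁ : ∀ m → suc (2 * m) ≡ m + suc m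
          e₁ = solve-∀
          e₂ : ∀ m k i → m + (k + i) ≡ i + (m + k)
          e₂ = solve-∀
        ω-big : m + 2 ≤ 2 * length I
        ω-big = ω-large size top (subst (λ n → 33 * n ≤ 124 * length I) size (cov X []
            (permute (X ∷ []) (# 0 ⊕ ∅) (# 0)) (length I) top))
        2k≤m : 2 * k ≤ m
        2k≤m = +-cancelʳ-≤ (2 * length I) _ _ (≤-trans (≤-reflexive (≡-trans (≡-sym (*-distribˡ-+ 2 k (length I))) (≡-trans (cong (2 *_) k+ω) (e m))))
          (+-monoʳ-≤ m ω-big))
          where
          e : ∀ m → 2 * suc m ≡ m + (m + 2)
          e = solve-∀
        large : 3 * k ≤ length R
        large = subst (3 * k ≤_) (≡-sym lenR) (≤-trans (≤-reflexive (e k)) (+-monoˡ-≤ k 2k≤m))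
          where
          e : ∀ k → 3 * k ≡ 2 * k + k
          e = solve-∀
        αb : IndependentBound k R
        αb C W ρ i = ≤-trans (+-monoˡ-≤ (2 * k) (top C (W ++ I) (lin ρ (lin π
            (permute (C ∷ W ∷ I ∷ R ∷ X ∷ [])
              (((# 0 ⊕ # 1 ⊕ # 2) ⊕ # 3) ⊕ # 4)
              ((# 4 ⊕ # 0 ⊕ # 1) ⊕ # 2 ⊕ # 3)))) i))
          (≤-reflexive (≡-trans (e (length I) k) (≡-trans (cong (_+ k) k+ω) (cong suc (≡-sym lenR)))))
          where
          e : ∀ i k → i + 2 * k ≡ k + i + k
          e = solve-∀
        βb : BicliqueBound k R
        βb a A b B S ρ c = subst (length (a ∷ A) + length (b ∷ B) + k ≤_) (≡-sym lenR)
          (+-monoˡ-≤ k (biclique-small {S = S ++ I} (lin ρ (lin π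
              (permute ([ _ ] ∷ A ∷ [ _ ] ∷ B ∷ S ∷ I ∷ R ∷ X ∷ [])
                (# 0 ⊕ ((# 1 ⊕ # 2 ⊕ # 3 ⊕ # 4 ⊕ # 5) ⊕ # 6) ⊕ # 7)
                ((# 7 ⊕ # 0 ⊕ # 1 ⊕ # 2 ⊕ # 3 ⊕ # 4) ⊕ # 5 ⊕ # 6)))) c))
        wheel-⊥ : k ≡ 2 → length R ≡ 6 → Wheel R → ⊥
        -- The orders are forced: `m` is 4 and the largest clique has three vertices.
        wheel-⊥ k≡2 r≡6 W = three I π ind (+-cancelˡ-≡ 2 _ _ (≡-trans (cong (_+ length I) (≡-sym k≡2)) (≡-trans k+ω (cong suc m≡4))))
          where
          m≡4 : m ≡ 4
          m≡4 = +-cancelʳ-≡ 2 _ _ (≡-trans (cong (m +_) (≡-sym k≡2)) (≡-trans (≡-sym lenR) r≡6))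
          three : ∀ I → I ++ R ↭ X → Independent I → length I ≡ 3 → ⊥
          three (i₁ ∷ i₂ ∷ i₃ ∷ []) π ind refl = none (subst (Minor X) (cong suc (≡-sym m≡4)) (WheelMinor.wheel-minor ind π W))

  -- If one vertex can be spared it is dropped, so only order exactly `2m + 1` needs the
  -- counterexample argument.
  half-minor : ∀ n X → length X ≤ n → Coverable X → ∀ t → 2 * t ≤ suc (length X) → (Minor X t → ⊥) → ⊥
  half-minor n X le cov zero _ k = k minor-empty
  half-minor n [] le cov (suc t) 2t k = 1+n≰n (≤-trans (≤-trans (s≤s (m≤m+n 1 _)) (≤-reflexive (≡-sym (*-suc 2 t)))) 2t)
  half-minor (suc n) (x ∷ X) (s≤s le) cov (suc m) 2t k with <-≤-connex (suc (2 * m)) (suc (length X))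
  ... | inj₁ lt = half-minor n X le (coverable-⊆ cov (++-comm (x ∷ []) X)) (suc m)
          (≤-trans (≤-reflexive (*-suc 2 m)) lt) (k ∘ minor-mono {Z = x ∷ []} (++-comm (x ∷ []) X))
  ... | inj₂ ge = odd-case {x ∷ X} {m} (≤-antisym ge (≤-pred (≤-trans (≤-reflexive (≡-sym (*-suc 2 m))) 2t))) cov k
          λ {y} {Y} {Z} {t} π 2t′ k′ → half-minor n Y
            (≤-trans (≤-trans (m≤n+m (length Y) (length Z))
              (≤-reflexive (suc-injective (≡-trans (cong suc (≡-sym (length-++ Z))) (≡-sym (↭-length π)))))) le)
            (coverable-⊆ {Z = y ∷ Z} cov (lin π
                (permute ([ _ ] ∷ X ∷ [ _ ] ∷ Z ∷ Y ∷ [])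
                  (# 0 ⊕ # 1 ⊕ # 2 ⊕ # 3 ⊕ # 4)
                  ((# 4 ⊕ # 2 ⊕ # 3) ⊕ # 0 ⊕ # 1)))) t 2t′ k′

-- Maximum matchings and the reduction to half the order.

module Gallai (𝓗 : TriangleFree) where

  open Triples 𝓗
  open Minors 𝓗
  open HalfMinor 𝓗

  ends : List (V × V) → List V
  ends []             = []
  ends ((x , y) ∷ M) = x ∷ y ∷ ends M

  length-ends : ∀ M → length (ends M) ≡ 2 * length M
  length-ends []      = refl
  length-ends (e ∷ M) = ≡-trans (cong (2 +_) (length-ends M)) (≡-sym (*-suc 2 (length M)))

  ends-++ : ∀ M N → ends (M ++ N) ↭ ends M ++ ends N
  ends-++ []      N = refl
  ends-++ (e ∷ M) N = prep _ (prep _ (ends-++ M N))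

  Edges : List (V × V) → Set
  Edges = All λ { (x , y) → x ~ y }

  -- A matching of X with ν edges that misses exactly U.
  Misses : List V → ℕ → List V → Set
  Misses X ν U = ∃ λ M → ends M ++ U ↭ X × Edges M × length M ≡ ν

  Maximal : List V → ℕ → Set
  Maximal X ν = ∀ μ U → Misses X μ U → μ ≤ ν

  add-edge : ∀ {X ν x y U} → x ~ y → Misses X ν (x ∷ y ∷ U) → Misses X (suc ν) U
  add-edge {X} {x = x} {y} {U} e (M , π , es , refl) = (x , y) ∷ M , lin π
      (permute ([ _ ] ∷ [ _ ] ∷ (ends M) ∷ U ∷ X ∷ [])
        (# 0 ⊕ # 1 ⊕ (# 2 ⊕ # 3) ⊕ # 4)
        (# 4 ⊕ # 2 ⊕ # 0 ⊕ # 1 ⊕ # 3)) , e ∷ es , refl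

  mate : ∀ {w} M → Edges M → w ∈ₗ ends M →
         ∃ λ x → ∃ λ M′ → ends M ↭ w ∷ x ∷ ends M′ × w ~ x × Edges M′ × length M ≡ suc (length M′)
  mate ((x , y) ∷ M) (e ∷ es) (here refl)         = y , M , refl , e , es , refl
  mate ((x , y) ∷ M) (e ∷ es) (there (here refl)) = x , M ,
      (permute ([ _ ] ∷ [ _ ] ∷ (ends M) ∷ []) (# 0 ⊕ # 1 ⊕ # 2) (# 1 ⊕ # 0 ⊕ # 2)) , ~-sym e , es , refl
  mate ((x , y) ∷ M) (e ∷ es) (there (there i)) with mate M es i
  ... | z , M′ , π , e′ , es′ , len = z , (x , y) ∷ M′ , lin π
      (permute ([ _ ] ∷ [ _ ] ∷ (ends M) ∷ [ _ ] ∷ [ _ ] ∷ (ends M′) ∷ [])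
        (# 0 ⊕ # 1 ⊕ # 2 ⊕ # 3 ⊕ # 4 ⊕ # 5)
        (# 3 ⊕ # 4 ⊕ # 0 ⊕ # 1 ⊕ # 5 ⊕ # 2)) , e′ , e ∷ es′ , cong suc len

  -- Gallai's lemma in exchange form. Follow w – x₁ in M and x₁ – x₂ in N, delete w and x₁, and
  -- recurse with x₂ in the role of w.
  exchange : ∀ n {X ν u v w U W} → ν ≤ n → Maximal X ν → Misses X ν (u ∷ v ∷ U) → Misses X ν (w ∷ W) →
             ∃ λ x → ∃ λ T → Misses X ν (w ∷ x ∷ T) × (x ≡ u ⊎ x ≡ v)
  exchange n {X} {ν} {u} {v} {w} {U} {W} ν≤n top (M , π , es , len) (N , ρ , fs , len′)
    with ∈-++⁻ (ends M) (∈-resp-↭ (trans ρ (↭-sym π)) (∈-++⁺ʳ (ends N) (here refl)))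
  ... | inj₂ (here refl) = v , U , (M , π , es , len) , inj₂ refl
  ... | inj₂ (there (here refl)) = u , U , (M , trans
      (permute ((ends M) ∷ [ _ ] ∷ [ _ ] ∷ U ∷ []) (# 0 ⊕ # 1 ⊕ # 2 ⊕ # 3) (# 0 ⊕ # 2 ⊕ # 1 ⊕ # 3)) π , es , len) , inj₁ refl
  ... | inj₂ (there (there i)) with ∈⇒↭ i
  ...   | U′ , σ = u , v ∷ U′ , (M , lin π (lin (↭-sym σ)
      (permute ((ends M) ∷ [ _ ] ∷ [ _ ] ∷ [ _ ] ∷ U′ ∷ X ∷ U ∷ [])
        (((# 0 ⊕ # 1 ⊕ # 2 ⊕ # 3 ⊕ # 4) ⊕ # 5) ⊕ # 6)
        ((# 5 ⊕ # 0 ⊕ # 2 ⊕ # 3 ⊕ # 6) ⊕ # 1 ⊕ # 4))) , es , len) , inj₁ refl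
  exchange n {X} {ν} {u} {v} {w} {U} {W} ν≤n top (M , π , es , len) (N , ρ , fs , len′) | inj₁ i with mate M es i
  ... | x₁ , M′ , σ , e₁ , es′ , lenM
    with ∈-++⁻ (ends N) (∈-resp-↭ (trans π (↭-sym ρ)) (∈-++⁺ˡ (∈-resp-↭ (↭-sym σ) (there (here refl)))))
  ...   | inj₂ (here refl) = ⊥-elim (~⇒¬≁ e₁ ≁-refl)
  ...   | inj₂ (there j) with ∈⇒↭ j
  ...     | W′ , τ = ⊥-elim (1+n≰n (top (suc ν) W′ (add-edge e₁ (N , lin ρ (lin (↭-sym τ)
      (permute ((ends N) ∷ [ _ ] ∷ [ _ ] ∷ W′ ∷ X ∷ W ∷ [])
        (((# 0 ⊕ # 1 ⊕ # 2 ⊕ # 3) ⊕ # 4) ⊕ # 5)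
        ((# 4 ⊕ # 0 ⊕ # 1 ⊕ # 5) ⊕ # 2 ⊕ # 3))) , fs , len′))))
  exchange zero ν≤n top (M , π , es , len) _ | inj₁ i | x₁ , M′ , σ , e₁ , es′ , lenM | inj₁ j
    with () ← ≤-trans (≤-reflexive (≡-trans (≡-sym lenM) len)) ν≤n
  exchange (suc n) {X} {ν} {u} {v} {w} {U} {W} ν≤n top (M , π , es , len) (N , ρ , fs , len′)
    | inj₁ i | x₁ , M′ , σ , e₁ , es′ , lenM | inj₁ j with mate N fs j
  ... | x₂ , N′ , τ , e₂ , fs′ , lenN
    = extend (exchange n {ends M′ ++ u ∷ v ∷ U} {length M′} {u} {v} {x₂}
        (≤-pred (≤-trans (≤-reflexive (≡-trans (≡-sym lenM) len)) ν≤n))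
        (λ { μ T (K , κ , ks , refl) → ≤-pred (≤-trans (top (suc μ) T
           ((w , x₁) ∷ K , lin κ (lin π (lin (↭-sym σ)
               (permute ([ _ ] ∷ [ _ ] ∷ (ends K) ∷ T ∷ (ends M′) ∷ [ _ ] ∷ [ _ ] ∷ U ∷ X ∷
                 (ends M) ∷ [])
                 (# 0 ⊕ # 1 ⊕ (((# 2 ⊕ # 3) ⊕ # 4 ⊕ # 5 ⊕ # 6 ⊕ # 7) ⊕ # 8) ⊕ # 9)
                 (((# 8 ⊕ # 2 ⊕ # 3) ⊕ # 9 ⊕ # 5 ⊕ # 6 ⊕ # 7) ⊕ # 0 ⊕ # 1 ⊕ # 4)))) , e₁ ∷ ks , refl)) (≤-reflexive (≡-trans (≡-sym len) lenM))) })
        (M′ , refl , es′ , refl)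
        (N′ , drop-∷ {x = w} (drop-∷ {x = x₁} {w ∷ ends N′ ++ x₂ ∷ W} {w ∷ ends M′ ++ u ∷ v ∷ U}
           (lin ρ (lin (↭-sym τ) (lin (↭-sym π) (lin σ
               (permute ([ _ ] ∷ [ _ ] ∷ (ends N′) ∷ [ _ ] ∷ W ∷ X ∷ (ends N) ∷ (ends M) ∷ [ _ ] ∷
                 [ _ ] ∷ U ∷ (ends M′) ∷ [])
                 (# 0 ⊕ # 1 ⊕ ((((# 2 ⊕ # 3 ⊕ # 4) ⊕ # 5) ⊕ # 6) ⊕ # 7 ⊕ # 8 ⊕ # 9 ⊕ # 10) ⊕ # 1 ⊕
                 # 0 ⊕ # 11)
                 (# 0 ⊕ # 1 ⊕ ((((# 11 ⊕ # 8 ⊕ # 9 ⊕ # 10) ⊕ # 6 ⊕ # 1 ⊕ # 4) ⊕ # 0 ⊕ # 3 ⊕ # 2) ⊕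
                 # 5) ⊕ # 7))))))) , fs′ ,
         suc-injective (≡-trans (≡-sym lenN) (≡-trans len′ (≡-trans (≡-sym len) lenM)))))
    where
    extend : (∃ λ x → ∃ λ T → Misses (ends M′ ++ u ∷ v ∷ U) (length M′) (x₂ ∷ x ∷ T) × (x ≡ u ⊎ x ≡ v)) →
             ∃ λ x → ∃ λ T → Misses X ν (w ∷ x ∷ T) × (x ≡ u ⊎ x ≡ v)
    extend (x , T , (K , κ , ks , lenK) , x≡) =
      x , T , ((x₁ , x₂) ∷ K , lin κ (lin π (lin (↭-sym σ)
          (permute ([ _ ] ∷ [ _ ] ∷ (ends K) ∷ [ _ ] ∷ [ _ ] ∷ T ∷ (ends M′) ∷ [ _ ] ∷ [ _ ] ∷ U ∷
            X ∷ (ends M) ∷ [])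
            (# 0 ⊕ # 1 ⊕ (((# 2 ⊕ # 3 ⊕ # 4 ⊕ # 5) ⊕ # 6 ⊕ # 7 ⊕ # 8 ⊕ # 9) ⊕ # 10) ⊕ # 11)
            (((# 10 ⊕ # 2 ⊕ # 1 ⊕ # 4 ⊕ # 5) ⊕ # 11 ⊕ # 7 ⊕ # 8 ⊕ # 9) ⊕ # 3 ⊕ # 0 ⊕ # 6)))) , e₂ ∷ ks ,
        ≡-trans (cong suc lenK) (≡-trans (≡-sym lenM) len)) , x≡

  -- A partition into edges and single vertices, with a clique minor of the same size.
  Goal : List V → Set
  Goal X = ∃ λ M → ∃ λ U → ends M ++ U ↭ X × Edges M × Minor X (length M + length U)

  goal-join : ∀ {X Y Z} → X ↭ Y ++ Z → (∀ {y z} → y ∈ₗ Y → z ∈ₗ Z → y ≁ z) → Goal Y → Goal Z → Goal X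
  goal-join {X} {Y} {Z} π sep (M , U , ρ , es , m) (N , W , σ , fs , m′) =
    M ++ N , U ++ W , lin (ends-++ M N) (lin ρ (lin σ (lin (↭-sym π)
        (permute ((ends (M ++ N)) ∷ U ∷ W ∷ (ends M) ∷ (ends N) ∷ Y ∷ Z ∷ X ∷ [])
          (((((# 0 ⊕ # 1 ⊕ # 2) ⊕ # 3 ⊕ # 4) ⊕ # 5) ⊕ # 6) ⊕ # 7)
          ((((# 7 ⊕ # 0) ⊕ # 3 ⊕ # 1) ⊕ # 4 ⊕ # 2) ⊕ # 5 ⊕ # 6))))) , AllP.++⁺ es fs ,
    subst (Minor X) (≡-trans (identity (length M) (length U) (length N) (length W))
      (≡-sym (cong₂ _+_ (length-++ M) (length-++ U)))) (minor-join π sep m m′)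
    where
    identity : ∀ a b c d → a + b + (c + d) ≡ a + c + (b + d)
    identity = solve-∀

  -- Membership is first refused; whoever refutes the refusal supplies the proof with which the
  -- element is moved to the other part.
  split-list : ∀ {P : V → Set} xs → ((∃ λ ys → ∃ λ zs → xs ↭ ys ++ zs × All P ys × All (λ x → P x → ⊥) zs) → ⊥) → ⊥
  split-list [] k = k ([] , [] , refl , [] , [])
  split-list (x ∷ xs) k = split-list xs λ { (ys , zs , π , ps , ns) →
    k (ys , x ∷ zs , lin π
        (permute ([ _ ] ∷ xs ∷ ys ∷ zs ∷ []) (# 0 ⊕ # 1 ⊕ # 2 ⊕ # 3) ((# 2 ⊕ # 0 ⊕ # 3) ⊕ # 1)) , ps , (λ px → k (x ∷ ys , zs , lin π
            (permute ([ _ ] ∷ xs ∷ ys ∷ zs ∷ []) (# 0 ⊕ # 1 ⊕ # 2 ⊕ # 3) (# 0 ⊕ (# 2 ⊕ # 3) ⊕ # 1)) , px ∷ ps , ns)) ∷ ns) }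

  -- If a maximum matching misses two vertices, either some vertex is missed by no maximum matching
  -- and can be deleted, or Gallai's lemma splits `X` into two parts without edges of 𝓗 between
  -- them. Both the cover and the minor add up over such a splitting.
  cover-minor : ∀ n X → length X ≤ n → Coverable X → (Goal X → ⊥) → ⊥
  cover-minor n X le cov k = maximum {λ ν → ∃ (Misses X ν)} 0 (length X) bounded (X , [] , refl , [] , refl)
    λ { (ν , (U , M , π , es , refl) , top) → step M U π es (λ μ W m → top μ (W , m)) }
    where
    bounded : ∀ ν → ∃ (Misses X ν) → ν ≤ length X
    bounded _ (U , M , π , _ , refl) = ≤-trans (m≤m+n (length M) _)
      (≤-trans (≤-reflexive (≡-sym (length-ends M))) (≤-trans (m≤m+n _ (length U))
        (≤-reflexive (≡-trans (≡-sym (length-++ (ends M))) (↭-length π)))))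

    module _ (M : List (V × V)) (U : List V) (π : ends M ++ U ↭ X) (es : Edges M) (top : Maximal X (length M)) where

      lenX : length X ≡ 2 * length M + length U
      lenX = ≡-trans (≡-sym (↭-length π)) (≡-trans (length-++ (ends M)) (cong (_+ length U) (length-ends M)))

      -- The cover then has at most half of `length X + 1` members, so `half-minor` matches it.
      small : length U ≤ 1 → ⊥
      small le₁ = half-minor (length X) X ≤-refl cov (length M + length U)
        (≤-trans (≤-reflexive (e (length M) (length U))) (≤-trans (+-monoʳ-≤ (2 * length M + length U) le₁)
          (≤-reflexive (≡-trans (+-comm _ 1) (cong suc (≡-sym lenX))))))
        λ m → k (M , U , π , es , m)
        where
        e : ∀ a b → 2 * (a + b) ≡ 2 * a + b + b
        e = solve-∀

      Missed : V → Set
      Missed x = ∃ λ W → Misses X (length M) (x ∷ W)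

      -- Were `x` missed by no maximum matching, deleting it would cost a matching edge. A cover of
      -- the rest would need as many members as one of `X`, so the minor found in the rest would do.
      missed : ∀ {x Y} → (∀ Y → length Y < length X → Coverable Y → (Goal Y → ⊥) → ⊥) → X ↭ x ∷ Y → (Missed x → ⊥) → ⊥
      missed {x} {Y} rec ρ not = rec Y (≤-reflexive (≡-sym (↭-length ρ))) (coverable-⊆ {Z = x ∷ []} cov (lin ρ
          (permute (X ∷ [ _ ] ∷ Y ∷ []) (# 0 ⊕ # 1 ⊕ # 2) ((# 2 ⊕ # 1) ⊕ # 0))))
        λ { (M₁ , U₁ , σ , fs , m) → k (M , U , π , es , minor-≤ (fewer M₁ U₁ σ fs) (minor-mono {Z = x ∷ []} (lin ρ
            (permute (X ∷ [ _ ] ∷ Y ∷ []) (# 0 ⊕ # 1 ⊕ # 2) ((# 2 ⊕ # 1) ⊕ # 0))) m)) }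
        where
        fewer : ∀ M₁ U₁ → ends M₁ ++ U₁ ↭ Y → Edges M₁ → length M + length U ≤ length M₁ + length U₁
        fewer M₁ U₁ σ fs = +-cancelʳ-≤ (suc (length M₁)) _ _
          (≤-trans (+-monoʳ-≤ (length M + length U) lt)
            (≤-reflexive (≡-trans (e₁ (length M) (length U)) (≡-trans (≡-sym lenX)
              (≡-trans (↭-length ρ) (≡-trans (cong suc (≡-trans (≡-sym (↭-length σ)) (≡-trans (length-++ (ends M₁)) (cong (_+ length U₁) (length-ends M₁)))))
                (e₂ (length M₁) (length U₁))))))))
          where
          misses : Misses X (length M₁) (x ∷ U₁)
          misses = M₁ , lin σ (lin (↭-sym ρ)
              (permute ((ends M₁) ∷ [ _ ] ∷ U₁ ∷ Y ∷ X ∷ [])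
                (((# 0 ⊕ # 1 ⊕ # 2) ⊕ # 3) ⊕ # 4)
                ((# 4 ⊕ # 0 ⊕ # 2) ⊕ # 1 ⊕ # 3))) , fs , refl
          lt : length M₁ < length M
          lt = ≤∧≢⇒< (top _ _ misses) λ e → not (U₁ , subst (λ n → Misses X n (x ∷ U₁)) e misses)
          e₁ : ∀ a b → a + b + a ≡ 2 * a + b
          e₁ = solve-∀
          e₂ : ∀ c d → suc (2 * c + d) ≡ c + d + suc c
          e₂ = solve-∀

      no-more : ∀ {x y W} → Misses X (length M) (x ∷ y ∷ W) → x ≁ y
      no-more m = ¬~⇒≁ λ e → 1+n≰n (top _ _ (add-edge e m))

    step : ∀ M U → ends M ++ U ↭ X → Edges M → Maximal X (length M) → ⊥
    step M [] π es top = small M [] π es top z≤n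
    step M (u ∷ []) π es top = small M (u ∷ []) π es top (s≤s z≤n)
    step M (u ∷ v ∷ U) π es top = split-list {λ c → ∃ λ W → Misses X (length M) (u ∷ c ∷ W)} (ends M ++ v ∷ U)
      λ { (D , C , ρ , together , apart) → parts D C ρ (All.lookup together) (All.lookup apart) }
      where
      smaller : ∀ Y → length Y < length X → Coverable Y → (Goal Y → ⊥) → ⊥
      smaller Y lt cov′ = shrink n (≤-trans lt le)
        where
        shrink : ∀ n → length Y < n → (Goal Y → ⊥) → ⊥
        shrink (suc n) (s≤s le′) = cover-minor n Y le′ cov′
      parts : ∀ D C → ends M ++ v ∷ U ↭ D ++ C → (∀ {c} → c ∈ₗ D → ∃ λ W → Misses X (length M) (u ∷ c ∷ W)) →
              (∀ {c} → c ∈ₗ C → (∃ λ W → Misses X (length M) (u ∷ c ∷ W)) → ⊥) → ⊥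
      parts D C ρ together apart with ∈-++⁻ D (∈-resp-↭ ρ (∈-++⁺ʳ (ends M) (here refl)))
      ... | inj₂ v∈C = apart v∈C (U , M , lin π
          (permute ((ends M) ∷ [ _ ] ∷ [ _ ] ∷ U ∷ X ∷ [])
            ((# 0 ⊕ # 1 ⊕ # 2 ⊕ # 3) ⊕ # 4)
            (# 4 ⊕ # 0 ⊕ # 1 ⊕ # 2 ⊕ # 3)) , es , refl)
      ... | inj₁ v∈D with ∈⇒↭ v∈D
      ...   | D₁ , σ =
        -- `D` holds the vertices that some maximum matching misses together with `u`. It contains
        -- `v`, so both parts are smaller than `X`.
        smaller (u ∷ C) (shorter (lin X↭ (lin σ
            (permute (X ∷ [ _ ] ∷ C ∷ D ∷ [ _ ] ∷ D₁ ∷ [])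
              ((# 0 ⊕ # 1 ⊕ # 2 ⊕ # 3) ⊕ # 4 ⊕ # 5)
              (# 4 ⊕ # 1 ⊕ ((# 2 ⊕ # 5) ⊕ # 0) ⊕ # 3))))) (coverable-⊆ cov X↭) λ goal₁ →
        smaller D (≤-trans (s≤s (m≤m+n _ (length C)))
            (≤-reflexive (≡-trans (cong suc (≡-sym (length-++ D))) (≡-sym (↭-length {xs = X} {u ∷ D ++ C} (lin X↭
                (permute (X ∷ [ _ ] ∷ C ∷ D ∷ []) (# 0 ⊕ # 1 ⊕ # 2 ⊕ # 3) (# 1 ⊕ (# 3 ⊕ # 2) ⊕ # 0))))))))
          (coverable-⊆ {Z = u ∷ C} cov (lin X↭
              (permute (X ∷ [ _ ] ∷ C ∷ D ∷ []) (# 0 ⊕ # 1 ⊕ # 2 ⊕ # 3) ((# 3 ⊕ # 1 ⊕ # 2) ⊕ # 0)))) λ goal₂ →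
        k (goal-join X↭ separated goal₁ goal₂)
        where
        X↭ : X ↭ (u ∷ C) ++ D
        X↭ = lin (↭-sym π) (lin ρ
            (permute (X ∷ (ends M) ∷ [ _ ] ∷ [ _ ] ∷ U ∷ D ∷ C ∷ [])
              ((# 0 ⊕ # 1 ⊕ # 2 ⊕ # 3 ⊕ # 4) ⊕ # 5 ⊕ # 6)
              (# 2 ⊕ ((# 6 ⊕ # 5) ⊕ # 0) ⊕ # 1 ⊕ # 3 ⊕ # 4)))
        shorter : X ↭ v ∷ (u ∷ C) ++ D₁ → length (u ∷ C) < length X
        shorter r = ≤-trans (s≤s (m≤m+n _ (length D₁))) (≤-reflexive (≡-sym (≡-trans (↭-length r) (cong suc (length-++ (u ∷ C))))))
        separated : ∀ {y z} → y ∈ₗ u ∷ C → z ∈ₗ D → y ≁ z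
        separated (here refl) z∈ = no-more M (u ∷ v ∷ U) π es top (proj₂ (together z∈))
        separated {y} {z} (there y∈) z∈ = ¬~⇒≁ λ e →
          missed M (u ∷ v ∷ U) π es top smaller (proj₂ (∈⇒↭ (∈-resp-↭ (↭-sym X↭) (∈-++⁺ˡ (there y∈))))) λ { (W , misses) →
            -- The exchange makes `y` missed together with `u`, which puts it into `D`, or together
            -- with `z`, where the edge `y z` could be added.
            conclude e (exchange (length M) ≤-refl top (proj₂ (together z∈)) misses) }
          where
          conclude : y ~ z → _ → ⊥
          conclude e (x , T , (K , κ , ks , len) , inj₁ refl) = apart y∈ (T , K , trans
              (permute ((ends K) ∷ [ _ ] ∷ [ _ ] ∷ T ∷ [])
                (# 0 ⊕ # 1 ⊕ # 2 ⊕ # 3)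
                (# 0 ⊕ # 2 ⊕ # 1 ⊕ # 3)) κ , ks , len)
          conclude e (x , T , m , inj₂ refl) = ~⇒¬≁ e (no-more M (u ∷ v ∷ U) π es top m)

-- Return to inflations, colourings and branch functions.

module Inflations {n : ℕ} (G : FinGraph n) (c : Fin n → ℕ) where

  open import Data.Fin using () renaming (_≟_ to _≟ᶠ_)
  open import Data.Fin.Subset using (Subset; ∣_∣)
  open import Data.List using (lookup)
  open import Data.List.Relation.Unary.Unique.Propositional using (Unique)
  open import Data.Maybe using (Maybe; just; nothing) renaming (map to mapₘ)
  open import Data.Maybe.Properties using (just-injective)
  open import Data.Vec using ([]; _∷_; tail) renaming (lookup to lookupᵥ)
  open import Data.Vec.Properties using (lookup⇒[]=)
  open import Relation.Binary.Construct.Closure.ReflexiveTransitive using (Star; ε; _◅_)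
  open import Relation.Nullary.Decidable using (⌊_⌋)
  import Data.Product.Properties as ΣP
  import Data.List.Relation.Unary.Any as Any
  import Data.List.Relation.Unary.Unique.Propositional.Properties as UniqueP
  import Data.List.Relation.Binary.Permutation.Setoid.Properties as SetoidPerm
  import Relation.Binary.PropositionalEquality as ≡

  W : Set
  W = InflV c

  G′ : Graph W
  G′ = inflation G c

  _≟W_ : (u v : W) → Dec (u ≡ v)
  _≟W_ = ΣP.≡-dec _≟ᶠ_ _≟ᶠ_

  vertices : List W
  vertices = concat (tabulate λ x → tabulate λ i → x , i)

  ∈-vertices : ∀ v → v ∈ₗ vertices
  ∈-vertices (x , i) = ∈-concat⁺′ (∈-tabulate⁺ i) (∈-tabulate⁺ x)

  vertices-unique : Unique vertices
  vertices-unique = UniqueP.concat⁺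
    (AllP.tabulate⁺ λ x → UniqueP.tabulate⁺ λ { refl → refl })
    (AllPairsP.tabulate⁺ λ {x} {y} x≢y → λ { (p , q) → x≢y
      (≡-trans (≡-sym (∈-tabulate (λ v → proj₁ v ≡ x) (λ i → x , i) (λ _ → refl) p))
               (∈-tabulate (λ v → proj₁ v ≡ y) (λ i → y , i) (λ _ → refl) q)) })

  module Decided (E? : ∀ x y → Dec (E G x y)) (no-three : ∀ j → HasIndependentSet G′ j → j ≤ 2) where

    adjacent : W → W → Bool
    adjacent (x , _) (y , _) = not ⌊ x ≟ᶠ y ⌋ ∧ not ⌊ E? x y ⌋

    adjacent⇒ : ∀ {u v} → adjacent u v ≡ true → ¬ E G′ u v × u ≢ v × proj₁ u ≢ proj₁ v × ¬ E G (proj₁ u) (proj₁ v)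
    adjacent⇒ {x , _} {y , _} p with x ≟ᶠ y | E? x y
    ... | no x≢y | no ¬e = (λ { (inj₁ (e , _)) → x≢y e ; (inj₂ e) → ¬e e }) , (λ { refl → x≢y refl }) , x≢y , ¬e

    ¬adjacent⇒ : ∀ {u v} → adjacent u v ≡ false → u ≡ v ⊎ E G′ u v
    ¬adjacent⇒ {u@(x , i)} {v@(y , j)} p with x ≟ᶠ y | E? x y
    ... | yes refl | _     = [ inj₁ , (λ ne → inj₂ (inj₁ (refl , ne))) ]′ (decide (u ≟W v))
      where
      decide : Dec (u ≡ v) → u ≡ v ⊎ u ≢ v
      decide (yes e) = inj₁ e
      decide (no ne) = inj₂ ne
    ... | no _ | yes e = inj₂ (inj₂ e)

    adjacent-sym : ∀ u v → adjacent u v ≡ adjacent v u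
    adjacent-sym (x , _) (y , _) with x ≟ᶠ y | y ≟ᶠ x | E? x y | E? y x
    ... | yes _ | yes _ | _ | _ = refl
    ... | yes e | no ne | _ | _ = ⊥-elim (ne (≡-sym e))
    ... | no ne | yes e | _ | _ = ⊥-elim (ne (≡-sym e))
    ... | no _ | no _ | yes _ | yes _ = refl
    ... | no _ | no _ | no _  | no _  = refl
    ... | no _ | no _ | yes e | no ¬e = ⊥-elim (¬e (Graph.sym G e))
    ... | no _ | no _ | no ¬e | yes e = ⊥-elim (¬e (Graph.sym G e))

    triangle-free : ∀ {u v w} → adjacent u v ≡ true → adjacent u w ≡ true → adjacent v w ≡ true → ⊥
    triangle-free {u} {v} {w} p q r = 1+n≰n (no-three 3 (f , inj , indep))
      where
      f : Fin 3 → W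
      f zero             = u
      f (suc zero)       = v
      f (suc (suc zero)) = w
      u≢v = proj₁ (proj₂ (adjacent⇒ {u} {v} p))
      u≢w = proj₁ (proj₂ (adjacent⇒ {u} {w} q))
      v≢w = proj₁ (proj₂ (adjacent⇒ {v} {w} r))
      inj : ∀ {i j} → f i ≡ f j → i ≡ j
      inj {zero} {zero} _ = refl
      inj {zero} {suc zero} e = ⊥-elim (u≢v e)
      inj {zero} {suc (suc zero)} e = ⊥-elim (u≢w e)
      inj {suc zero} {zero} e = ⊥-elim (u≢v (≡-sym e))
      inj {suc zero} {suc zero} _ = refl
      inj {suc zero} {suc (suc zero)} e = ⊥-elim (v≢w e)
      inj {suc (suc zero)} {zero} e = ⊥-elim (u≢w (≡-sym e))
      inj {suc (suc zero)} {suc zero} e = ⊥-elim (v≢w (≡-sym e))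
      inj {suc (suc zero)} {suc (suc zero)} _ = refl
      no-edge : ∀ {a b} → adjacent a b ≡ true → ¬ E G′ a b
      no-edge {a} {b} p = proj₁ (adjacent⇒ {a} {b} p)
      indep : ∀ i j → ¬ E G′ (f i) (f j)
      indep zero zero = Graph.irrefl G′
      indep zero (suc zero) = no-edge {u} {v} p
      indep zero (suc (suc zero)) = no-edge {u} {w} q
      indep (suc zero) zero e = no-edge {u} {v} p (Graph.sym G′ {v} {u} e)
      indep (suc zero) (suc zero) = Graph.irrefl G′
      indep (suc zero) (suc (suc zero)) = no-edge {v} {w} r
      indep (suc (suc zero)) zero e = no-edge {u} {w} q (Graph.sym G′ {w} {u} e)
      indep (suc (suc zero)) (suc zero) e = no-edge {v} {w} r (Graph.sym G′ {w} {v} e)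
      indep (suc (suc zero)) (suc (suc zero)) = Graph.irrefl G′

    𝓗 : TriangleFree
    𝓗 = record { V = W ; h = adjacent ; hsym = adjacent-sym ; htf = λ {x} {y} {z} → triangle-free {x} {y} {z} }

    open Triples 𝓗 using (Independent; _~_; _≁_)
    open Minors 𝓗 using (Minor; Touch; Connected; NonEmpty)
    open HalfMinor 𝓗 using (Bounded; Coverable)
    open Gallai 𝓗 using (Goal; Edges; ends; cover-minor)

    total : ∀ {k} → (W → Subset k) → List W → ℕ
    total s []      = 0
    total s (v ∷ Y) = ∣ s v ∣ + total s Y

    tails : ∀ {k} → (W → Subset (suc k)) → W → Subset k
    tails s v = tail (s v)

    first-class : ∀ {k} (s : W → Subset (suc k)) Y → ∃ λ C → ∃ λ R → C ++ R ↭ Y ×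
                  (∀ {v} → v ∈ₗ C → lookupᵥ (s v) zero ≡ true) × total s Y ≡ length C + total (tails s) Y
    first-class s [] = [] , [] , refl , (λ ()) , refl
    first-class s (v ∷ Y) with s v in e | first-class s Y
    ... | true ∷ p | C , R , π , f , eq =
      v ∷ C , R , prep v π , (λ { (here refl) → cong (λ q → lookupᵥ q zero) e ; (there i) → f i }) ,
      cong suc (≡-trans (cong (∣ p ∣ +_) eq) (identity ∣ p ∣ (length C) _))
      where
      identity : ∀ a b d → a + (b + d) ≡ b + (a + d)
      identity = solve-∀
    ... | false ∷ p | C , R , π , f , eq =
      C , v ∷ R , trans (shift v C R) (prep v π) , f , ≡-trans (cong (∣ p ∣ +_) eq) (identity ∣ p ∣ (length C) _)
      where
      identity : ∀ a b d → a + (b + d) ≡ b + (a + d)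
      identity = solve-∀

    -- Double counting of pairs of a vertex and one of its colours, one colour class at a time.
    colour-count : ∀ {k} (s : W → Subset k) Y ω →
      (∀ i C R → C ++ R ↭ Y → (∀ {v} → v ∈ₗ C → lookupᵥ (s v) i ≡ true) → length C ≤ ω) → total s Y ≤ k * ω
    colour-count {zero} s Y ω _ = ≤-reflexive (none Y)
      where
      none : ∀ Y → total s Y ≡ 0
      none [] = refl
      none (v ∷ Y) with s v
      ... | [] = none Y
    colour-count {suc k} s Y ω bound with first-class s Y
    ... | C , R , π , f , eq = ≤-trans (≤-reflexive eq) (+-mono-≤ (bound zero C R π f)
      (colour-count (tails s) Y ω λ i C R π g → bound (suc i) C R π λ {v} v∈ → ≡-trans (lookup-tail (s v) i) (g v∈)))
      where
      lookup-tail : ∀ {k} (p : Subset (suc k)) i → lookupᵥ p (suc i) ≡ lookupᵥ (tail p) i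
      lookup-tail (x ∷ p) i = refl

    total-uniform : ∀ {k b} (s : W → Subset k) → (∀ v → ∣ s v ∣ ≡ b) → ∀ Y → total s Y ≡ length Y * b
    total-uniform s e []      = refl
    total-uniform s e (v ∷ Y) = cong₂ _+_ (e v) (total-uniform s e Y)

    coverable : FracCliqueCoverAtMost G 124 33 → Coverable vertices
    -- The fractional colouring is pulled back along the projection to `G`. A failure of the
    -- inequality is by at least one unit, so a tolerance of `1 / (33 * ω + 1)` already contradicts
    -- it.
    coverable frac Y Z _ ω bounded = ≮⇒≥ λ lt → contradiction lt (frac (suc (33 * ω)) (s≤s z≤n))
      where
      contradiction : 124 * ω < 33 * length Y → _ → ⊥
      contradiction lt (suc b , k , _ , (s , size , proper) , le) = excess b chain (exceeds ω b)
        where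
        m : ℕ
        m = suc (33 * ω)
        same-colour : ∀ {u v} i → lookupᵥ (s (proj₁ u)) i ≡ true → lookupᵥ (s (proj₁ v)) i ≡ true → u ≁ v
        same-colour {u} {v} i p q with adjacent u v in e
        ... | false = refl
        ... | true with adjacent⇒ {u} {v} e
        ...   | _ , _ , x≢y , ¬e = ⊥-elim (proper (proj₁ u) (proj₁ v) (x≢y , ¬e) i (lookup⇒[]= i _ p) (lookup⇒[]= i _ q))
        count : length Y * suc b ≤ k * ω
        count = ≤-trans (≤-reflexive (≡-sym (total-uniform (s ∘ proj₁) (λ v → size (proj₁ v)) Y)))
          (colour-count (s ∘ proj₁) Y ω λ i C R π f → bounded C R π λ {u} {v} u∈ v∈ → same-colour {u} {v} i (f u∈) (f v∈))
        exceeds : ∀ ω b → suc (33 * ω) * suc b * suc (124 * ω) ≡ suc ((124 * suc (33 * ω) * suc b + 33 * suc b) * ω + b)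
        exceeds = solve-∀
        regroup₁ : ∀ m b l → m * b * (33 * l) ≡ 33 * m * (l * b)
        regroup₁ = solve-∀
        regroup₂ : ∀ m k w → 33 * m * (k * w) ≡ 33 * m * k * w
        regroup₂ = solve-∀
        chain : m * suc b * suc (124 * ω) ≤ (124 * m * suc b + 33 * suc b) * ω
        chain = begin
          m * suc b * suc (124 * ω)              ≤⟨ *-monoʳ-≤ (m * suc b) lt ⟩
          m * suc b * (33 * length Y)            ≡⟨ regroup₁ m (suc b) (length Y) ⟩
          33 * m * (length Y * suc b)            ≤⟨ *-monoʳ-≤ (33 * m) count ⟩
          33 * m * (k * ω)                       ≡⟨ regroup₂ m k ω ⟩
          33 * m * k * ω                         ≤⟨ *-monoˡ-≤ ω le ⟩
          (124 * m * suc b + 33 * suc b) * ω     ∎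
          where open ≤-Reasoning

    Stable : List W → Set
    Stable C = ∀ {u v} → u ∈ₗ C → v ∈ₗ C → ¬ E G′ u v

    colourable : ∀ Cs → All Stable Cs → (∀ v → v ∈ₗ concat Cs) → Colourable G′ (length Cs)
    colourable Cs stable covers = (λ v → proj₁ (place v)) , λ u v e same → proper u v e same
      where
      locate : ∀ Cs {v} → v ∈ₗ concat Cs → Σ (Fin (length Cs)) λ i → v ∈ₗ lookup Cs i
      locate (C ∷ Cs) v∈ with ∈-++⁻ C v∈
      ... | inj₁ i = zero , i
      ... | inj₂ j with locate Cs j
      ...   | i , k = suc i , k
      place : ∀ v → Σ (Fin (length Cs)) λ i → v ∈ₗ lookup Cs i
      place v = locate Cs (covers v)
      proper : ∀ u v → E G′ u v → proj₁ (place u) ≢ proj₁ (place v)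
      proper u v e same = stable-at Cs stable (proj₁ (place v))
        (subst (λ i → u ∈ₗ lookup Cs i) same (proj₂ (place u))) (proj₂ (place v)) e
        where
        stable-at : ∀ Cs → All Stable Cs → ∀ i → Stable (lookup Cs i)
        stable-at (C ∷ Cs) (s ∷ ss) zero    = s
        stable-at (C ∷ Cs) (s ∷ ss) (suc i) = stable-at Cs ss i

    colour-classes : ∀ M U → Edges M → ∃ λ Cs → length Cs ≡ length M + length U × All Stable Cs × ends M ++ U ≡ concat Cs
    colour-classes [] [] _ = [] , refl , [] , refl
    colour-classes [] (u ∷ U) _ with colour-classes [] U []
    ... | Cs , len , st , e = (u ∷ []) ∷ Cs , cong suc len , single ∷ st , cong (u ∷_) e
      where
      single : Stable (u ∷ [])
      single (here refl) (here refl) = Graph.irrefl G′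
    colour-classes ((x , y) ∷ M) U (e ∷ es) with colour-classes M U es
    ... | Cs , len , st , eq = (x ∷ y ∷ []) ∷ Cs , cong suc len , pair ∷ st , cong (λ l → x ∷ y ∷ l) eq
      where
      pair : Stable (x ∷ y ∷ [])
      pair (here refl) (here refl) = Graph.irrefl G′
      pair (here refl) (there (here refl)) = proj₁ (adjacent⇒ {x} {y} e)
      pair (there (here refl)) (here refl) k = proj₁ (adjacent⇒ {x} {y} e) (Graph.sym G′ {y} {x} k)
      pair (there (here refl)) (there (here refl)) = Graph.irrefl G′

    branch-index : (Cs : List (List W)) → W → Maybe (Fin (length Cs))
    branch-index [] v = nothing
    branch-index (C ∷ Cs) v with Any.any? (v ≟W_) C
    ... | yes _ = just zero
    ... | no _  = mapₘ suc (branch-index Cs v)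

    index-sound : ∀ Cs {v i} → branch-index Cs v ≡ just i → v ∈ₗ lookup Cs i
    index-sound (C ∷ Cs) {v} e with Any.any? (v ≟W_) C
    index-sound (C ∷ Cs) refl | yes v∈ = v∈
    ... | no _ with branch-index Cs v in e′
    index-sound (C ∷ Cs) refl | no _ | just j = index-sound Cs e′

    unique-suffix : ∀ (xs : List W) {ys} → Unique (xs ++ ys) → Unique ys
    unique-suffix []       u       = u
    unique-suffix (x ∷ xs) (_ ∷ u) = unique-suffix xs u

    index-complete : ∀ Cs → Unique (concat Cs) → ∀ i {v} → v ∈ₗ lookup Cs i → branch-index Cs v ≡ just i
    index-complete (C ∷ Cs) uniq i {v} v∈ with Any.any? (v ≟W_) C
    index-complete (C ∷ Cs) uniq zero v∈ | yes _ = refl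
    index-complete (C ∷ Cs) uniq zero v∈ | no n = ⊥-elim (n v∈)
    index-complete (C ∷ Cs) uniq (suc i) v∈ | yes v∈C = ⊥-elim (apart C uniq v∈C (∈-concat⁺′ v∈ (∈-lookup Cs i)))
      where
      ∈-lookup : ∀ (Cs : List (List W)) i → lookup Cs i ∈ₗ Cs
      ∈-lookup (C ∷ Cs) zero    = here refl
      ∈-lookup (C ∷ Cs) (suc i) = there (∈-lookup Cs i)
      apart : ∀ (xs : List W) {ys v} → Unique (xs ++ ys) → v ∈ₗ xs → v ∈ₗ ys → ⊥
      apart (x ∷ xs) (a ∷ _) (here refl) j = All.lookup a (∈-++⁺ʳ xs j) refl
      apart (x ∷ xs) (_ ∷ u) (there i) j = apart xs u i j
    index-complete (C ∷ Cs) uniq (suc i) v∈ | no _ rewrite index-complete Cs (unique-suffix C uniq) i v∈ = refl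

    clique-minor : ∀ {t} → Minor vertices t → HasCliqueMinor G′ t
    clique-minor (Cs , rest , π , refl , ok , pairs) =
      branch-index Cs , nonempty , connected , touching
      where
      unique : Unique (concat Cs)
      unique = prefix (concat Cs) (SetoidPerm.Unique-resp-↭ (≡.setoid W) (↭⇒↭ₛ (↭-sym π)) vertices-unique)
        where
        prefix : ∀ (xs : List W) {ys} → Unique (xs ++ ys) → Unique xs
        prefix []       _       = []
        prefix (x ∷ xs) (a ∷ u) = AllP.++⁻ˡ xs a ∷ prefix xs u
      ok-at : ∀ Cs → All (λ C → NonEmpty C × Connected C) Cs → ∀ i → NonEmpty (lookup Cs i) × Connected (lookup Cs i)
      ok-at (C ∷ Cs) (o ∷ os) zero    = o
      ok-at (C ∷ Cs) (o ∷ os) (suc i) = ok-at Cs os i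
      nonempty : ∀ i → Σ W λ v → InBranch (branch-index Cs) i v
      nonempty i with proj₁ (ok-at Cs ok i)
      ... | v , v∈ = v , index-complete Cs unique i v∈
      connected : ∀ i u v → InBranch (branch-index Cs) i u → InBranch (branch-index Cs) i v →
        Star (λ x y → InBranch (branch-index Cs) i x × InBranch (branch-index Cs) i y × E G′ x y) u v
      connected i u v p q = walk (proj₂ (ok-at Cs ok i) (index-sound Cs p) (index-sound Cs q))
        where
        walk : ∀ {u v} → Star (λ x y → x ∈ₗ lookup Cs i × y ∈ₗ lookup Cs i × x ≁ y) u v →
               Star (λ x y → InBranch (branch-index Cs) i x × InBranch (branch-index Cs) i y × E G′ x y) u v
        walk ε = ε
        walk {u} (_◅_ {j = w} (x∈ , y∈ , n) s) with ¬adjacent⇒ {u} {w} n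
        -- Nonadjacency in 𝓗 includes equality; such idle steps are left out of the walk.
        ... | inj₁ refl = walk s
        ... | inj₂ e = (index-complete Cs unique i x∈ , index-complete Cs unique i y∈ , e) ◅ walk s
      touch-sym : ∀ {C D} → Touch C D → Touch D C
      touch-sym (x , y , x∈ , y∈ , n) = y , x , y∈ , x∈ , ≡-trans (adjacent-sym y x) n
      touch-all : ∀ {C} Cs → All (Touch C) Cs → ∀ j → Touch C (lookup Cs j)
      touch-all (D ∷ Ds) (t ∷ _) zero     = t
      touch-all (D ∷ Ds) (_ ∷ ts) (suc j) = touch-all Ds ts j
      touch-at : ∀ Cs → AllPairs Touch Cs → ∀ i j → i ≢ j → Touch (lookup Cs i) (lookup Cs j)
      touch-at (C ∷ Cs) _ zero zero ne = ⊥-elim (ne refl)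
      touch-at (C ∷ Cs) (a ∷ _) zero (suc j) _ = touch-all Cs a j
      touch-at (C ∷ Cs) (a ∷ _) (suc i) zero _ = touch-sym (touch-all Cs a i)
      touch-at (C ∷ Cs) (_ ∷ ps) (suc i) (suc j) ne = touch-at Cs ps i j (ne ∘ cong suc)
      touching : ∀ i j → i ≢ j → Σ W λ u → Σ W λ v →
        InBranch (branch-index Cs) i u × InBranch (branch-index Cs) j v × E G′ u v
      touching i j ne with touch-at Cs pairs i j ne
      ... | u , v , u∈ , v∈ , n with ¬adjacent⇒ {u} {v} n
      ...   | inj₂ e = u , v , index-complete Cs unique i u∈ , index-complete Cs unique j v∈ , e
      ...   | inj₁ refl = ⊥-elim (ne (just-injective
                (≡-trans (≡-sym (index-complete Cs unique i u∈)) (index-complete Cs unique j v∈))))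

    -- Edges of 𝓗 are stable pairs of the inflation, so the cover by edges and single vertices is a
    -- colouring, and it has as many classes as the minor has branch sets.
    hadwiger : FracCliqueCoverAtMost G 124 33 → ∀ {χ h} → (∀ j → Colourable G′ j → χ ≤ j) →
               (∀ s → HasCliqueMinor G′ s → s ≤ h) → h < χ → ⊥
    hadwiger frac {χ} {h} χ-least h-most lt = cover-minor (length vertices) vertices ≤-refl (coverable frac)
      λ { (M , U , π , es , m) → case colour-classes M U es of λ { (Cs , len , stable , eq) →
        <⇒≱ lt (≤-trans (χ-least (length Cs) (colourable Cs stable λ v →
            subst (v ∈ₗ_) eq (∈-resp-↭ (↭-sym π) (∈-vertices v))))
          (≤-trans (≤-reflexive len) (h-most _ (clique-minor m)))) } }

-- Double-negation shift, valid here because the index set is finite.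
¬¬-Π : ∀ {n} {P : Fin n → Set} → (∀ i → ¬ ¬ P i) → ¬ ¬ (∀ i → P i)
¬¬-Π {zero}  f k = k λ ()
¬¬-Π {suc n} f k = f zero λ p → ¬¬-Π (f ∘ suc) λ ps → k λ { zero → p ; (suc i) → ps i }

theorem2p30 : (n : ℕ) (G : FinGraph n) →
    IndependenceNumber G 2 →
    FracCliqueCoverAtMost G 124 33 →
    (c : Fin n → ℕ) →
    IndependenceNumber (inflation G c) 2 →
    (χ h : ℕ) → ChromaticNumber (inflation G c) χ → HadwigerNumber (inflation G c) h →
    χ ≤ h
theorem2p30 n G _ frac c (_ , no-three) χ h (_ , χ-least) (_ , h-most) = ≮⇒≥ λ lt →
  -- The goal is now absurdity, so adjacency may be assumed decidable on the finitely many pairs.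
  ¬¬-Π (λ x → ¬¬-Π λ y → ¬¬-excluded-middle {A = E G x y}) λ E? →
    Inflations.Decided.hadwiger G c E? no-three frac χ-least h-most lt
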